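{- Let $n\in\mathbb{N}$ and let $\lambda$ be a partition of $n$ with conjugate partition $\lambda'$. Then $$\dim_{\mathbb{F}}\big(\mathcal{A}_{n,\lambda}^{(q_1)}\cap\mathcal{A}_{n,\lambda'}^{(q_2)}\big)=1.$$
   Context: Let $q_1,q_2$ be independent indeterminates, $q_3=1/(q_1q_2)$, $\mathbb{F}=\mathbb{Q}(q_1,q_2)$. For $n,k\in\mathbb{N}_+$ and a symmetric rational function $f$ in $x_1,\dots,x_n$ define $\partial^{(0,k)}f=\frac{n!}{(n-k)!}\lim_{\xi\to0}f(x_1,\dots,x_{n-k},\xi x_{n-k+1},\dots,\xi x_n)$ and $\partial^{(\infty,k)}f$ likewise with $\xi\to\infty$, whenever the limits exist; $\partial^{(\cdot,k)}c=0$ for constants $c$, and $\partial^{(\cdot,0)}$ is the identity. The space $\mathcal{A}_n$ consists of: $\mathcal{A}_0=\mathbb{F}$; for $n\ge1$, symmetric rational functions $f(x_1,\dots,x_n)$ over $\mathbb{F}$ such that for all $0\le k\le n$ the limits $\partial^{(\infty,k)}f,\partial^{(0,k)}f$ exist and coincide, whose poles lie only on the diagonals $x_i=x_j$ ($i\neq j$) with order at most two, and (for $n\ge3$) $f(x_1,q_1x_1,q_1q_2x_1,x_4,\dots)=f(x_1,q_2x_1,q_1q_2x_1,x_4,\dots)=0$. Partitions of $n$ carry the dominance order: $\lambda\ge\mu$ iff $|\lambda|=|\mu|$ and $\lambda_1+\dots+\lambda_i\ge\mu_1+\dots+\mu_i$ for all $i$. For $p\in\mathbb{F}$ and a partition $\mu=(\mu_1,\dots,\mu_m)$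 of $n$, the specialization map $\varphi^{(p)}_\mu:\mathcal{A}_n\to\mathbb{F}(y_1,\dots,y_m)$ sends $f$ to $f(y_1,py_1,\dots,p^{\mu_1-1}y_1,\,y_2,py_2,\dots,p^{\mu_2-1}y_2,\dots,y_m,\dots,p^{\mu_m-1}y_m)$. For $i\in\{1,2,3\}$ and $\lambda\vdash n$ the Gordon filter is $\mathcal{A}^{(q_i)}_{n,\lambda}=\bigcap_{\mu\vdash n,\ \mu\not\le\lambda}\ker\varphi^{(q_i)}_\mu$ if $\lambda<(n)$, and $\mathcal{A}^{(q_i)}_{n,(n)}=\mathcal{A}_n$. -}

module Defs where

open import Data.Nat as ℕ using (ℕ; zero; suc; _≤_; _<_; _≤?_; _<?_; _∸_; _⊔_)
open import Data.Rational as ℚ using (ℚ; 0ℚ; 1ℚ)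
open import Data.Fin as Fin using (Fin; toℕ; fromℕ<)
open import Data.Fin.Permutation using (Permutation′; _⟨$⟩ʳ_)
open import Data.Vec as Vec using (Vec; []; _∷_)
import Data.Vec.Properties as VecP
open import Data.List as List using (List; []; _∷_; _++_; map; concatMap; foldr; length; filter; upTo; take; allFin)
open import Data.Nat.ListAction using (sum)
open import Data.List.Relation.Unary.All using (All)
open import Data.List.Relation.Unary.Linked using (Linked)
open import Data.Bool using (if_then_else_)
open import Data.Product using (Σ; ∃; _×_; _,_; proj₁; proj₂)
open import Data.Unit using (⊤)
open import Relation.Nullary using (¬_; yes; no)
open import Relation.Nullary.Decidable using (⌊_⌋)
open import Relation.Binary.PropositionalEquality using (_≡_)

-- Multivariate polynomials over ℚ in variables indexed by Fin m.
-- A polynomial is a finite formal sum of terms (coefficient, exponent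
-- vector); two polynomials are equal iff all monomial coefficients agree.

Monomial : ℕ → Set
Monomial m = Vec ℕ m

Poly : ℕ → Set
Poly m = List (ℚ × Monomial m)

coeff : ∀ {m} → Poly m → Monomial m → ℚ
coeff [] e = 0ℚ
coeff ((c , e′) ∷ P) e with VecP.≡-dec ℕ._≟_ e′ e
... | yes _ = c ℚ.+ coeff P e
... | no _ = coeff P e

infix 4 _≈_
_≈_ : ∀ {m} → Poly m → Poly m → Set
P ≈ Q = ∀ e → coeff P e ≡ coeff Q e

0ₚ : ∀ {m} → Poly m
0ₚ = []

constₚ : ∀ {m} → ℚ → Poly m
constₚ {m} c = (c , Vec.replicate m 0) ∷ []

1ₚ : ∀ {m} → Poly m
1ₚ = constₚ 1ℚ

var : ∀ {m} → Fin m → Poly m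
var i = (1ℚ , Vec.tabulate (λ j → if ⌊ i Fin.≟ j ⌋ then 1 else 0)) ∷ []

infixl 6 _+ₚ_ _-ₚ_
infixl 7 _*ₚ_
infixr 8 _^ₚ_

_+ₚ_ : ∀ {m} → Poly m → Poly m → Poly m
P +ₚ Q = P ++ Q

-ₚ_ : ∀ {m} → Poly m → Poly m
-ₚ P = map (λ { (c , e) → (ℚ.- c , e) }) P

_-ₚ_ : ∀ {m} → Poly m → Poly m → Poly m
P -ₚ Q = P +ₚ (-ₚ Q)

_*ₚ_ : ∀ {m} → Poly m → Poly m → Poly m
P *ₚ Q = concatMap (λ { (c , e) → map (λ { (d , e′) → (c ℚ.* d , Vec.zipWith ℕ._+_ e e′) }) Q }) P

_^ₚ_ : ∀ {m} → Poly m → ℕ → Poly m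
P ^ₚ zero = 1ₚ
P ^ₚ suc k = P *ₚ (P ^ₚ k)

prodₚ : ∀ {m} → List (Poly m) → Poly m
prodₚ = foldr _*ₚ_ 1ₚ

monoEval : ∀ {m m′} → (Fin m → Poly m′) → Monomial m → Poly m′
monoEval σ e = prodₚ (Vec.toList (Vec.zipWith (λ i k → σ i ^ₚ k) (Vec.allFin _) e))

subst : ∀ {m m′} → (Fin m → Poly m′) → Poly m → Poly m′
subst σ P = foldr (λ { (c , e) acc → (constₚ c *ₚ monoEval σ e) +ₚ acc }) 0ₚ P

coeffξ : ∀ {m} → ℕ → Poly (suc m) → Poly m
coeffξ j P = concatMap (λ { (c , k ∷ e) → if ⌊ k ℕ.≟ j ⌋ then (c , e) ∷ [] else [] }) P

record Frac (m : ℕ) : Set where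
  field
    num den : Poly m
    den≉0 : ¬ (den ≈ 0ₚ)
open Frac public

_≃[_/_] : ∀ {m} → Frac m → Poly m → Poly m → Set
f ≃[ P / Q ] = num f *ₚ Q ≈ P *ₚ den f

Vanishes : ∀ {m m′} → (Fin m → Poly m′) → Frac m → Set
Vanishes σ f = Σ _ λ P → Σ _ λ Q →
  f ≃[ P / Q ] × ¬ (subst σ Q ≈ 0ₚ) × subst σ P ≈ 0ₚ

Invariant : ∀ {m} → (Fin m → Poly m) → Frac m → Set
Invariant σ f = Σ _ λ P → Σ _ λ Q →
  f ≃[ P / Q ] × ¬ (subst σ Q ≈ 0ₚ) × f ≃[ subst σ P / subst σ Q ]

-- lim_{ξ→0} A/B = L   (ξ = variable zero; A/B a rational function)
LimZero : ∀ {m} → Poly (suc m) → Poly (suc m) → Frac m → Set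
LimZero A B L = Σ _ λ P → Σ _ λ Q →
  (A *ₚ Q ≈ P *ₚ B) × ¬ (coeffξ 0 Q ≈ 0ₚ) × L ≃[ coeffξ 0 P / coeffξ 0 Q ]

-- lim_{ξ→∞} A/B = L
LimInf : ∀ {m} → Poly (suc m) → Poly (suc m) → Frac m → Set
LimInf A B L = Σ _ λ P → Σ _ λ Q → Σ ℕ λ d →
  (A *ₚ Q ≈ P *ₚ B)
  × (∀ j → d < j → coeffξ j P ≈ 0ₚ)
  × (∀ j → d < j → coeffξ j Q ≈ 0ₚ)
  × ¬ (coeffξ d Q ≈ 0ₚ) × L ≃[ coeffξ d P / coeffξ d Q ]

LimitsCoincide : ∀ {m} → (Fin m → Poly (suc m)) → Frac m → Set
LimitsCoincide σ f = Σ _ λ P → Σ _ λ Q →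
  f ≃[ P / Q ] × ¬ (subst σ Q ≈ 0ₚ) ×
  Σ (Frac _) λ L → LimZero (subst σ P) (subst σ Q) L × LimInf (subst σ P) (subst σ Q) L

-- The ambient variables of 𝒜ₙ: index 0 = q₁, index 1 = q₂, index 2+i = xᵢ.
-- 𝔽 = ℚ(q₁,q₂) is Frac 2.

ι : ∀ {n} → Poly 2 → Poly (2 ℕ.+ n)
ι {n} = subst (λ i → var (i Fin.↑ˡ n))

q₁ q₂ : Poly 2
q₁ = var Fin.zero
q₂ = var (Fin.suc Fin.zero)

X : ∀ {n} → Fin n → Poly (2 ℕ.+ n)
X i = var (Fin.suc (Fin.suc i))

Δ² : ∀ {n} → Poly (2 ℕ.+ n)
Δ² {n} = prodₚ (concatMap (λ i → concatMap (λ j →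
  if ⌊ toℕ i <? toℕ j ⌋ then ((X i -ₚ X j) ^ₚ 2) ∷ [] else []) (allFin n)) (allFin n))

permσ : ∀ {n} → Permutation′ n → Fin (2 ℕ.+ n) → Poly (2 ℕ.+ n)
permσ π Fin.zero = var Fin.zero
permσ π (Fin.suc Fin.zero) = var (Fin.suc Fin.zero)
permσ π (Fin.suc (Fin.suc i)) = X (π ⟨$⟩ʳ i)

-- (x₁,…,xₙ) ↦ (x₁,…,x_{n-k}, ξx_{n-k+1},…,ξxₙ); ξ is variable zero of the target
scaleσ : (n k : ℕ) → Fin (2 ℕ.+ n) → Poly (suc (2 ℕ.+ n))
scaleσ n k Fin.zero = var (Fin.suc Fin.zero)
scaleσ n k (Fin.suc Fin.zero) = var (Fin.suc (Fin.suc Fin.zero))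
scaleσ n k (Fin.suc (Fin.suc i)) =
  if ⌊ toℕ i <? n ∸ k ⌋ then var (Fin.suc (Fin.suc (Fin.suc i)))
  else var Fin.zero *ₚ var (Fin.suc (Fin.suc (Fin.suc i)))

wheelσ : (r : ℕ) → Poly 2 → Fin (2 ℕ.+ (3 ℕ.+ r)) → Poly (2 ℕ.+ (3 ℕ.+ r))
wheelσ r a Fin.zero = var Fin.zero
wheelσ r a (Fin.suc Fin.zero) = var (Fin.suc Fin.zero)
wheelσ r a (Fin.suc (Fin.suc Fin.zero)) = X Fin.zero
wheelσ r a (Fin.suc (Fin.suc (Fin.suc Fin.zero))) = ι a *ₚ X Fin.zero
wheelσ r a (Fin.suc (Fin.suc (Fin.suc (Fin.suc Fin.zero)))) = ι (q₁ *ₚ q₂) *ₚ X Fin.zero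
wheelσ r a (Fin.suc (Fin.suc i)) = X i

Wheel : (n : ℕ) → Frac (2 ℕ.+ n) → Set
Wheel (suc (suc (suc r))) f = Vanishes (wheelσ r q₁) f × Vanishes (wheelσ r q₂) f
Wheel _ f = ⊤

record InA (n : ℕ) (f : Frac (2 ℕ.+ n)) : Set where
  field
    symmetric : ∀ (π : Permutation′ n) → Invariant (permσ π) f
    limits    : ∀ k → k ≤ n → LimitsCoincide (scaleσ n k) f
    poles     : Σ (Poly (2 ℕ.+ n)) λ P → Σ (Poly 2) λ D →
                  ¬ (D ≈ 0ₚ) × f ≃[ P / (ι D *ₚ Δ²) ]
    wheel     : Wheel n f

record Partition (n : ℕ) : Set where
  field
    parts    : List ℕ
    positive : All (λ a → 0 < a) parts
    nonincr  : Linked ℕ._≥_ parts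
    size     : sum parts ≡ n
open Partition public

-- μ ≤ λ in dominance order (sizes are equal for partitions of the same n)
_≤ᵈ_ : List ℕ → List ℕ → Set
μ ≤ᵈ la = ∀ i → sum (take i μ) ≤ sum (take i la)

conj : List ℕ → List ℕ
conj ps = map (λ j → length (filter (λ a → suc j ≤? a) ps)) (upTo (foldr _⊔_ 0 ps))

blockPos : List ℕ → ℕ → ℕ × ℕ
blockPos [] k = 0 , 0
blockPos (a ∷ as) k with k <? a
... | yes _ = 0 , k
... | no _ = suc (proj₁ (blockPos as (k ∸ a))) , proj₂ (blockPos as (k ∸ a))

varℕ : ∀ {m} → ℕ → Poly m
varℕ {m} k with k <? m
... | yes p = var (fromℕ< p)
... | no _ = 0ₚ

-- x_k ↦ p^j y_i where x_k is the j-th (0-based) variable of the i-th block;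
-- target variables: 0 = q₁, 1 = q₂, 2+i = y_i
specσ : ∀ {n} → Poly 2 → (μ : List ℕ) → Fin (2 ℕ.+ n) → Poly (2 ℕ.+ length μ)
specσ p μ Fin.zero = var Fin.zero
specσ p μ (Fin.suc Fin.zero) = var (Fin.suc Fin.zero)
specσ p μ (Fin.suc (Fin.suc i)) =
  ι p ^ₚ proj₂ (blockPos μ (toℕ i)) *ₚ varℕ (2 ℕ.+ proj₁ (blockPos μ (toℕ i)))

Gordon : ∀ {n} → Poly 2 → Partition n → Frac (2 ℕ.+ n) → Set
Gordon {n} p la f = InA n f × (∀ (μ : Partition n) → ¬ (parts μ ≤ᵈ parts la) → Vanishes (specσ p (parts μ)) f)

DimOne : ∀ {n} → (Frac (2 ℕ.+ n) → Set) → Set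
DimOne {n} S = Σ (Frac (2 ℕ.+ n)) λ f → S f × ¬ (num f ≈ 0ₚ) ×
  (∀ g → S g → Σ (Frac 2) λ c →
     num g *ₚ (ι (den c) *ₚ den f) ≈ (ι (num c) *ₚ num f) *ₚ den g)

-- At the Zariski dense set of points (q₁, q₂) = (2^i, 3^j), substitute the rows of a diagram μ into the numerator F of an
-- element of 𝒜ₙ one after the other, each time dividing out the zeros which the wheel conditions force. This leaves a
-- number, the row value of F at μ; up to nonzero factors it is the value obtained in the same way from the columns,
-- with q₁ and q₂ exchanged. The limit conditions bound degrees so tightly that, if F vanishes at the strings of all
-- diagrams larger than μ, its specialization at μ is the row value times a fixed product. Hence F lies in both Gordon
-- filters iff its row values vanish at all μ ≠ λ, and then it is determined by the row value at λ. This gives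
-- dimension at most 1. The elements ε_ν are linearly independent and indexed by all partitions of n, one more than the
-- number of these linear conditions, so a nonzero solution exists.
module Submission where

open import Defs
open import Data.Nat as ℕ using (ℕ; zero; suc; z≤n; s≤s; _≤_; _<_; _≤?_; _<?_; _∸_; _⊔_)
import Data.Nat.Properties as ℕP
open ℕP using (*-assoc; *-identityˡ; *-zeroʳ; +-assoc; +-cancelʳ-≡; +-cancelˡ-≡; +-cancelˡ-≤; +-comm; +-identityʳ; +-mono-≤; +-monoʳ-≤; +-monoˡ-≤; +-suc; +-∸-assoc; 0∸n≡0; <-irrefl; <-≤-trans; <⇒≢; <⇒≤; <⇒≱; m+[n∸m]≡n; m∸[m∸n]≡n; m∸n+n≡m; m∸n≤m; m≤m+n; m≤m⊔n; m≤n+m; m≤n⇒m<n∨m≡n; m≤n⇒m∸n≡0; m≤n⇒m≤1+n; m≤n⊔m; n∸n≡0; n≤1+n; suc-injective; ≤-pred; ≤-refl; ≤-reflexive; ≤-total; ≤-trans; ≮⇒≥; ≰⇒>)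
open import Data.Nat.ListAction using (sum)
open import Data.Nat.ListAction.Properties using (sum-++; sum-↭)
open import Data.Rational using (ℚ; 0ℚ; 1ℚ)
import Data.Rational as ℚ
import Data.Rational.Properties as ℚP
open import Data.Fin as Fin using (Fin; toℕ; fromℕ<)
open import Data.Fin.Patterns using (0F; 1F; 2F)
import Data.Fin.Properties as FinP
open import Data.Fin.Permutation using (Permutation′; _⟨$⟩ʳ_; _⟨$⟩ˡ_)
import Data.Fin.Permutation as Perm
open import Data.Vec as Vec using (toList; head; tail; Vec; []; _∷_; lookup; tabulate)
import Data.Vec.Properties as VecP
open VecP using ([]≔-lookup; length-toList; lookup-replicate; lookup∘update; lookup∘update′; tabulate∘lookup; ≡-dec)
open import Data.List as List using (List; []; _∷_; _++_; map; concatMap; foldr; length; filter; applyUpTo; upTo; take; drop; allFin)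
import Data.List.Properties as ListP
open ListP using (++-assoc; drop-map; length-++; length-applyUpTo; length-map; map-++; map-cong; map-id; map-tabulate; map-upTo; map-∘; tabulate-cong; take++drop≡id; take-map; ∷-injectiveʳ; ∷-injectiveˡ)
open import Data.List.Relation.Unary.All as All using (All; []; _∷_)
import Data.List.Relation.Unary.All.Properties as AllP
open AllP using (++⁺; all-filter; applyUpTo⁺₁; applyUpTo⁺₂; concat⁺; map⁺; map⁻; tabulate⁺)
open import Data.List.Relation.Unary.Any as Any using (Any; here; there)
import Data.List.Relation.Unary.Any.Properties as AnyP
open import Data.List.Relation.Unary.AllPairs as AllPairs using (AllPairs; []; _∷_)
import Data.List.Relation.Unary.AllPairs.Properties as AllPairsP
import Data.List.Relation.Unary.Unique.DecPropositional.Properties as UniqueP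
open import Data.List.Relation.Unary.Linked using (Linked; []; [-]; _∷_)
import Data.List.Relation.Unary.Linked.Properties as LinkedP
open import Data.List.Membership.Propositional using (_∈_; lose)
import Data.List.Membership.Propositional.Properties as MemP
open MemP using (∈-filter⁺; ∈-lookup; ∈-map⁺)
open import Data.List.Relation.Binary.Permutation.Propositional as Permutation using (_↭_; ↭-refl; ↭-sym; ↭-trans; ↭-reflexive)
import Data.List.Relation.Binary.Permutation.Propositional.Properties as PermP
open PermP using (++⁺ˡ; All-resp-↭; ↭-length)
open import Data.Bool using (Bool; true; false; if_then_else_)
open import Data.Product using (Σ; _×_; _,_; proj₁; proj₂; uncurry)
open import Data.Sum using (_⊎_; inj₁; inj₂)
open import Data.Empty using (⊥; ⊥-elim)
open import Data.Unit using (⊤; tt)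
open import Function using (_∘_; id; _$_; case_of_)
open import Relation.Nullary using (¬_; Dec; yes; no)
import Relation.Binary.Definitions as Tri
open import Relation.Nullary.Decidable using (⌊_⌋; dec⇒maybe; decidable-stable; isYes≗does; ¬?)
open import Relation.Binary.PropositionalEquality using (_≡_; _≢_; refl; sym; trans; cong; cong₂; _≗_; module ≡-Reasoning) renaming (subst to transport)
open import Level using (0ℓ)
open import Algebra.Bundles using (CommutativeRing)
open import Algebra.Structures using (IsCommutativeRing)
open import Tactic.RingSolver using (solve-∀)
import Tactic.RingSolver.Core.AlmostCommutativeRing as ACR
import Data.Nat.Tactic.RingSolver as ℕSolver

-- Why the degrees are tight: for two rows of lengths a ≥ b the wheel conditions force 2(a-1)b
-- linear zeros, and vanishing at larger diagrams forces 2b more, because at such a zero two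
-- overlapping strings can exchange their tails. These are 2ab forms, so 2a(n-a) forms pass through
-- the variable of a row of length a. This is exactly the width of the exponent range left by finite
-- limits at 0 and infinity. The quotient is therefore a monomial in each variable, and its value at
-- one point decides whether it is zero. Row and column values are compared by removing a hook in
-- both orders. The obstacle to existence is that row values are defined only at numerical
-- parameters, whereas the coefficients must lie in ℚ(q₁,q₂). A fraction-free elimination bridges
-- the gap: a family is either dependent over the field or independent off a hypersurface, and
-- numerical solutions on a dense set exclude the second case. The ε_ν are shuffle products written
-- as sums over colorings. On a q₁-string only colorings that increase strictly along the string
-- contribute, which makes the family triangular for dominance.

infixl 6 _+_ _-_
infixl 7 _*_
infix 8 -_

-- Opaque copies of the operations of ℚ: unification then never unfolds them.
opaque
  _+_ _*_ _-_ : ℚ → ℚ → ℚ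
  _+_ = ℚ._+_
  _*_ = ℚ._*_
  _-_ = ℚ._-_

  -_ : ℚ → ℚ
  -_ = ℚ.-_

  isCommutativeRing : IsCommutativeRing _≡_ _+_ _*_ -_ 0ℚ 1ℚ
  isCommutativeRing = ℚP.+-*-isCommutativeRing

  +-def : ∀ x y → x + y ≡ x ℚ.+ y
  +-def x y = refl

  *-def : ∀ x y → x * y ≡ x ℚ.* y
  *-def x y = refl

  neg-def : ∀ x → - x ≡ ℚ.- x
  neg-def x = refl

commutativeRing : CommutativeRing 0ℓ 0ℓ
commutativeRing = record { isCommutativeRing = isCommutativeRing }

ringℚ : ACR.AlmostCommutativeRing 0ℓ 0ℓ
ringℚ = ACR.fromCommutativeRing commutativeRing (λ x → dec⇒maybe (0ℚ ℚP.≟ x))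

module F = IsCommutativeRing isCommutativeRing

opaque
  unfolding _+_

  x+0≡x : ∀ x → x + 0ℚ ≡ x
  x+0≡x = solve-∀ ringℚ

  [x-y]+y≡x : ∀ x y → (x - y) + y ≡ x
  [x-y]+y≡x = solve-∀ ringℚ

  x-x≡0 : ∀ x → x - x ≡ 0ℚ
  x-x≡0 = solve-∀ ringℚ

  x*[y-z] : ∀ x y z → x * (y - z) ≡ x * y - x * z
  x*[y-z] = solve-∀ ringℚ

  [x*y]*z≡y*[x*z] : ∀ x y z → (x * y) * z ≡ y * (x * z)
  [x*y]*z≡y*[x*z] = solve-∀ ringℚ

  x*y*[a*b]≡x*a*[y*b] : ∀ x y a b → x * y * (a * b) ≡ x * a * (y * b)
  x*y*[a*b]≡x*a*[y*b] = solve-∀ ringℚ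

  [1+x]-1≡x : ∀ x → (1ℚ + x) - 1ℚ ≡ x
  [1+x]-1≡x = solve-∀ ringℚ

  y+x*y≡[1+x]*y : ∀ x y → y + x * y ≡ (1ℚ + x) * y
  y+x*y≡[1+x]*y = solve-∀ ringℚ

  c+0*x≡c : ∀ c x → c + 0ℚ * x ≡ c
  c+0*x≡c = solve-∀ ringℚ

  quotient-nil : ∀ t r → 0ℚ ≡ 0ℚ + (t - r) * 0ℚ
  quotient-nil = solve-∀ ringℚ

  quotient-singleton : ∀ c t r → c + t * 0ℚ ≡ (c + r * 0ℚ) + (t - r) * 0ℚ
  quotient-singleton = solve-∀ ringℚ

  quotient-step : ∀ c t r h Q → c + t * (h + (t - r) * Q) ≡ (c + r * h) + (t - r) * (h + t * Q)
  quotient-step = solve-∀ ringℚ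

  invℚ : ∀ x → x ≢ 0ℚ → Σ ℚ λ y → x * y ≡ 1ℚ
  invℚ x x≢0 = ℚ.1/_ x {{ℚ.≢-nonZero x≢0}} , ℚP.*-inverseʳ x {{ℚ.≢-nonZero x≢0}}

x-y≡0⇒x≡y : ∀ {x y} → x - y ≡ 0ℚ → x ≡ y
x-y≡0⇒x≡y {x} {y} e = trans (sym ([x-y]+y≡x x y)) (trans (cong (_+ y) e) (F.+-identityˡ y))

x≡y⇒x-y≡0 : ∀ {x y} → x ≡ y → x - y ≡ 0ℚ
x≡y⇒x-y≡0 {x} refl = x-x≡0 x

*-cancelˡ-0 : ∀ {x y} → x ≢ 0ℚ → x * y ≡ 0ℚ → y ≡ 0ℚ
*-cancelˡ-0 {x} {y} x≢0 e with invℚ x x≢0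
... | r , xr = begin
  y             ≡⟨ sym (F.*-identityˡ y) ⟩
  1ℚ * y        ≡⟨ cong (_* y) (sym xr) ⟩
  (x * r) * y   ≡⟨ [x*y]*z≡y*[x*z] x r y ⟩
  r * (x * y)   ≡⟨ cong (r *_) e ⟩
  r * 0ℚ        ≡⟨ F.zeroʳ r ⟩
  0ℚ            ∎
  where
  open ≡-Reasoning

*-cancelˡ-≡ : ∀ {x y z} → x ≢ 0ℚ → x * y ≡ x * z → y ≡ z
*-cancelˡ-≡ {x} {y} {z} x≢0 e =
  x-y≡0⇒x≡y (*-cancelˡ-0 x≢0 (trans (x*[y-z] x y z) (x≡y⇒x-y≡0 e)))

*-cancelʳ-0 : ∀ {x y} → y ≢ 0ℚ → x * y ≡ 0ℚ → x ≡ 0ℚ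
*-cancelʳ-0 {x} {y} y≢0 e = *-cancelˡ-0 y≢0 (trans (F.*-comm y x) e)

*-≢0 : ∀ {x y} → x ≢ 0ℚ → y ≢ 0ℚ → x * y ≢ 0ℚ
*-≢0 x≢0 y≢0 e = y≢0 (*-cancelˡ-0 x≢0 e)

infixr 8 _^_
_^_ : ℚ → ℕ → ℚ
x ^ zero = 1ℚ
x ^ suc k = x * x ^ k

^-+ : ∀ x m n → x ^ (m ℕ.+ n) ≡ x ^ m * x ^ n
^-+ x zero n = sym (F.*-identityˡ _)
^-+ x (suc m) n = trans (cong (x *_) (^-+ x m n)) (sym (F.*-assoc x _ _))

^-* : ∀ x y n → (x * y) ^ n ≡ x ^ n * y ^ n
^-* x y zero = sym (F.*-identityˡ 1ℚ)
^-* x y (suc n) = trans (cong (x * y *_) (^-* x y n)) (x*y*[a*b]≡x*a*[y*b] x y (x ^ n) (y ^ n))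

1^ : ∀ n → 1ℚ ^ n ≡ 1ℚ
1^ zero = refl
1^ (suc n) = trans (F.*-identityˡ _) (1^ n)

^-≢0 : ∀ {x} n → x ≢ 0ℚ → x ^ n ≢ 0ℚ
^-≢0 zero x≢0 ()
^-≢0 (suc n) x≢0 = *-≢0 x≢0 (^-≢0 n x≢0)

*0≡0 : ∀ {x y} → y ≡ 0ℚ → x * y ≡ 0ℚ
*0≡0 {x} refl = F.zeroʳ x

0*≡0 : ∀ {x y} → x ≡ 0ℚ → x * y ≡ 0ℚ
0*≡0 {y = y} refl = F.zeroˡ y

fromℕ : ℕ → ℚ
fromℕ zero = 0ℚ
fromℕ (suc n) = 1ℚ + fromℕ n

opaque
  unfolding _+_

  fromℕ-nonNeg : ∀ n → 0ℚ ℚ.≤ fromℕ n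
  fromℕ-nonNeg zero = ℚP.≤-refl
  fromℕ-nonNeg (suc n) = ℚP.+-mono-≤ {0ℚ} {1ℚ} {0ℚ} {fromℕ n} (ℚP.nonNegative⁻¹ 1ℚ) (fromℕ-nonNeg n)

  fromℕ-suc≢0 : ∀ n → fromℕ (suc n) ≢ 0ℚ
  fromℕ-suc≢0 n e = ℚP.<-irrefl (sym e) (ℚP.+-mono-<-≤ {0ℚ} {1ℚ} {0ℚ} {fromℕ n} (ℚP.positive⁻¹ 1ℚ) (fromℕ-nonNeg n))

fromℕ-injective : ∀ m n → fromℕ m ≡ fromℕ n → m ≡ n
fromℕ-injective zero zero e = refl
fromℕ-injective zero (suc n) e = ⊥-elim (fromℕ-suc≢0 n (sym e))
fromℕ-injective (suc m) zero e = ⊥-elim (fromℕ-suc≢0 m e)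
fromℕ-injective (suc m) (suc n) e = cong suc (fromℕ-injective m n (begin
  fromℕ m                 ≡⟨ sym ([1+x]-1≡x (fromℕ m)) ⟩
  (1ℚ + fromℕ m) - 1ℚ     ≡⟨ cong (_- 1ℚ) e ⟩
  (1ℚ + fromℕ n) - 1ℚ     ≡⟨ [1+x]-1≡x (fromℕ n) ⟩
  fromℕ n                 ∎))
  where
  open ≡-Reasoning

fromℕ-+ : ∀ m n → fromℕ (m ℕ.+ n) ≡ fromℕ m + fromℕ n
fromℕ-+ zero n = sym (F.+-identityˡ _)
fromℕ-+ (suc m) n = trans (cong (1ℚ +_) (fromℕ-+ m n)) (sym (F.+-assoc 1ℚ _ _))

fromℕ-* : ∀ m n → fromℕ (m ℕ.* n) ≡ fromℕ m * fromℕ n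
fromℕ-* zero n = sym (F.zeroˡ _)
fromℕ-* (suc m) n = begin
  fromℕ (n ℕ.+ m ℕ.* n)            ≡⟨ fromℕ-+ n (m ℕ.* n) ⟩
  fromℕ n + fromℕ (m ℕ.* n)        ≡⟨ cong (fromℕ n +_) (fromℕ-* m n) ⟩
  fromℕ n + fromℕ m * fromℕ n      ≡⟨ y+x*y≡[1+x]*y (fromℕ m) (fromℕ n) ⟩
  (1ℚ + fromℕ m) * fromℕ n         ∎
  where
  open ≡-Reasoning

fromℕ-^ : ∀ m n → fromℕ (m ℕ.^ n) ≡ fromℕ m ^ n
fromℕ-^ m zero = F.+-identityʳ 1ℚ
fromℕ-^ m (suc n) = trans (fromℕ-* m (m ℕ.^ n)) (cong (fromℕ m *_) (fromℕ-^ m n))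

-- Univariate polynomials

horner : List ℚ → ℚ → ℚ
horner [] t = 0ℚ
horner (c ∷ cs) t = c + t * horner cs t

-- Synthetic division by `t - r`: the coefficients of the quotient are the values at `r` of the
-- successive tails of the list.
quotient : ℚ → List ℚ → List ℚ
quotient r [] = []
quotient r (c ∷ []) = []
quotient r (c ∷ cs@(_ ∷ _)) = horner cs r ∷ quotient r cs

quotient-correct : ∀ r cs t → horner cs t ≡ horner cs r + (t - r) * horner (quotient r cs) t
quotient-correct r [] t = quotient-nil t r
quotient-correct r (c ∷ []) t = quotient-singleton c t r
quotient-correct r (c ∷ cs@(_ ∷ _)) t = begin
  c + t * horner cs t                      ≡⟨ cong (λ z → c + t * z) (quotient-correct r cs t) ⟩
  c + t * (horner cs r + (t - r) * Q)      ≡⟨ quotient-step c t r (horner cs r) Q ⟩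
  (c + r * horner cs r) + (t - r) * (horner cs r + t * Q) ∎
  where
  open ≡-Reasoning
  Q = horner (quotient r cs) t

length-quotient : ∀ r c cs → length (quotient r (c ∷ cs)) ≡ length cs
length-quotient r c [] = refl
length-quotient r c (d ∷ cs) = cong suc (length-quotient r d cs)

quotient-root : ∀ r cs t → horner cs r ≡ 0ℚ → horner cs t ≡ (t - r) * horner (quotient r cs) t
quotient-root r cs t e = trans (quotient-correct r cs t)
  (trans (cong (_+ (t - r) * horner (quotient r cs) t) e) (F.+-identityˡ _))

-- Dividing by the first root shortens the coefficient list by one, and the remaining roots, being
-- different from it, stay roots of the quotient.
horner-roots : ∀ rs cs → AllPairs _≢_ rs → All (λ r → horner cs r ≡ 0ℚ) rs →
  length cs ≤ length rs → ∀ t → horner cs t ≡ 0ℚ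
horner-roots rs [] u z l t = refl
horner-roots [] (c ∷ cs) u z () t
horner-roots (r ∷ rs) (c ∷ cs) (r≢ ∷ u) (zr ∷ z) (s≤s l) t =
  trans (quotient-root r (c ∷ cs) t zr) (*0≡0 (horner-roots rs (quotient r (c ∷ cs)) u
    (All.zipWith (λ {r′} p → *-cancelˡ-0 (λ e → proj₁ p (sym (x-y≡0⇒x≡y e)))
       (trans (sym (quotient-root r (c ∷ cs) r′ zr)) (proj₂ p))) (r≢ , z))
    (≤-trans (≤-reflexive (length-quotient r c cs)) l) t))

applyUpTo-unique : (g : ℕ → ℚ) → (∀ i j → g i ≡ g j → i ≡ j) → ∀ n → AllPairs _≢_ (applyUpTo g n)
applyUpTo-unique g inj n = AllPairsP.applyUpTo⁺₁ g n (λ i<j _ e → <⇒≢ i<j (inj _ _ e))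

horner-zero-at : (g : ℕ → ℚ) → (∀ i j → g i ≡ g j → i ≡ j) → ∀ cs →
  (∀ i → horner cs (g i) ≡ 0ℚ) → ∀ t → horner cs t ≡ 0ℚ
horner-zero-at g inj cs z = horner-roots (applyUpTo g (length cs)) cs (applyUpTo-unique g inj _)
  (applyUpTo⁺₂ g (length cs) z) (≤-reflexive (sym (length-applyUpTo g (length cs))))

horner-coeffs-0 : ∀ cs → (∀ t → horner cs t ≡ 0ℚ) → All (_≡ 0ℚ) cs
horner-coeffs-0 [] z = []
horner-coeffs-0 (c ∷ cs) z = c≡0 ∷ horner-coeffs-0 cs
  (horner-zero-at (fromℕ ∘ suc) (λ i j e → suc-injective (fromℕ-injective _ _ e)) cs
    (λ i → *-cancelˡ-0 (fromℕ-suc≢0 i) (trans (sym (F.+-identityˡ _))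
      (trans (cong (_+ fromℕ (suc i) * horner cs (fromℕ (suc i))) (sym c≡0)) (z (fromℕ (suc i)))))))
  where
  c≡0 : c ≡ 0ℚ
  c≡0 = trans (sym (c+0*x≡c c (horner cs 0ℚ))) (z 0ℚ)

length-filter-∁ : ∀ {A : Set} {P Q : A → Set} (P? : ∀ x → Dec (P x)) (Q? : ∀ x → Dec (Q x)) xs →
  All (λ x → P x ⊎ Q x) xs → length xs ≤ length (filter P? xs) ℕ.+ length (filter Q? xs)
length-filter-∁ P? Q? [] [] = z≤n
length-filter-∁ P? Q? (x ∷ xs) (pq ∷ pqs) with P? x | Q? x
... | yes _ | yes _ = s≤s (≤-trans (length-filter-∁ P? Q? xs pqs) (+-monoʳ-≤ (length (filter P? xs)) (n≤1+n _)))
... | yes _ | no _ = s≤s (length-filter-∁ P? Q? xs pqs)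
... | no _ | yes _ = ≤-trans (s≤s (length-filter-∁ P? Q? xs pqs)) (≤-reflexive (sym (+-suc _ _)))
... | no ¬p | no ¬q = ⊥-elim (case pq of λ { (inj₁ p) → ¬p p ; (inj₂ q) → ¬q q })

-- Pigeonhole on `length as + length bs` distinct points: one of the two polynomials has as many
-- roots among them as it has coefficients.
horner-domain : (g : ℕ → ℚ) → (∀ i j → g i ≡ g j → i ≡ j) → ∀ as bs →
  (∀ i → horner as (g i) ≡ 0ℚ ⊎ horner bs (g i) ≡ 0ℚ) →
  (∀ t → horner as t ≡ 0ℚ) ⊎ (∀ t → horner bs t ≡ 0ℚ)
horner-domain g inj as bs z = case length as ≤? length (filter A? pts) of λ
  { (yes le) → inj₁ (horner-roots (filter A? pts) as (AllPairsP.filter⁺ A? (applyUpTo-unique g inj n)) (all-filter A? pts) le)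
  ; (no ¬le) → inj₂ (horner-roots (filter B? pts) bs (AllPairsP.filter⁺ B? (applyUpTo-unique g inj n)) (all-filter B? pts)
      (+-cancelˡ-≤ (length as) _ _ (≤-trans
        (≤-trans (≤-reflexive (sym (length-applyUpTo g n)))
          (length-filter-∁ A? B? pts (applyUpTo⁺₂ g n z)))
        (+-monoˡ-≤ _ (<⇒≤ (≰⇒> ¬le))))))
  }
  where
  n = length as ℕ.+ length bs
  pts = applyUpTo g n
  A? = λ t → horner as t ℚP.≟ 0ℚ
  B? = λ t → horner bs t ℚP.≟ 0ℚ

-- Evaluation of polynomials

evM : ∀ {m} → Monomial m → Vec ℚ m → ℚ
evM [] [] = 1ℚ
evM (k ∷ e) (t ∷ v) = t ^ k * evM e v

ev : ∀ {m} → Poly m → Vec ℚ m → ℚ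
ev [] v = 0ℚ
ev ((c , e) ∷ P) v = c * evM e v + ev P v

opaque
  unfolding _+_

  0+0≡0 : 0ℚ + 0ℚ ≡ 0ℚ
  0+0≡0 = refl

  -0≡0 : - 0ℚ ≡ 0ℚ
  -0≡0 = refl

  neg-term : ∀ c x y → (- c) * x + - y ≡ - (c * x + y)
  neg-term = solve-∀ ringℚ

  [x+y]*z : ∀ x y z → (x + y) * z ≡ x * z + y * z
  [x+y]*z = solve-∀ ringℚ

  mul-term : ∀ c d x y z → (c * d) * (x * y) + (c * x) * z ≡ (c * x) * (d * y + z)
  mul-term = solve-∀ ringℚ

  interchange+ : ∀ a b c d → (a + b) + (c + d) ≡ (a + c) + (b + d)
  interchange+ = solve-∀ ringℚ

  x*[c*1]+0 : ∀ x → x * 1ℚ + 0ℚ ≡ x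
  x*[c*1]+0 = solve-∀ ringℚ

  horner-+-step : ∀ a b t x y → (a + b) + t * (x + y) ≡ (a + t * x) + (b + t * y)
  horner-+-step = solve-∀ ringℚ

  horner-δ-step : ∀ t c x → 0ℚ + t * (c * x) ≡ c * (t * x)
  horner-δ-step = solve-∀ ringℚ

  c*[t*e] : ∀ c t e → c * (t * e) ≡ (c * e) * t
  c*[t*e] = solve-∀ ringℚ

  horner-δ-base : ∀ t c x → x ≡ 0ℚ → c + t * x ≡ c * 1ℚ
  horner-δ-base t c x refl = base t c
    where
    base : ∀ t c → c + t * 0ℚ ≡ c * 1ℚ
    base = solve-∀ ringℚ

ev-++ : ∀ {m} (P Q : Poly m) v → ev (P +ₚ Q) v ≡ ev P v + ev Q v
ev-++ [] Q v = sym (F.+-identityˡ _)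
ev-++ ((c , e) ∷ P) Q v = trans (cong (c * evM e v +_) (ev-++ P Q v)) (sym (F.+-assoc _ _ _))

ev-neg : ∀ {m} (P : Poly m) v → ev (-ₚ P) v ≡ - ev P v
ev-neg [] v = sym -0≡0
ev-neg ((c , e) ∷ P) v = trans (cong₂ (λ a b → a * evM e v + b) (sym (neg-def c)) (ev-neg P v)) (neg-term c _ _)

sub-def : ∀ x y → x - y ≡ x + - y
sub-def = opaque-sub
  where
  opaque
    unfolding _+_
    opaque-sub : ∀ x y → x - y ≡ x + - y
    opaque-sub = solve-∀ ringℚ

ev-sub : ∀ {m} (P Q : Poly m) v → ev (P -ₚ Q) v ≡ ev P v - ev Q v
ev-sub P Q v = trans (ev-++ P (-ₚ Q) v) (trans (cong (ev P v +_) (ev-neg Q v)) (sym (sub-def _ _)))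

evM-+ : ∀ {m} (e e′ : Monomial m) v → evM (Vec.zipWith ℕ._+_ e e′) v ≡ evM e v * evM e′ v
evM-+ [] [] [] = sym (F.*-identityˡ 1ℚ)
evM-+ (k ∷ e) (l ∷ e′) (t ∷ v) = trans (cong₂ _*_ (^-+ t k l) (evM-+ e e′ v)) (x*y*[a*b]≡x*a*[y*b] (t ^ k) (t ^ l) (evM e v) (evM e′ v))

ev-map : ∀ {m} c (e : Monomial m) v (g : ℚ × Monomial m → ℚ × Monomial m) →
  (∀ d e′ → g (d , e′) ≡ (c ℚ.* d , Vec.zipWith ℕ._+_ e e′)) →
  ∀ Q → ev (map g Q) v ≡ (c * evM e v) * ev Q v
ev-map c e v g h [] = sym (F.zeroʳ _)
ev-map c e v g h ((d , e′) ∷ Q) with g (d , e′) | h d e′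
... | _ | refl = begin
  c ℚ.* d * evM (Vec.zipWith ℕ._+_ e e′) v + ev (map g Q) v
    ≡⟨ cong₂ _+_ (cong₂ _*_ (sym (*-def c d)) (evM-+ e e′ v)) (ev-map c e v g h Q) ⟩
  (c * d) * (evM e v * evM e′ v) + (c * evM e v) * ev Q v
    ≡⟨ mul-term c d (evM e v) (evM e′ v) (ev Q v) ⟩
  (c * evM e v) * (d * evM e′ v + ev Q v) ∎
  where open ≡-Reasoning

ev-* : ∀ {m} (P Q : Poly m) v → ev (P *ₚ Q) v ≡ ev P v * ev Q v
ev-* [] Q v = sym (F.zeroˡ _)
ev-* ((c , e) ∷ P) Q v = trans (ev-++ (map _ Q) (P *ₚ Q) v)
  (trans (cong₂ _+_ (ev-map c e v _ (λ _ _ → refl) Q) (ev-* P Q v)) (sym ([x+y]*z _ _ _)))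

evM-0 : ∀ {m} (v : Vec ℚ m) → evM (Vec.replicate m 0) v ≡ 1ℚ
evM-0 [] = refl
evM-0 (t ∷ v) = trans (F.*-identityˡ _) (evM-0 v)

ev-const : ∀ {m} c (v : Vec ℚ m) → ev (constₚ c) v ≡ c
ev-const c v = trans (cong (λ z → c * z + 0ℚ) (evM-0 v)) (x*[c*1]+0 c)

evM-tabulate-0 : ∀ {m} (v : Vec ℚ m) → evM (tabulate (λ _ → 0)) v ≡ 1ℚ
evM-tabulate-0 [] = refl
evM-tabulate-0 (t ∷ v) = trans (F.*-identityˡ _) (evM-tabulate-0 v)

evM-var : ∀ {m} (i : Fin m) v → evM (tabulate (λ j → if ⌊ i Fin.≟ j ⌋ then 1 else 0)) v ≡ lookup v i
evM-var 0F (t ∷ v) = trans (cong₂ _*_ (F.*-identityʳ t) (evM-tabulate-0 v)) (F.*-identityʳ t)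
evM-var (Fin.suc i) (t ∷ v) = trans (F.*-identityˡ _) (trans
  (cong (λ e → evM e v) (VecP.tabulate-cong (λ j → cong (λ b → if b then 1 else 0)
    (trans (isYes≗does (Fin.suc i Fin.≟ Fin.suc j)) (sym (isYes≗does (i Fin.≟ j)))))))
  (evM-var i v))

ev-var : ∀ {m} (i : Fin m) v → ev (var i) v ≡ lookup v i
ev-var i v = trans (cong (λ z → 1ℚ * z + 0ℚ) (evM-var i v)) (trans (x+0≡x _) (F.*-identityˡ _))

ev-^ : ∀ {m} (P : Poly m) k v → ev (P ^ₚ k) v ≡ ev P v ^ k
ev-^ P zero v = ev-const 1ℚ v
ev-^ P (suc k) v = trans (ev-* P (P ^ₚ k) v) (cong (ev P v *_) (ev-^ P k v))

prodℚ : List ℚ → ℚ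
prodℚ = foldr _*_ 1ℚ

ev-prod : ∀ {m} (Ps : List (Poly m)) v → ev (prodₚ Ps) v ≡ prodℚ (map (λ P → ev P v) Ps)
ev-prod [] v = ev-const 1ℚ v
ev-prod (P ∷ Ps) v = trans (ev-* P (prodₚ Ps) v) (cong (ev P v *_) (ev-prod Ps v))

ev-monoEval : ∀ {m n k} (σ : Fin m → Poly n) (f : Fin k → Fin m) (e : Monomial k) v →
  ev (prodₚ (toList (Vec.zipWith (λ i j → σ i ^ₚ j) (tabulate f) e))) v ≡ evM e (tabulate (λ i → ev (σ (f i)) v))
ev-monoEval σ f [] v = ev-const 1ℚ v
ev-monoEval σ f (k ∷ e) v = trans (ev-* (σ (f 0F) ^ₚ k) (prodₚ (toList (Vec.zipWith (λ i j → σ i ^ₚ j) (tabulate (f ∘ Fin.suc)) e))) v)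
  (cong₂ _*_ (ev-^ (σ (f 0F)) k v) (ev-monoEval σ (f ∘ Fin.suc) e v))

ev-subst : ∀ {m n} (σ : Fin m → Poly n) P v → ev (subst σ P) v ≡ ev P (tabulate (λ i → ev (σ i) v))
ev-subst σ [] v = refl
ev-subst σ ((c , e) ∷ P) v = trans (ev-++ (constₚ c *ₚ monoEval σ e) (subst σ P) v)
  (cong₂ _+_ (trans (ev-* (constₚ c) (monoEval σ e) v) (cong₂ _*_ (ev-const c v) (ev-monoEval σ id e v))) (ev-subst σ P v))

-- A polynomial as a univariate polynomial in variable zero

coeffs : ∀ {m} → ℕ → Poly (suc m) → Vec ℚ m → List ℚ
coeffs N P v = applyUpTo (λ j → ev (coeffξ j P) v) N

-- Strictly larger than every exponent of variable zero, so that it serves directly as the length of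
-- a coefficient list.
degBound : ∀ {m} → Poly (suc m) → ℕ
degBound [] = 0
degBound ((c , k ∷ e) ∷ P) = suc k ⊔ degBound P

horner-applyUpTo-+ : ∀ (f g h : ℕ → ℚ) → (∀ j → h j ≡ f j + g j) → ∀ N t →
  horner (applyUpTo h N) t ≡ horner (applyUpTo f N) t + horner (applyUpTo g N) t
horner-applyUpTo-+ f g h eq zero t = sym 0+0≡0
horner-applyUpTo-+ f g h eq (suc N) t =
  trans (cong₂ (λ a b → a + t * b) (eq 0) (horner-applyUpTo-+ (f ∘ suc) (g ∘ suc) (h ∘ suc) (λ j → eq (suc j)) N t))
    (horner-+-step _ _ _ _ _)

horner-applyUpTo-0 : ∀ (f : ℕ → ℚ) → (∀ j → f j ≡ 0ℚ) → ∀ N t → horner (applyUpTo f N) t ≡ 0ℚ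
horner-applyUpTo-0 f z zero t = refl
horner-applyUpTo-0 f z (suc N) t = trans (cong₂ (λ a b → a + t * b) (z 0) (horner-applyUpTo-0 (f ∘ suc) (z ∘ suc) N t))
  (trans (F.+-identityˡ _) (F.zeroʳ t))

δ : ℕ → ℚ → ℕ → ℚ
δ k c j = if ⌊ k ℕ.≟ j ⌋ then c else 0ℚ

δ-suc : ∀ k c j → δ (suc k) c (suc j) ≡ δ k c j
δ-suc k c j with k ℕ.≟ j
... | yes refl = cong (λ b → if b then c else 0ℚ) (does-refl k)
  where
  does-refl : ∀ k → ⌊ suc k ℕ.≟ suc k ⌋ ≡ true
  does-refl k with suc k ℕ.≟ suc k
  ... | yes _ = refl
  ... | no ≢ = ⊥-elim (≢ refl)
... | no k≢j with suc k ℕ.≟ suc j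
... | yes e = ⊥-elim (k≢j (suc-injective e))
... | no _ = refl

horner-δ : ∀ (f : ℕ → ℚ) k c N t → k < N → (∀ j → f j ≡ δ k c j) → horner (applyUpTo f N) t ≡ c * t ^ k
horner-δ f zero c (suc N) t (s≤s l) eq = trans (cong (_+ t * horner (applyUpTo (f ∘ suc) N) t) (eq 0))
  (horner-δ-base t c _ (horner-applyUpTo-0 (f ∘ suc) (eq ∘ suc) N t))
horner-δ f (suc k) c (suc N) t (s≤s l) eq =
  trans (cong₂ (λ a b → a + t * b) (eq 0) (horner-δ (f ∘ suc) k c N t l (λ j → trans (eq (suc j)) (δ-suc k c j))))
    (horner-δ-step t c (t ^ k))

ev-coeffξ-∷ : ∀ {m} j c k (e : Monomial m) P v →
  ev (coeffξ j ((c , k ∷ e) ∷ P)) v ≡ δ k (c * evM e v) j + ev (coeffξ j P) v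
ev-coeffξ-∷ j c k e P v with ⌊ k ℕ.≟ j ⌋
... | true = refl
... | false = sym (F.+-identityˡ _)

ev-horner : ∀ {m} (P : Poly (suc m)) N → degBound P ≤ N → ∀ t v → ev P (t ∷ v) ≡ horner (coeffs N P v) t
ev-horner [] N l t v = sym (horner-applyUpTo-0 _ (λ _ → refl) N t)
ev-horner ((c , k ∷ e) ∷ P) N l t v = trans
  (cong₂ _+_ (trans (c*[t*e] c (t ^ k) (evM e v))
      (sym (horner-δ _ k (c * evM e v) N t (≤-trans (m≤m⊔n (suc k) (degBound P)) l) (λ _ → refl))))
    (ev-horner P N (≤-trans (m≤n⊔m (suc k) (degBound P)) l) t v))
  (sym (horner-applyUpTo-+ _ _ _ (λ j → ev-coeffξ-∷ j c k e P v) N t))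

coeff-coeffξ : ∀ {m} k (P : Poly (suc m)) e → coeff (coeffξ k P) e ≡ coeff P (k ∷ e)
coeff-coeffξ k [] e = refl
coeff-coeffξ k ((c , l ∷ e′) ∷ P) e with l ℕ.≟ k
coeff-coeffξ k ((c , l ∷ e′) ∷ P) e | yes refl with ≡-dec ℕ._≟_ e′ e | ≡-dec ℕ._≟_ (k ∷ e′) (k ∷ e)
... | yes _ | yes _ = cong (c ℚ.+_) (coeff-coeffξ k P e)
... | yes refl | no ≢ = ⊥-elim (≢ refl)
... | no ≢ | yes refl = ⊥-elim (≢ refl)
... | no _ | no _ = coeff-coeffξ k P e
coeff-coeffξ k ((c , l ∷ e′) ∷ P) e | no l≢k with ≡-dec ℕ._≟_ (l ∷ e′) (k ∷ e)
... | yes refl = ⊥-elim (l≢k refl)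
... | no _ = coeff-coeffξ k P e

applyUpTo-cong : ∀ {A : Set} {f g : ℕ → A} N → (∀ i → f i ≡ g i) → applyUpTo f N ≡ applyUpTo g N
applyUpTo-cong zero h = refl
applyUpTo-cong (suc N) h = cong₂ _∷_ (h 0) (applyUpTo-cong N (h ∘ suc))

coeff-[] : (P : Poly 0) → ev P [] ≡ coeff P []
coeff-[] [] = refl
coeff-[] ((c , []) ∷ P) = trans (cong₂ _+_ (F.*-identityʳ c) (coeff-[] P)) (+-def c (coeff P []))

ev-resp-≈ : ∀ {m} {P Q : Poly m} → P ≈ Q → ∀ v → ev P v ≡ ev Q v
ev-resp-≈ {P = P} {Q} eq [] = trans (coeff-[] P) (trans (eq []) (sym (coeff-[] Q)))
ev-resp-≈ {P = P} {Q} eq (t ∷ v) = begin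
  ev P (t ∷ v)              ≡⟨ ev-horner P N (m≤m⊔n _ _) t v ⟩
  horner (coeffs N P v) t   ≡⟨ cong (λ cs → horner cs t) (applyUpTo-cong N (λ i → ev-resp-≈ {P = coeffξ i P} {coeffξ i Q} (coeffξ-eq i) v)) ⟩
  horner (coeffs N Q v) t   ≡⟨ sym (ev-horner Q N (m≤n⊔m (degBound P) _) t v) ⟩
  ev Q (t ∷ v)              ∎
  where
  open ≡-Reasoning
  N = degBound P ⊔ degBound Q
  coeffξ-eq : ∀ i → coeffξ i P ≈ coeffξ i Q
  coeffξ-eq i e = trans (coeff-coeffξ i P e) (trans (eq (i ∷ e)) (sym (coeff-coeffξ i Q e)))

ev-coeffξ-0 : ∀ {m} (P : Poly (suc m)) v → (∀ t → ev P (t ∷ v) ≡ 0ℚ) → ∀ k → ev (coeffξ k P) v ≡ 0ℚ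
ev-coeffξ-0 P v z k = AllP.applyUpTo⁻ (λ j → ev (coeffξ j P) v) N
  (horner-coeffs-0 (coeffs N P v) (λ t → trans (sym (ev-horner P N (m≤n⊔m (suc k) _) t v)) (z t)))
  (m≤m⊔n (suc k) (degBound P))
  where N = suc k ⊔ degBound P

-- Since ℚ is infinite, vanishing at all values of the first variable kills each coefficient in that
-- variable; these are polynomials in fewer variables. With `ev-resp-≈` this replaces equality of
-- coefficients by equality of values everywhere below.
ev≡0⇒≈0 : ∀ {m} (P : Poly m) → (∀ v → ev P v ≡ 0ℚ) → P ≈ 0ₚ
ev≡0⇒≈0 P z [] = trans (sym (coeff-[] P)) (z [])
ev≡0⇒≈0 P z (k ∷ e) = trans (sym (coeff-coeffξ k P e))
  (ev≡0⇒≈0 (coeffξ k P) (λ v → ev-coeffξ-0 P v (λ t → z (t ∷ v)) k) e)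

coeff-++ : ∀ {m} (P Q : Poly m) e → coeff (P +ₚ Q) e ≡ coeff P e + coeff Q e
coeff-++ [] Q e = sym (F.+-identityˡ _)
coeff-++ ((c , e′) ∷ P) Q e with ≡-dec ℕ._≟_ e′ e
... | yes _ = trans (trans (cong (c ℚ.+_) (coeff-++ P Q e)) (sym (+-def c _)))
                (trans (sym (F.+-assoc c _ _)) (cong (_+ coeff Q e) (+-def c _)))
... | no _ = coeff-++ P Q e

opaque
  unfolding _+_

  coeff-neg : ∀ {m} (P : Poly m) e → coeff (-ₚ P) e ≡ - coeff P e
  coeff-neg [] e = refl
  coeff-neg ((c , e′) ∷ P) e with ≡-dec ℕ._≟_ e′ e
  ... | yes _ = trans (cong (ℚ.- c ℚ.+_) (coeff-neg P e)) (sym (ℚP.neg-distrib-+ c (coeff P e)))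
  ... | no _ = coeff-neg P e

ev≡⇒≈ : ∀ {m} (P Q : Poly m) → (∀ v → ev P v ≡ ev Q v) → P ≈ Q
ev≡⇒≈ P Q eq e = x-y≡0⇒x≡y (trans (sub-def _ _) (trans
  (trans (cong (coeff P e +_) (sym (coeff-neg Q e))) (sym (coeff-++ P (-ₚ Q) e)))
  (ev≡0⇒≈0 (P -ₚ Q) (λ v → trans (ev-sub P Q v) (x≡y⇒x-y≡0 (eq v))) e)))

-- Polynomial functions

-- Formal polynomials are unnormalised sums. Working with functions that some polynomial represents
-- makes identities pointwise, and a substitution or a quotient is just another function.
IsPoly : ∀ n → (Vec ℚ n → ℚ) → Set
IsPoly n h = Σ (Poly n) λ P → ∀ v → h v ≡ ev P v

poly-resp : ∀ {n} {h k : Vec ℚ n → ℚ} → (∀ v → h v ≡ k v) → IsPoly n h → IsPoly n k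
poly-resp e (P , p) = P , λ v → trans (sym (e v)) (p v)

poly-ev : ∀ {n} (P : Poly n) → IsPoly n (ev P)
poly-ev P = P , λ _ → refl

poly-const : ∀ {n} c → IsPoly n (λ _ → c)
poly-const c = constₚ c , λ v → sym (ev-const c v)

poly-var : ∀ {n} i → IsPoly n (λ v → lookup v i)
poly-var i = var i , λ v → sym (ev-var i v)

poly-+ : ∀ {n} {h k : Vec ℚ n → ℚ} → IsPoly n h → IsPoly n k → IsPoly n (λ v → h v + k v)
poly-+ (P , p) (Q , q) = P +ₚ Q , λ v → trans (cong₂ _+_ (p v) (q v)) (sym (ev-++ P Q v))

poly-- : ∀ {n} {h k : Vec ℚ n → ℚ} → IsPoly n h → IsPoly n k → IsPoly n (λ v → h v - k v)
poly-- (P , p) (Q , q) = P -ₚ Q , λ v → trans (cong₂ _-_ (p v) (q v)) (sym (ev-sub P Q v))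

poly-* : ∀ {n} {h k : Vec ℚ n → ℚ} → IsPoly n h → IsPoly n k → IsPoly n (λ v → h v * k v)
poly-* (P , p) (Q , q) = P *ₚ Q , λ v → trans (cong₂ _*_ (p v) (q v)) (sym (ev-* P Q v))

poly-^ : ∀ {n} {h : Vec ℚ n → ℚ} k → IsPoly n h → IsPoly n (λ v → h v ^ k)
poly-^ k (P , p) = P ^ₚ k , λ v → trans (cong (_^ k) (p v)) (sym (ev-^ P k v))

poly-prod : ∀ {n} {A : Set} (f : A → Vec ℚ n → ℚ) (as : List A) → (∀ a → IsPoly n (f a)) →
  IsPoly n (λ v → prodℚ (map (λ a → f a v) as))
poly-prod f [] h = poly-const 1ℚ
poly-prod f (a ∷ as) h = poly-* (h a) (poly-prod f as h)

poly-∘ : ∀ {m n} {h : Vec ℚ m → ℚ} (g : Vec ℚ n → Vec ℚ m) →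
  IsPoly m h → (∀ i → IsPoly n (λ v → lookup (g v) i)) → IsPoly n (h ∘ g)
poly-∘ g (P , p) gp = subst (proj₁ ∘ gp) P , λ v → trans (p (g v)) (trans
  (cong (ev P) (trans (sym (tabulate∘lookup (g v))) (VecP.tabulate-cong (λ i → proj₂ (gp i) v))))
  (sym (ev-subst (proj₁ ∘ gp) P v)))

poly-tail : ∀ {n} {h : Vec ℚ n → ℚ} → IsPoly n h → IsPoly (suc n) (h ∘ tail)
poly-tail hp = poly-∘ tail hp (λ i → poly-resp (λ { (t ∷ v) → refl }) (poly-var (Fin.suc i)))

poly-∷ : ∀ {n} {h : Vec ℚ (suc n) → ℚ} {a : Vec ℚ n → ℚ} → IsPoly (suc n) h → IsPoly n a → IsPoly n (λ v → h (a v ∷ v))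
poly-∷ {a = a} hp ap = poly-∘ (λ v → a v ∷ v) hp λ { 0F → ap ; (Fin.suc i) → poly-var i }

poly-fix : ∀ {n} {h : Vec ℚ (suc n) → ℚ} t → IsPoly (suc n) h → IsPoly n (λ v → h (t ∷ v))
poly-fix t hp = poly-∷ hp (poly-const t)

poly-update : ∀ {n} {h : Vec ℚ n → ℚ} i → IsPoly n h → IsPoly (suc n) (λ v → h (tail v Vec.[ i ]≔ head v))
poly-update {n} i hp = poly-∘ (λ v → tail v Vec.[ i ]≔ head v) hp λ j → coord j
  where
  coord : ∀ j → IsPoly (suc n) (λ v → lookup (tail v Vec.[ i ]≔ head v) j)
  coord j with i Fin.≟ j
  ... | yes refl = poly-resp (λ { (t ∷ v) → sym (lookup∘update i v t) }) (poly-var 0F)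
  ... | no i≢j = poly-resp (λ { (t ∷ v) → sym (lookup∘update′ (i≢j ∘ sym) v t) }) (poly-var (Fin.suc j))

poly-update-at : ∀ {n} {h a : Vec ℚ n → ℚ} i → IsPoly n h → IsPoly n a → IsPoly n (λ v → h (v Vec.[ i ]≔ a v))
poly-update-at i hp ap = poly-∷ (poly-update i hp) ap

poly-horner : ∀ {n} {h : Vec ℚ (suc n) → ℚ} → IsPoly (suc n) h → ∀ v → Σ (List ℚ) λ cs → ∀ t → h (t ∷ v) ≡ horner cs t
poly-horner (P , p) v = coeffs (degBound P) P v , λ t → trans (p (t ∷ v)) (ev-horner P (degBound P) ≤-refl t v)

-- One variable at a time: at each integer `i`, either `h` vanishes at `i ∷ v₀`, or by induction `k`
-- vanishes on the whole slice over `i`. The univariate dichotomy then leaves only the vanishing of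
-- `k`, because `h` is nonzero at `t₀ ∷ v₀`.
poly-domain : ∀ {n} {h k : Vec ℚ n → ℚ} → IsPoly n h → IsPoly n k → (∀ v → h v * k v ≡ 0ℚ) →
  ∀ v₀ → h v₀ ≢ 0ℚ → ∀ v → k v ≡ 0ℚ
poly-domain hp kp z [] h≢0 [] = *-cancelˡ-0 h≢0 (z [])
poly-domain {suc n} {h} {k} hp kp z (t₀ ∷ v₀) h≢0 (t ∷ v)
  with poly-horner hp v₀ | poly-horner kp v
... | as , ha | bs , kb with horner-domain fromℕ fromℕ-injective as bs dichotomy
  where
  dichotomy : ∀ i → horner as (fromℕ i) ≡ 0ℚ ⊎ horner bs (fromℕ i) ≡ 0ℚ
  dichotomy i with h (fromℕ i ∷ v₀) ℚP.≟ 0ℚ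
  ... | yes e = inj₁ (trans (sym (ha _)) e)
  ... | no ≢0 = inj₂ (trans (sym (kb _)) (poly-domain (poly-fix (fromℕ i) hp) (poly-fix (fromℕ i) kp) (λ w → z (fromℕ i ∷ w)) v₀ ≢0 v))
... | inj₁ zero-as = ⊥-elim (h≢0 (trans (ha t₀) (zero-as t₀)))
... | inj₂ zero-bs = trans (kb t) (zero-bs t)

poly-cancel : ∀ {n} {h k l : Vec ℚ n → ℚ} → IsPoly n h → IsPoly n k → IsPoly n l → (∀ v → h v * k v ≡ h v * l v) →
  ∀ v₀ → h v₀ ≢ 0ℚ → ∀ v → k v ≡ l v
poly-cancel hp kp lp e v₀ h≢0 v = x-y≡0⇒x≡y (poly-domain hp (poly-- kp lp)
  (λ w → trans (x*[y-z] _ _ _) (x≡y⇒x-y≡0 (e w))) v₀ h≢0 v)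

-- The search is finite: with `degBound P` coefficients in the first variable, vanishing on the
-- slices over that many integers implies vanishing everywhere.
poly-zero? : ∀ {n} {h : Vec ℚ n → ℚ} → IsPoly n h → (∀ v → h v ≡ 0ℚ) ⊎ Σ (Vec ℚ n) λ v → h v ≢ 0ℚ
poly-zero? {zero} {h} hp with h [] ℚP.≟ 0ℚ
... | yes e = inj₁ λ { [] → e }
... | no ne = inj₂ ([] , ne)
poly-zero? {suc n} {h} (P , p) with search (degBound P)
  where
  search : ∀ N → (∀ i → i < N → ∀ v → h (fromℕ i ∷ v) ≡ 0ℚ) ⊎ Σ (Vec ℚ (suc n)) λ v → h v ≢ 0ℚ
  search zero = inj₁ λ i ()
  search (suc N) with search N | poly-zero? (poly-fix (fromℕ N) (P , p))
  ... | inj₂ w | _ = inj₂ w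
  ... | inj₁ z | inj₂ (v , ne) = inj₂ (fromℕ N ∷ v , ne)
  ... | inj₁ z | inj₁ zN = inj₁ λ i i<1+N v → case m≤n⇒m<n∨m≡n (≤-pred i<1+N) of λ
      { (inj₁ i<N) → z i i<N v ; (inj₂ refl) → zN v }
... | inj₂ w = inj₂ w
... | inj₁ z = inj₁ λ { (t ∷ v) → trans (hcs t v) (horner-roots (applyUpTo fromℕ N) (coeffs N P v)
      (applyUpTo-unique fromℕ fromℕ-injective N)
      (applyUpTo⁺₁ fromℕ N (λ {i} i<N → trans (sym (hcs (fromℕ i) v)) (z i i<N v)))
      (≤-reflexive (trans (length-applyUpTo _ N) (sym (length-applyUpTo fromℕ N)))) t) }
  where
  N = degBound P
  hcs : ∀ t v → h (t ∷ v) ≡ horner (coeffs N P v) t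
  hcs t v = trans (p (t ∷ v)) (ev-horner P N ≤-refl t v)

-- Division by linear forms

opaque
  unfolding _+_

  factor-step : ∀ t a T A → t * T - a * A ≡ (t - a) * A + t * (T - A)
  factor-step = solve-∀ ringℚ

  factor-step′ : ∀ t a q A → t * ((t - a) * q) + (t - a) * A ≡ (t - a) * (t * q + A)
  factor-step′ = solve-∀ ringℚ

  factor-nil : ∀ t a → 0ℚ ≡ 0ℚ + (t - a) * 0ℚ
  factor-nil = solve-∀ ringℚ

  1-1≡d*0 : ∀ d → 1ℚ - 1ℚ ≡ d * 0ℚ
  1-1≡d*0 = solve-∀ ringℚ

  factor-cons : ∀ C A T d E q h k → (T - A) ≡ d * q →
    C * (T * E) + (h + d * k) ≡ (C * (A * E) + h) + d * ((C * E + 0ℚ) * q + k)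
  factor-cons C A T d E q h k e = trans (expand C A T d E h k) (trans (cong (λ z → (C * (A * E) + h) + (C * E * z + d * k)) e) (collect C A d E q h k))
    where
    expand : ∀ C A T d E h k → C * (T * E) + (h + d * k) ≡ (C * (A * E) + h) + (C * E * (T - A) + d * k)
    expand = solve-∀ ringℚ
    collect : ∀ C A d E q h k → (C * (A * E) + h) + (C * E * (d * q) + d * k) ≡ (C * (A * E) + h) + d * ((C * E + 0ℚ) * q + k)
    collect = solve-∀ ringℚ

powQuotient : ℕ → ℚ → ℚ → ℚ
powQuotient zero t a = 0ℚ
powQuotient (suc k) t a = t * powQuotient k t a + a ^ k

powQuotient-correct : ∀ k t a → t ^ k - a ^ k ≡ (t - a) * powQuotient k t a
powQuotient-correct zero t a = 1-1≡d*0 (t - a)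
powQuotient-correct (suc k) t a = trans (factor-step t a (t ^ k) (a ^ k))
  (trans (cong ((t - a) * a ^ k +_) (cong (t *_) (powQuotient-correct k t a)))
  (trans (F.+-comm _ _) (factor-step′ t a (powQuotient k t a) (a ^ k))))

poly-powQuotient : ∀ {n} k {h a : Vec ℚ n → ℚ} → IsPoly n h → IsPoly n a → IsPoly n (λ v → powQuotient k (h v) (a v))
poly-powQuotient zero hp ap = poly-const 0ℚ
poly-powQuotient (suc k) hp ap = poly-+ (poly-* hp (poly-powQuotient k hp ap)) (poly-^ k ap)

-- Monomial by monomial, from the divisibility of `t ^ k - a ^ k` by `t - a`. The remainder is the
-- restriction to the graph of `a`.
poly-factor : ∀ {n} {h : Vec ℚ (suc n) → ℚ} {a : Vec ℚ n → ℚ} → IsPoly (suc n) h → IsPoly n a →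
  Σ (Vec ℚ (suc n) → ℚ) λ k → IsPoly (suc n) k × ∀ t v → h (t ∷ v) ≡ h (a v ∷ v) + (t - a v) * k (t ∷ v)
poly-factor {n} {h} {a} (P , p) ap = let (k , kp , eq) = go P in
  k , kp , λ t v → trans (p (t ∷ v)) (trans (eq t v) (cong (_+ (t - a v) * k (t ∷ v)) (sym (p (a v ∷ v)))))
  where
  go : ∀ P → Σ (Vec ℚ (suc n) → ℚ) λ k → IsPoly (suc n) k × ∀ t v → ev P (t ∷ v) ≡ ev P (a v ∷ v) + (t - a v) * k (t ∷ v)
  go [] = (λ _ → 0ℚ) , poly-const 0ℚ , λ t v → factor-nil t (a v)
  go ((c , l ∷ e) ∷ P) with go P
  ... | k , kp , eq = (λ w → ev ((c , e) ∷ []) (tail w) * powQuotient l (head w) (a (tail w)) + k w)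
    , poly-+ (poly-* (poly-tail (poly-ev ((c , e) ∷ []))) (poly-powQuotient l (poly-resp (λ { (t ∷ v) → refl }) (poly-var 0F)) (poly-tail ap))) kp
    , λ t v → trans (cong (c * (t ^ l * evM e v) +_) (eq t v))
        (factor-cons c (a v ^ l) (t ^ l) (t - a v) (evM e v) (powQuotient l t (a v)) (ev P (a v ∷ v)) (k (t ∷ v)) (powQuotient-correct l t (a v)))

-- All forced zeros equate multiples of two coordinates. Fixing `lo < hi` makes the `hi` coordinate
-- the one that is eliminated, and lets two forms be compared by their indices and by the ratio of
-- their coefficients.
record Form (n : ℕ) : Set where
  constructor form
  field
    hi lo : Fin n
    lo<hi : lo Fin.< hi
    α β : ℚ
    α≢0 : α ≢ 0ℚ
    β≢0 : β ≢ 0ℚ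

value : ∀ {n} → Form n → Vec ℚ n → ℚ
value f v = α * lookup v hi - β * lookup v lo
  where open Form f

product : ∀ {n} → List (Form n) → Vec ℚ n → ℚ
product fs v = prodℚ (map (λ f → value f v) fs)

poly-value : ∀ {n} (f : Form n) → IsPoly n (value f)
poly-value f = poly-- (poly-* (poly-const α) (poly-var hi)) (poly-* (poly-const β) (poly-var lo))
  where open Form f

poly-product : ∀ {n} (fs : List (Form n)) → IsPoly n (product fs)
poly-product fs = poly-prod value fs poly-value

prodℚ-++ : ∀ xs ys → prodℚ (xs ++ ys) ≡ prodℚ xs * prodℚ ys
prodℚ-++ [] ys = sym (F.*-identityˡ _)
prodℚ-++ (x ∷ xs) ys = trans (cong (x *_) (prodℚ-++ xs ys)) (sym (F.*-assoc x _ _))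

product-++ : ∀ {n} (fs gs : List (Form n)) v → product (fs ++ gs) v ≡ product fs v * product gs v
product-++ fs gs v = trans (cong prodℚ (map-++ (λ f → value f v) fs gs)) (prodℚ-++ (map (λ f → value f v) fs) (map (λ f → value f v) gs))

opaque
  unfolding _+_

  α*r*β : ∀ α r β x → α * (r * β * x) - β * x ≡ (α * r - 1ℚ) * (β * x)
  α*r*β = solve-∀ ringℚ

  r*α*x : ∀ α r x y → α * r ≡ 1ℚ → α * x ≡ y → r * y ≡ x
  r*α*x α r x y e refl = trans (assoc α r x) (trans (cong (_* x) e) (F.*-identityˡ x))
    where
    assoc : ∀ α r x → r * (α * x) ≡ α * r * x
    assoc = solve-∀ ringℚ

  scale-root : ∀ α r β x y k → α * r ≡ 1ℚ → (x - r * β * y) * k ≡ (α * x - β * y) * (r * k)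
  scale-root α r β x y k e = trans (sym (F.*-identityˡ ((x - r * β * y) * k))) (trans (cong (_* ((x - r * β * y) * k)) (sym e)) (regroup α r β x y k e))
    where
    regroup₁ : ∀ α r β x y k → α * r * ((x - r * β * y) * k) ≡ (α * x - (α * r) * (β * y)) * (r * k)
    regroup₁ = solve-∀ ringℚ
    regroup : ∀ α r β x y k → α * r ≡ 1ℚ → α * r * ((x - r * β * y) * k) ≡ (α * x - β * y) * (r * k)
    regroup α r β x y k e = trans (regroup₁ α r β x y k) (cong (λ z → (α * x - z) * (r * k)) (trans (cong (_* (β * y)) e) (F.*-identityˡ (β * y))))

  form-at-hi : ∀ α β → α * 1ℚ - β * 0ℚ ≡ α
  form-at-hi = solve-∀ ringℚ

  form-at-lo : ∀ α β → α * 0ℚ - β * 1ℚ ≡ - β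
  form-at-lo = solve-∀ ringℚ

  neg-≢0 : ∀ {x} → x ≢ 0ℚ → - x ≢ 0ℚ
  neg-≢0 {x} x≢0 e = x≢0 (trans (double x) (cong -_ e))
    where
    double : ∀ x → x ≡ - (- x)
    double = solve-∀ ringℚ

  cross-form : ∀ α α′ β β′ r → α * r ≡ 1ℚ → α * (α′ * (r * β * 1ℚ) - β′ * 1ℚ) ≡ α′ * β - α * β′
  cross-form α α′ β β′ r e = trans (regroup α α′ β β′ r) (cong (_- α * β′) (trans (cong (_* (α′ * β)) e) (F.*-identityˡ (α′ * β))))
    where
    regroup : ∀ α α′ β β′ r → α * (α′ * (r * β * 1ℚ) - β′ * 1ℚ) ≡ α * r * (α′ * β) - α * β′
    regroup = solve-∀ ringℚ

  A*[d*x] : ∀ A d x → A * (d * x) ≡ d * (A * x)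
  A*[d*x] = solve-∀ ringℚ

module _ {n} (f : Form n) where
  open Form f

  private
    r = proj₁ (invℚ α α≢0)
    αr≡1 = proj₂ (invℚ α α≢0)

    lo≢hi : lo ≢ hi
    lo≢hi e = <⇒≢ lo<hi (cong toℕ e)

  -- A retraction onto the hyperplane of `f`. Pulling back along it turns statements on the
  -- hyperplane into statements on the whole space.
  projection : Vec ℚ n → Vec ℚ n
  projection v = v Vec.[ hi ]≔ r * β * lookup v lo

  lookup-projection-hi : ∀ v → lookup (projection v) hi ≡ r * β * lookup v lo
  lookup-projection-hi v = lookup∘update hi v _

  lookup-projection : ∀ v {i} → i ≢ hi → lookup (projection v) i ≡ lookup v i
  lookup-projection v i≢hi = lookup∘update′ i≢hi v _

  value-projection : ∀ v → value f (projection v) ≡ 0ℚ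
  value-projection v = trans
    (cong₂ (λ x y → α * x - β * y) (lookup-projection-hi v) (lookup-projection v lo≢hi))
    (trans (α*r*β α r β _) (0*≡0 (x≡y⇒x-y≡0 αr≡1)))

  projection-fixes : ∀ v → value f v ≡ 0ℚ → projection v ≡ v
  projection-fixes v e = trans
    (cong (v Vec.[ hi ]≔_) (trans (F.*-assoc r β _) (r*α*x α r (lookup v hi) _ αr≡1 (x-y≡0⇒x≡y e))))
    ([]≔-lookup v hi)

  poly-projection : ∀ {h} → IsPoly n h → IsPoly n (h ∘ projection)
  poly-projection hp = poly-update-at hi hp (poly-* (poly-const (r * β)) (poly-var lo))

  open ≡-Reasoning

  factor-theorem : ∀ {h} → IsPoly n h → (∀ v → value f v ≡ 0ℚ → h v ≡ 0ℚ) →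
    Σ (Vec ℚ n → ℚ) λ k → IsPoly n k × ∀ v → h v ≡ value f v * k v
  factor-theorem {h} hp z = let (k , kp , eq) = poly-factor (poly-update hi hp) (poly-* (poly-const (r * β)) (poly-var lo)) in
    (λ v → r * k (lookup v hi ∷ v)) , poly-* (poly-const r) (poly-∷ kp (poly-var hi)) , λ v → begin
    h v                                   ≡⟨ cong h (sym ([]≔-lookup v hi)) ⟩
    h (v Vec.[ hi ]≔ lookup v hi)         ≡⟨ eq (lookup v hi) v ⟩
    h (projection v) + (lookup v hi - r * β * lookup v lo) * k (lookup v hi ∷ v)
      ≡⟨ cong (_+ (lookup v hi - r * β * lookup v lo) * k (lookup v hi ∷ v)) (z (projection v) (value-projection v)) ⟩
    0ℚ + (lookup v hi - r * β * lookup v lo) * k (lookup v hi ∷ v) ≡⟨ F.+-identityˡ _ ⟩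
    (lookup v hi - r * β * lookup v lo) * k (lookup v hi ∷ v) ≡⟨ scale-root α r β (lookup v hi) (lookup v lo) _ αr≡1 ⟩
    value f v * (r * k (lookup v hi ∷ v)) ∎

  -- The hyperplane is irreducible: pulled back along `projection`, this is `poly-domain`.
  hyperplane-domain : ∀ {A B} → IsPoly n A → IsPoly n B → (∀ v → value f v ≡ 0ℚ → A v * B v ≡ 0ℚ) →
    ∀ v₀ → value f v₀ ≡ 0ℚ → A v₀ ≢ 0ℚ → ∀ v → value f v ≡ 0ℚ → B v ≡ 0ℚ
  hyperplane-domain {A} {B} Ap Bp z v₀ e₀ A≢0 v e = trans (cong B (sym (projection-fixes v e)))
    (poly-domain (poly-projection Ap) (poly-projection Bp) (λ w → z (projection w) (value-projection w)) v₀
      (λ e′ → A≢0 (trans (cong A (sym (projection-fixes v₀ e₀))) e′)) v)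

  value-nonzero : Σ (Vec ℚ n) λ v → value f v ≢ 0ℚ
  value-nonzero = unit , λ e → α≢0 (trans (sym (form-at-hi α β)) (trans
    (sym (cong₂ (λ x y → α * x - β * y) (lookup∘update hi zeros 1ℚ)
      (trans (lookup∘update′ lo≢hi zeros 1ℚ) (lookup-replicate lo 0ℚ)))) e))
    where
    zeros = Vec.replicate n 0ℚ
    unit = zeros Vec.[ hi ]≔ 1ℚ

-- A witness that `g` does not vanish identically on the hyperplane of `f`, which is what
-- cancellation on that hyperplane needs.
Coprime : ∀ {n} → Form n → Form n → Set
Coprime {n} f g = Σ (Vec ℚ n) λ v → value f v ≡ 0ℚ × value g v ≢ 0ℚ

Distinct : ∀ {n} → Form n → Form n → Set
Distinct f g = Form.hi f ≡ Form.hi g → Form.lo f ≡ Form.lo g → Form.α g * Form.β f ≢ Form.α f * Form.β g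

-- The witness is a unit vector projected to the hyperplane of `f`: the vector of `hi′` if the upper
-- indices differ, of `lo′` if only the lower ones do, and of the common lower index otherwise,
-- where the value of `g` is the cross difference of the coefficients up to a factor.
distinct⇒coprime : ∀ {n} (f g : Form n) → Distinct f g → Coprime f g
distinct⇒coprime {n} f@(form hi lo lo<hi α β α≢0 β≢0) g@(form hi′ lo′ lo′<hi′ α′ β′ α′≢0 β′≢0) d
  with hi′ Fin.≟ hi
... | no hi′≢hi = v , value-projection f w , λ e → α′≢0 (trans (sym (form-at-hi α′ β′)) (trans (sym g-value) e))
  where
  w = Vec.replicate n 0ℚ Vec.[ hi′ ]≔ 1ℚ
  v = projection f w
  w-off : ∀ i → i ≢ hi′ → lookup w i ≡ 0ℚ
  w-off i ne = trans (lookup∘update′ ne (Vec.replicate n 0ℚ) 1ℚ) (lookup-replicate i 0ℚ)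
  v-lo′ : lookup v lo′ ≡ 0ℚ
  v-lo′ with lo′ Fin.≟ hi
  ... | yes refl = trans (lookup-projection-hi f w) (*0≡0 (w-off lo (λ e → <⇒≢ (ℕP.<-trans lo<hi lo′<hi′) (cong toℕ e))))
  ... | no ne = trans (lookup-projection f w ne) (w-off lo′ (λ e → <⇒≢ lo′<hi′ (cong toℕ e)))
  g-value : value g v ≡ α′ * 1ℚ - β′ * 0ℚ
  g-value = cong₂ (λ x y → α′ * x - β′ * y) (trans (lookup-projection f w hi′≢hi) (lookup∘update hi′ (Vec.replicate n 0ℚ) 1ℚ)) v-lo′
... | yes refl with lo′ Fin.≟ lo
...   | no lo′≢lo = v , value-projection f w , λ e → neg-≢0 β′≢0 (trans (sym (form-at-lo α′ β′)) (trans (sym g-value) e))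
  where
  w = Vec.replicate n 0ℚ Vec.[ lo′ ]≔ 1ℚ
  v = projection f w
  v-hi : lookup v hi ≡ 0ℚ
  v-hi = trans (lookup-projection-hi f w) (*0≡0 (trans (lookup∘update′ (lo′≢lo ∘ sym) (Vec.replicate n 0ℚ) 1ℚ) (lookup-replicate lo 0ℚ)))
  g-value : value g v ≡ α′ * 0ℚ - β′ * 1ℚ
  g-value = cong₂ (λ x y → α′ * x - β′ * y) v-hi
    (trans (lookup-projection f w (λ e → <⇒≢ lo′<hi′ (cong toℕ e))) (lookup∘update lo′ (Vec.replicate n 0ℚ) 1ℚ))
...   | yes refl = v , value-projection f w , λ e → d refl refl (x-y≡0⇒x≡y (trans
          (sym (cross-form α α′ β β′ r αr≡1)) (*0≡0 (trans (sym g-value) e))))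
  where
  r = proj₁ (invℚ α α≢0)
  αr≡1 = proj₂ (invℚ α α≢0)
  w = Vec.replicate n 0ℚ Vec.[ lo ]≔ 1ℚ
  w-lo = lookup∘update lo (Vec.replicate n 0ℚ) 1ℚ
  v = projection f w
  g-value : value g v ≡ α′ * (r * β * 1ℚ) - β′ * 1ℚ
  g-value = cong₂ (λ x y → α′ * x - β′ * y) (trans (lookup-projection-hi f w) (cong (r * β *_) w-lo))
    (trans (lookup-projection f w (λ e → <⇒≢ lo<hi (cong toℕ e))) w-lo)

-- Divisibility by products of linear forms

Divides : ∀ {n} → List (Form n) → (Vec ℚ n → ℚ) → Set
Divides {n} fs h = Σ (Vec ℚ n → ℚ) λ k → IsPoly n k × ∀ v → h v ≡ product fs v * k v

poly-*-nonzero : ∀ {n} {h k : Vec ℚ n → ℚ} → IsPoly n h → IsPoly n k →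
  (Σ (Vec ℚ n) λ v → h v ≢ 0ℚ) → (Σ (Vec ℚ n) λ v → k v ≢ 0ℚ) → Σ (Vec ℚ n) λ v → h v * k v ≢ 0ℚ
poly-*-nonzero hp kp (v , hv) (w , kw) with poly-zero? (poly-* hp kp)
... | inj₁ z = ⊥-elim (kw (poly-domain hp kp z v hv w))
... | inj₂ x = x

poly-prod-nonzero : ∀ {n} {A : Set} (f : A → Vec ℚ n → ℚ) as → (∀ a → IsPoly n (f a)) →
  All (λ a → Σ (Vec ℚ n) λ v → f a v ≢ 0ℚ) as → Σ (Vec ℚ n) λ v → prodℚ (map (λ a → f a v) as) ≢ 0ℚ
poly-prod-nonzero f [] p [] = Vec.replicate _ 0ℚ , λ ()
poly-prod-nonzero f (a ∷ as) p (x ∷ xs) = poly-*-nonzero (p a) (poly-prod f as p) x (poly-prod-nonzero f as p xs)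

product-nonzero : ∀ {n} (fs : List (Form n)) → Σ (Vec ℚ n) λ v → product fs v ≢ 0ℚ
product-nonzero fs = poly-prod-nonzero value fs poly-value (All.universal value-nonzero fs)

product-nonzero-on : ∀ {n} (f : Form n) gs → All (Coprime f) gs → Σ (Vec ℚ n) λ v → value f v ≡ 0ℚ × product gs v ≢ 0ℚ
product-nonzero-on {n} f gs cs = case poly-prod-nonzero (λ g → value g ∘ projection f) gs (λ g → poly-projection f (poly-value g))
  (All.map (λ {g} → lift g) cs) of λ
  { (v , ne) → projection f v , value-projection f v , ne }
  where
  lift : ∀ g → Coprime f g → Σ (Vec ℚ n) λ v → value g (projection f v) ≢ 0ℚ
  lift g (v , e , ne) = v , λ e′ → ne (trans (cong (value g) (sym (projection-fixes f v e))) e′)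

-- On the hyperplane of each form the right side is zero and `A` is not identically zero, so `M`
-- vanishes there and the form divides `M`. Cancel it and continue; repeated forms cause no
-- difficulty.
divide-coprime : ∀ {n} {A M M′ : Vec ℚ n → ℚ} → IsPoly n A → IsPoly n M → IsPoly n M′ → ∀ fs →
  All (λ f → Σ (Vec ℚ n) λ v → value f v ≡ 0ℚ × A v ≢ 0ℚ) fs →
  (∀ v → A v * M v ≡ product fs v * M′ v) → Divides fs M
divide-coprime Ap Mp M′p [] [] e = _ , Mp , λ v → sym (F.*-identityˡ _)
divide-coprime {n} {A} {M} {M′} Ap Mp M′p (f ∷ fs) ((v₀ , e₀ , ne₀) ∷ nz) e = M≡product*K′
  where
  open ≡-Reasoning
  M-vanishes : ∀ v → value f v ≡ 0ℚ → M v ≡ 0ℚ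
  M-vanishes = hyperplane-domain f Ap Mp (λ v z → begin
    A v * M v                               ≡⟨ e v ⟩
    value f v * product fs v * M′ v         ≡⟨ cong (λ x → x * product fs v * M′ v) z ⟩
    0ℚ * product fs v * M′ v                ≡⟨ cong (_* M′ v) (F.zeroˡ (product fs v)) ⟩
    0ℚ * M′ v                               ≡⟨ F.zeroˡ (M′ v) ⟩
    0ℚ                                      ∎) v₀ e₀ ne₀
  quotient-by-f = factor-theorem f Mp M-vanishes
  K = proj₁ quotient-by-f
  Kp = proj₁ (proj₂ quotient-by-f)
  M≡ : ∀ v → M v ≡ value f v * K v
  M≡ = proj₂ (proj₂ quotient-by-f)
  cancelled : ∀ v → A v * K v ≡ product fs v * M′ v
  cancelled = poly-cancel {h = value f} {k = λ v → A v * K v} {l = λ v → product fs v * M′ v}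
    (poly-value f) (poly-* Ap Kp) (poly-* (poly-product fs) M′p)
    (λ v → begin
      value f v * (A v * K v)         ≡⟨ sym (A*[d*x] (A v) (value f v) (K v)) ⟩
      A v * (value f v * K v)         ≡⟨ cong (A v *_) (sym (M≡ v)) ⟩
      A v * M v                       ≡⟨ e v ⟩
      value f v * product fs v * M′ v ≡⟨ F.*-assoc (value f v) (product fs v) (M′ v) ⟩
      value f v * (product fs v * M′ v) ∎)
    (proj₁ (value-nonzero f)) (proj₂ (value-nonzero f))
  M≡product*K′ : Divides (f ∷ fs) M
  M≡product*K′ = let (K′ , K′p , K≡) = divide-coprime Ap Kp M′p fs nz cancelled in K′ , K′p , λ v → begin
    M v                               ≡⟨ M≡ v ⟩
    value f v * K v                   ≡⟨ cong (value f v *_) (K≡ v) ⟩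
    value f v * (product fs v * K′ v) ≡⟨ sym (F.*-assoc (value f v) (product fs v) (K′ v)) ⟩
    value f v * product fs v * K′ v   ∎

-- Only forms from different lists have to be coprime. Within one list forms may repeat, which is
-- needed for the wheel zeros of a pair of strings.
divides-++ : ∀ {n} {h : Vec ℚ n → ℚ} fs gs → Divides fs h → Divides gs h → All (λ g → All (Coprime g) fs) gs → Divides (fs ++ gs) h
divides-++ {h = h} fs gs (M , Mp , eM) (M′ , M′p , eM′) cs =
  let (K , Kp , M≡) = divide-coprime (poly-product fs) Mp M′p gs (All.map (λ {g} → product-nonzero-on g fs) cs)  (λ v → trans (sym (eM v)) (eM′ v))
  in K , Kp , λ v → begin
    h v                               ≡⟨ eM v ⟩
    product fs v * M v                ≡⟨ cong (product fs v *_) (M≡ v) ⟩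
    product fs v * (product gs v * K v) ≡⟨ sym (F.*-assoc (product fs v) (product gs v) (K v)) ⟩
    product fs v * product gs v * K v ≡⟨ cong (_* K v) (sym (product-++ fs gs v)) ⟩
    product (fs ++ gs) v * K v        ∎
  where open ≡-Reasoning

-- Functions of a list of arguments

-- The families of arguments at which functions of lists are evaluated: strings and concatenations
-- depending polynomially on parameters, with a length that does not vary.
PolyList : ∀ m → ℕ → (Vec ℚ m → List ℚ) → Set
PolyList m n xs = Σ (List (Vec ℚ m → ℚ)) λ fs → length fs ≡ n × All (IsPoly m) fs × ∀ v → xs v ≡ map (λ f → f v) fs

PolyOn : ℕ → (List ℚ → ℚ) → Set
PolyOn n F = IsPoly n (F ∘ toList)

polyOn-∘ : ∀ {m n F xs} → PolyOn n F → PolyList m n xs → IsPoly m (F ∘ xs)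
polyOn-∘ {m} {F = F} {xs} Fp (fs , refl , ps , eq) =
  poly-resp (λ v → cong F (trans (toList-map v fs) (sym (eq v)))) (poly-∘ entries Fp (coordinate fs ps))
  where
  entries : Vec ℚ m → Vec ℚ (length fs)
  entries v = Vec.map (λ f → f v) (Vec.fromList fs)
  toList-map : ∀ v fs → toList (Vec.map (λ f → f v) (Vec.fromList fs)) ≡ map (λ (f : Vec ℚ m → ℚ) → f v) fs
  toList-map v [] = refl
  toList-map v (f ∷ fs) = cong (f v ∷_) (toList-map v fs)
  coordinate : ∀ fs → All (IsPoly m) fs → ∀ i → IsPoly m (λ v → lookup (Vec.map (λ f → f v) (Vec.fromList fs)) i)
  coordinate (f ∷ fs) (p ∷ ps) 0F = p
  coordinate (f ∷ fs) (p ∷ ps) (Fin.suc i) = coordinate fs ps i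

polyList-resp : ∀ {m n xs ys} → (∀ v → xs v ≡ ys v) → PolyList m n xs → PolyList m n ys
polyList-resp e (fs , l , ps , eq) = fs , l , ps , λ v → trans (sym (e v)) (eq v)

polyList-[] : ∀ {m} → PolyList m 0 (λ _ → [])
polyList-[] = [] , refl , [] , λ _ → refl

polyList-∷ : ∀ {m n h xs} → IsPoly m h → PolyList m n xs → PolyList m (suc n) (λ v → h v ∷ xs v)
polyList-∷ {h = h} hp (fs , l , ps , eq) = h ∷ fs , cong suc l , hp ∷ ps , λ v → cong (h v ∷_) (eq v)

polyList-++ : ∀ {m k n xs ys} → PolyList m k xs → PolyList m n ys → PolyList m (k ℕ.+ n) (λ v → xs v ++ ys v)
polyList-++ (fs , refl , ps , eq) (gs , refl , qs , eq′) = fs ++ gs , length-++ fs , ++⁺ ps qs ,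
  λ v → trans (cong₂ _++_ (eq v) (eq′ v)) (sym (map-++ (λ f → f v) fs gs))

polyList-∘ : ∀ {m n k xs} (g : Vec ℚ k → Vec ℚ m) → (∀ {h} → IsPoly m h → IsPoly k (h ∘ g)) → PolyList m n xs → PolyList k n (xs ∘ g)
polyList-∘ g gp (fs , refl , ps , eq) = map (_∘ g) fs , length-map (_∘ g) fs , map⁺ (All.map gp ps) ,
  λ v → trans (eq (g v)) (map-∘ fs)

polyList-toList : ∀ n → PolyList n n toList
polyList-toList zero = polyList-resp (λ { [] → refl }) polyList-[]
polyList-toList (suc n) = polyList-resp (λ { (t ∷ v) → refl })
  (polyList-∷ {h = head} (poly-resp (λ { (t ∷ v) → refl }) (poly-var 0F)) (polyList-∘ tail poly-tail (polyList-toList n)))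

-- Lists shorter than n are padded with zeros, longer ones are truncated.
toVec : ∀ n → List ℚ → Vec ℚ n
toVec zero xs = []
toVec (suc n) [] = 0ℚ ∷ toVec n []
toVec (suc n) (x ∷ xs) = x ∷ toVec n xs

toVec-toList : ∀ {n} (v : Vec ℚ n) → toVec n (toList v) ≡ v
toVec-toList [] = refl
toVec-toList (t ∷ v) = cong (t ∷_) (toVec-toList v)

toList-toVec : ∀ n xs → length xs ≡ n → toList (toVec n xs) ≡ xs
toList-toVec zero [] refl = refl
toList-toVec (suc n) (x ∷ xs) e = cong (x ∷_) (toList-toVec n xs (suc-injective e))

poly-prodList′ : ∀ {m n xs} (g : Vec ℚ m → ℚ → ℚ) → (∀ {h} → IsPoly m h → IsPoly m (λ v → g v (h v))) → PolyList m n xs →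
  IsPoly m (λ v → prodℚ (map (g v) (xs v)))
poly-prodList′ {m} g gp (fs , refl , ps , eq) = poly-resp (λ v → cong (λ zs → prodℚ (map (g v) zs)) (sym (eq v))) (go fs ps)
  where
  go : ∀ fs → All (IsPoly m) fs → IsPoly m (λ v → prodℚ (map (g v) (map (λ f → f v) fs)))
  go [] [] = poly-const 1ℚ
  go (f ∷ fs) (p ∷ ps) = poly-* (gp p) (go fs ps)

poly-prodList : ∀ {m n xs} (g : ℚ → ℚ) → (∀ {h} → IsPoly m h → IsPoly m (g ∘ h)) → PolyList m n xs → IsPoly m (λ v → prodℚ (map g (xs v)))
poly-prodList g = poly-prodList′ (λ _ → g)

polyOn-toVec : ∀ {n h} → IsPoly n h → PolyOn n (h ∘ toVec n)
polyOn-toVec {h = h} hp = poly-resp (λ v → cong h (sym (toVec-toList v))) hp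

swapAt : ∀ {A : Set} → ℕ → List A → List A
swapAt zero (x ∷ y ∷ zs) = y ∷ x ∷ zs
swapAt (suc k) (x ∷ zs) = x ∷ swapAt k zs
swapAt _ zs = zs

swapAt-↭ : ∀ {A : Set} k (zs : List A) → swapAt k zs ↭ zs
swapAt-↭ zero [] = ↭-refl
swapAt-↭ zero (x ∷ []) = ↭-refl
swapAt-↭ zero (x ∷ y ∷ zs) = Permutation.swap y x ↭-refl
swapAt-↭ (suc k) [] = ↭-refl
swapAt-↭ (suc k) (x ∷ zs) = Permutation.prep x (swapAt-↭ k zs)

swapAt-map : ∀ {A B : Set} (f : A → B) k zs → swapAt k (map f zs) ≡ map f (swapAt k zs)
swapAt-map f zero [] = refl
swapAt-map f zero (x ∷ []) = refl
swapAt-map f zero (x ∷ y ∷ zs) = refl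
swapAt-map f (suc k) [] = refl
swapAt-map f (suc k) (x ∷ zs) = cong (f x ∷_) (swapAt-map f k zs)

polyList-swapAt : ∀ {m n xs} k → PolyList m n xs → PolyList m n (λ v → swapAt k (xs v))
polyList-swapAt k (fs , refl , ps , eq) = swapAt k fs , ↭-length (swapAt-↭ k fs) ,
  All-resp-↭ (↭-sym (swapAt-↭ k fs)) ps , λ v → trans (cong (swapAt k) (eq v)) (swapAt-map (λ f → f v) k fs)

swapAt-++ : ∀ {A : Set} (pre : List A) x y zs → swapAt (length pre) (pre ++ x ∷ y ∷ zs) ≡ pre ++ y ∷ x ∷ zs
swapAt-++ [] x y zs = refl
swapAt-++ (w ∷ pre) x y zs = cong (w ∷_) (swapAt-++ pre x y zs)

SymmetricOn : ∀ {A : Set} → ℕ → (List A → ℚ) → Set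
SymmetricOn n F = ∀ {xs ys} → xs ↭ ys → length xs ≡ n → F xs ≡ F ys

-- Adjacent transpositions generate all permutations; the sign c is ±1 in the applications.
swaps⇒↭ : ∀ {A : Set} {n} (R : ℚ → ℚ → Set) → (∀ {x} → R x x) → (∀ {x y z} → R x y → R y z → R x z) →
  (F : List A → ℚ) → (∀ k zs → length zs ≡ n → R (F zs) (F (swapAt k zs))) →
  ∀ {xs ys} → xs ↭ ys → length xs ≡ n → R (F xs) (F ys)
swaps⇒↭ {A} {n} R rfl trn F h = go []
  where
  go : ∀ (pre : List A) {xs ys} → xs ↭ ys → length (pre ++ xs) ≡ n → R (F (pre ++ xs)) (F (pre ++ ys))
  go pre Permutation.refl l = rfl
  go pre {x ∷ xs} {_ ∷ ys} (Permutation.prep x p) l = transport (λ zs → R (F zs) _) (++-assoc pre (x ∷ []) xs)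
    (transport (λ zs → R _ (F zs)) (++-assoc pre (x ∷ []) ys)
      (go (pre ++ x ∷ []) p (trans (cong length (++-assoc pre (x ∷ []) xs)) l)))
  go pre {x ∷ y ∷ xs} {_ ∷ _ ∷ ys} (Permutation.swap x y p) l =
    trn (transport (λ zs → R (F (pre ++ x ∷ y ∷ xs)) (F zs)) (swapAt-++ pre x y xs) (h (length pre) (pre ++ x ∷ y ∷ xs) l))
      (transport (λ zs → R (F zs) _) (++-assoc pre (y ∷ x ∷ []) xs)
        (transport (λ zs → R _ (F zs)) (++-assoc pre (y ∷ x ∷ []) ys)
          (go (pre ++ y ∷ x ∷ []) p (trans (cong length (++-assoc pre (y ∷ x ∷ []) xs))
            (trans (length-++ pre) (trans (sym (length-++ pre)) l))))))
  go pre (Permutation.trans p q) l = trn (go pre p l) (go pre q (trans (↭-length (++⁺ˡ pre (↭-sym p))) l))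

swaps⇒symmetric : ∀ {A : Set} {n} (F : List A → ℚ) → (∀ k zs → length zs ≡ n → F zs ≡ F (swapAt k zs)) → SymmetricOn n F
swaps⇒symmetric = swaps⇒↭ _≡_ refl trans

prodℚ-↭ : ∀ {xs ys} → xs ↭ ys → prodℚ xs ≡ prodℚ ys
prodℚ-↭ Permutation.refl = refl
prodℚ-↭ (Permutation.prep x p) = cong (x *_) (prodℚ-↭ p)
prodℚ-↭ {x ∷ y ∷ xs} {_ ∷ _ ∷ ys} (Permutation.swap x y p) = trans (sym (F.*-assoc x y (prodℚ xs)))
  (trans (cong₂ _*_ (F.*-comm x y) (prodℚ-↭ p)) (F.*-assoc y x (prodℚ ys)))
prodℚ-↭ (Permutation.trans p q) = trans (prodℚ-↭ p) (prodℚ-↭ q)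

prodℚ-≢0 : ∀ {xs} → All (_≢ 0ℚ) xs → prodℚ xs ≢ 0ℚ
prodℚ-≢0 [] ()
prodℚ-≢0 (x ∷ xs) = *-≢0 x (prodℚ-≢0 xs)

-- Strings

str : ℚ → ℕ → ℚ → List ℚ
str p zero s = []
str p (suc a) s = s ∷ str p a (p * s)

length-str : ∀ p a s → length (str p a s) ≡ a
length-str p zero s = refl
length-str p (suc a) s = cong suc (length-str p a (p * s))

opaque
  unfolding _+_

  p^a*[p*s] : ∀ p P s → P * (p * s) ≡ p * P * s
  p^a*[p*s] = solve-∀ ringℚ

  t*[p*s] : ∀ t p s → t * (p * s) ≡ p * (t * s)
  t*[p*s] = solve-∀ ringℚ

str-+ : ∀ p a b s → str p (a ℕ.+ b) s ≡ str p a s ++ str p b (p ^ a * s)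
str-+ p zero b s = cong (str p b) (sym (F.*-identityˡ s))
str-+ p (suc a) b s = cong (s ∷_) (trans (str-+ p a b (p * s)) (cong (λ x → str p a (p * s) ++ str p b x) (p^a*[p*s] p (p ^ a) s)))

map-*-str : ∀ t p a s → map (t *_) (str p a s) ≡ str p a (t * s)
map-*-str t p zero s = refl
map-*-str t p (suc a) s = cong (t * s ∷_) (trans (map-*-str t p a (p * s)) (cong (str p a) (t*[p*s] t p s)))

polyList-str : ∀ {m h} p a → IsPoly m h → PolyList m a (λ v → str p a (h v))
polyList-str p zero hp = polyList-[]
polyList-str p (suc a) hp = polyList-∷ hp (polyList-str p a (poly-* (poly-const p) hp))

-- The sum-of-lengths exchange behind the Gordon filtration: two overlapping strings are a longer and a shorter one.
str-exchange : ∀ p t c d y → str p (t ℕ.+ c) y ++ str p d (p ^ t * y) ↭ str p (t ℕ.+ d) y ++ str p c (p ^ t * y)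
str-exchange p t c d y = ↭-trans (↭-reflexive (trans (cong (_++ D) (str-+ p t c y)) (++-assoc T C D)))
  (↭-trans (++⁺ˡ T (PermP.++-comm C D))
    (↭-reflexive (sym (trans (cong (_++ C) (str-+ p t d y)) (++-assoc T D C)))))
  where
  T = str p t y
  C = str p c (p ^ t * y)
  D = str p d (p ^ t * y)

pick : ∀ {n} (v : Vec ℚ n) i → Σ (List ℚ) λ R → toList v ↭ lookup v i ∷ R
pick (x ∷ v) 0F = toList v , ↭-refl
pick (x ∷ v) (Fin.suc i) = let (R , e) = pick v i in x ∷ R , ↭-trans (Permutation.prep x e) (Permutation.swap x (lookup v i) ↭-refl)

toList-tabulate : ∀ {n} (v : Vec ℚ n) → toList v ≡ List.tabulate (lookup v)
toList-tabulate [] = refl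
toList-tabulate (x ∷ v) = cong (x ∷_) (toList-tabulate v)

-- The wheel class

-- The properties that survive the substitution of a row and the division by its forced zeros, see
-- `peeled-wheeled`; this is what allows rows to be substituted recursively. Degree bounds are kept
-- apart in `Bounded`.
record Wheeled (p q : ℚ) (n : ℕ) (F : List ℚ → ℚ) : Set where
  field
    poly : PolyOn n F
    symmetric : SymmetricOn n F
    wheel₁ : ∀ x zs → 3 ℕ.+ length zs ≡ n → F (x ∷ p * x ∷ p * (q * x) ∷ zs) ≡ 0ℚ
    wheel₂ : ∀ x zs → 3 ℕ.+ length zs ≡ n → F (x ∷ q * x ∷ p * (q * x) ∷ zs) ≡ 0ℚ

-- Multiplicative independence, with natural exponents on both sides in place of integer exponents
-- on one.
record Generic (p q : ℚ) : Set where
  field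
    p≢0 : p ≢ 0ℚ
    q≢0 : q ≢ 0ℚ
    independent : ∀ a b c d → p ^ a * q ^ b ≡ p ^ c * q ^ d → a ≡ c × b ≡ d

generic-swap : ∀ {p q} → Generic p q → Generic q p
generic-swap {p} {q} g = record
  { p≢0 = q≢0 ; q≢0 = p≢0
  ; independent = λ a b c d e → let (x , y) = independent b a d c (trans (F.*-comm (p ^ b) (q ^ a)) (trans e (F.*-comm (q ^ c) (p ^ d)))) in y , x }
  where open Generic g

wheeled-swap : ∀ {p q n F} → Wheeled p q n F → Wheeled q p n F
wheeled-swap {p} {q} {F = F} w = record
  { poly = poly ; symmetric = symmetric
  ; wheel₁ = λ x zs l → trans (cong (λ y → F (x ∷ q * x ∷ y ∷ zs)) (t*[p*s] q p x)) (wheel₂ x zs l)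
  ; wheel₂ = λ x zs l → trans (cong (λ y → F (x ∷ p * x ∷ y ∷ zs)) (t*[p*s] q p x)) (wheel₁ x zs l) }
  where open Wheeled w

triple-front : ∀ {A : Set} {as bs as′ bs′ : List A} {x y z} → as ↭ x ∷ y ∷ as′ → bs ↭ z ∷ bs′ → as ++ bs ↭ x ∷ y ∷ z ∷ as′ ++ bs′
triple-front {as′ = as′} {bs′ = bs′} {x} {y} {z} p q = ↭-trans (PermP.++⁺ p q)
  (Permutation.prep x (Permutation.prep y (PermP.shift z as′ bs′)))

pair-front : ∀ {A : Set} (pre : List A) x y post → pre ++ x ∷ y ∷ post ↭ x ∷ y ∷ pre ++ post
pair-front pre x y post = ↭-trans (PermP.shift x pre (y ∷ post)) (Permutation.prep x (PermP.shift y pre post))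

zeros : ∀ n → Vec ℚ n
zeros n = Vec.replicate n 0ℚ

product-concat-tabulate : ∀ {n m} (g : Fin m → List (Form n)) v →
  product (List.concat (List.tabulate g)) v ≡ prodℚ (List.tabulate (λ i → product (g i) v))
product-concat-tabulate {m = zero} g v = refl
product-concat-tabulate {m = suc m} g v = trans (product-++ (g 0F) (List.concat (List.tabulate (g ∘ Fin.suc))) v)
  (cong (product (g 0F) v *_) (product-concat-tabulate (g ∘ Fin.suc) v))

divides-distinct : ∀ {n} {h : Vec ℚ n → ℚ} → IsPoly n h → ∀ fs →
  All (λ f → ∀ v → value f v ≡ 0ℚ → h v ≡ 0ℚ) fs → AllPairs Distinct fs → Divides fs h
divides-distinct {h = h} hp [] [] [] = h , hp , λ v → sym (F.*-identityˡ (h v))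
divides-distinct {h = h} hp (f ∷ fs) (z ∷ zs) (d ∷ ds) =
  let (k , kp , e) = factor-theorem f hp z in
  divides-++ (f ∷ []) fs (k , kp , λ v → trans (e v) (cong (_* k v) (sym (F.*-identityʳ (value f v)))))
    (divides-distinct hp fs zs ds)
    (All.map (λ {g} d → distinct⇒coprime g f (λ e₁ e₂ e₃ → d (sym e₁) (sym e₂) (sym e₃)) ∷ []) d)

opaque
  unfolding _+_

  form-root-scale : ∀ A x P C D y → A * x - (P * C) * D * y ≡ A * x - P * (C * D * y)
  form-root-scale = solve-∀ ringℚ

  1*1*x : ∀ x → 1ℚ * 1ℚ * x ≡ x
  1*1*x = solve-∀ ringℚ

  1*[q*1]*x : ∀ q x → 1ℚ * (q * 1ℚ) * x ≡ q * x
  1*[q*1]*x = solve-∀ ringℚ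

  p*1*[q*1]*x : ∀ p q x → p * 1ℚ * (q * 1ℚ) * x ≡ p * (q * x)
  p*1*[q*1]*x = solve-∀ ringℚ

  P*p*q*s : ∀ P p q s → P * (p * 1ℚ) * (q * 1ℚ) * s ≡ p * (q * (P * s))
  P*p*q*s = solve-∀ ringℚ

  P*1*s : ∀ P s → P * 1ℚ * 1ℚ * s ≡ P * s
  P*1*s = solve-∀ ringℚ

  1*x-y : ∀ x y → x - 1ℚ * y ≡ x - y
  1*x-y = solve-∀ ringℚ

  cross-monomials : ∀ a b c d → a * b * (c * d) ≡ (a * c) * (b * d)
  cross-monomials = solve-∀ ringℚ

  0-x≢0 : ∀ {x} → x ≢ 0ℚ → 0ℚ - x ≢ 0ℚ
  0-x≢0 {x} x≢0 e = x≢0 (trans (neg x) (cong -_ e))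
    where
    neg : ∀ x → x ≡ - (0ℚ - x)
    neg = solve-∀ ringℚ

-- The zeros forced by one string

module Ladder (p q : ℚ) where
  -- ladder k u w = (w - u)(w - pu)⋯(w - pᵏ⁻¹u)
  ladder : ℕ → ℚ → ℚ → ℚ
  ladder k u w = prodℚ (applyUpTo (λ j → w - p ^ j * u) k)

  ladder-suc : ∀ k u w → ladder (suc k) u w ≡ (w - u) * ladder k (p * u) w
  ladder-suc k u w = cong₂ _*_ (1*x-y w u) (cong prodℚ (applyUpTo-cong k (λ j → cong (λ y → w - y) (sym (p^a*[p*s] p (p ^ j) u)))))

  poly-ladder : ∀ {n} k {u w : Vec ℚ n → ℚ} → IsPoly n u → IsPoly n w → IsPoly n (λ v → ladder k (u v) (w v))
  poly-ladder zero up wp = poly-const 1ℚ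
  poly-ladder (suc k) {u} {w} up wp = poly-resp (λ v → sym (ladder-suc k (u v) (w v)))
    (poly-* (poly-- wp up) (poly-ladder k (poly-* (poly-const p) up) wp))

  -- The wheel conditions make F(s, ps, …, pᵃ⁻¹s, w, …) vanish at the zeros of Φ a s.
  Φ : ℕ → ℚ → ℚ → ℚ
  Φ a s w = ladder (a ∸ 1) (p * (q * s)) w * ladder (a ∸ 1) s (q * w)

  ΠΦ : ℕ → ℚ → List ℚ → ℚ
  ΠΦ a s zs = prodℚ (map (Φ a s) zs)

  poly-Φ : ∀ {n} a {s w : Vec ℚ n → ℚ} → IsPoly n s → IsPoly n w → IsPoly n (λ v → Φ a (s v) (w v))
  poly-Φ a sp wp = poly-* (poly-ladder (a ∸ 1) (poly-* (poly-const p) (poly-* (poly-const q) sp)) wp) (poly-ladder (a ∸ 1) sp (poly-* (poly-const q) wp))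

module Rows (p q : ℚ) (gen : Generic p q) where
  open Generic gen
  open Ladder p q public

  ladder-at-0 : ∀ k {u} → u ≢ 0ℚ → ladder k u 0ℚ ≢ 0ℚ
  ladder-at-0 k {u} u≢0 = prodℚ-≢0 (applyUpTo⁺₂ _ k (λ j → 0-x≢0 (*-≢0 (^-≢0 j p≢0) u≢0)))

  Φ-at-0 : ∀ a {s} → s ≢ 0ℚ → Φ a s 0ℚ ≢ 0ℚ
  Φ-at-0 a {s} s≢0 = *-≢0 (ladder-at-0 (a ∸ 1) (*-≢0 p≢0 (*-≢0 q≢0 s≢0)))
    (transport (λ x → ladder (a ∸ 1) s x ≢ 0ℚ) (sym (F.zeroʳ q)) (ladder-at-0 (a ∸ 1) s≢0))

  monomial-≢0 : ∀ a b → p ^ a * q ^ b ≢ 0ℚ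
  monomial-≢0 a b = *-≢0 (^-≢0 a p≢0) (^-≢0 b q≢0)

  mform : ∀ {n} (hi lo : Fin n) → lo Fin.< hi → (a b c d : ℕ) → Form n
  mform hi lo lt a b c d = form hi lo lt (p ^ a * q ^ b) (p ^ c * q ^ d) (monomial-≢0 a b) (monomial-≢0 c d)

  -- Proportionality of two forms with monomial coefficients is an equality of monomials in `p` and
  -- `q`, so by genericity it can be refuted by comparing exponents.
  mform-distinct : ∀ {n} {hi lo hi′ lo′ : Fin n} {lt lt′ a b c d a′ b′ c′ d′} →
    (hi ≡ hi′ → lo ≡ lo′ → a′ ℕ.+ c ≡ a ℕ.+ c′ → b′ ℕ.+ d ≡ b ℕ.+ d′ → ⊥) →
    Distinct (mform hi lo lt a b c d) (mform hi′ lo′ lt′ a′ b′ c′ d′)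
  mform-distinct {a = a} {b} {c} {d} {a′} {b′} {c′} {d′} h e₁ e₂ e = uncurry (h e₁ e₂) (independent _ _ _ _
    (trans (regroup a′ b′ c d) (trans e (sym (regroup a b c′ d′)))))
    where
    regroup : ∀ a b c d → p ^ (a ℕ.+ c) * q ^ (b ℕ.+ d) ≡ p ^ a * q ^ b * (p ^ c * q ^ d)
    regroup a b c d = trans (cong₂ _*_ (^-+ p a c) (^-+ q b d)) (sym (cross-monomials (p ^ a) (q ^ b) (p ^ c) (q ^ d)))

  xforms : ∀ {n} (hi lo : Fin n) → lo Fin.< hi → (a b c d k : ℕ) → List (Form n)
  xforms hi lo lt a b c d k = applyUpTo (λ j → mform hi lo lt a b (j ℕ.+ c) d) k

  product-xforms : ∀ {n} (hi lo : Fin n) lt a b c d k v →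
    product (xforms hi lo lt a b c d k) v ≡ ladder k (p ^ c * q ^ d * lookup v lo) (p ^ a * q ^ b * lookup v hi)
  product-xforms hi lo lt a b c d k v = cong prodℚ (trans (ListP.map-applyUpTo (λ j → mform hi lo lt a b (j ℕ.+ c) d) (λ f → value f v) k)
    (applyUpTo-cong k (λ j → trans (cong (λ x → p ^ a * q ^ b * lookup v hi - x * q ^ d * lookup v lo) (^-+ p j c))
      (form-root-scale (p ^ a * q ^ b) (lookup v hi) (p ^ j) (p ^ c) (q ^ d) (lookup v lo)))))

  xforms-distinct : ∀ {n} (hi lo : Fin n) lt a b c d k → AllPairs Distinct (xforms hi lo lt a b c d k)
  xforms-distinct hi lo lt a b c d k = AllPairsP.applyUpTo⁺₁ _ k (λ {i} {j} i<j _ →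
    mform-distinct {lt = lt} {lt} {a} {b} {i ℕ.+ c} {d} {a} {b} {j ℕ.+ c} {d} λ _ _ e _ →
      <⇒≢ i<j (+-cancelʳ-≡ c i j (+-cancelˡ-≡ a (i ℕ.+ c) (j ℕ.+ c) e)))

  -- Variable zero is the start `s` of the string. In the first progression `x` and `px` of a wheel
  -- `(x, px, pqx)` lie in the string and `w` is the third entry; in the second `qx` and `pqx` of a
  -- wheel `(x, qx, pqx)` lie in the string and `w` is the first entry. Each has one root per pair
  -- of neighbours in the string, hence `a ∸ 1` of them.
  peelRow : ∀ {n} → ℕ → Fin n → List (Form (suc n))
  peelRow a i = xforms (Fin.suc i) 0F (s≤s z≤n) 0 0 1 1 (a ∸ 1) ++ xforms (Fin.suc i) 0F (s≤s z≤n) 0 1 0 0 (a ∸ 1)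

  peelForms : ∀ n → ℕ → List (Form (suc n))
  peelForms n a = List.concat (List.tabulate {n = n} (peelRow a))

  product-peelRow : ∀ {n} a (i : Fin n) s v → product (peelRow a i) (s ∷ v) ≡ Φ a s (lookup v i)
  product-peelRow a i s v = trans (product-++ (xforms (Fin.suc i) 0F (s≤s z≤n) 0 0 1 1 (a ∸ 1)) (xforms (Fin.suc i) 0F (s≤s z≤n) 0 1 0 0 (a ∸ 1)) (s ∷ v))
    (cong₂ _*_ (trans (product-xforms (Fin.suc i) 0F (s≤s z≤n) 0 0 1 1 (a ∸ 1) (s ∷ v)) (cong₂ (ladder (a ∸ 1)) (p*1*[q*1]*x p q s) (1*1*x (lookup v i))))
      (trans (product-xforms (Fin.suc i) 0F (s≤s z≤n) 0 1 0 0 (a ∸ 1) (s ∷ v)) (cong₂ (ladder (a ∸ 1)) (1*1*x s) (1*[q*1]*x q (lookup v i)))))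

  product-peelForms : ∀ n a s (v : Vec ℚ n) → product (peelForms n a) (s ∷ v) ≡ ΠΦ a s (toList v)
  product-peelForms n a s v = begin
    product (peelForms n a) (s ∷ v)
      ≡⟨ product-concat-tabulate (peelRow a) (s ∷ v) ⟩
    prodℚ (List.tabulate (λ i → product (peelRow a i) (s ∷ v)))
      ≡⟨ cong prodℚ (tabulate-cong (λ i → product-peelRow a i s v)) ⟩
    prodℚ (List.tabulate (λ i → Φ a s (lookup v i)))
      ≡⟨ cong prodℚ (sym (map-tabulate (lookup v) (Φ a s))) ⟩
    prodℚ (map (Φ a s) (List.tabulate (lookup v)))
      ≡⟨ cong (λ zs → prodℚ (map (Φ a s) zs)) (sym (toList-tabulate v)) ⟩
    ΠΦ a s (toList v) ∎
    where open ≡-Reasoning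

  peelForms-distinct : ∀ n a → AllPairs Distinct (peelForms n a)
  peelForms-distinct n a = AllPairsP.concat⁺ (tabulate⁺ {n = n} within) (AllPairsP.tabulate⁺ across)
    where
    within : ∀ (i : Fin n) → AllPairs Distinct (peelRow a i)
    within i = AllPairsP.++⁺ (xforms-distinct _ _ _ 0 0 1 1 (a ∸ 1)) (xforms-distinct _ _ _ 0 1 0 0 (a ∸ 1))
      (applyUpTo⁺₂ _ (a ∸ 1) (λ j → applyUpTo⁺₂ _ (a ∸ 1) (λ k →
        mform-distinct {lt = s≤s z≤n} {s≤s z≤n} {0} {0} {j ℕ.+ 1} {1} {0} {1} {k ℕ.+ 0} {0} λ _ _ _ ())))
    hi-in : ∀ (i : Fin n) → All (λ f → Form.hi f ≡ Fin.suc i) (peelRow a i)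
    hi-in i = ++⁺ (applyUpTo⁺₂ _ (a ∸ 1) (λ _ → refl)) (applyUpTo⁺₂ _ (a ∸ 1) (λ _ → refl))
    across : ∀ {i j : Fin n} → i ≢ j → All (λ f → All (Distinct f) (peelRow a j)) (peelRow a i)
    across {i} {j} i≢j = All.map (λ e → All.map (λ e′ h _ → ⊥-elim (i≢j (FinP.suc-injective (trans (sym e) (trans h e′))))) (hi-in j)) (hi-in i)

  module _ {n F} (w : Wheeled p q n F) where
    open Wheeled w

    wheel-vanishes₁ : ∀ {as bs as′ bs′ x z} → length (as ++ bs) ≡ n → as ↭ x ∷ p * x ∷ as′ → bs ↭ z ∷ bs′ →
      z ≡ p * (q * x) → F (as ++ bs) ≡ 0ℚ
    wheel-vanishes₁ {as′ = as′} {bs′} {x} l pa pb refl = trans (symmetric perm l)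
      (wheel₁ x (as′ ++ bs′) (trans (sym (↭-length perm)) l))
      where perm = triple-front pa pb

    wheel-vanishes₂ : ∀ {as bs as′ bs′ x y z} → length (as ++ bs) ≡ n → as ↭ x ∷ y ∷ as′ → bs ↭ z ∷ bs′ →
      x ≡ q * z → y ≡ p * (q * z) → F (as ++ bs) ≡ 0ℚ
    wheel-vanishes₂ {as′ = as′} {bs′} {x} {y} {z} l pa pb refl refl = trans (symmetric perm l)
      (wheel₂ z (as′ ++ bs′) (trans (sym (↭-length perm)) l))
      where
      perm = ↭-trans (triple-front pa pb) (↭-trans (Permutation.prep x (Permutation.swap y z ↭-refl)) (Permutation.swap x z ↭-refl))

  adjacent-in-str : ∀ a s k → k < a ∸ 1 → Σ (List ℚ) λ R → str p a s ↭ p ^ k * s ∷ p * (p ^ k * s) ∷ R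
  adjacent-in-str a s k k<a-1 = transport (λ b → Σ (List ℚ) λ R → str p b s ↭ p ^ k * s ∷ p * (p ^ k * s) ∷ R) (split a k<a-1)
    (str p k s ++ str p (a ∸ 2 ∸ k) (p * (p * (p ^ k * s))) ,
     ↭-trans (↭-reflexive (str-+ p k (2 ℕ.+ (a ∸ 2 ∸ k)) s)) (pair-front (str p k s) _ _ _))
    where
    split : ∀ a → k < a ∸ 1 → k ℕ.+ (2 ℕ.+ (a ∸ 2 ∸ k)) ≡ a
    split (suc (suc a)) (s≤s k≤a) = trans (+-suc k _) (cong suc (trans (+-suc k (a ∸ k)) (cong suc (m+[n∸m]≡n k≤a))))

  -- The arguments outside the string are still independent variables, so the forced zeros are
  -- pairwise distinct forms and can all be divided out at once.
  peel : ∀ {n F} a → Wheeled p q (a ℕ.+ n) F →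
    Σ (Vec ℚ (suc n) → ℚ) λ Q → IsPoly (suc n) Q × ∀ s v → F (str p a s ++ toList v) ≡ ΠΦ a s (toList v) * Q (s ∷ v)
  peel {n} {F} a w = let (Q , Qp , e) = divides-distinct hp (peelForms n a) vanishing (peelForms-distinct n a) in
    Q , Qp , λ s v → trans (e (s ∷ v)) (cong (_* Q (s ∷ v)) (product-peelForms n a s v))
    where
    h : Vec ℚ (suc n) → ℚ
    h w = F (str p a (head w) ++ toList (tail w))
    hp : IsPoly (suc n) h
    hp = polyOn-∘ {F = F} (Wheeled.poly w) (polyList-++ (polyList-str {h = head} p a (poly-resp (λ { (t ∷ v) → refl }) (poly-var 0F)))
      (polyList-∘ tail poly-tail (polyList-toList n)))
    len : ∀ s (v : Vec ℚ n) → length (str p a s ++ toList v) ≡ a ℕ.+ n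
    len s v = trans (length-++ (str p a s)) (cong₂ ℕ._+_ (length-str p a s) (length-toList v))
    vanishing : All (λ f → ∀ w → value f w ≡ 0ℚ → h w ≡ 0ℚ) (peelForms n a)
    vanishing = concat⁺ (tabulate⁺ {n = n} λ i → ++⁺
      (applyUpTo⁺₁ _ (a ∸ 1) λ { {k} k<a-1 (s ∷ v) e →
        wheel-vanishes₁ w (len s v) (proj₂ (adjacent-in-str a s k k<a-1)) (proj₂ (pick v i))
          (trans (sym (1*1*x (lookup v i))) (trans (x-y≡0⇒x≡y e) (trans (cong (λ x → x * (q * 1ℚ) * s) (^-+ p k 1)) (P*p*q*s (p ^ k) p q s)))) })
      (applyUpTo⁺₁ _ (a ∸ 1) λ { {k} k<a-1 (s ∷ v) e →
        let x≡qz = trans (sym (P*1*s (p ^ k) s)) (trans (cong (λ x → x * 1ℚ * s) (sym (^-+ p k 0)))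
                     (trans (sym (x-y≡0⇒x≡y e)) (1*[q*1]*x q (lookup v i)))) in
        wheel-vanishes₂ w (len s v) (proj₂ (adjacent-in-str a s k k<a-1)) (proj₂ (pick v i)) x≡qz (cong (p *_) x≡qz) }))

  ΠΦ-at-0 : ∀ a {s} → s ≢ 0ℚ → ∀ k → ΠΦ a s (toList (zeros k)) ≢ 0ℚ
  ΠΦ-at-0 a s≢0 zero ()
  ΠΦ-at-0 a s≢0 (suc k) = *-≢0 (Φ-at-0 a s≢0) (ΠΦ-at-0 a s≢0 k)

  module Peeled {n F a s} (s≢0 : s ≢ 0ℚ) (w : Wheeled p q (a ℕ.+ n) F) (G : List ℚ → ℚ)
    (Gp : PolyOn n G) (eq : ∀ zs → length zs ≡ n → F (str p a s ++ zs) ≡ ΠΦ a s zs * G zs) where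
    private module w = Wheeled w

    poly-ΠΦ : ∀ {m xs} → PolyList m n xs → IsPoly m (λ v → ΠΦ a s (xs v))
    poly-ΠΦ = poly-prodList (Φ a s) (poly-Φ a (poly-const s))

    len : ∀ {zs} → length zs ≡ n → length (str p a s ++ zs) ≡ a ℕ.+ n
    len l = trans (length-++ (str p a s)) (cong₂ ℕ._+_ (length-str p a s) l)

    peeled-symmetric : SymmetricOn n G
    peeled-symmetric = swaps⇒symmetric G λ k zs l → transport (λ xs → G xs ≡ G (swapAt k xs)) (toList-toVec n zs l) (invariant k (toVec n zs))
      where
      invariant : ∀ k v → G (toList v) ≡ G (swapAt k (toList v))
      invariant k = poly-cancel {h = λ v → ΠΦ a s (toList v)} (poly-ΠΦ (polyList-toList n)) Gp
        (polyOn-∘ {F = G} Gp (polyList-swapAt k (polyList-toList n)))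
        (λ v → let l = length-toList v ; perm = swapAt-↭ k (toList v) ; l′ = trans (↭-length perm) l in begin
          ΠΦ a s (toList v) * G (toList v)     ≡⟨ sym (eq (toList v) l) ⟩
          F (str p a s ++ toList v)                ≡⟨ w.symmetric (++⁺ˡ (str p a s) (↭-sym perm)) (len l) ⟩
          F (str p a s ++ swapAt k (toList v))     ≡⟨ eq (swapAt k (toList v)) l′ ⟩
          ΠΦ a s (swapAt k (toList v)) * G (swapAt k (toList v))
            ≡⟨ cong (_* G (swapAt k (toList v))) (prodℚ-↭ (PermP.map⁺ (Φ a s) perm)) ⟩
          ΠΦ a s (toList v) * G (swapAt k (toList v)) ∎)
        (zeros n) (ΠΦ-at-0 a s≢0 n)
        where open ≡-Reasoning

    -- Because `s` is nonzero, `ΠΦ` is nonzero at the origin, so it cancels on every polynomial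
    -- family of arguments through the origin. The wheel families pass through it at `x = 0`.
    peeled-vanishes : ∀ {m xs} → PolyList m n xs → (∀ v → length (xs v) ≡ n) → xs (zeros m) ≡ toList (zeros n) →
      (∀ v → F (str p a s ++ xs v) ≡ 0ℚ) → ∀ v → G (xs v) ≡ 0ℚ
    peeled-vanishes {m} {xs} xp l e z = poly-domain (poly-ΠΦ xp) (polyOn-∘ {F = G} Gp xp) (λ v → trans (sym (eq (xs v) (l v))) (z v))
      (zeros m) (λ e′ → ΠΦ-at-0 a s≢0 n (trans (cong (ΠΦ a s) (sym e)) e′))

    wheel-move : ∀ x y z zs → str p a s ++ x ∷ y ∷ z ∷ zs ↭ x ∷ y ∷ z ∷ str p a s ++ zs
    wheel-move x y z zs = ↭-trans (PermP.shift x (str p a s) (y ∷ z ∷ zs)) (Permutation.prep x (pair-front (str p a s) y z zs))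

    peeled-wheel : ∀ c d (m : ℕ) → 3 ℕ.+ m ≡ n → (∀ x zs → 3 ℕ.+ length zs ≡ a ℕ.+ n → F (x ∷ c * x ∷ p * (d * x) ∷ zs) ≡ 0ℚ) →
      ∀ v → G (head v ∷ c * head v ∷ p * (d * head v) ∷ toList {n = m} (tail v)) ≡ 0ℚ
    peeled-wheel c d m refl wh = peeled-vanishes
      (polyList-∷ hd (polyList-∷ (poly-* (poly-const c) hd) (polyList-∷ (poly-* (poly-const p) (poly-* (poly-const d) hd))
        (polyList-∘ tail poly-tail (polyList-toList m)))))
      (λ { (t ∷ v) → cong (λ k → suc (suc (suc k))) (length-toList v) })
      (cong₂ (λ x y → 0ℚ ∷ x ∷ y ∷ toList (zeros m)) (F.zeroʳ c) (trans (cong (p *_) (F.zeroʳ d)) (F.zeroʳ p)))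
      (λ { (t ∷ v) → let perm = wheel-move t (c * t) (p * (d * t)) (toList v) in
        trans (w.symmetric perm (len (cong (λ k → suc (suc (suc k))) (length-toList v))))
          (wh t (str p a s ++ toList v) (trans (sym (↭-length perm)) (len (cong (λ k → suc (suc (suc k))) (length-toList v))))) })
      where
      hd : IsPoly (suc m) head
      hd = poly-resp (λ { (t ∷ v) → refl }) (poly-var 0F)

    peeled-wheeled : Wheeled p q n G
    peeled-wheeled = record
      { poly = Gp ; symmetric = peeled-symmetric
      ; wheel₁ = λ x zs l → at p q (length zs) l w.wheel₁ x zs refl
      ; wheel₂ = λ x zs l → at q q (length zs) l w.wheel₂ x zs refl }
      where
      at : ∀ c d m → 3 ℕ.+ m ≡ n → (∀ x zs → 3 ℕ.+ length zs ≡ a ℕ.+ n → F (x ∷ c * x ∷ p * (d * x) ∷ zs) ≡ 0ℚ) →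
        ∀ x zs → length zs ≡ m → G (x ∷ c * x ∷ p * (d * x) ∷ zs) ≡ 0ℚ
      at c d m l wh x zs e = transport (λ ys → G (x ∷ c * x ∷ p * (d * x) ∷ ys) ≡ 0ℚ) (toList-toVec m zs e) (peeled-wheel c d m l wh (x ∷ toVec m zs))

wheeled-linear : ∀ {p q n F G} c d → Wheeled p q n F → Wheeled p q n G → Wheeled p q n (λ zs → c * F zs + d * G zs)
wheeled-linear c d w w′ = record
  { poly = poly-+ (poly-* (poly-const c) w.poly) (poly-* (poly-const d) w′.poly)
  ; symmetric = λ perm l → cong₂ (λ x y → c * x + d * y) (w.symmetric perm l) (w′.symmetric perm l)
  ; wheel₁ = λ x zs l → vanish (w.wheel₁ x zs l) (w′.wheel₁ x zs l)
  ; wheel₂ = λ x zs l → vanish (w.wheel₂ x zs l) (w′.wheel₂ x zs l) }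
  where
  module w = Wheeled w
  module w′ = Wheeled w′
  vanish : ∀ {x y} → x ≡ 0ℚ → y ≡ 0ℚ → c * x + d * y ≡ 0ℚ
  vanish refl refl = trans (cong₂ _+_ (F.zeroʳ c) (F.zeroʳ d)) 0+0≡0

PolyFun : (ℚ → ℚ) → Set
PolyFun H = ∀ {m h} → IsPoly m h → IsPoly m (H ∘ h)

opaque
  unfolding _+_

  peel-factor : ∀ P k S G H → P * ((k * S) * (G * H)) ≡ k * ((P * G) * (S * H))
  peel-factor = solve-∀ ringℚ

  split-factor : ∀ k S e B → (k * S) * (e * B) ≡ k * (e * (S * B))
  split-factor = solve-∀ ringℚ

  linear-factor : ∀ c d P G G′ → c * (P * G) + d * (P * G′) ≡ P * (c * G + d * G′)
  linear-factor = solve-∀ ringℚ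

prodℚ-1 : ∀ {A : Set} (zs : List A) → prodℚ (map (λ _ → 1ℚ) zs) ≡ 1ℚ
prodℚ-1 [] = refl
prodℚ-1 (z ∷ zs) = trans (F.*-identityˡ _) (prodℚ-1 zs)

prodℚ-map-++ : ∀ (H : ℚ → ℚ) xs ys → prodℚ (map H (xs ++ ys)) ≡ prodℚ (map H xs) * prodℚ (map H ys)
prodℚ-map-++ H xs ys = trans (cong prodℚ (map-++ H xs ys)) (prodℚ-++ (map H xs) (map H ys))

-- RowValue μ s F e says that e is the value of F at the boxes pᵃqᵇs of the diagram μ, its rows being substituted one
-- after the other, each after division by the zeros ΠΦ that the wheel conditions impose.
module RowValues (p q : ℚ) where
  open Ladder p q public

  RowValue : List ℕ → ℚ → (List ℚ → ℚ) → ℚ → Set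
  RowValue [] s F e = F [] ≡ e
  RowValue (a ∷ ρ) s F e = Σ (List ℚ → ℚ) λ G → Wheeled p q (sum ρ) G ×
    (∀ zs → length zs ≡ sum ρ → F (str p a s ++ zs) ≡ ΠΦ a s zs * G zs) × RowValue ρ (q * s) G e

  boxes : List ℕ → ℚ → List ℚ
  boxes [] s = []
  boxes (a ∷ ρ) s = str p a s ++ boxes ρ (q * s)

  rowValue-linear : ∀ μ {s F F′ e e′} c d → RowValue μ s F e → RowValue μ s F′ e′ →
    RowValue μ s (λ zs → c * F zs + d * F′ zs) (c * e + d * e′)
  rowValue-linear [] c d refl refl = refl
  rowValue-linear (a ∷ ρ) {s} c d (G , w , eq , v) (G′ , w′ , eq′ , v′) =
    (λ zs → c * G zs + d * G′ zs) , wheeled-linear c d w w′ ,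
    (λ zs l → trans (cong₂ (λ x y → c * x + d * y) (eq zs l) (eq′ zs l)) (linear-factor c d (ΠΦ a s zs) (G zs) (G′ zs))) ,
    rowValue-linear ρ c d v v′

  rowValue-empty : ∀ μ {s F e} → sum μ ≡ 0 → RowValue μ s F e → F [] ≡ e
  rowValue-empty [] z v = v
  rowValue-empty (zero ∷ ρ) z (G , w , eq , v) = trans (eq [] (sym z)) (trans (F.*-identityˡ (G [])) (rowValue-empty ρ z v))

module RowTheory (p q : ℚ) (gen : Generic p q) where
  open Generic gen public
  open Rows p q gen public
  open RowValues p q public hiding (ladder; ladder-suc; poly-ladder; Φ; ΠΦ; poly-Φ)

  peel-at : ∀ {n F} a {s} → s ≢ 0ℚ → Wheeled p q (a ℕ.+ n) F → Σ (List ℚ → ℚ) λ G → Wheeled p q n G ×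
    (∀ zs → length zs ≡ n → F (str p a s ++ zs) ≡ ΠΦ a s zs * G zs)
  peel-at {n} {F} a {s} s≢0 w = let (Q , Qp , eq) = peel a w in
    let G = λ zs → Q (s ∷ toVec n zs)
        Gp = poly-resp (λ v → cong (λ x → Q (s ∷ x)) (sym (toVec-toList v))) (poly-fix s Qp)
        eq′ = λ zs l → transport (λ ys → F (str p a s ++ ys) ≡ ΠΦ a s ys * G zs) (toList-toVec n zs l) (eq s (toVec n zs))
    in G , Peeled.peeled-wheeled {a = a} s≢0 w G Gp eq′ , eq′

  rowValue-exists : ∀ μ {s F} → s ≢ 0ℚ → Wheeled p q (sum μ) F → Σ ℚ λ e → RowValue μ s F e
  rowValue-exists [] {F = F} s≢0 w = F [] , refl
  rowValue-exists (a ∷ ρ) s≢0 w = let (G , Gw , eq) = peel-at a s≢0 w in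
    let (e , v) = rowValue-exists ρ (*-≢0 q≢0 s≢0) Gw in e , G , Gw , eq , v

  -- The twists `H` and `H′` are needed because removing a hook in two orders gives functions that
  -- agree only up to such products. At each row the twist splits into its value on the row,
  -- absorbed into the constant, and the twist of the remaining arguments; the common `ΠΦ` is
  -- cancelled as a polynomial.
  rowValue-compare : ∀ μ {s F F′ e e′} → s ≢ 0ℚ → RowValue μ s F e → RowValue μ s F′ e′ → ∀ k k′ H H′ → PolyFun H → PolyFun H′ →
    (∀ zs → length zs ≡ sum μ → k * (F zs * prodℚ (map H zs)) ≡ k′ * (F′ zs * prodℚ (map H′ zs))) →
    k * (e * prodℚ (map H (boxes μ s))) ≡ k′ * (e′ * prodℚ (map H′ (boxes μ s)))
  rowValue-compare [] s≢0 refl refl k k′ H H′ Hp H′p eq = eq [] refl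
  rowValue-compare (a ∷ ρ) {s} {F} {F′} {e} {e′} s≢0 (G , w , eqG , v) (G′ , w′ , eqG′ , v′) k k′ H H′ Hp H′p eq =
    trans (sym (assemble H k e)) (trans (rowValue-compare ρ (*-≢0 q≢0 s≢0) v v′ (k * P H S) (k′ * P H′ S) H H′ Hp H′p inner) (assemble H′ k′ e′))
    where
    n = sum ρ
    S = str p a s
    B = boxes ρ (q * s)
    P : (ℚ → ℚ) → List ℚ → ℚ
    P H zs = prodℚ (map H zs)
    assemble : ∀ H k e → (k * P H S) * (e * P H B) ≡ k * (e * P H (S ++ B))
    assemble H k e = trans (split-factor k (P H S) e (P H B)) (cong (λ x → k * (e * x)) (sym (prodℚ-map-++ H S B)))
    shuffle : ∀ F G → (∀ zs → length zs ≡ n → F (S ++ zs) ≡ ΠΦ a s zs * G zs) → ∀ H k zs → length zs ≡ n →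
      ΠΦ a s zs * ((k * P H S) * (G zs * P H zs)) ≡ k * (F (S ++ zs) * P H (S ++ zs))
    shuffle F G eqG H k zs l = trans (peel-factor (ΠΦ a s zs) k (P H S) (G zs) (P H zs))
      (cong₂ (λ x y → k * (x * y)) (sym (eqG zs l)) (sym (prodℚ-map-++ H S zs)))
    poly-side : ∀ G H k → Wheeled p q n G → PolyFun H → IsPoly n (λ v → (k * P H S) * (G (toList v) * P H (toList v)))
    poly-side G H k w Hp = poly-* (poly-const (k * P H S)) (poly-* (Wheeled.poly w) (poly-prodList H Hp (polyList-toList n)))
    on-Vec : ∀ v → (k * P H S) * (G (toList v) * P H (toList v)) ≡ (k′ * P H′ S) * (G′ (toList v) * P H′ (toList v))
    on-Vec = poly-cancel (poly-prodList (Φ a s) (poly-Φ a (poly-const s)) (polyList-toList n))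
      (poly-side G H k w Hp) (poly-side G′ H′ k′ w′ H′p)
      (λ v → let zs = toList v ; l = length-toList v in
        trans (shuffle F G eqG H k zs l) (trans
          (eq (S ++ zs) (trans (length-++ S) (cong₂ ℕ._+_ (length-str p a s) l)))
          (sym (shuffle F′ G′ eqG′ H′ k′ zs l))))
      (zeros n) (ΠΦ-at-0 a s≢0 n)
    inner : ∀ zs → length zs ≡ n → (k * P H S) * (G zs * P H zs) ≡ (k′ * P H′ S) * (G′ zs * P H′ zs)
    inner zs l = transport (λ zs → (k * P H S) * (G zs * P H zs) ≡ (k′ * P H′ S) * (G′ zs * P H′ zs)) (toList-toVec n zs l) (on-Vec (toVec n zs))

-- Transposition of diagrams, trailing zeros being allowed

nth : List ℕ → ℕ → ℕ
nth [] i = 0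
nth (a ∷ as) zero = a
nth (a ∷ as) (suc i) = nth as i

record Transposed (μ ν : List ℕ) : Set where
  constructor transposed
  field cell : ∀ i j → (j < nth μ i → i < nth ν j) × (i < nth ν j → j < nth μ i)
open Transposed public

transposed-sym : ∀ {μ ν} → Transposed μ ν → Transposed ν μ
transposed-sym t = transposed λ i j → let (f , g) = cell t j i in g , f

nth-pred : ∀ as i → nth (map ℕ.pred as) i ≡ ℕ.pred (nth as i)
nth-pred [] i = refl
nth-pred (a ∷ as) zero = refl
nth-pred (a ∷ as) (suc i) = nth-pred as i

<pred⇒suc< : ∀ {i x} → i < ℕ.pred x → suc i < x
<pred⇒suc< {x = suc x} l = s≤s l

suc<⇒<pred : ∀ {i x} → suc i < x → i < ℕ.pred x
suc<⇒<pred {x = suc x} (s≤s l) = l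

remove-row : ∀ {a ρ ν} → Transposed (a ∷ ρ) ν → Transposed ρ (map ℕ.pred ν)
remove-row {ν = ν} t = transposed λ i j → let (f , g) = cell t (suc i) j in
  (λ l → transport (i <_) (sym (nth-pred ν j)) (suc<⇒<pred (f l))) ,
  (λ l → g (<pred⇒suc< (transport (i <_) (nth-pred ν j) l)))

remove-column : ∀ {μ b γ} → Transposed μ (b ∷ γ) → Transposed (map ℕ.pred μ) γ
remove-column t = transposed-sym (remove-row (transposed-sym t))

nth≡0⇒sum≡0 : ∀ μ → (∀ i → nth μ i ≡ 0) → sum μ ≡ 0
nth≡0⇒sum≡0 [] z = refl
nth≡0⇒sum≡0 (a ∷ μ) z = cong₂ ℕ._+_ (z 0) (nth≡0⇒sum≡0 μ (z ∘ suc))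

zero-row⇒empty : ∀ {ι ν} → Transposed (0 ∷ ι) ν → sum ι ≡ 0 × sum ν ≡ 0
zero-row⇒empty {ι} {ν} t = nth≡0⇒sum≡0 ι ι≡0 , nth≡0⇒sum≡0 ν ν≡0
  where
  ν≡0 : ∀ j → nth ν j ≡ 0
  ν≡0 j with nth ν j in eq
  ... | zero = refl
  ... | suc k with proj₂ (cell t 0 j) (transport (0 <_) (sym eq) (s≤s z≤n))
  ... | ()
  ι≡0 : ∀ i → nth ι i ≡ 0
  ι≡0 i with nth ι i in eq
  ... | zero = refl
  ... | suc k with transport (suc i <_) (ν≡0 0) (proj₁ (cell t (suc i) 0) (transport (0 <_) (sym eq) (s≤s z≤n)))
  ... | ()

empty-row : ∀ {ν} → Transposed [] ν → sum ν ≡ 0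
empty-row {ν} t = proj₂ (zero-row⇒empty {[]} {ν} (transposed λ { zero j → cell t zero j ; (suc i) j → cell t (suc i) j }))

-- Both sums count the first row, the rest of the first column and the inner diagram. The recursion
-- removes a row or a column from one side at a time, and `k` bounds the total length.
sum-transposed : ∀ k μ ν → length μ ℕ.+ length ν ≤ k → Transposed μ ν → sum μ ≡ sum ν
sum-transposed k [] ν l t = sym (empty-row t)
sum-transposed k (a ∷ ρ) [] l t = empty-row (transposed-sym t)
sum-transposed k (zero ∷ ρ) (b ∷ γ) l t = let (x , y) = zero-row⇒empty t in trans x (sym y)
sum-transposed k (suc a ∷ ρ) (zero ∷ γ) l t = let (x , y) = zero-row⇒empty (transposed-sym t) in trans y (sym x)
sum-transposed (suc k) (suc a ∷ ρ) (suc b ∷ γ) (s≤s l) t = begin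
  suc a ℕ.+ sum ρ                        ≡⟨ cong (suc a ℕ.+_) (sum-transposed k ρ (b ∷ map ℕ.pred γ) l₁ (remove-row t)) ⟩
  suc a ℕ.+ (b ℕ.+ sum (map ℕ.pred γ))   ≡⟨ cong (λ x → suc a ℕ.+ (b ℕ.+ x)) (sym (sum-transposed k (map ℕ.pred ρ) (map ℕ.pred γ) l₃ (remove-column (remove-row t)))) ⟩
  suc a ℕ.+ (b ℕ.+ sum (map ℕ.pred ρ))   ≡⟨ exchange a b (sum (map ℕ.pred ρ)) ⟩
  suc b ℕ.+ (a ℕ.+ sum (map ℕ.pred ρ))   ≡⟨ cong (suc b ℕ.+_) (sum-transposed k (a ∷ map ℕ.pred ρ) γ l₂ (remove-column t)) ⟩
  suc b ℕ.+ sum γ                        ∎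
  where
  open ≡-Reasoning
  exchange : ∀ a b c → suc a ℕ.+ (b ℕ.+ c) ≡ suc b ℕ.+ (a ℕ.+ c)
  exchange = ℕSolver.solve-∀
  l₁ : length ρ ℕ.+ suc (length (map ℕ.pred γ)) ≤ k
  l₁ = transport (λ x → length ρ ℕ.+ suc x ≤ k) (sym (length-map ℕ.pred γ)) l
  l₂ : suc (length (map ℕ.pred ρ)) ℕ.+ length γ ≤ k
  l₂ = transport (λ x → suc x ℕ.+ length γ ≤ k) (sym (length-map ℕ.pred ρ)) (≤-trans (≤-reflexive (sym (+-suc _ _))) l)
  l₃ : length (map ℕ.pred ρ) ℕ.+ length (map ℕ.pred γ) ≤ k
  l₃ = ≤-trans (+-monoʳ-≤ (length (map ℕ.pred ρ)) (n≤1+n _)) (transport (λ x → x ℕ.+ suc (length (map ℕ.pred γ)) ≤ k) (sym (length-map ℕ.pred ρ)) l₁)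

-- Hooks: exchanging the first row and the first column

opaque
  unfolding _+_

  hook-cancel : ∀ C U H P Q G → (C * ((U * H) * P)) * (Q * G) ≡ (U * P * Q) * (C * (G * H))
  hook-cancel = solve-∀ ringℚ

  hook-cancel′ : ∀ C U H P Q G → (C * ((U * H) * Q)) * (P * G) ≡ (U * P * Q) * (C * (G * H))
  hook-cancel′ = solve-∀ ringℚ

  empty-hook : ∀ C G → (C * 1ℚ) * (1ℚ * G) ≡ C * G
  empty-hook = solve-∀ ringℚ

  ladder-pair : ∀ a b c d → (a * b) * (c * d) ≡ (a * c) * (b * d)
  ladder-pair = solve-∀ ringℚ

  difference-scale : ∀ P Q s → P * s - Q * s ≡ (P - Q) * s
  difference-scale = solve-∀ ringℚ

  str-step : ∀ p P s → P * (p * s) ≡ (p * P) * s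
  str-step = solve-∀ ringℚ

  box-step : ∀ P q Q s → P * Q * (q * s) ≡ P * (q * Q) * s
  box-step = solve-∀ ringℚ

  monomial-z : ∀ P p s → P * (p * s) ≡ p * P * 1ℚ * s
  monomial-z = solve-∀ ringℚ

  monomial-qz : ∀ p P s → p * (P * (p * s)) ≡ p * (p * P) * 1ℚ * s
  monomial-qz = solve-∀ ringℚ

  monomial-root : ∀ Q q p s → Q * (q * (p * s)) ≡ p * 1ℚ * (q * Q) * s
  monomial-root = solve-∀ ringℚ

  monomial-pw : ∀ p q P Q s → p * (P * Q * (p * (q * s))) ≡ p * (p * P) * (q * Q) * s
  monomial-pw = solve-∀ ringℚ

  1*1*s : ∀ s → s ≡ 1ℚ * 1ℚ * s
  1*1*s = solve-∀ ringℚ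

  1*Q*s : ∀ Q s → Q * s ≡ 1ℚ * Q * s
  1*Q*s = solve-∀ ringℚ

  P*1*s″ : ∀ P s → P * s ≡ P * 1ℚ * s
  P*1*s″ = solve-∀ ringℚ

prodℚ-map-* : ∀ {A : Set} (f g : A → ℚ) zs → prodℚ (map (λ z → f z * g z) zs) ≡ prodℚ (map f zs) * prodℚ (map g zs)
prodℚ-map-* f g [] = sym (F.*-identityˡ 1ℚ)
prodℚ-map-* f g (z ∷ zs) = trans (cong (f z * g z *_) (prodℚ-map-* f g zs)) (ladder-pair (f z) (g z) (prodℚ (map f zs)) (prodℚ (map g zs)))

str-All : ∀ p a s → All (λ z → Σ ℕ λ j → z ≡ p ^ j * s) (str p a s)
str-All p zero s = []
str-All p (suc a) s = (0 , sym (F.*-identityˡ s)) ∷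
  All.map (λ { (j , e) → suc j , trans e (str-step p (p ^ j) s) }) (str-All p a (p * s))

module _ (p q : ℚ) where
  open RowValues p q

  boxes-All : ∀ μ s → All (λ z → Σ ℕ λ i → Σ ℕ λ j → z ≡ p ^ i * q ^ j * s) (boxes μ s)
  boxes-All [] s = []
  boxes-All (a ∷ ρ) s = ++⁺ (All.map (λ { (i , e) → i , 0 , trans e (P*1*s″ (p ^ i) s) }) (str-All p a s))
    (All.map (λ { (i , j , e) → i , suc j , trans e (box-step (p ^ i) q (q ^ j) s) }) (boxes-All ρ (q * s)))

  -- The factors with index 0 belong to the corner box `s`; those that remain are the zeros forced
  -- by the rest of the row, which starts at `p * s`.
  Φ-suc : ∀ a s w → Φ (suc (suc a)) s w ≡ ((w - p * (q * s)) * (q * w - s)) * Φ (suc a) (p * s) w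
  Φ-suc a s w = trans (cong₂ _*_ (ladder-suc a (p * (q * s)) w) (ladder-suc a s (q * w)))
    (trans (ladder-pair (w - p * (q * s)) (ladder a (p * (p * (q * s))) w) (q * w - s) (ladder a (p * s) (q * w)))
      (cong (λ x → ((w - p * (q * s)) * (q * w - s)) * (ladder a x w * ladder a (p * s) (q * w))) (cong (p *_) (t*[p*s] p q s))))

  ΠΦ-suc : ∀ a s ws → ΠΦ (suc (suc a)) s ws ≡
    (prodℚ (map (λ w → w - p * (q * s)) ws) * prodℚ (map (λ w → q * w - s) ws)) * ΠΦ (suc a) (p * s) ws
  ΠΦ-suc a s ws = trans (cong prodℚ (map-cong (Φ-suc a s) ws))
    (trans (prodℚ-map-* (λ w → (w - p * (q * s)) * (q * w - s)) (Φ (suc a) (p * s)) ws)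
      (cong (_* ΠΦ (suc a) (p * s) ws) (prodℚ-map-* (λ w → w - p * (q * s)) (λ w → q * w - s) ws)))

module _ {p q : ℚ} (gen : Generic p q) where
  open Generic gen

  monomials-differ : ∀ a b c d {s x y} → s ≢ 0ℚ → (a ≡ c → b ≡ d → ⊥) → x ≡ p ^ a * q ^ b * s → y ≡ p ^ c * q ^ d * s → x - y ≢ 0ℚ
  monomials-differ a b c d {s} s≢0 h refl refl e = uncurry h (independent a b c d
    (x-y≡0⇒x≡y (*-cancelʳ-0 s≢0 (trans (sym (difference-scale (p ^ a * q ^ b) (p ^ c * q ^ d) s)) e))))

  -- The columns of a hook never meet the zeros forced by its first row.
  ΠΦ-hook-≢0 : ∀ a b {s} → s ≢ 0ℚ → Ladder.ΠΦ q p (suc b) s (str p a (p * s)) ≢ 0ℚ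
  ΠΦ-hook-≢0 a b {s} s≢0 = prodℚ-≢0 (map⁺ (All.map nonzero (str-All p a (p * s))))
    where
    nonzero : ∀ {z} → Σ ℕ (λ j → z ≡ p ^ j * (p * s)) → Ladder.Φ q p (suc b) s z ≢ 0ℚ
    nonzero (j , refl) = *-≢0
      (prodℚ-≢0 (applyUpTo⁺₂ _ b λ i → monomials-differ (suc j) 0 1 (suc i) s≢0 (λ _ ())
        (monomial-z (p ^ j) p s) (monomial-root (q ^ i) q p s)))
      (prodℚ-≢0 (applyUpTo⁺₂ _ b λ i → monomials-differ (suc (suc j)) 0 0 i s≢0 (λ ())
        (monomial-qz p (p ^ j) s) (1*Q*s (q ^ i) s)))

  boxes-factor-≢0 : ∀ μ {s} → s ≢ 0ℚ → prodℚ (map (λ w → p * w - s) (RowValues.boxes p q μ (p * (q * s)))) ≢ 0ℚ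
  boxes-factor-≢0 μ {s} s≢0 = prodℚ-≢0 (map⁺ (All.map nonzero (boxes-All p q μ (p * (q * s)))))
    where
    nonzero : ∀ {w} → Σ ℕ (λ i → Σ ℕ λ j → w ≡ p ^ i * q ^ j * (p * (q * s))) → p * w - s ≢ 0ℚ
    nonzero (i , j , refl) = monomials-differ (suc (suc i)) (suc j) 0 0 s≢0 (λ ()) (monomial-pw p q (p ^ i) (q ^ j) s) (1*1*s s)

-- Substituting the first row and then the rest of the first column, or the first column and then the rest of the first
-- row, leaves the same function of the inner diagram up to factors that do not vanish at its boxes.
module Hook {p q : ℚ} (gen : Generic p q) {s} (s≢0 : s ≢ 0ℚ) (a b : ℕ) (ι : List ℕ) {n F} (w : Wheeled p q n F)
  (n≡ : n ≡ suc a ℕ.+ (b ℕ.+ sum ι))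
  {G₁ G₂ G₁₂ G₂₁ : List ℚ → ℚ}
  (eq₁ : ∀ zs → length zs ≡ b ℕ.+ sum ι → F (str p (suc a) s ++ zs) ≡ Ladder.ΠΦ p q (suc a) s zs * G₁ zs)
  (eq₂ : ∀ zs → length zs ≡ a ℕ.+ sum ι → F (str q (suc b) s ++ zs) ≡ Ladder.ΠΦ q p (suc b) s zs * G₂ zs)
  (eq₁₂ : ∀ zs → length zs ≡ sum ι → G₁ (str q b (q * s) ++ zs) ≡ Ladder.ΠΦ q p b (q * s) zs * G₁₂ zs)
  (eq₂₁ : ∀ zs → length zs ≡ sum ι → G₂ (str p a (p * s) ++ zs) ≡ Ladder.ΠΦ p q a (p * s) zs * G₂₁ zs)
  (w₁₂ : Wheeled p q (sum ι) G₁₂) (w₂₁ : Wheeled p q (sum ι) G₂₁) where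

  private
    module R = RowTheory p q gen
    module C = RowTheory q p (generic-swap gen)
    A = str p a (p * s)
    B = str q b (q * s)
    C₁ = R.ΠΦ (suc a) s B
    C₂ = C.ΠΦ (suc b) s A
    u = p * (q * s)

  two-ways : ∀ ws → length ws ≡ sum ι →
    (C₁ * R.ΠΦ (suc a) s ws) * (C.ΠΦ b (q * s) ws * G₁₂ ws) ≡ (C₂ * C.ΠΦ (suc b) s ws) * (R.ΠΦ a (p * s) ws * G₂₁ ws)
  two-ways ws l = begin
    (C₁ * R.ΠΦ (suc a) s ws) * (C.ΠΦ b (q * s) ws * G₁₂ ws)
      ≡⟨ cong₂ _*_ (sym (prodℚ-map-++ (R.Φ (suc a) s) B ws)) (sym (eq₁₂ ws l)) ⟩
    R.ΠΦ (suc a) s (B ++ ws) * G₁ (B ++ ws)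
      ≡⟨ sym (eq₁ (B ++ ws) (trans (length-++ B) (cong₂ ℕ._+_ (length-str q b (q * s)) l))) ⟩
    F (s ∷ A ++ B ++ ws)
      ≡⟨ Wheeled.symmetric w (Permutation.prep s (PermP.shifts A B))
           (trans (cong suc (trans (length-++ A) (cong₂ ℕ._+_ (length-str p a (p * s)) (trans (length-++ B) (cong₂ ℕ._+_ (length-str q b (q * s)) l))))) (sym n≡)) ⟩
    F (s ∷ B ++ A ++ ws)
      ≡⟨ eq₂ (A ++ ws) (trans (length-++ A) (cong₂ ℕ._+_ (length-str p a (p * s)) l)) ⟩
    C.ΠΦ (suc b) s (A ++ ws) * G₂ (A ++ ws)
      ≡⟨ cong₂ _*_ (prodℚ-map-++ (C.Φ (suc b) s) A ws) (eq₂₁ ws l) ⟩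
    (C₂ * C.ΠΦ (suc b) s ws) * (R.ΠΦ a (p * s) ws * G₂₁ ws) ∎
    where open ≡-Reasoning

  inner-zero-empty : sum ι ≡ 0 → ∀ {e₁ e₂} → R.RowValue ι u G₁₂ e₁ → R.RowValue ι u G₂₁ e₂ → e₁ ≡ 0ℚ → e₂ ≡ 0ℚ
  inner-zero-empty z {e₁} {e₂} v₁ v₂ e₁≡0 = trans (sym (R.rowValue-empty ι z v₂))
    (*-cancelˡ-0 (ΠΦ-hook-≢0 gen a b s≢0) (trans (sym (empty-hook C₂ (G₂₁ []))) (trans (sym (two-ways [] (sym z)))
      (trans (empty-hook C₁ (G₁₂ [])) (*0≡0 (trans (R.rowValue-empty ι z v₁) e₁≡0))))))

module HookInner {p q : ℚ} (gen : Generic p q) {s} (s≢0 : s ≢ 0ℚ) (a b : ℕ) (ι : List ℕ) {G₁₂ G₂₁ : List ℚ → ℚ}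
  (w₁₂ : Wheeled p q (sum ι) G₁₂) (w₂₁ : Wheeled p q (sum ι) G₂₁) (C₁ C₂ : ℚ) (C₂≢0 : C₂ ≢ 0ℚ)
  (two-ways : ∀ ws → length ws ≡ sum ι →
    (C₁ * Ladder.ΠΦ p q (suc (suc a)) s ws) * (Ladder.ΠΦ q p (suc b) (q * s) ws * G₁₂ ws) ≡
    (C₂ * Ladder.ΠΦ q p (suc (suc b)) s ws) * (Ladder.ΠΦ p q (suc a) (p * s) ws * G₂₁ ws)) where

  open ≡-Reasoning

  private
    module R = RowTheory p q gen
    module C = RowTheory q p (generic-swap gen)
    n = sum ι
    u = p * (q * s)
    -- The corner contributes `w - pqs` in both orders, collected in `U` and cancelled. Its second
    -- factor is `H₁` when the row goes first and `H₂` when the column does, and these are the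
    -- twists that remain.
    H₁ H₂ : ℚ → ℚ
    H₁ w = q * w - s
    H₂ w = p * w - s
    ps≢0 = *-≢0 R.p≢0 s≢0
    qs≢0 = *-≢0 R.q≢0 s≢0
    H₁p : PolyFun H₁
    H₁p hp = poly-- (poly-* (poly-const q) hp) (poly-const s)
    H₂p : PolyFun H₂
    H₂p hp = poly-- (poly-* (poly-const p) hp) (poly-const s)
    U P Q : List ℚ → ℚ
    U ws = prodℚ (map (λ w → w - u) ws)
    P ws = R.ΠΦ (suc a) (p * s) ws
    Q ws = C.ΠΦ (suc b) (q * s) ws
    U-at-0 : ∀ k → U (toList (zeros k)) ≢ 0ℚ
    U-at-0 zero ()
    U-at-0 (suc k) = *-≢0 (0-x≢0 (*-≢0 R.p≢0 qs≢0)) (U-at-0 k)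
    expand₁ : ∀ ws → (C₁ * R.ΠΦ (suc (suc a)) s ws) * (Q ws * G₁₂ ws) ≡ (U ws * P ws * Q ws) * (C₁ * (G₁₂ ws * prodℚ (map H₁ ws)))
    expand₁ ws = begin
      (C₁ * R.ΠΦ (suc (suc a)) s ws) * (Q ws * G₁₂ ws) ≡⟨ cong (λ x → (C₁ * x) * (Q ws * G₁₂ ws)) (ΠΦ-suc p q a s ws) ⟩
      (C₁ * ((U ws * prodℚ (map H₁ ws)) * P ws)) * (Q ws * G₁₂ ws) ≡⟨ hook-cancel C₁ (U ws) _ (P ws) (Q ws) (G₁₂ ws) ⟩
      (U ws * P ws * Q ws) * (C₁ * (G₁₂ ws * prodℚ (map H₁ ws))) ∎
    expand₂ : ∀ ws → (C₂ * C.ΠΦ (suc (suc b)) s ws) * (P ws * G₂₁ ws) ≡ (U ws * P ws * Q ws) * (C₂ * (G₂₁ ws * prodℚ (map H₂ ws)))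
    expand₂ ws = begin
      (C₂ * C.ΠΦ (suc (suc b)) s ws) * (P ws * G₂₁ ws) ≡⟨ cong (λ x → (C₂ * x) * (P ws * G₂₁ ws)) (ΠΦ-suc q p b s ws) ⟩
      (C₂ * ((prodℚ (map (λ w → w - q * (p * s)) ws) * prodℚ (map H₂ ws)) * Q ws)) * (P ws * G₂₁ ws)
        ≡⟨ cong (λ y → (C₂ * ((prodℚ (map (λ w → w - y) ws) * prodℚ (map H₂ ws)) * Q ws)) * (P ws * G₂₁ ws)) (t*[p*s] q p s) ⟩
      (C₂ * ((U ws * prodℚ (map H₂ ws)) * Q ws)) * (P ws * G₂₁ ws) ≡⟨ hook-cancel′ C₂ (U ws) _ (P ws) (Q ws) (G₂₁ ws) ⟩
      (U ws * P ws * Q ws) * (C₂ * (G₂₁ ws * prodℚ (map H₂ ws))) ∎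
    pl = polyList-toList n
    on-Vec : ∀ (v : Vec ℚ n) → C₁ * (G₁₂ (toList v) * prodℚ (map H₁ (toList v))) ≡ C₂ * (G₂₁ (toList v) * prodℚ (map H₂ (toList v)))
    on-Vec = poly-cancel {h = λ v → U (toList v) * P (toList v) * Q (toList v)}
      (poly-* (poly-* (poly-prodList (λ w → w - u) (λ hp → poly-- hp (poly-const u)) pl)
        (poly-prodList (R.Φ (suc a) (p * s)) (R.poly-Φ (suc a) (poly-const (p * s))) pl))
        (poly-prodList (C.Φ (suc b) (q * s)) (C.poly-Φ (suc b) (poly-const (q * s))) pl))
      (poly-* (poly-const C₁) (poly-* (Wheeled.poly w₁₂) (poly-prodList H₁ H₁p pl)))
      (poly-* (poly-const C₂) (poly-* (Wheeled.poly w₂₁) (poly-prodList H₂ H₂p pl)))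
      (λ v → trans (sym (expand₁ (toList v))) (trans (two-ways (toList v) (length-toList v)) (expand₂ (toList v))))
      (zeros n) (*-≢0 (*-≢0 (U-at-0 n) (R.ΠΦ-at-0 (suc a) ps≢0 n)) (C.ΠΦ-at-0 (suc b) qs≢0 n))

  inner-zero : ∀ {e₁ e₂} → R.RowValue ι u G₁₂ e₁ → R.RowValue ι u G₂₁ e₂ → e₁ ≡ 0ℚ → e₂ ≡ 0ℚ
  inner-zero {e₁} {e₂} v₁ v₂ e₁≡0 = *-cancelʳ-0 (boxes-factor-≢0 gen ι s≢0) (*-cancelˡ-0 C₂≢0 (trans
    (sym (R.rowValue-compare ι (*-≢0 R.p≢0 qs≢0) v₁ v₂ C₁ C₂ H₁ H₂ H₁p H₂p
      (λ zs l → transport (λ zs → C₁ * (G₁₂ zs * prodℚ (map H₁ zs)) ≡ C₂ * (G₂₁ zs * prodℚ (map H₂ zs))) (toList-toVec n zs l) (on-Vec (toVec n zs)))))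
    (*0≡0 (0*≡0 e₁≡0))))

wheeled-size : ∀ {p q m n F} → m ≡ n → Wheeled p q m F → Wheeled p q n F
wheeled-size refl w = w

-- Without its first row the diagram is covered by induction: the vanishing row value of `G₁` gives
-- the column value whose first step removes the rest of the first column and leaves `G₁₂`.
-- Induction on the inner diagram turns this back into a row value of `G₁₂`, and the hook comparison
-- carries its vanishing to `G₂₁`, obtained with the first column removed first. That is a row value
-- of `G₂`, and induction on the diagram without its first column ends the circle. The number `k`
-- bounds the total number of rows and columns.
rowValue-transpose : ∀ k p q (gen : Generic p q) μ ν {s F e e′} → length μ ℕ.+ length ν ≤ k → Transposed μ ν → s ≢ 0ℚ →
  Wheeled p q (sum μ) F → RowValues.RowValue p q μ s F e → RowValues.RowValue q p ν s F e′ → e ≡ 0ℚ → e′ ≡ 0ℚ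
rowValue-transpose-empty : ∀ p q μ ν {s F e e′} → sum μ ≡ 0 × sum ν ≡ 0 →
  RowValues.RowValue p q μ s F e → RowValues.RowValue q p ν s F e′ → e ≡ 0ℚ → e′ ≡ 0ℚ
rowValue-transpose-empty p q μ ν (z , z′) v v′ e≡0 =
  trans (sym (RowValues.rowValue-empty q p ν z′ v′)) (trans (RowValues.rowValue-empty p q μ z v) e≡0)
rowValue-transpose k p q gen [] ν {F = F} l t s≢0 w v v′ = rowValue-transpose-empty p q [] ν {F = F} (refl , empty-row t) v v′
rowValue-transpose k p q gen (a ∷ ρ) [] {F = F} l t s≢0 w v v′ =
  rowValue-transpose-empty p q (a ∷ ρ) [] {F = F} (empty-row (transposed-sym t) , refl) v v′
rowValue-transpose k p q gen (zero ∷ ρ) (b ∷ γ) {F = F} l t s≢0 w v v′ =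
  rowValue-transpose-empty p q (zero ∷ ρ) (b ∷ γ) (zero-row⇒empty t) v v′
rowValue-transpose k p q gen (suc a ∷ ρ) (zero ∷ γ) {F = F} l t s≢0 w v v′ =
  rowValue-transpose-empty p q (suc a ∷ ρ) (zero ∷ γ) {F = F} (let (x , y) = zero-row⇒empty (transposed-sym t) in y , x) v v′
rowValue-transpose (suc k) p q gen (suc a ∷ ρ) (suc b ∷ γ) {s} {F} {e} {e′} (s≤s l) t s≢0 w (G₁ , w₁ , eq₁ , v₁) (G₂ , w₂ , eq₂ , v₂) e≡0 =
  rowValue-transpose k p q gen (a ∷ κ) γ l₂ (remove-column t) ps≢0 w₂′ (G₂₁ , w₂₁ , eq₂₁ , v₂₁) v₂ e₂≡0
  where
  module R = RowTheory p q gen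
  module C = RowTheory q p (generic-swap gen)
  κ = map ℕ.pred ρ
  η = map ℕ.pred γ
  ps≢0 = *-≢0 R.p≢0 s≢0
  qs≢0 = *-≢0 R.q≢0 s≢0
  l₁ : length ρ ℕ.+ suc (length η) ≤ k
  l₁ = transport (λ x → length ρ ℕ.+ suc x ≤ k) (sym (length-map ℕ.pred γ)) l
  l₂ : suc (length κ) ℕ.+ length γ ≤ k
  l₂ = transport (λ x → suc x ℕ.+ length γ ≤ k) (sym (length-map ℕ.pred ρ)) (≤-trans (≤-reflexive (sym (+-suc (length ρ) (length γ)))) l)
  l₃ : length η ℕ.+ length κ ≤ k
  l₃ = ≤-trans (≤-reflexive (+-comm (length η) (length κ)))
    (≤-trans (+-monoʳ-≤ (length κ) (n≤1+n _)) (transport (λ x → x ℕ.+ suc (length η) ≤ k) (sym (length-map ℕ.pred ρ)) l₁))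
  inner : Transposed κ η
  inner = remove-column (remove-row t)
  size₃ : sum κ ≡ sum η
  size₃ = sum-transposed (length κ ℕ.+ length η) κ η ≤-refl inner
  size₁ : sum ρ ≡ b ℕ.+ sum η
  size₁ = sum-transposed (length ρ ℕ.+ suc (length η)) ρ (b ∷ η) ≤-refl (remove-row t)
  size₂ : a ℕ.+ sum κ ≡ sum γ
  size₂ = sum-transposed (suc (length κ) ℕ.+ length γ) (a ∷ κ) γ ≤-refl (remove-column t)
  w₂′ : Wheeled p q (a ℕ.+ sum κ) G₂
  w₂′ = wheeled-size (sym size₂) (wheeled-swap w₂)
  first-column = C.rowValue-exists (b ∷ η) qs≢0 (wheeled-size size₁ (wheeled-swap w₁))
  e₁ = proj₁ first-column
  G₁₂ = proj₁ (proj₂ first-column)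
  w₁₂ = proj₁ (proj₂ (proj₂ first-column))
  eq₁₂ = proj₁ (proj₂ (proj₂ (proj₂ first-column)))
  v₁₂ = proj₂ (proj₂ (proj₂ (proj₂ first-column)))
  first-row = R.rowValue-exists (a ∷ κ) ps≢0 w₂′
  e₂ = proj₁ first-row
  G₂₁ = proj₁ (proj₂ first-row)
  w₂₁ = proj₁ (proj₂ (proj₂ first-row))
  eq₂₁ = proj₁ (proj₂ (proj₂ (proj₂ first-row)))
  v₂₁ = proj₂ (proj₂ (proj₂ (proj₂ first-row)))
  e₁≡0 : e₁ ≡ 0ℚ
  e₁≡0 = rowValue-transpose k p q gen ρ (b ∷ η) l₁ (remove-row t) qs≢0 w₁ v₁ (G₁₂ , w₁₂ , eq₁₂ , v₁₂) e≡0
  w₁₂′ : Wheeled p q (sum κ) G₁₂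
  w₁₂′ = wheeled-size (sym size₃) (wheeled-swap w₁₂)
  third = R.rowValue-exists κ {p * (q * s)} (*-≢0 R.p≢0 qs≢0) w₁₂′
  e₃ = proj₁ third
  v₃ = proj₂ third
  e₃≡0 : e₃ ≡ 0ℚ
  e₃≡0 = rowValue-transpose k q p (generic-swap gen) η κ l₃ (transposed-sym inner) (*-≢0 R.p≢0 qs≢0) w₁₂ v₁₂ v₃ e₁≡0
  v₂₁′ : R.RowValue κ (p * (q * s)) G₂₁ e₂
  v₂₁′ = transport (λ u → R.RowValue κ u G₂₁ e₂) (t*[p*s] q p s) v₂₁
  module hook = Hook gen s≢0 a b κ {F = F} w
    (cong (suc a ℕ.+_) (trans size₁ (cong (b ℕ.+_) (sym size₃))))
    (λ zs l → eq₁ zs (trans l (trans (cong (b ℕ.+_) size₃) (sym size₁)))) (λ zs l → eq₂ zs (trans l size₂))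
    (λ zs l → eq₁₂ zs (trans l size₃)) eq₂₁ w₁₂′ w₂₁
  e₂≡0 : e₂ ≡ 0ℚ
  e₂≡0 = go a b refl refl
    where
    go : ∀ a′ b′ → a ≡ a′ → b ≡ b′ → e₂ ≡ 0ℚ
    -- If the first row or the first column has a single box, the inner diagram is empty, and the
    -- two orders are compared at the empty list without splitting off corner factors.
    go zero b′ refl refl = hook.inner-zero-empty (proj₁ (zero-row⇒empty (remove-column t))) v₃ v₂₁′ e₃≡0
    go (suc a″) zero refl refl = hook.inner-zero-empty (trans size₃ (proj₁ (zero-row⇒empty (transposed-sym (remove-row t))))) v₃ v₂₁′ e₃≡0
    go (suc a″) (suc b″) refl refl = HookInner.inner-zero gen s≢0 a″ b″ κ w₁₂′ w₂₁ _ _ (ΠΦ-hook-≢0 gen a b s≢0) hook.two-ways v₃ v₂₁′ e₃≡0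

-- Polynomials with exponents in a given range

record Ranged (e l : ℕ) (h : ℚ → ℚ) : Set where
  constructor ranged
  field
    coefficients : List ℚ
    length-coefficients : length coefficients ≡ l
    expansion : ∀ t → h t ≡ t ^ e * horner coefficients t

opaque
  unfolding _+_

  scale-step : ∀ c x t y → c * x + t * (c * y) ≡ c * (x + t * y)
  scale-step = solve-∀ ringℚ

  root-of-linear : ∀ a r b → a * (- (r * b)) + b ≡ (1ℚ - a * r) * b
  root-of-linear = solve-∀ ringℚ

  linear-from-root : ∀ a t b x → a * x + b ≡ 0ℚ → a * t + b ≡ (t - x) * a
  linear-from-root a t b x e = trans (split a t b x) (trans (cong ((t - x) * a +_) e) (x+0≡x ((t - x) * a)))
    where
    split : ∀ a t b x → a * t + b ≡ (t - x) * a + (a * x + b)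
    split = solve-∀ ringℚ

  swap-power : ∀ T d H → T * (d * H) ≡ d * (T * H)
  swap-power = solve-∀ ringℚ

  unscale : ∀ a r g T H → a * r ≡ 1ℚ → a * g ≡ T * H → g ≡ T * (r * H)
  unscale a r g T H e e′ = trans (sym (trans (cong (_* g) e) (F.*-identityˡ g)))
    (trans (assoc a r g) (trans (cong (r *_) e′) (comm r T H)))
    where
    assoc : ∀ a r g → a * r * g ≡ r * (a * g)
    assoc = solve-∀ ringℚ
    comm : ∀ r T H → r * (T * H) ≡ T * (r * H)
    comm = solve-∀ ringℚ

  hi-linear : ∀ α t β y → α * t - β * y ≡ α * t + - (β * y)
  hi-linear = solve-∀ ringℚ

  lo-linear : ∀ α t β y → α * y - β * t ≡ (- β) * t + α * y
  lo-linear = solve-∀ ringℚ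

horner-scale : ∀ c cs t → horner (map (c *_) cs) t ≡ c * horner cs t
horner-scale c [] t = sym (F.zeroʳ c)
horner-scale c (x ∷ cs) t = trans (cong (λ y → c * x + t * y) (horner-scale c cs t)) (scale-step c x t (horner cs t))

poly-horner-list : ∀ {n} {h : Vec ℚ n → ℚ} cs → IsPoly n h → IsPoly n (λ v → horner cs (h v))
poly-horner-list [] hp = poly-const 0ℚ
poly-horner-list (c ∷ cs) hp = poly-+ (poly-const c) (poly-* hp (poly-horner-list cs hp))

Poly₁ : (ℚ → ℚ) → Set
Poly₁ g = IsPoly 1 (g ∘ head)

poly₁-id : Poly₁ id
poly₁-id = poly-resp (λ { (t ∷ v) → refl }) (poly-var 0F)

poly₁-cancel : ∀ {h k l} → Poly₁ h → Poly₁ k → Poly₁ l → (∀ t → h t * k t ≡ h t * l t) → ∀ t₀ → h t₀ ≢ 0ℚ → ∀ t → k t ≡ l t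
poly₁-cancel hp kp lp e t₀ ne t = poly-cancel hp kp lp (e ∘ head) (t₀ ∷ []) ne (t ∷ [])

-- The root of `a * t + b` is nonzero, so it is a root of the list of coefficients and not of
-- `t ^ e`: the division costs exactly one coefficient and keeps the lowest exponent.
ranged-linear : ∀ {e l g} a b → a ≢ 0ℚ → b ≢ 0ℚ → Poly₁ g → Ranged e (suc l) (λ t → (a * t + b) * g t) → Ranged e l g
ranged-linear {e} {l} {g} a b a≢0 b≢0 gp (ranged (c ∷ cs) len eq) =
  ranged (map (r *_) ds) (trans (length-map (r *_) ds) (trans (length-quotient x c cs) (suc-injective len)))
  λ t → trans (unscale a r (g t) (t ^ e) (horner ds t) ar≡1 (a*g t)) (cong (t ^ e *_) (sym (horner-scale r ds t)))
  where
  r = proj₁ (invℚ a a≢0)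
  ar≡1 = proj₂ (invℚ a a≢0)
  x = - (r * b)
  root : a * x + b ≡ 0ℚ
  root = trans (root-of-linear a r b) (0*≡0 (x≡y⇒x-y≡0 (sym ar≡1)))
  r≢0 : r ≢ 0ℚ
  r≢0 r≡0 with trans (sym ar≡1) (*0≡0 r≡0)
  ... | ()
  x≢0 : x ≢ 0ℚ
  x≢0 = neg-≢0 (*-≢0 r≢0 b≢0)
  ds = quotient x (c ∷ cs)
  cs-root : horner (c ∷ cs) x ≡ 0ℚ
  cs-root = *-cancelˡ-0 (^-≢0 e x≢0) (trans (sym (eq x)) (0*≡0 root))
  a*g : ∀ t → a * g t ≡ t ^ e * horner ds t
  a*g = poly₁-cancel {λ t → t - x} (poly-- poly₁-id (poly-const x)) (poly-* (poly-const a) gp)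
    (poly-* (poly-^ e poly₁-id) (poly-horner-list ds poly₁-id))
    (λ t → begin
      (t - x) * (a * g t)                ≡⟨ sym (F.*-assoc (t - x) a (g t)) ⟩
      (t - x) * a * g t                  ≡⟨ cong (_* g t) (sym (linear-from-root a t b x root)) ⟩
      (a * t + b) * g t                  ≡⟨ eq t ⟩
      t ^ e * horner (c ∷ cs) t          ≡⟨ cong (t ^ e *_) (quotient-root x (c ∷ cs) t cs-root) ⟩
      t ^ e * ((t - x) * horner ds t)    ≡⟨ swap-power (t ^ e) (t - x) (horner ds t) ⟩
      (t - x) * (t ^ e * horner ds t)    ∎)
    0ℚ (0-x≢0 x≢0)
    where open ≡-Reasoning

ranged-const : ∀ {e l g} c → c ≢ 0ℚ → Ranged e l (λ t → c * g t) → Ranged e l g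
ranged-const {e} {g = g} c c≢0 (ranged cs len eq) = ranged (map (r *_) cs) (trans (length-map (r *_) cs) len)
  λ t → trans (unscale c r (g t) (t ^ e) (horner cs t) cr≡1 (eq t)) (cong (t ^ e *_) (sym (horner-scale r cs t)))
  where
  r = proj₁ (invℚ c c≢0)
  cr≡1 = proj₂ (invℚ c c≢0)

ranged-resp : ∀ {e l g h} → (∀ t → g t ≡ h t) → Ranged e l g → Ranged e l h
ranged-resp eq (ranged cs len eq′) = ranged cs len λ t → trans (sym (eq t)) (eq′ t)

involves : ∀ {m} → Fin m → Form m → ℕ
involves k f with Form.hi f Fin.≟ k | Form.lo f Fin.≟ k
... | no _ | no _ = 0
... | _ | _ = 1

occurrences : ∀ {m} → Fin m → List (Form m) → ℕ
occurrences k fs = sum (map (involves k) fs)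

module _ {m} (k : Fin m) (y : Vec ℚ m) (y≢0 : ∀ i → lookup y i ≢ 0ℚ) where

  private
    at : ℚ → Vec ℚ m
    at t = y Vec.[ k ]≔ t

    at-poly : ∀ {h} → IsPoly m h → Poly₁ (h ∘ at)
    at-poly {h} hp = poly-∘ (λ w → at (head w)) hp coordinate
      where
      coordinate : ∀ i → IsPoly 1 (λ w → lookup (at (head w)) i)
      coordinate i with i Fin.≟ k
      ... | yes refl = poly-resp (λ w → sym (lookup∘update i y (head w))) poly₁-id
      ... | no i≢k = poly-resp (λ w → sym (lookup∘update′ i≢k y (head w))) (poly-const (lookup y i))

  ranged-form : ∀ {e l g} (f : Form m) → value f y ≢ 0ℚ → Poly₁ g →
    Ranged e (involves k f ℕ.+ l) (λ t → value f (at t) * g t) → Ranged e l g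
  ranged-form {g = g} f@(form hi lo lo<hi α β α≢0 β≢0) ne gp rg with hi Fin.≟ k | lo Fin.≟ k
  ... | yes refl | yes refl = ⊥-elim (<-irrefl refl lo<hi)
  ... | yes refl | no lo≢k = ranged-linear α (- (β * lookup y lo)) α≢0 (neg-≢0 (*-≢0 β≢0 (y≢0 lo))) gp
    (ranged-resp (λ t → cong (_* g t) (trans (cong₂ (λ x z → α * x - β * z) (lookup∘update k y t) (lookup∘update′ lo≢k y t))
      (hi-linear α t β (lookup y lo)))) rg)
  ... | no hi≢k | yes refl = ranged-linear (- β) (α * lookup y hi) (neg-≢0 β≢0) (*-≢0 α≢0 (y≢0 hi)) gp
    (ranged-resp (λ t → cong (_* g t) (trans (cong₂ (λ x z → α * x - β * z) (lookup∘update′ hi≢k y t) (lookup∘update k y t))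
      (lo-linear α t β (lookup y hi)))) rg)
  ... | no hi≢k | no lo≢k = ranged-const (value f y) ne
    (ranged-resp (λ t → cong (_* g t) (cong₂ (λ x z → α * x - β * z) (lookup∘update′ hi≢k y t) (lookup∘update′ lo≢k y t))) rg)

  -- As a function of the coordinate `k`, a form through it is linear with two nonzero coefficients
  -- and costs one coefficient; every other form is a nonzero constant and costs none.
  ranged-product : ∀ {e l g} fs → product fs y ≢ 0ℚ → IsPoly m g →
    Ranged e (occurrences k fs ℕ.+ l) (λ t → product fs (at t) * g (at t)) → Ranged e l (g ∘ at)
  ranged-product {g = g} [] ne gp rg = ranged-resp (λ t → F.*-identityˡ (g (at t))) rg
  ranged-product {e} {l} {g} (f ∷ fs) ne gp rg = ranged-product {g = g} fs (λ z → ne (*0≡0 z)) gp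
    (ranged-form {g = λ t → product fs (at t) * g (at t)} f (λ z → ne (0*≡0 z)) (at-poly (poly-* (poly-product fs) gp))
      (transport (λ x → Ranged e x (λ t → value f (at t) * (product fs (at t) * g (at t)))) (+-assoc (involves k f) (occurrences k fs) l)
        (ranged-resp (λ t → F.*-assoc (value f (at t)) (product fs (at t)) (g (at t))) rg)))

-- Blocks of strings

Blocks : Set
Blocks = List (ℕ × ℚ)

strings : ℚ → Blocks → List ℚ
strings p [] = []
strings p ((a , y) ∷ L) = str p a y ++ strings p L

strings-↭ : ∀ p {L L′} → L ↭ L′ → strings p L ↭ strings p L′
strings-↭ p Permutation.refl = ↭-refl
strings-↭ p (Permutation.prep (a , y) e) = ++⁺ˡ (str p a y) (strings-↭ p e)
strings-↭ p (Permutation.swap (a , y) (b , z) e) =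
  ↭-trans (PermP.shifts (str p a y) (str p b z)) (++⁺ˡ (str p b z) (++⁺ˡ (str p a y) (strings-↭ p e)))
strings-↭ p (Permutation.trans e e′) = ↭-trans (strings-↭ p e) (strings-↭ p e′)

strings-++ : ∀ p L L′ → strings p (L ++ L′) ≡ strings p L ++ strings p L′
strings-++ p [] L′ = refl
strings-++ p ((a , y) ∷ L) L′ = trans (cong (str p a y ++_) (strings-++ p L L′)) (sym (++-assoc (str p a y) (strings p L) (strings p L′)))

length-strings : ∀ p L → length (strings p L) ≡ sum (map proj₁ L)
length-strings p [] = refl
length-strings p ((a , y) ∷ L) = trans (length-++ (str p a y)) (cong₂ ℕ._+_ (length-str p a y) (length-strings p L))

Indexed : ℕ → Set
Indexed m = List (ℕ × Fin m)

blocks : ∀ {m} → Indexed m → Vec ℚ m → Blocks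
blocks ib y = map (λ { (a , i) → a , lookup y i }) ib

total : ∀ {m} → Indexed m → ℕ
total ib = sum (map proj₁ ib)

polyList-strings : ∀ {m} p (ib : Indexed m) → PolyList m (total ib) (λ y → strings p (blocks ib y))
polyList-strings p [] = polyList-[]
polyList-strings p ((a , i) ∷ ib) = polyList-++ (polyList-str p a (poly-var i)) (polyList-strings p ib)

str-applyUpTo : ∀ p a s → str p a s ≡ applyUpTo (λ k → p ^ k * s) a
str-applyUpTo p zero s = refl
str-applyUpTo p (suc a) s = cong₂ _∷_ (sym (F.*-identityˡ s))
  (trans (str-applyUpTo p a (p * s)) (applyUpTo-cong a (λ k → str-step p (p ^ k) s)))

product-concat-applyUpTo : ∀ {n} (g : ℕ → List (Form n)) b v →
  product (List.concat (applyUpTo g b)) v ≡ prodℚ (applyUpTo (λ k → product (g k) v) b)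
product-concat-applyUpTo g zero v = refl
product-concat-applyUpTo g (suc b) v = trans (product-++ (g 0) (List.concat (applyUpTo (g ∘ suc) b)) v)
  (cong (product (g 0) v *_) (product-concat-applyUpTo (g ∘ suc) b v))

Above : ∀ {m} → Fin m → ℕ × Fin m → Set
Above i x = i Fin.< proj₂ x

Ordered : ∀ {m} → ℕ × Fin m → ℕ × Fin m → Set
Ordered x y = Above (proj₂ x) y × proj₁ y ≤ proj₁ x

opaque
  unfolding _+_

  P*1*x : ∀ P x → P * 1ℚ * x ≡ P * x
  P*1*x = solve-∀ ringℚ

  P*[q*1]*x : ∀ P q x → P * (q * 1ℚ) * x ≡ q * (P * x)
  P*[q*1]*x = solve-∀ ringℚ

-- F vanishes at all blocks obtained by moving t ≥ 1 boxes of a diagram with row lengths μ from a row to a longer one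
-- (up to the order of the rows).
RaisedVanish : ℚ → List ℕ → (List ℚ → ℚ) → Set
RaisedVanish p μ F = ∀ t c d y z (L : Blocks) → 1 ≤ t → c < d → (t ℕ.+ c) ∷ d ∷ map proj₁ L ↭ μ →
  F (strings p ((t ℕ.+ d , y) ∷ (c , z) ∷ L)) ≡ 0ℚ

module GordonForms (p q : ℚ) (gen : Generic p q) {m : ℕ} where
  open RowTheory p q gen

  wheelAt : ∀ (a : ℕ) (i j : Fin m) → i Fin.< j → ℕ → List (Form m)
  wheelAt a i j lt k = xforms j i lt k 0 1 1 (a ∸ 1) ++ xforms j i lt k 1 0 0 (a ∸ 1)

  pairWheel : ∀ (a : ℕ) (i : Fin m) (b : ℕ) (j : Fin m) → i Fin.< j → List (Form m)
  pairWheel a i b j lt = List.concat (applyUpTo (wheelAt a i j lt) b)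

  -- The zeros y_j = pᵗ y_i (a - b < t ≤ a) and pᵗ y_j = y_i (0 < t ≤ b), at which two strings merge into a longer one.
  pairGordon : ∀ (a : ℕ) (i : Fin m) (b : ℕ) (j : Fin m) → i Fin.< j → List (Form m)
  pairGordon a i b j lt = applyUpTo (λ k → mform j i lt 0 0 ((a ∸ b) ℕ.+ suc k) 0) b ++ applyUpTo (λ k → mform j i lt (suc k) 0 0 0) b

  rowWheel rowGordon : ∀ (a : ℕ) (i : Fin m) {ib : Indexed m} → All (Above i) ib → List (Form m)
  rowWheel a i [] = []
  rowWheel a i {(b , j) ∷ ib} (lt ∷ lts) = pairWheel a i b j lt ++ rowWheel a i lts
  rowGordon a i [] = []
  rowGordon a i {(b , j) ∷ ib} (lt ∷ lts) = pairGordon a i b j lt ++ rowGordon a i lts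

  rowForms : ∀ (a : ℕ) (i : Fin m) {ib : Indexed m} → All (Above i) ib → List (Form m)
  rowForms a i lts = rowWheel a i lts ++ rowGordon a i lts

  forms gordonForms : ∀ {ib : Indexed m} → AllPairs Ordered ib → List (Form m)
  forms [] = []
  forms {(a , i) ∷ ib} (o ∷ os) = rowForms a i (All.map proj₁ o) ++ forms os
  gordonForms [] = []
  gordonForms {(a , i) ∷ ib} (o ∷ os) = rowGordon a i (All.map proj₁ o) ++ gordonForms os

  wheelFactor : Blocks → ℚ
  wheelFactor [] = 1ℚ
  wheelFactor ((a , y) ∷ L) = ΠΦ a y (strings p L) * wheelFactor L

  product-wheelAt : ∀ a i j lt k y → product (wheelAt a i j lt k) y ≡ Φ a (lookup y i) (p ^ k * lookup y j)
  product-wheelAt a i j lt k y = trans (product-++ (xforms j i lt k 0 1 1 (a ∸ 1)) (xforms j i lt k 1 0 0 (a ∸ 1)) y)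
    (cong₂ _*_ (trans (product-xforms j i lt k 0 1 1 (a ∸ 1) y) (cong₂ (ladder (a ∸ 1)) (p*1*[q*1]*x p q (lookup y i)) (P*1*x (p ^ k) (lookup y j))))
      (trans (product-xforms j i lt k 1 0 0 (a ∸ 1) y) (cong₂ (ladder (a ∸ 1)) (1*1*x (lookup y i)) (P*[q*1]*x (p ^ k) q (lookup y j)))))

  product-pairWheel : ∀ a i b j lt y → product (pairWheel a i b j lt) y ≡ ΠΦ a (lookup y i) (str p b (lookup y j))
  product-pairWheel a i b j lt y = trans (product-concat-applyUpTo (wheelAt a i j lt) b y)
    (cong prodℚ (trans (applyUpTo-cong b (λ k → product-wheelAt a i j lt k y))
      (sym (trans (cong (map (Φ a (lookup y i))) (str-applyUpTo p b (lookup y j))) (ListP.map-applyUpTo (λ k → p ^ k * lookup y j) (Φ a (lookup y i)) b)))))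

  product-rowWheel : ∀ a i {ib} (lts : All (Above i) ib) y → product (rowWheel a i lts) y ≡ ΠΦ a (lookup y i) (strings p (blocks ib y))
  product-rowWheel a i [] y = refl
  product-rowWheel a i {(b , j) ∷ ib} (lt ∷ lts) y = trans (product-++ (pairWheel a i b j lt) (rowWheel a i lts) y)
    (trans (cong₂ _*_ (product-pairWheel a i b j lt y) (product-rowWheel a i lts y))
      (sym (prodℚ-map-++ (Φ a (lookup y i)) (str p b (lookup y j)) (strings p (blocks ib y)))))

  product-forms : ∀ {ib} (os : AllPairs Ordered ib) y → product (forms os) y ≡ wheelFactor (blocks ib y) * product (gordonForms os) y
  product-forms [] y = sym (F.*-identityˡ 1ℚ)
  product-forms {(a , i) ∷ ib} (o ∷ os) y = begin
    product ((rowWheel a i lts ++ rowGordon a i lts) ++ forms os) y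
      ≡⟨ product-++ (rowWheel a i lts ++ rowGordon a i lts) (forms os) y ⟩
    product (rowWheel a i lts ++ rowGordon a i lts) y * product (forms os) y
      ≡⟨ cong₂ _*_ (product-++ (rowWheel a i lts) (rowGordon a i lts) y) (product-forms os y) ⟩
    (product (rowWheel a i lts) y * product (rowGordon a i lts) y) * (wheelFactor (blocks ib y) * product (gordonForms os) y)
      ≡⟨ ladder-pair (product (rowWheel a i lts) y) (product (rowGordon a i lts) y) (wheelFactor (blocks ib y)) (product (gordonForms os) y) ⟩
    (product (rowWheel a i lts) y * wheelFactor (blocks ib y)) * (product (rowGordon a i lts) y * product (gordonForms os) y)
      ≡⟨ cong₂ _*_ (cong (_* wheelFactor (blocks ib y)) (product-rowWheel a i lts y)) (sym (product-++ (rowGordon a i lts) (gordonForms os) y)) ⟩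
    wheelFactor (blocks ((a , i) ∷ ib) y) * product (gordonForms (o ∷ os)) y ∎
    where
    open ≡-Reasoning
    lts = All.map proj₁ o

  Between : Fin m → Fin m → Form m → Set
  Between i j f = Form.hi f ≡ j × Form.lo f ≡ i

  pairWheel-between : ∀ a i b j lt → All (Between i j) (pairWheel a i b j lt)
  pairWheel-between a i b j lt = concat⁺ (applyUpTo⁺₂ _ b (λ k →
    ++⁺ (applyUpTo⁺₂ _ (a ∸ 1) (λ _ → refl , refl)) (applyUpTo⁺₂ _ (a ∸ 1) (λ _ → refl , refl))))

  pairGordon-between : ∀ a i b j lt → All (Between i j) (pairGordon a i b j lt)
  pairGordon-between a i b j lt = ++⁺ (applyUpTo⁺₂ _ b (λ _ → refl , refl)) (applyUpTo⁺₂ _ b (λ _ → refl , refl))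

  rowWheel-lo : ∀ a i {ib} (lts : All (Above i) ib) → All (λ f → Form.lo f ≡ i) (rowWheel a i lts)
  rowWheel-lo a i [] = []
  rowWheel-lo a i {(b , j) ∷ ib} (lt ∷ lts) = ++⁺ (All.map proj₂ (pairWheel-between a i b j lt)) (rowWheel-lo a i lts)

  rowGordon-lo : ∀ a i {ib} (lts : All (Above i) ib) → All (λ f → Form.lo f ≡ i) (rowGordon a i lts)
  rowGordon-lo a i [] = []
  rowGordon-lo a i {(b , j) ∷ ib} (lt ∷ lts) = ++⁺ (All.map proj₂ (pairGordon-between a i b j lt)) (rowGordon-lo a i lts)

  rowGordon-hi : ∀ {P : Fin m → Set} a i {ib} (lts : All (Above i) ib) → All (P ∘ proj₂) ib → All (P ∘ Form.hi) (rowGordon a i lts)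
  rowGordon-hi a i [] [] = []
  rowGordon-hi {P} a i {(b , j) ∷ ib} (lt ∷ lts) (x ∷ xs) =
    ++⁺ (All.map (λ e → transport P (sym (proj₁ e)) x) (pairGordon-between a i b j lt)) (rowGordon-hi {P} a i lts xs)

  forms-lo : ∀ {P : Fin m → Set} {ib} (os : AllPairs Ordered ib) → All (P ∘ proj₂) ib → All (P ∘ Form.lo) (forms os)
  forms-lo [] [] = []
  forms-lo {P} {(a , i) ∷ ib} (o ∷ os) (x ∷ xs) = ++⁺
    (All.map (λ e → transport P (sym e) x) (++⁺ (rowWheel-lo a i (All.map proj₁ o)) (rowGordon-lo a i (All.map proj₁ o)))) (forms-lo {P} os xs)

  -- Exponents of q tell wheel zeros from merging zeros.
  Monomial-form : ℕ → ℕ → Form m → Set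
  Monomial-form b d f = Σ ℕ λ a → Σ ℕ λ c → Form.α f ≡ p ^ a * q ^ b × Form.β f ≡ p ^ c * q ^ d

  q-distinct : ∀ {b d b′ d′ f g} → (b′ ℕ.+ d ≡ b ℕ.+ d′ → ⊥) → Monomial-form b d f → Monomial-form b′ d′ g → Distinct f g
  q-distinct {b} {d} {b′} {d′} h (a , c , α≡ , β≡) (a′ , c′ , α′≡ , β′≡) _ _ e = h (proj₂ (independent (a′ ℕ.+ c) (b′ ℕ.+ d) (a ℕ.+ c′) (b ℕ.+ d′)
    (trans (regroup a′ b′ c d) (trans (sym (cong₂ _*_ α′≡ β≡)) (trans e (trans (cong₂ _*_ α≡ β′≡) (sym (regroup a b c′ d′))))))))
    where
    regroup : ∀ a b c d → p ^ (a ℕ.+ c) * q ^ (b ℕ.+ d) ≡ p ^ a * q ^ b * (p ^ c * q ^ d)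
    regroup a b c d = trans (cong₂ _*_ (^-+ p a c) (^-+ q b d)) (sym (cross-monomials (p ^ a) (q ^ b) (p ^ c) (q ^ d)))

  rowWheel-monomial : ∀ a i {ib} (lts : All (Above i) ib) → All (λ f → Monomial-form 0 1 f ⊎ Monomial-form 1 0 f) (rowWheel a i lts)
  rowWheel-monomial a i [] = []
  rowWheel-monomial a i {(b , j) ∷ ib} (lt ∷ lts) = ++⁺ (concat⁺ (applyUpTo⁺₂ _ b (λ k →
    ++⁺ (applyUpTo⁺₂ _ (a ∸ 1) (λ l → inj₁ (k , l ℕ.+ 1 , refl , refl))) (applyUpTo⁺₂ _ (a ∸ 1) (λ l → inj₂ (k , l ℕ.+ 0 , refl , refl))))))
    (rowWheel-monomial a i lts)

  rowGordon-monomial : ∀ a i {ib} (lts : All (Above i) ib) → All (Monomial-form 0 0) (rowGordon a i lts)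
  rowGordon-monomial a i [] = []
  rowGordon-monomial a i {(b , j) ∷ ib} (lt ∷ lts) = ++⁺
    (++⁺ (applyUpTo⁺₂ _ b (λ k → 0 , (a ∸ b) ℕ.+ suc k , refl , refl)) (applyUpTo⁺₂ _ b (λ k → suc k , 0 , refl , refl)))
    (rowGordon-monomial a i lts)

  pairGordon-distinct : ∀ a i b j lt → AllPairs Distinct (pairGordon a i b j lt)
  pairGordon-distinct a i b j lt = AllPairsP.++⁺
    (AllPairsP.applyUpTo⁺₁ _ b (λ {k} {l} k<l _ → mform-distinct {lt = lt} {lt} {0} {0} {(a ∸ b) ℕ.+ suc k} {0} {0} {0} {(a ∸ b) ℕ.+ suc l} {0}
      λ _ _ e _ → <⇒≢ k<l (suc-injective (+-cancelˡ-≡ (a ∸ b) (suc k) (suc l) e))))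
    (AllPairsP.applyUpTo⁺₁ _ b (λ {k} {l} k<l _ → mform-distinct {lt = lt} {lt} {suc k} {0} {0} {0} {suc l} {0} {0} {0}
      λ _ _ e _ → <⇒≢ k<l (suc-injective (sym (+-cancelʳ-≡ 0 (suc l) (suc k) e)))))
    (applyUpTo⁺₂ _ b (λ k → applyUpTo⁺₂ _ b (λ l → mform-distinct {lt = lt} {lt} {0} {0} {(a ∸ b) ℕ.+ suc k} {0} {suc l} {0} {0} {0}
      λ _ _ ())))

  rowGordon-distinct : ∀ a i {ib} (lts : All (Above i) ib) → AllPairs (λ x y → proj₂ x Fin.< proj₂ y) ib → AllPairs Distinct (rowGordon a i lts)
  rowGordon-distinct a i [] [] = []
  rowGordon-distinct a i {(b , j) ∷ ib} (lt ∷ lts) (o ∷ os) = AllPairsP.++⁺ (pairGordon-distinct a i b j lt) (rowGordon-distinct a i lts os)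
    (All.map (λ {f} hi≡j → All.map (λ {g} j<hi e _ → ⊥-elim (<⇒≢ j<hi (cong toℕ (trans (sym (proj₁ hi≡j)) e))))
      (rowGordon-hi {j Fin.<_} a i lts o)) (pairGordon-between a i b j lt))

  module _ (ib₀ : Indexed m) {F : List ℚ → ℚ} (w : Wheeled p q (total ib₀) F) where

    substituted : Vec ℚ m → ℚ
    substituted y = F (strings p (blocks ib₀ y))

    poly-substituted : IsPoly m substituted
    poly-substituted = polyOn-∘ {F = F} (Wheeled.poly w) (polyList-strings p ib₀)

    length-blocks : ∀ (ib : Indexed m) y → length (strings p (blocks ib y)) ≡ total ib
    length-blocks ib y = trans (length-strings p (blocks ib y)) (cong sum (sym (map-∘ ib)))

    permuted : ∀ {ib} → ib₀ ↭ ib → ∀ y → substituted y ≡ F (strings p (blocks ib y))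
    permuted e y = Wheeled.symmetric w (strings-↭ p (PermP.map⁺ _ e)) (length-blocks ib₀ y)

    total-↭ : ∀ {ib ib′ : Indexed m} → ib ↭ ib′ → total ib ≡ total ib′
    total-↭ e = sum-↭ (PermP.map⁺ proj₁ e)

    -- After specialization to strings the wheel zeros of a pair of rows repeat, since shifting
    -- along both strings gives the same form. The multiplicity is obtained by applying `peel` to
    -- the row while all other arguments are free and only then specializing them. The zeros against
    -- the rows in `pre` go into the quotient.
    rowWheel-divides : ∀ a i {ib} (lts : All (Above i) ib) pre → ib₀ ↭ (a , i) ∷ ib ++ pre → Divides (rowWheel a i lts) substituted
    rowWheel-divides a i {ib} lts pre e =
      let (Q , Qp , eq) = peel {F = F} a (wheeled-size (total-↭ e) w) in
      (λ y → ΠΦ a (lookup y i) (P y) * Q (lookup y i ∷ toVec n (Z y))) ,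
      poly-* (poly-prodList′ (λ y → Φ a (lookup y i)) (λ hp → poly-Φ a (poly-var i) hp) (polyList-strings p pre))
        (polyOn-∘ {F = λ zs → Q (toVec (suc n) zs)} (polyOn-toVec Qp) (polyList-∷ (poly-var i) (polyList-strings p (ib ++ pre)))) ,
      λ y → begin
        substituted y ≡⟨ permuted e y ⟩
        F (str p a (lookup y i) ++ Z y) ≡⟨ cong (λ zs → F (str p a (lookup y i) ++ zs)) (sym (padded y)) ⟩
        F (str p a (lookup y i) ++ toList (toVec n (Z y))) ≡⟨ eq (lookup y i) (toVec n (Z y)) ⟩
        ΠΦ a (lookup y i) (toList (toVec n (Z y))) * Q (lookup y i ∷ toVec n (Z y))
          ≡⟨ cong (λ zs → ΠΦ a (lookup y i) zs * Q (lookup y i ∷ toVec n (Z y))) (trans (padded y) (split y)) ⟩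
        ΠΦ a (lookup y i) (strings p (blocks ib y) ++ P y) * Q (lookup y i ∷ toVec n (Z y))
          ≡⟨ cong (_* Q (lookup y i ∷ toVec n (Z y))) (prodℚ-map-++ (Φ a (lookup y i)) (strings p (blocks ib y)) (P y)) ⟩
        (ΠΦ a (lookup y i) (strings p (blocks ib y)) * ΠΦ a (lookup y i) (P y)) * Q (lookup y i ∷ toVec n (Z y))
          ≡⟨ F.*-assoc (ΠΦ a (lookup y i) (strings p (blocks ib y))) (ΠΦ a (lookup y i) (P y)) (Q (lookup y i ∷ toVec n (Z y))) ⟩
        ΠΦ a (lookup y i) (strings p (blocks ib y)) * (ΠΦ a (lookup y i) (P y) * Q (lookup y i ∷ toVec n (Z y)))
          ≡⟨ cong (_* (ΠΦ a (lookup y i) (P y) * Q (lookup y i ∷ toVec n (Z y)))) (sym (product-rowWheel a i lts y)) ⟩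
        product (rowWheel a i lts) y * (ΠΦ a (lookup y i) (P y) * Q (lookup y i ∷ toVec n (Z y))) ∎
      where
      open ≡-Reasoning
      n = total (ib ++ pre)
      P Z : Vec ℚ m → List ℚ
      P y = strings p (blocks pre y)
      Z y = strings p (blocks (ib ++ pre) y)
      padded : ∀ y → toList (toVec n (Z y)) ≡ Z y
      padded y = toList-toVec n (Z y) (length-blocks (ib ++ pre) y)
      split : ∀ y → Z y ≡ strings p (blocks ib y) ++ P y
      split y = trans (cong (strings p) (map-++ _ ib pre)) (strings-++ p (blocks ib y) (blocks pre y))

-- When k of n variables are scaled by `t`, the exponents in the squared Vandermonde product run
-- from k(k-1) to k(k-1) + 2k(n-k). Finite limits at 0 and at infinity confine the numerator to the
-- same range.
Bounded : ℕ → (List ℚ → ℚ) → Set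
Bounded n F = ∀ ws zs → length ws ℕ.+ length zs ≡ n →
  Ranged (length ws ℕ.* (length ws ∸ 1)) (suc (2 ℕ.* (length ws ℕ.* length zs))) (λ t → F (map (t *_) ws ++ zs))

amount : ∀ {m} → Fin m → Fin m → ℕ → ℕ
amount k j b with j Fin.≟ k
... | yes _ = b
... | no _ = 0

amount-≡ : ∀ {m} (k : Fin m) b → amount k k b ≡ b
amount-≡ k b with k Fin.≟ k
... | yes _ = refl
... | no ne = ⊥-elim (ne refl)

amount-≢ : ∀ {m} {k j : Fin m} b → j ≢ k → amount k j b ≡ 0
amount-≢ {k = k} {j} b ne with j Fin.≟ k
... | yes e = ⊥-elim (ne e)
... | no _ = refl

amountAt : ∀ {m} → Fin m → Indexed m → ℕ
amountAt k ib = sum (map (λ { (b , j) → amount k j b }) ib)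

amountAt-off : ∀ {m} {k : Fin m} {ib} → All (λ x → proj₂ x ≢ k) ib → amountAt k ib ≡ 0
amountAt-off [] = refl
amountAt-off {ib = (b , j) ∷ ib} (ne ∷ nes) = cong₂ ℕ._+_ (amount-≢ b ne) (amountAt-off nes)

involves-hi : ∀ {m} {k : Fin m} (f : Form m) → Form.hi f ≡ k → involves k f ≡ 1
involves-hi {k = k} f e with Form.hi f Fin.≟ k | Form.lo f Fin.≟ k
... | yes _ | yes _ = refl
... | yes _ | no _ = refl
... | no ne | _ = ⊥-elim (ne e)

involves-lo : ∀ {m} {k : Fin m} (f : Form m) → Form.lo f ≡ k → involves k f ≡ 1
involves-lo {k = k} f e with Form.hi f Fin.≟ k | Form.lo f Fin.≟ k
... | yes _ | yes _ = refl
... | no _ | yes _ = refl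
... | _ | no ne = ⊥-elim (ne e)

involves-none : ∀ {m} {k : Fin m} (f : Form m) → Form.hi f ≢ k → Form.lo f ≢ k → involves k f ≡ 0
involves-none {k = k} f ne ne′ with Form.hi f Fin.≟ k | Form.lo f Fin.≟ k
... | yes e | _ = ⊥-elim (ne e)
... | no _ | yes e = ⊥-elim (ne′ e)
... | no _ | no _ = refl

occurrences-++ : ∀ {m} (k : Fin m) fs gs → occurrences k (fs ++ gs) ≡ occurrences k fs ℕ.+ occurrences k gs
occurrences-++ k fs gs = trans (cong sum (map-++ (involves k) fs gs)) (sum-++ (map (involves k) fs) (map (involves k) gs))

occurrences-all : ∀ {m} (k : Fin m) {fs} → All (λ f → involves k f ≡ 1) fs → occurrences k fs ≡ length fs
occurrences-all k [] = refl
occurrences-all k (e ∷ es) = cong₂ ℕ._+_ e (occurrences-all k es)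

occurrences-none : ∀ {m} (k : Fin m) {fs} → All (λ f → involves k f ≡ 0) fs → occurrences k fs ≡ 0
occurrences-none k [] = refl
occurrences-none k (e ∷ es) = cong₂ ℕ._+_ e (occurrences-none k es)

length-concat-applyUpTo : ∀ {A : Set} (g : ℕ → List A) c b → (∀ k → length (g k) ≡ c) → length (List.concat (applyUpTo g b)) ≡ b ℕ.* c
length-concat-applyUpTo g c zero e = refl
length-concat-applyUpTo g c (suc b) e = trans (length-++ (g 0)) (cong₂ ℕ._+_ (e 0) (length-concat-applyUpTo (g ∘ suc) c b (e ∘ suc)))

module GordonCount (p q : ℚ) (gen : Generic p q) {m : ℕ} where
  open RowTheory p q gen
  open GordonForms p q gen {m}

  -- There are 2(a-1)b wheel zeros and 2b merging zeros. The total 2ab is symmetric in the two rows,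
  -- so each variable can be counted in the same way whether it is `hi` or `lo`.
  length-pair : ∀ a i b j lt → 1 ≤ a → length (pairWheel a i b j lt) ℕ.+ length (pairGordon a i b j lt) ≡ 2 ℕ.* (a ℕ.* b)
  length-pair (suc a) i b j lt _ = trans (cong₂ ℕ._+_
      (length-concat-applyUpTo (wheelAt (suc a) i j lt) (a ℕ.+ a) b (λ k → trans (length-++ (xforms j i lt k 0 1 1 a))
        (cong₂ ℕ._+_ (length-applyUpTo _ a) (length-applyUpTo _ a))))
      (trans (length-++ (applyUpTo (λ k → mform j i lt 0 0 ((suc a ∸ b) ℕ.+ suc k) 0) b)) (cong₂ ℕ._+_ (length-applyUpTo _ b) (length-applyUpTo _ b))))
    (arith a b)
    where
    arith : ∀ a b → b ℕ.* (a ℕ.+ a) ℕ.+ (b ℕ.+ b) ≡ 2 ℕ.* (suc a ℕ.* b)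
    arith = ℕSolver.solve-∀

  length-row : ∀ a i {ib} (lts : All (Above i) ib) → 1 ≤ a → length (rowWheel a i lts) ℕ.+ length (rowGordon a i lts) ≡ 2 ℕ.* (a ℕ.* total ib)
  length-row a i [] _ = sym (trans (cong (2 ℕ.*_) (*-zeroʳ a)) refl)
  length-row a i {(b , j) ∷ ib} (lt ∷ lts) 1≤a = begin
    length (pairWheel a i b j lt ++ rowWheel a i lts) ℕ.+ length (pairGordon a i b j lt ++ rowGordon a i lts)
      ≡⟨ cong₂ ℕ._+_ (length-++ (pairWheel a i b j lt)) (length-++ (pairGordon a i b j lt)) ⟩
    (length (pairWheel a i b j lt) ℕ.+ length (rowWheel a i lts)) ℕ.+ (length (pairGordon a i b j lt) ℕ.+ length (rowGordon a i lts))
      ≡⟨ interchange (length (pairWheel a i b j lt)) (length (rowWheel a i lts)) (length (pairGordon a i b j lt)) (length (rowGordon a i lts)) ⟩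
    (length (pairWheel a i b j lt) ℕ.+ length (pairGordon a i b j lt)) ℕ.+ (length (rowWheel a i lts) ℕ.+ length (rowGordon a i lts))
      ≡⟨ cong₂ ℕ._+_ (length-pair a i b j lt 1≤a) (length-row a i lts 1≤a) ⟩
    2 ℕ.* (a ℕ.* b) ℕ.+ 2 ℕ.* (a ℕ.* total ib) ≡⟨ distrib a b (total ib) ⟩
    2 ℕ.* (a ℕ.* (b ℕ.+ total ib)) ∎
    where
    open ≡-Reasoning
    interchange : ∀ x y z w → (x ℕ.+ y) ℕ.+ (z ℕ.+ w) ≡ (x ℕ.+ z) ℕ.+ (y ℕ.+ w)
    interchange = ℕSolver.solve-∀
    distrib : ∀ a b c → 2 ℕ.* (a ℕ.* b) ℕ.+ 2 ℕ.* (a ℕ.* c) ≡ 2 ℕ.* (a ℕ.* (b ℕ.+ c))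
    distrib = ℕSolver.solve-∀

  occurrences-pair : ∀ (k : Fin m) a i b j lt → 1 ≤ a → i ≢ k →
    occurrences k (pairWheel a i b j lt) ℕ.+ occurrences k (pairGordon a i b j lt) ≡ 2 ℕ.* (a ℕ.* amount k j b)
  occurrences-pair k a i b j lt 1≤a i≢k = go (j Fin.≟ k)
    where
    W = pairWheel a i b j lt
    G = pairGordon a i b j lt
    go : Dec (j ≡ k) → occurrences k W ℕ.+ occurrences k G ≡ 2 ℕ.* (a ℕ.* amount k j b)
    go (yes j≡k) = trans (cong₂ ℕ._+_
        (occurrences-all k (All.map (λ {f} e → involves-hi f (trans (proj₁ e) j≡k)) (pairWheel-between a i b j lt)))
        (occurrences-all k (All.map (λ {f} e → involves-hi f (trans (proj₁ e) j≡k)) (pairGordon-between a i b j lt))))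
      (trans (length-pair a i b j lt 1≤a) (cong (λ x → 2 ℕ.* (a ℕ.* x)) (sym (trans (cong (λ i → amount k i b) j≡k) (amount-≡ k b)))))
    go (no j≢k) = trans (cong₂ ℕ._+_
        (occurrences-none k (All.map (λ {f} e → involves-none f (j≢k ∘ trans (sym (proj₁ e))) (i≢k ∘ trans (sym (proj₂ e)))) (pairWheel-between a i b j lt)))
        (occurrences-none k (All.map (λ {f} e → involves-none f (j≢k ∘ trans (sym (proj₁ e))) (i≢k ∘ trans (sym (proj₂ e)))) (pairGordon-between a i b j lt))))
      (sym (trans (cong (λ x → 2 ℕ.* (a ℕ.* x)) (amount-≢ b j≢k)) (cong (2 ℕ.*_) (*-zeroʳ a))))

  occurrences-row : ∀ (k : Fin m) a i {ib} (lts : All (Above i) ib) → 1 ≤ a → i ≢ k →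
    occurrences k (rowWheel a i lts) ℕ.+ occurrences k (rowGordon a i lts) ≡ 2 ℕ.* (a ℕ.* amountAt k ib)
  occurrences-row k a i [] _ _ = sym (cong (2 ℕ.*_) (*-zeroʳ a))
  occurrences-row k a i {(b , j) ∷ ib} (lt ∷ lts) 1≤a i≢k = begin
    occurrences k (pairWheel a i b j lt ++ rowWheel a i lts) ℕ.+ occurrences k (pairGordon a i b j lt ++ rowGordon a i lts)
      ≡⟨ cong₂ ℕ._+_ (occurrences-++ k (pairWheel a i b j lt) (rowWheel a i lts)) (occurrences-++ k (pairGordon a i b j lt) (rowGordon a i lts)) ⟩
    (occurrences k (pairWheel a i b j lt) ℕ.+ occurrences k (rowWheel a i lts)) ℕ.+ (occurrences k (pairGordon a i b j lt) ℕ.+ occurrences k (rowGordon a i lts))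
      ≡⟨ interchange (occurrences k (pairWheel a i b j lt)) (occurrences k (rowWheel a i lts)) (occurrences k (pairGordon a i b j lt)) (occurrences k (rowGordon a i lts)) ⟩
    (occurrences k (pairWheel a i b j lt) ℕ.+ occurrences k (pairGordon a i b j lt)) ℕ.+ (occurrences k (rowWheel a i lts) ℕ.+ occurrences k (rowGordon a i lts))
      ≡⟨ cong₂ ℕ._+_ (occurrences-pair k a i b j lt 1≤a i≢k) (occurrences-row k a i lts 1≤a i≢k) ⟩
    2 ℕ.* (a ℕ.* amount k j b) ℕ.+ 2 ℕ.* (a ℕ.* amountAt k ib) ≡⟨ distrib a (amount k j b) (amountAt k ib) ⟩
    2 ℕ.* (a ℕ.* (amount k j b ℕ.+ amountAt k ib)) ∎
    where
    open ≡-Reasoning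
    interchange : ∀ x y z w → (x ℕ.+ y) ℕ.+ (z ℕ.+ w) ≡ (x ℕ.+ z) ℕ.+ (y ℕ.+ w)
    interchange = ℕSolver.solve-∀
    distrib : ∀ a b c → 2 ℕ.* (a ℕ.* b) ℕ.+ 2 ℕ.* (a ℕ.* c) ≡ 2 ℕ.* (a ℕ.* (b ℕ.+ c))
    distrib = ℕSolver.solve-∀

  above⇒≢ : ∀ {k : Fin m} {ib} → All (Above k) ib → All (λ x → proj₂ x ≢ k) ib
  above⇒≢ = All.map (λ lt e → <⇒≢ lt (cong toℕ (sym e)))

  -- Stated additively: (amountAt k)·(total) = (amountAt k)² + ½ (number of forms through k).
  occurrences-forms : ∀ (k : Fin m) {ib} (os : AllPairs Ordered ib) → All (λ x → 1 ≤ proj₁ x) ib →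
    occurrences k (forms os) ℕ.+ 2 ℕ.* (amountAt k ib ℕ.* amountAt k ib) ≡ 2 ℕ.* (amountAt k ib ℕ.* total ib)
  occurrences-forms k [] [] = refl
  occurrences-forms k {(a , i) ∷ ib} (o ∷ os) (1≤a ∷ pos) = trans (cong (ℕ._+ 2 ℕ.* (A ℕ.* A)) unfolded) (go (i Fin.≟ k))
    where
    lts = All.map proj₁ o
    A = amountAt k ((a , i) ∷ ib)
    row = occurrences k (rowWheel a i lts) ℕ.+ occurrences k (rowGordon a i lts)
    rest = occurrences k (forms os)
    unfolded : occurrences k (forms (o ∷ os)) ≡ row ℕ.+ rest
    unfolded = trans (occurrences-++ k (rowForms a i lts) (forms os)) (cong (ℕ._+ rest) (occurrences-++ k (rowWheel a i lts) (rowGordon a i lts)))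
    arith₁ : ∀ a t → (2 ℕ.* (a ℕ.* t) ℕ.+ 0) ℕ.+ 2 ℕ.* ((a ℕ.+ 0) ℕ.* (a ℕ.+ 0)) ≡ 2 ℕ.* ((a ℕ.+ 0) ℕ.* (a ℕ.+ t))
    arith₁ = ℕSolver.solve-∀
    arith₂ : ∀ a x r t → r ℕ.+ 2 ℕ.* (x ℕ.* x) ≡ 2 ℕ.* (x ℕ.* t) →
      (2 ℕ.* (a ℕ.* x) ℕ.+ r) ℕ.+ 2 ℕ.* ((0 ℕ.+ x) ℕ.* (0 ℕ.+ x)) ≡ 2 ℕ.* ((0 ℕ.+ x) ℕ.* (a ℕ.+ t))
    arith₂ a x r t e = trans (+-assoc (2 ℕ.* (a ℕ.* x)) r (2 ℕ.* (x ℕ.* x))) (trans (cong (2 ℕ.* (a ℕ.* x) ℕ.+_) e) (distrib a x t))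
      where
      distrib : ∀ a x t → 2 ℕ.* (a ℕ.* x) ℕ.+ 2 ℕ.* (x ℕ.* t) ≡ 2 ℕ.* (x ℕ.* (a ℕ.+ t))
      distrib = ℕSolver.solve-∀
    go : Dec (i ≡ k) → (row ℕ.+ rest) ℕ.+ 2 ℕ.* (A ℕ.* A) ≡ 2 ℕ.* (A ℕ.* (a ℕ.+ total ib))
    go (yes refl) = trans (cong₂ (λ x y → (x ℕ.+ y) ℕ.+ 2 ℕ.* (A ℕ.* A)) row≡ rest≡0)
        (transport (λ x → (2 ℕ.* (a ℕ.* total ib) ℕ.+ 0) ℕ.+ 2 ℕ.* (x ℕ.* x) ≡ 2 ℕ.* (x ℕ.* (a ℕ.+ total ib))) (sym A≡) (arith₁ a (total ib)))
      where
      off≡0 : amountAt i ib ≡ 0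
      off≡0 = amountAt-off (above⇒≢ lts)
      A≡ : A ≡ a ℕ.+ 0
      A≡ = cong₂ ℕ._+_ (amount-≡ i a) off≡0
      row≡ : row ≡ 2 ℕ.* (a ℕ.* total ib)
      row≡ = trans (cong₂ ℕ._+_ (occurrences-all i (All.map (λ {f} e → involves-lo f e) (rowWheel-lo a i lts)))
        (occurrences-all i (All.map (λ {f} e → involves-lo f e) (rowGordon-lo a i lts)))) (length-row a i lts 1≤a)
      rest≡0 : rest ≡ 0
      rest≡0 = ℕP.m+n≡0⇒m≡0 rest (trans (occurrences-forms i os pos) (cong (λ x → 2 ℕ.* (x ℕ.* total ib)) off≡0))
    go (no i≢k) = trans (cong (λ x → (x ℕ.+ rest) ℕ.+ 2 ℕ.* (A ℕ.* A)) (occurrences-row k a i lts 1≤a i≢k))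
      (transport (λ z → (2 ℕ.* (a ℕ.* amountAt k ib) ℕ.+ rest) ℕ.+ 2 ℕ.* ((z ℕ.+ amountAt k ib) ℕ.* (z ℕ.+ amountAt k ib)) ≡ 2 ℕ.* ((z ℕ.+ amountAt k ib) ℕ.* (a ℕ.+ total ib)))
        (sym (amount-≢ a i≢k)) (arith₂ a (amountAt k ib) rest (total ib) (occurrences-forms k os pos)))

-- Dividing a specialization by all its forced zeros

opaque
  unfolding _+_

  M-step : ∀ T c Y → (T * (c + 0ℚ)) * Y ≡ T * (Y * (c + 0ℚ))
  M-step = solve-∀ ringℚ

  t*1 : ∀ t → t * 1ℚ ≡ t
  t*1 = solve-∀ ringℚ

  form-root₁ : ∀ P y z → (1ℚ * 1ℚ) * y - (P * 1ℚ) * z ≡ y - P * z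
  form-root₁ = solve-∀ ringℚ

  form-root₂ : ∀ P y z → (P * 1ℚ) * y - (1ℚ * 1ℚ) * z ≡ P * y - z
  form-root₂ = solve-∀ ringℚ

  monomial-value : ∀ P Q s → P * 1ℚ * (Q * s) ≡ P * Q * s
  monomial-value = solve-∀ ringℚ

  values-N : ∀ P W G c d r → (P * G) * c ≡ d * ((P * W) * r) → P * (G * c) ≡ P * (d * (W * r))
  values-N P W G c d r e = trans (sym (F.*-assoc P G c)) (trans e (regroup P W d r))
    where
    regroup : ∀ P W d r → d * ((P * W) * r) ≡ P * (d * (W * r))
    regroup = solve-∀ ringℚ

  1*N : ∀ N W G M → N ≡ (W * G) * M → N * 1ℚ ≡ 1ℚ * (W * (G * M))
  1*N N W G M refl = regroup W G M
    where
    regroup : ∀ W G M → (W * G) * M * 1ℚ ≡ 1ℚ * (W * (G * M))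
    regroup = solve-∀ ringℚ

-- Passes from `d` to `y` one coordinate at a time; the coordinate about to be replaced still has
-- its value in `d`, hence is nonzero.
update-closed : ∀ {m} (P : Vec ℚ m → Set) → (∀ v k t → lookup v k ≢ 0ℚ → P v → P (v Vec.[ k ]≔ t)) →
  ∀ d → (∀ i → lookup d i ≢ 0ℚ) → P d → ∀ y → P y
update-closed P step [] ne Pd [] = Pd
update-closed P step (x ∷ d) ne Pd (y ∷ ys) = step (x ∷ ys) 0F y (ne 0F)
  (update-closed (P ∘ (x ∷_)) (λ v k → step (x ∷ v) (Fin.suc k)) d (ne ∘ Fin.suc) Pd ys)

prodℚ-≢0⁻¹ : ∀ {n} (v : Vec ℚ n) → prodℚ (toList v) ≢ 0ℚ → ∀ i → lookup v i ≢ 0ℚ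
prodℚ-≢0⁻¹ (x ∷ v) ne 0F e = ne (0*≡0 e)
prodℚ-≢0⁻¹ (x ∷ v) ne (Fin.suc i) = prodℚ-≢0⁻¹ v (ne ∘ *0≡0) i

prodℚ-ones : ∀ n → prodℚ (toList (Vec.replicate n 1ℚ)) ≢ 0ℚ
prodℚ-ones zero ()
prodℚ-ones (suc n) = *-≢0 (λ ()) (prodℚ-ones n)

map-proj₁-blocks : ∀ {m} (ib : Indexed m) y → map proj₁ (blocks ib y) ≡ map proj₁ ib
map-proj₁-blocks ib y = sym (map-∘ ib)

blocks-update : ∀ {m} (ib : Indexed m) y {k} t → All (λ x → proj₂ x ≢ k) ib → blocks ib (y Vec.[ k ]≔ t) ≡ blocks ib y
blocks-update [] y t [] = refl
blocks-update ((b , j) ∷ ib) y t (ne ∷ nes) = cong₂ _∷_ (cong (b ,_) (lookup∘update′ ne y t)) (blocks-update ib y t nes)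

module GordonDivision (p q : ℚ) (gen : Generic p q) {m : ℕ} (ib₀ : Indexed m) {F : List ℚ → ℚ}
  (w : Wheeled p q (total ib₀) F) (vanish : RaisedVanish p (map proj₁ ib₀) F) where
  open RowTheory p q gen
  open GordonForms p q gen {m}
  open GordonCount p q gen {m}

  N : Vec ℚ m → ℚ
  N = substituted ib₀ {F} w

  exchange-vanish : ∀ t c d y L → 1 ≤ t → c < d → (t ℕ.+ c) ∷ d ∷ map proj₁ L ↭ map proj₁ ib₀ →
    F (str p (t ℕ.+ c) y ++ (str p d (p ^ t * y) ++ strings p L)) ≡ 0ℚ
  exchange-vanish t c d y L 1≤t c<d e = trans (Wheeled.symmetric w perm len) (vanish t c d y (p ^ t * y) L 1≤t c<d e)
    where
    S = str p (t ℕ.+ c) y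
    T = str p d (p ^ t * y)
    perm : S ++ (T ++ strings p L) ↭ str p (t ℕ.+ d) y ++ (str p c (p ^ t * y) ++ strings p L)
    perm = ↭-trans (↭-reflexive (sym (++-assoc S T (strings p L))))
      (↭-trans (PermP.++⁺ʳ (strings p L) (str-exchange p t c d y)) (↭-reflexive (++-assoc (str p (t ℕ.+ d) y) (str p c (p ^ t * y)) (strings p L))))
    len : length (S ++ (T ++ strings p L)) ≡ total ib₀
    len = trans (length-strings p ((t ℕ.+ c , y) ∷ (d , p ^ t * y) ∷ L)) (sum-↭ e)

  -- At each root the two strings lie on one geometric progression. In the first family the string
  -- of `j` starts t = a - b + k + 1 steps after that of `i` and ends beyond it; in the second it
  -- starts t = k + 1 steps earlier. Exchanging tails gives a string of length t + b or t + a
  -- respectively and one of length b - (k+1), a raised diagram, where `F` vanishes.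
  pairGordon-vanish : ∀ a i b j lt R → b ≤ a → ib₀ ↭ (a , i) ∷ (b , j) ∷ R →
    All (λ f → ∀ y → value f y ≡ 0ℚ → N y ≡ 0ℚ) (pairGordon a i b j lt)
  pairGordon-vanish a i b j lt R b≤a e = ++⁺
    (applyUpTo⁺₁ _ b λ {k} k<b y z → at₁ k k<b y (x-y≡0⇒x≡y (trans (sym (form-root₁ (p ^ ((a ∸ b) ℕ.+ suc k)) (lookup y j) (lookup y i))) z)))
    (applyUpTo⁺₁ _ b λ {k} k<b y z → at₂ k k<b y (x-y≡0⇒x≡y (trans (sym (form-root₂ (p ^ suc k) (lookup y j) (lookup y i))) z)))
    where
    split₁ : ∀ k → k < b → ((a ∸ b) ℕ.+ suc k) ℕ.+ (b ∸ suc k) ≡ a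
    split₁ k k<b = trans (+-assoc (a ∸ b) (suc k) (b ∸ suc k)) (trans (cong ((a ∸ b) ℕ.+_) (m+[n∸m]≡n k<b)) (m∸n+n≡m b≤a))
    lower : ∀ k → k < b → b ∸ suc k < b
    lower k k<b = ℕP.∸-monoʳ-< (s≤s z≤n) k<b
    at₁ : ∀ k → k < b → ∀ y → lookup y j ≡ p ^ ((a ∸ b) ℕ.+ suc k) * lookup y i → N y ≡ 0ℚ
    at₁ k k<b y root = trans (permuted ib₀ {F} w e y) (trans
      (cong₂ (λ c z → F (str p c (lookup y i) ++ (str p b z ++ strings p (blocks R y)))) (sym (split₁ k k<b)) root)
      (exchange-vanish ((a ∸ b) ℕ.+ suc k) (b ∸ suc k) b (lookup y i) (blocks R y)
        (≤-trans (s≤s z≤n) (m≤n+m (suc k) (a ∸ b))) (lower k k<b)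
        (↭-trans (↭-reflexive (cong₂ (λ x z → x ∷ b ∷ z) (split₁ k k<b) (map-proj₁-blocks R y))) (↭-sym (PermP.map⁺ proj₁ e)))))
    at₂ : ∀ k → k < b → ∀ y → p ^ suc k * lookup y j ≡ lookup y i → N y ≡ 0ℚ
    at₂ k k<b y root = trans (permuted ib₀ {F} w (↭-trans e (Permutation.swap (a , i) (b , j) ↭-refl)) y) (trans
      (cong₂ (λ c z → F (str p c (lookup y j) ++ (str p a z ++ strings p (blocks R y)))) (sym (m+[n∸m]≡n k<b)) (sym root))
      (exchange-vanish (suc k) (b ∸ suc k) a (lookup y j) (blocks R y) (s≤s z≤n) (<-≤-trans (lower k k<b) b≤a)
        (↭-trans (↭-reflexive (cong₂ (λ x z → x ∷ a ∷ z) (m+[n∸m]≡n k<b) (map-proj₁-blocks R y)))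
          (↭-trans (Permutation.swap b a ↭-refl) (↭-sym (PermP.map⁺ proj₁ e))))))

  rowGordon-vanish : ∀ a i {ib} (lts : All (Above i) ib) pre → All (λ x → proj₁ x ≤ a) ib → ib₀ ↭ (a , i) ∷ ib ++ pre →
    All (λ f → ∀ y → value f y ≡ 0ℚ → N y ≡ 0ℚ) (rowGordon a i lts)
  rowGordon-vanish a i [] pre [] e = []
  rowGordon-vanish a i {(b , j) ∷ ib} (lt ∷ lts) pre (b≤a ∷ les) e = ++⁺ (pairGordon-vanish a i b j lt (ib ++ pre) b≤a e)
    (rowGordon-vanish a i lts ((b , j) ∷ pre) les (↭-trans e (Permutation.prep (a , i) (↭-sym (PermP.shift (b , j) ib pre)))))

  -- Forms of different rows are coprime because their `lo` indices differ. Within a row, the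
  -- exponents of `q` separate the wheel forms, which may repeat, from the merging forms, which are
  -- pairwise distinct.
  forms-divides : ∀ {ib} (os : AllPairs Ordered ib) pre → ib₀ ↭ ib ++ pre → Divides (forms os) N
  forms-divides [] pre e = N , poly-substituted ib₀ {F} w , λ v → sym (F.*-identityˡ (N v))
  forms-divides {(a , i) ∷ ib} (o ∷ os) pre e = divides-++ {h = N} (rowForms a i lts) (forms os)
    (divides-++ {h = N} (rowWheel a i lts) (rowGordon a i lts) (rowWheel-divides ib₀ {F} w a i lts pre e)
      (divides-distinct {h = N} (poly-substituted ib₀ {F} w) (rowGordon a i lts)
        (rowGordon-vanish a i lts pre (All.map proj₂ o) e) (rowGordon-distinct a i lts (AllPairs.map proj₁ os)))
      (All.map (λ {g} mg → All.map (λ {f} → wheel-gordon g f mg) (rowWheel-monomial a i lts)) (rowGordon-monomial a i lts)))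
    (forms-divides os ((a , i) ∷ pre) (↭-trans e (↭-sym (PermP.shift (a , i) ib pre))))
    (All.map (λ {g} i<lo → All.map (λ {f} lo≡i → distinct⇒coprime g f (λ _ e → ⊥-elim (<⇒≢ i<lo (cong toℕ (sym (trans e lo≡i))))))
      (++⁺ (rowWheel-lo a i lts) (rowGordon-lo a i lts))) (forms-lo {i Fin.<_} os lts))
    where
    lts = All.map proj₁ o
    wheel-gordon : ∀ g f → Monomial-form 0 0 g → Monomial-form 0 1 f ⊎ Monomial-form 1 0 f → Coprime g f
    wheel-gordon g f mg (inj₁ mf) = distinct⇒coprime g f (q-distinct {0} {0} {0} {1} {f = g} {f} (λ ()) mg mf)
    wheel-gordon g f mg (inj₂ mf) = distinct⇒coprime g f (q-distinct {0} {0} {1} {0} {f = g} {f} (λ ()) mg mf)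

  module _ (os : AllPairs Ordered ib₀) (pos : All (λ x → 1 ≤ proj₁ x) ib₀) (bounded : Bounded (total ib₀) F)
    (covers : ∀ k → Σ ℕ λ a → Σ (Indexed m) λ R → ib₀ ↭ (a , k) ∷ R × All (λ x → proj₂ x ≢ k) R) where

    private
      division = forms-divides os [] (↭-reflexive (sym (ListP.++-identityʳ ib₀)))

    M : Vec ℚ m → ℚ
    M = proj₁ division

    poly-M : IsPoly m M
    poly-M = proj₁ (proj₂ division)

    N≡ : ∀ y → N y ≡ product (forms os) y * M y
    N≡ = proj₂ (proj₂ division)

    module _ (k : Fin m) where
      private
        a = proj₁ (covers k)
        R = proj₁ (proj₂ (covers k))
        ib₀↭ = proj₁ (proj₂ (proj₂ (covers k)))
        R≢k = proj₂ (proj₂ (proj₂ (covers k)))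
        e = a ℕ.* (a ∸ 1)

      amount-k : amountAt k ib₀ ≡ a
      amount-k = trans (sum-↭ (PermP.map⁺ _ ib₀↭)) (trans (cong₂ ℕ._+_ (amount-≡ k a) (amountAt-off R≢k)) (+-identityʳ a))

      occurrences≡ : occurrences k (forms os) ≡ 2 ℕ.* (a ℕ.* total R)
      occurrences≡ = +-cancelʳ-≡ (2 ℕ.* (a ℕ.* a)) (occurrences k (forms os)) (2 ℕ.* (a ℕ.* total R)) (begin
        occurrences k (forms os) ℕ.+ 2 ℕ.* (a ℕ.* a)
          ≡⟨ cong (λ x → occurrences k (forms os) ℕ.+ 2 ℕ.* (x ℕ.* x)) (sym amount-k) ⟩
        occurrences k (forms os) ℕ.+ 2 ℕ.* (amountAt k ib₀ ℕ.* amountAt k ib₀)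
          ≡⟨ occurrences-forms k os pos ⟩
        2 ℕ.* (amountAt k ib₀ ℕ.* total ib₀)
          ≡⟨ cong₂ (λ x z → 2 ℕ.* (x ℕ.* z)) amount-k (total-↭ ib₀ {F} w ib₀↭) ⟩
        2 ℕ.* (a ℕ.* (a ℕ.+ total R)) ≡⟨ arith a (total R) ⟩
        2 ℕ.* (a ℕ.* total R) ℕ.+ 2 ℕ.* (a ℕ.* a) ∎)
        where
        open ≡-Reasoning
        arith : ∀ a t → 2 ℕ.* (a ℕ.* (a ℕ.+ t)) ≡ 2 ℕ.* (a ℕ.* t) ℕ.+ 2 ℕ.* (a ℕ.* a)
        arith = ℕSolver.solve-∀

      N-ranged : ∀ y → Ranged e (suc (2 ℕ.* (a ℕ.* total R))) (λ t → N (y Vec.[ k ]≔ t))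
      N-ranged y = ranged-resp (λ t → sym (expand t)) (transport₂ (length-str p a 1ℚ) len-zs
        (bounded (str p a 1ℚ) zs (trans (cong₂ ℕ._+_ (length-str p a 1ℚ) len-zs) (sym (total-↭ ib₀ {F} w ib₀↭)))))
        where
        zs = strings p (blocks R y)
        len-zs : length zs ≡ total R
        len-zs = trans (length-strings p (blocks R y)) (cong sum (map-proj₁-blocks R y))
        transport₂ : ∀ {k k′ l l′ h} → k ≡ k′ → l ≡ l′ → Ranged (k ℕ.* (k ∸ 1)) (suc (2 ℕ.* (k ℕ.* l))) h → Ranged (k′ ℕ.* (k′ ∸ 1)) (suc (2 ℕ.* (k′ ℕ.* l′))) h
        transport₂ refl refl r = r
        expand : ∀ t → N (y Vec.[ k ]≔ t) ≡ F (map (t *_) (str p a 1ℚ) ++ zs)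
        expand t = trans (permuted ib₀ {F} w ib₀↭ (y Vec.[ k ]≔ t)) (cong₂ (λ S Z → F (S ++ strings p Z))
          (trans (cong (str p a) (trans (lookup∘update k y t) (sym (t*1 t)))) (sym (map-*-str t p a 1ℚ))) (blocks-update R y t R≢k))

      -- The range allows 2a(n-a) + 1 coefficients in the variable `k`, and 2a(n-a) forms pass
      -- through that variable. A single coefficient is left, at the exponent `e`.
      M-ranged : ∀ y → prodℚ (toList y) ≢ 0ℚ → product (forms os) y ≢ 0ℚ → Ranged e 1 (λ t → M (y Vec.[ k ]≔ t))
      M-ranged y ne ne′ = ranged-product k y (prodℚ-≢0⁻¹ y ne) {g = M} (forms os) ne′ poly-M
        (transport (λ l → Ranged e l (λ t → product (forms os) (y Vec.[ k ]≔ t) * M (y Vec.[ k ]≔ t)))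
          (trans (cong suc (sym occurrences≡)) (sym (+-comm (occurrences k (forms os)) 1)))
          (ranged-resp (λ t → N≡ (y Vec.[ k ]≔ t)) (N-ranged y)))

      M-homogeneous-generic : ∀ y t → prodℚ (toList y) ≢ 0ℚ → product (forms os) y ≢ 0ℚ →
        M (y Vec.[ k ]≔ t) * lookup y k ^ e ≡ t ^ e * M y
      M-homogeneous-generic y t ne ne′ = go (M-ranged y ne ne′)
        where
        go : Ranged e 1 (λ t → M (y Vec.[ k ]≔ t)) → M (y Vec.[ k ]≔ t) * lookup y k ^ e ≡ t ^ e * M y
        go (ranged (c ∷ []) _ eq) = begin
          M (y Vec.[ k ]≔ t) * Y ≡⟨ cong (_* Y) (trans (eq t) (cong (λ x → t ^ e * (c + x)) (F.zeroʳ t))) ⟩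
          (t ^ e * (c + 0ℚ)) * Y ≡⟨ M-step (t ^ e) c Y ⟩
          t ^ e * (Y * (c + 0ℚ)) ≡⟨ cong (t ^ e *_) (sym (trans (eq (lookup y k)) (cong (λ x → Y * (c + x)) (F.zeroʳ (lookup y k))))) ⟩
          t ^ e * M (y Vec.[ k ]≔ lookup y k) ≡⟨ cong (λ v → t ^ e * M v) ([]≔-lookup y k) ⟩
          t ^ e * M y ∎
          where
          open ≡-Reasoning
          Y = lookup y k ^ e

      -- The relation is known where no coordinate and no form vanishes. Multiplied by the
      -- coordinates and the forms it holds everywhere, and these factors are then cancelled.
      M-homogeneous : ∀ y t → M (y Vec.[ k ]≔ t) * lookup y k ^ e ≡ t ^ e * M y
      M-homogeneous y t = x-y≡0⇒x≡y (poly-domain {h = generic} {k = difference} generic-poly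
        (poly-- (poly-* (poly-update-at k poly-M (poly-const t)) (poly-^ e (poly-var k))) (poly-* (poly-const (t ^ e)) poly-M))
        both (proj₁ nonzero) (proj₂ nonzero) y)
        where
        generic difference : Vec ℚ m → ℚ
        generic v = prodℚ (toList v) * product (forms os) v
        difference v = M (v Vec.[ k ]≔ t) * lookup v k ^ e - t ^ e * M v
        entries-poly : IsPoly m (λ v → prodℚ (toList v))
        entries-poly = poly-resp (λ v → cong prodℚ (map-id (toList v))) (poly-prodList id id (polyList-toList m))
        generic-poly : IsPoly m generic
        generic-poly = poly-* entries-poly (poly-product (forms os))
        nonzero : Σ (Vec ℚ m) λ v → generic v ≢ 0ℚ
        nonzero = poly-*-nonzero entries-poly (poly-product (forms os)) (Vec.replicate m 1ℚ , prodℚ-ones m) (product-nonzero (forms os))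
        both : ∀ v → generic v * difference v ≡ 0ℚ
        both v = case prodℚ (toList v) ℚP.≟ 0ℚ of λ
          { (yes z) → 0*≡0 (0*≡0 z)
          ; (no ne) → case product (forms os) v ℚP.≟ 0ℚ of λ
            { (yes z) → 0*≡0 (*0≡0 z)
            ; (no ne′) → *0≡0 (x≡y⇒x-y≡0 (M-homogeneous-generic v t ne ne′)) } }

    -- Homogeneity in each variable separately spreads one zero with nonzero coordinates to the
    -- whole space.
    M-zero : ∀ d → (∀ i → lookup d i ≢ 0ℚ) → M d ≡ 0ℚ → ∀ y → M y ≡ 0ℚ
    M-zero = update-closed (λ v → M v ≡ 0ℚ) λ v k t ne z →
      *-cancelʳ-0 (^-≢0 (proj₁ (covers k) ℕ.* (proj₁ (covers k) ∸ 1)) ne) (trans (M-homogeneous k v t) (*0≡0 z))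

-- Blocks of a diagram

zipBlocks : (μ : List ℕ) → Vec ℚ (length μ) → Blocks
zipBlocks [] [] = []
zipBlocks (a ∷ μ) (y ∷ ys) = (a , y) ∷ zipBlocks μ ys

shift : ∀ {m} → ℕ × Fin m → ℕ × Fin (suc m)
shift (b , j) = b , Fin.suc j

indexed : (μ : List ℕ) → Indexed (length μ)
indexed [] = []
indexed (a ∷ μ) = (a , 0F) ∷ map shift (indexed μ)

blocks-indexed : ∀ μ y → blocks (indexed μ) y ≡ zipBlocks μ y
blocks-indexed [] [] = refl
blocks-indexed (a ∷ μ) (y ∷ ys) = cong ((a , y) ∷_) (trans (sym (map-∘ (indexed μ))) (blocks-indexed μ ys))

map-proj₁-indexed : ∀ μ → map proj₁ (indexed μ) ≡ μ
map-proj₁-indexed [] = refl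
map-proj₁-indexed (a ∷ μ) = cong (a ∷_) (trans (sym (map-∘ (indexed μ))) (map-proj₁-indexed μ))

map-proj₁-zipBlocks : ∀ μ y → map proj₁ (zipBlocks μ y) ≡ μ
map-proj₁-zipBlocks [] [] = refl
map-proj₁-zipBlocks (a ∷ μ) (y ∷ ys) = cong (a ∷_) (map-proj₁-zipBlocks μ ys)

Decreasing : List ℕ → Set
Decreasing = AllPairs (λ a b → b ≤ a)

indexed-ordered : ∀ {μ} → Decreasing μ → AllPairs Ordered (indexed μ)
indexed-ordered [] = []
indexed-ordered {a ∷ μ} (le ∷ dec) =
  map⁺ (All.map (λ b≤a → s≤s z≤n , b≤a) (map⁻ (transport (All (_≤ a)) (sym (map-proj₁-indexed μ)) le))) ∷
  AllPairsP.map⁺ (AllPairs.map (λ { (lt , le) → s≤s lt , le }) (indexed-ordered dec))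

indexed-positive : ∀ {μ} → All (1 ≤_) μ → All (λ x → 1 ≤ proj₁ x) (indexed μ)
indexed-positive {μ} pos = map⁻ (transport (All (1 ≤_)) (sym (map-proj₁-indexed μ)) pos)

indexed-covers : ∀ μ k → Σ ℕ λ a → Σ (Indexed (length μ)) λ R → indexed μ ↭ (a , k) ∷ R × All (λ x → proj₂ x ≢ k) R
indexed-covers (a ∷ μ) 0F = a , map shift (indexed μ) , ↭-refl , map⁺ (All.universal (λ _ ()) (indexed μ))
indexed-covers (a ∷ μ) (Fin.suc k) = let (b , R , e , ne) = indexed-covers μ k in
  b , (a , 0F) ∷ map shift R ,
  ↭-trans (Permutation.prep (a , 0F) (PermP.map⁺ shift e)) (Permutation.swap (a , 0F) (b , Fin.suc k) ↭-refl) ,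
  (λ ()) ∷ map⁺ (All.map (λ n e → n (FinP.suc-injective e)) ne)

toList-zeros-strings : ∀ p μ → strings p (zipBlocks μ (zeros (length μ))) ≡ toList (zeros (sum μ))
toList-zeros-strings p [] = refl
toList-zeros-strings p (a ∷ μ) = trans (cong₂ _++_ (str-0 a) (toList-zeros-strings p μ)) (zeros-++ a (sum μ))
  where
  str-0 : ∀ a → str p a 0ℚ ≡ toList (zeros a)
  str-0 zero = refl
  str-0 (suc a) = cong (0ℚ ∷_) (trans (cong (str p a) (F.zeroʳ p)) (str-0 a))
  zeros-++ : ∀ a b → toList (zeros a) ++ toList (zeros b) ≡ toList (zeros (a ℕ.+ b))
  zeros-++ zero b = refl
  zeros-++ (suc a) b = cong (0ℚ ∷_) (zeros-++ a b)

-- Row values and specializations at strings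

module Diagonal (p q : ℚ) (gen : Generic p q) where
  open RowTheory p q gen
  private module G {m} = GordonForms p q gen {m}

  wheelFactor : Blocks → ℚ
  wheelFactor = G.wheelFactor {0}

  polyList-zipBlocks : ∀ μ → PolyList (length μ) (sum μ) (λ y → strings p (zipBlocks μ y))
  polyList-zipBlocks μ = polyList-resp (λ y → cong (strings p) (blocks-indexed μ y))
    (transport (λ n → PolyList (length μ) n (λ y → strings p (blocks (indexed μ) y))) (cong sum (map-proj₁-indexed μ)) (polyList-strings p (indexed μ)))

  length-zipBlocks : ∀ μ y → length (strings p (zipBlocks μ y)) ≡ sum μ
  length-zipBlocks μ y = trans (length-strings p (zipBlocks μ y)) (cong sum (map-proj₁-zipBlocks μ y))

  poly-wheelFactor : ∀ μ → IsPoly (length μ) (λ y → wheelFactor (zipBlocks μ y))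
  poly-wheelFactor [] = poly-resp (λ { [] → refl }) (poly-const 1ℚ)
  poly-wheelFactor (a ∷ μ) = poly-resp (λ { (y ∷ ys) → refl })
    (poly-* (poly-prodList′ {xs = λ v → strings p (zipBlocks μ (tail v))} (λ v → Φ a (head v)) (λ hp → poly-Φ a (poly-resp (λ { (y ∷ ys) → refl }) (poly-var 0F)) hp)
      (polyList-∘ tail poly-tail (polyList-zipBlocks μ)))
      (poly-tail (poly-wheelFactor μ)))

  diagonal : (μ : List ℕ) → ℚ → Vec ℚ (length μ)
  diagonal [] s = []
  diagonal (a ∷ μ) s = s ∷ diagonal μ (q * s)

  lookup-diagonal : ∀ μ s i → lookup (diagonal μ s) i ≡ q ^ toℕ i * s
  lookup-diagonal (a ∷ μ) s 0F = sym (F.*-identityˡ s)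
  lookup-diagonal (a ∷ μ) s (Fin.suc i) = trans (lookup-diagonal μ (q * s) i) (str-step q (q ^ toℕ i) s)

  -- The factors divided out in the definition of `RowValue` are those collected in `wheelFactor`.
  -- Cancelling them row by row leaves the cofactor `ρ`, evaluated where the rows of the diagram
  -- start: at s, qs, q²s and so on.
  rowValue-diagonal : ∀ μ {s F e} → s ≢ 0ℚ → RowValue μ s F e → ∀ c d {ρ} → IsPoly (length μ) ρ →
    (∀ y → F (strings p (zipBlocks μ y)) * c ≡ d * (wheelFactor (zipBlocks μ y) * ρ y)) → e * c ≡ d * ρ (diagonal μ s)
  rowValue-diagonal [] s≢0 refl c d {ρ} ρp eq = trans (eq []) (cong (d *_) (F.*-identityˡ (ρ [])))
  rowValue-diagonal (a ∷ μ) {s} {F} {e} s≢0 (G , Gw , eqG , v) c d {ρ} ρp eq =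
    rowValue-diagonal μ (*-≢0 q≢0 s≢0) v c d {λ ys → ρ (s ∷ ys)} (poly-fix s ρp)
      (poly-cancel {h = λ ys → ΠΦ a s (S ys)} {k = λ ys → G (S ys) * c} {l = λ ys → d * (wheelFactor (zipBlocks μ ys) * ρ (s ∷ ys))}
        (poly-prodList (Φ a s) (poly-Φ a (poly-const s)) (polyList-zipBlocks μ))
        (poly-* (polyOn-∘ {F = G} (Wheeled.poly Gw) (polyList-zipBlocks μ)) (poly-const c))
        (poly-* (poly-const d) (poly-* (poly-wheelFactor μ) (poly-fix s ρp)))
        (λ ys → values-N (ΠΦ a s (S ys)) (wheelFactor (zipBlocks μ ys)) (G (S ys)) c d (ρ (s ∷ ys))
          (trans (cong (_* c) (sym (eqG (S ys) (length-zipBlocks μ ys)))) (eq (s ∷ ys))))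
        (zeros (length μ)) (λ z → ΠΦ-at-0 a s≢0 (sum μ) (trans (cong (ΠΦ a s) (sym (toList-zeros-strings p μ))) z)))
    where
    S : Vec ℚ (length μ) → List ℚ
    S ys = strings p (zipBlocks μ ys)

  rowValue-zero : ∀ μ {s F e} → s ≢ 0ℚ → RowValue μ s F e → (∀ y → F (strings p (zipBlocks μ y)) ≡ 0ℚ) → e ≡ 0ℚ
  rowValue-zero μ {F = F} {e} s≢0 v z = trans (sym (F.*-identityʳ e)) (trans
    (rowValue-diagonal μ {F = F} s≢0 v 1ℚ 0ℚ {λ _ → 0ℚ} (poly-const 0ℚ)
      (λ y → trans (0*≡0 (z y)) (sym (F.zeroˡ (wheelFactor (zipBlocks μ y) * 0ℚ)))))
    (F.zeroˡ 0ℚ))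

  -- The specialization is the product of the wheel factor, the merging forms and `M`, so the row
  -- value is the product of the last two at the row starts. There the merging forms are nonzero:
  -- their coefficients are powers of `p`, while the starts of different rows carry different powers
  -- of `q`. Hence `M` has a zero with nonzero coordinates and vanishes identically.
  gordon-step : ∀ μ {s F e} → Decreasing μ → All (1 ≤_) μ → s ≢ 0ℚ → Wheeled p q (sum μ) F → Bounded (sum μ) F →
    RaisedVanish p μ F → RowValue μ s F e → e ≡ 0ℚ → ∀ y → F (strings p (zipBlocks μ y)) ≡ 0ℚ
  gordon-step μ {s} {F} {e} dec pos s≢0 w bounded vanish v e≡0 y =
    trans (N-zip y) (trans (D.N≡′ y) (*0≡0 (M≡0 y)))
    where
    m = length μ
    ib = indexed μ
    total≡ : total ib ≡ sum μ
    total≡ = cong sum (map-proj₁-indexed μ)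
    os = indexed-ordered dec
    w′ : Wheeled p q (total ib) F
    w′ = wheeled-size (sym total≡) w
    module D where
      open GordonDivision p q gen ib {F} w′ (transport (λ μ → RaisedVanish p μ F) (sym (map-proj₁-indexed μ)) vanish) public
      pos′ = indexed-positive pos
      bounded′ : Bounded (total ib) F
      bounded′ = transport (λ n → Bounded n F) (sym total≡) bounded
      M′ : Vec ℚ m → ℚ
      M′ = M os pos′ bounded′ (indexed-covers μ)
      poly-M′ : IsPoly m M′
      poly-M′ = poly-M os pos′ bounded′ (indexed-covers μ)
      N≡′ : ∀ y → N y ≡ product (G.forms os) y * M′ y
      N≡′ = N≡ os pos′ bounded′ (indexed-covers μ)
      M-zero′ : ∀ d → (∀ i → lookup d i ≢ 0ℚ) → M′ d ≡ 0ℚ → ∀ y → M′ y ≡ 0ℚ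
      M-zero′ = M-zero os pos′ bounded′ (indexed-covers μ)
    N-zip : ∀ y → F (strings p (zipBlocks μ y)) ≡ D.N y
    N-zip y = cong (F ∘ strings p) (sym (blocks-indexed μ y))
    B : Vec ℚ m → ℚ
    B = product (G.gordonForms os)
    wheelFactor≡ : ∀ L → G.wheelFactor {m} L ≡ wheelFactor L
    wheelFactor≡ [] = refl
    wheelFactor≡ ((a , x) ∷ L) = cong (ΠΦ a x (strings p L) *_) (wheelFactor≡ L)
    N-factored : ∀ y → F (strings p (zipBlocks μ y)) ≡ (wheelFactor (zipBlocks μ y) * B y) * D.M′ y
    N-factored y = trans (N-zip y) (trans (D.N≡′ y) (cong (_* D.M′ y) (trans (G.product-forms os y)
      (cong (_* B y) (trans (cong (G.wheelFactor {m}) (blocks-indexed μ y)) (wheelFactor≡ (zipBlocks μ y)))))))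
    d = diagonal μ s
    value-at-diagonal : e * 1ℚ ≡ 1ℚ * (B d * D.M′ d)
    value-at-diagonal = rowValue-diagonal μ {F = F} s≢0 v 1ℚ 1ℚ (poly-* (poly-product (G.gordonForms os)) D.poly-M′)
      (λ y → 1*N (F (strings p (zipBlocks μ y))) (wheelFactor (zipBlocks μ y)) (B y) (D.M′ y) (N-factored y))
    B≢0 : ∀ {ib : Indexed m} (os : AllPairs Ordered ib) → product (G.gordonForms os) d ≢ 0ℚ
    B≢0 [] ()
    B≢0 {(a , i) ∷ ib} (o ∷ os) z = *-≢0 (prodℚ-≢0 (map⁺ (All.map (λ {f} x → form≢0 f x) (G.rowGordon-monomial a i (All.map proj₁ o))))) (B≢0 os)
      (trans (sym (product-++ (G.rowGordon a i (All.map proj₁ o)) (G.gordonForms os) d)) z)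
      where
      form≢0 : ∀ f → G.Monomial-form 0 0 f → value f d ≢ 0ℚ
      form≢0 f (x , y , α≡ , β≡) = monomials-differ gen x (toℕ (Form.hi f)) y (toℕ (Form.lo f)) s≢0
        (λ _ e → <⇒≢ (Form.lo<hi f) (sym e))
        (trans (cong₂ _*_ α≡ (lookup-diagonal μ s (Form.hi f))) (monomial-value (p ^ x) (q ^ toℕ (Form.hi f)) s))
        (trans (cong₂ _*_ β≡ (lookup-diagonal μ s (Form.lo f))) (monomial-value (p ^ y) (q ^ toℕ (Form.lo f)) s))
    M≡0 : ∀ y → D.M′ y ≡ 0ℚ
    M≡0 = D.M-zero′ d (λ i → transport (_≢ 0ℚ) (sym (lookup-diagonal μ s i)) (*-≢0 (^-≢0 (toℕ i) q≢0) s≢0))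
      (*-cancelˡ-0 (B≢0 os) (trans (sym (F.*-identityˡ (B d * D.M′ d))) (trans (sym value-at-diagonal) (0*≡0 e≡0))))

-- Dominance through the functions k ↦ Σᵢ max(μᵢ - k, 0), which do not see the order of the parts or zero parts

weight : (ℕ → ℕ) → List ℕ → ℕ
weight g μ = sum (map g μ)

excess : ℕ → List ℕ → ℕ
excess k = weight (_∸ k)

infix 4 _⊑_
_⊑_ : List ℕ → List ℕ → Set
μ ⊑ ν = ∀ k → excess k μ ≤ excess k ν

squares : List ℕ → ℕ
squares = weight (λ a → a ℕ.* a)

record IsPartition (n : ℕ) (μ : List ℕ) : Set where
  constructor isPartition
  field
    decreasing : Decreasing μ
    positive-parts : All (1 ≤_) μ
    sum≡ : sum μ ≡ n
open IsPartition public

weight-↭ : ∀ g {μ ν} → μ ↭ ν → weight g μ ≡ weight g ν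
weight-↭ g e = sum-↭ (PermP.map⁺ g e)

∸-superadditive : ∀ k a b → (a ∸ k) ℕ.+ (b ∸ k) ≤ (a ℕ.+ b) ∸ k
∸-superadditive zero a b = ≤-refl
∸-superadditive (suc k) zero b = ≤-refl
∸-superadditive (suc k) (suc a) b = ≤-trans (+-monoʳ-≤ (a ∸ k) (ℕP.∸-monoʳ-≤ b (n≤1+n k))) (∸-superadditive k a b)

-- Convexity of x ↦ max(x - k, 0): moving boxes to a longer row increases every `excess`, so raised
-- diagrams are larger for `⊑`.
∸-convex : ∀ k t {c d} → c ≤ d → ((t ℕ.+ c) ∸ k) ℕ.+ (d ∸ k) ≤ ((t ℕ.+ d) ∸ k) ℕ.+ (c ∸ k)
∸-convex zero t {c} {d} le = ≤-reflexive (arith t c d)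
  where
  arith : ∀ t c d → t ℕ.+ c ℕ.+ d ≡ t ℕ.+ d ℕ.+ c
  arith = ℕSolver.solve-∀
∸-convex (suc k) t {zero} {d} z≤n = ≤-trans (≤-reflexive (cong (λ x → (x ∸ suc k) ℕ.+ (d ∸ suc k)) (+-identityʳ t)))
  (≤-trans (∸-superadditive (suc k) t d) (m≤m+n _ 0))
∸-convex (suc k) t {suc c} {suc d} (s≤s le) = transport₂ (+-suc t c) (+-suc t d) (∸-convex k t le)
  where
  transport₂ : ∀ {x y} → x ≡ suc (t ℕ.+ c) → y ≡ suc (t ℕ.+ d) → ((t ℕ.+ c) ∸ k) ℕ.+ (d ∸ k) ≤ ((t ℕ.+ d) ∸ k) ℕ.+ (c ∸ k) →
    (x ∸ suc k) ℕ.+ (d ∸ k) ≤ (y ∸ suc k) ℕ.+ (c ∸ k)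
  transport₂ refl refl r = r

squares-raise : ∀ t c d → 1 ≤ t → c < d → (t ℕ.+ c) ℕ.* (t ℕ.+ c) ℕ.+ d ℕ.* d < (t ℕ.+ d) ℕ.* (t ℕ.+ d) ℕ.+ c ℕ.* c
squares-raise (suc t) c d _ c<d = transport (λ d → (suc t ℕ.+ c) ℕ.* (suc t ℕ.+ c) ℕ.+ d ℕ.* d < (suc t ℕ.+ d) ℕ.* (suc t ℕ.+ d) ℕ.+ c ℕ.* c)
  (m+[n∸m]≡n c<d) (≤-trans (m≤m+n _ _) (≤-reflexive (sym (arith t c (d ∸ suc c)))))
  where
  arith : ∀ t c r → (suc t ℕ.+ (suc c ℕ.+ r)) ℕ.* (suc t ℕ.+ (suc c ℕ.+ r)) ℕ.+ c ℕ.* c ≡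
    suc ((suc t ℕ.+ c) ℕ.* (suc t ℕ.+ c) ℕ.+ (suc c ℕ.+ r) ℕ.* (suc c ℕ.+ r)) ℕ.+ (1 ℕ.+ 2 ℕ.* r ℕ.+ 2 ℕ.* t ℕ.* (suc r))
  arith = ℕSolver.solve-∀

squares≤sum² : ∀ μ → squares μ ≤ sum μ ℕ.* sum μ
squares≤sum² [] = z≤n
squares≤sum² (a ∷ μ) = ≤-trans (+-monoʳ-≤ (a ℕ.* a) (squares≤sum² μ))
  (≤-trans (m≤m+n _ _) (≤-reflexive (sym (arith a (sum μ)))))
  where
  arith : ∀ a s → (a ℕ.+ s) ℕ.* (a ℕ.+ s) ≡ a ℕ.* a ℕ.+ s ℕ.* s ℕ.+ 2 ℕ.* a ℕ.* s
  arith = ℕSolver.solve-∀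

sizes : Blocks → List ℕ
sizes = map proj₁

values : ∀ L → Vec ℚ (length (sizes L))
values [] = []
values ((a , y) ∷ L) = y ∷ values L

zipBlocks-values : ∀ L → zipBlocks (sizes L) (values L) ≡ L
zipBlocks-values [] = refl
zipBlocks-values ((a , y) ∷ L) = cong ((a , y) ∷_) (zipBlocks-values L)

dropZeros : Blocks → Blocks
dropZeros [] = []
dropZeros ((zero , y) ∷ L) = dropZeros L
dropZeros ((suc a , y) ∷ L) = (suc a , y) ∷ dropZeros L

strings-dropZeros : ∀ p L → strings p (dropZeros L) ≡ strings p L
strings-dropZeros p [] = refl
strings-dropZeros p ((zero , y) ∷ L) = strings-dropZeros p L
strings-dropZeros p ((suc a , y) ∷ L) = cong (str p (suc a) y ++_) (strings-dropZeros p L)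

weight-dropZeros : ∀ g → g 0 ≡ 0 → ∀ L → weight g (sizes (dropZeros L)) ≡ weight g (sizes L)
weight-dropZeros g g0 [] = refl
weight-dropZeros g g0 ((zero , y) ∷ L) = trans (weight-dropZeros g g0 L) (cong (ℕ._+ weight g (sizes L)) (sym g0))
weight-dropZeros g g0 ((suc a , y) ∷ L) = cong (g (suc a) ℕ.+_) (weight-dropZeros g g0 L)

dropZeros-positive : ∀ L → All (λ x → 1 ≤ proj₁ x) (dropZeros L)
dropZeros-positive [] = []
dropZeros-positive ((zero , y) ∷ L) = dropZeros-positive L
dropZeros-positive ((suc a , y) ∷ L) = s≤s z≤n ∷ dropZeros-positive L

SortedBlocks : Blocks → Set
SortedBlocks = AllPairs (λ x y → proj₁ y ≤ proj₁ x)

insertBlock : ∀ x L → SortedBlocks L → Σ Blocks λ L′ → L′ ↭ x ∷ L × SortedBlocks L′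
insertBlock x [] [] = x ∷ [] , ↭-refl , [] ∷ []
insertBlock x (y ∷ L) (le ∷ s) with proj₁ y ≤? proj₁ x
... | yes y≤x = x ∷ y ∷ L , ↭-refl , (y≤x ∷ All.map (λ z≤y → ≤-trans z≤y y≤x) le) ∷ le ∷ s
... | no y≰x = let (L′ , e , s′) = insertBlock x L s in
  y ∷ L′ , ↭-trans (Permutation.prep y e) (Permutation.swap y x ↭-refl) ,
  All-resp-↭ (↭-sym e) (<⇒≤ (≰⇒> y≰x) ∷ le) ∷ s′

sortBlocks : ∀ L → Σ Blocks λ L′ → L′ ↭ L × SortedBlocks L′
sortBlocks [] = [] , ↭-refl , []
sortBlocks (x ∷ L) = let (L′ , e , s) = sortBlocks L ; (L″ , e′ , s′) = insertBlock x L′ s in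
  L″ , ↭-trans e′ (Permutation.prep x e) , s′

-- A raised diagram comes unsorted and possibly with an empty row. Neither affects the strings up to
-- order, nor any weight that is zero on empty rows, so an honest partition can replace it.
normalise : ∀ p L → Σ (List ℕ) λ ν → Σ (Vec ℚ (length ν)) λ y →
  IsPartition (sum (sizes L)) ν × strings p (zipBlocks ν y) ↭ strings p L × (∀ g → g 0 ≡ 0 → weight g ν ≡ weight g (sizes L))
normalise p L =
  let (L′ , e , s) = sortBlocks (dropZeros L) in
  sizes L′ , values L′ ,
  isPartition (AllPairsP.map⁺ s) (map⁺ (All-resp-↭ (↭-sym e) (dropZeros-positive L)))
    (trans (cong sum (sym (map-id (sizes L′)))) (trans (weights e id refl) (cong sum (map-id (sizes L))))) ,
  ↭-trans (↭-reflexive (cong (strings p) (zipBlocks-values L′))) (↭-trans (strings-↭ p e) (↭-reflexive (strings-dropZeros p L))) ,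
  weights e
  where
  weights : ∀ {L′} → L′ ↭ dropZeros L → ∀ g → g 0 ≡ 0 → weight g (sizes L′) ≡ weight g (sizes L)
  weights e g g0 = trans (weight-↭ g (PermP.map⁺ proj₁ e)) (weight-dropZeros g g0 L)

-- Vanishing on upward closed sets of diagrams

module Filtration (p q : ℚ) (gen : Generic p q) where
  open RowTheory p q gen
  open Diagonal p q gen

  Vanishing : List ℕ → (List ℚ → ℚ) → Set
  Vanishing μ F = ∀ y → F (strings p (zipBlocks μ y)) ≡ 0ℚ

  -- Induction from large diagrams to small ones. Raising strictly increases the sum of squares of
  -- the parts, which never exceeds `n * n`, and stays in `S` because `S` is upward closed. Thus the
  -- hypothesis `RaisedVanish` of `gordon-step` is supplied by the recursion, whose fuel is `k`.
  row-values-vanish : ∀ {n F s} → s ≢ 0ℚ → Wheeled p q n F → Bounded n F → (S : List ℕ → Set) → (∀ {μ ν} → S μ → μ ⊑ ν → S ν) →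
    (∀ μ → IsPartition n μ → S μ → ∀ e → RowValue μ s F e → e ≡ 0ℚ) →
    ∀ k μ → n ℕ.* n < squares μ ℕ.+ k → IsPartition n μ → S μ → Vanishing μ F
  row-values-vanish {n} s≢0 w bounded S up zero-values zero μ l part Sμ =
    ⊥-elim (<⇒≱ l (transport (λ x → squares μ ℕ.+ 0 ≤ x ℕ.* x) (sum≡ part) (≤-trans (≤-reflexive (+-identityʳ _)) (squares≤sum² μ))))
  row-values-vanish {n} {F} {s} s≢0 w bounded S up zero-values (suc k) μ l part Sμ =
    gordon-step μ {s} {F} {proj₁ row} (decreasing part) (positive-parts part) s≢0 (wheeled-size (sym (sum≡ part)) w)
      (transport (λ n → Bounded n F) (sym (sum≡ part)) bounded) raised (proj₂ row) (zero-values μ part Sμ (proj₁ row) (proj₂ row))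
    where
    row = rowValue-exists μ {s} {F} s≢0 (wheeled-size (sym (sum≡ part)) w)
    raised : RaisedVanish p μ F
    raised t c d y z L 1≤t c<d e =
      let L′ = (t ℕ.+ d , y) ∷ (c , z) ∷ L
          (ν , ys , ν-part , perm , weights) = normalise p L′
          old : ∀ g → weight g μ ≡ g (t ℕ.+ c) ℕ.+ (g d ℕ.+ weight g (sizes L))
          old g = sym (weight-↭ g e)
          size≡ : sum (sizes L′) ≡ n
          size≡ = trans (arith t c d (sum (sizes L))) (trans (sum-↭ e) (sum≡ part))
          ν-part′ : IsPartition n ν
          ν-part′ = transport (λ n → IsPartition n ν) size≡ ν-part
          μ⊑ν : μ ⊑ ν
          μ⊑ν k = ≤-trans (≤-reflexive (trans (old (_∸ k)) (sym (+-assoc (t ℕ.+ c ∸ k) (d ∸ k) _))))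
            (≤-trans (+-monoˡ-≤ (excess k (sizes L)) (∸-convex k t (<⇒≤ c<d)))
              (≤-reflexive (trans (+-assoc (t ℕ.+ d ∸ k) (c ∸ k) _) (sym (weights (_∸ k) (0∸n≡0 k))))))
          squares< : squares μ < squares ν
          squares< = ≤-trans (s≤s (≤-reflexive (trans (old (λ a → a ℕ.* a)) (sym (+-assoc ((t ℕ.+ c) ℕ.* (t ℕ.+ c)) (d ℕ.* d) (squares (sizes L)))))))
            (≤-trans (+-monoˡ-≤ (squares (sizes L)) (squares-raise t c d 1≤t c<d))
              (≤-reflexive (trans (+-assoc ((t ℕ.+ d) ℕ.* (t ℕ.+ d)) (c ℕ.* c) (squares (sizes L))) (sym (weights (λ a → a ℕ.* a) refl)))))
      in trans (Wheeled.symmetric w (↭-sym perm) (trans (length-strings p L′) size≡))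
        (row-values-vanish s≢0 w bounded S up zero-values k ν
          (<-≤-trans l (≤-trans (≤-reflexive (+-suc (squares μ) k)) (+-monoˡ-≤ k squares<))) ν-part′ (up Sμ μ⊑ν) ys)
      where
      arith : ∀ t c d s → t ℕ.+ d ℕ.+ (c ℕ.+ s) ≡ t ℕ.+ c ℕ.+ (d ℕ.+ s)
      arith = ℕSolver.solve-∀

  filtration-vanishing : ∀ {n F s} → s ≢ 0ℚ → Wheeled p q n F → Bounded n F → (S : List ℕ → Set) → (∀ {μ ν} → S μ → μ ⊑ ν → S ν) →
    (∀ μ → IsPartition n μ → S μ → ∀ e → RowValue μ s F e → e ≡ 0ℚ) → ∀ μ → IsPartition n μ → S μ → Vanishing μ F
  filtration-vanishing {n} {F} {s} s≢0 w bounded S up zero-values μ = row-values-vanish {n} {F} {s} s≢0 w bounded S up zero-values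
    (suc (n ℕ.* n)) μ (m≤n+m (suc (n ℕ.* n)) (squares μ))

-- Dominance order and conjugation

nth-≤ : ∀ {a μ} → All (_≤ a) μ → ∀ i → nth μ i ≤ a
nth-≤ [] i = z≤n
nth-≤ (le ∷ les) zero = le
nth-≤ (le ∷ les) (suc i) = nth-≤ les i

excess-0 : ∀ {k μ} → All (_≤ k) μ → excess k μ ≡ 0
excess-0 [] = refl
excess-0 (le ∷ les) = cong₂ ℕ._+_ (m≤n⇒m∸n≡0 le) (excess-0 les)

sum-take≤excess : ∀ i k μ → sum (take i μ) ≤ excess k μ ℕ.+ i ℕ.* k
sum-take≤excess zero k μ = z≤n
sum-take≤excess (suc i) k [] = z≤n
sum-take≤excess (suc i) k (a ∷ μ) = ≤-trans (+-mono-≤ (ℕP.m≤n+m∸n a k) (sum-take≤excess i k μ)) (≤-reflexive (arith k (a ∸ k) (excess k μ) (i ℕ.* k)))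
  where
  arith : ∀ k x y z → k ℕ.+ x ℕ.+ (y ℕ.+ z) ≡ x ℕ.+ y ℕ.+ (k ℕ.+ z)
  arith = ℕSolver.solve-∀

excess-step : ∀ a k x y z → k ≤ a → x ℕ.+ y ≤ z → (a ∸ k) ℕ.+ x ℕ.+ (k ℕ.+ y) ≤ a ℕ.+ z
excess-step a k x y z k≤a le = ≤-trans (≤-reflexive (arith (a ∸ k) x k y)) (+-mono-≤ (≤-reflexive (m∸n+n≡m k≤a)) le)
  where
  arith : ∀ d x k y → d ℕ.+ x ℕ.+ (k ℕ.+ y) ≡ d ℕ.+ k ℕ.+ (x ℕ.+ y)
  arith = ℕSolver.solve-∀

-- With `sum-take≤excess` this is a duality: the sum of the first `i` parts is the minimum over `k`
-- of `excess k μ + i * k`, attained at the first part left out.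
excess≤sum-take : ∀ {μ} → Decreasing μ → ∀ i → excess (nth μ i) μ ℕ.+ i ℕ.* nth μ i ≤ sum (take i μ)
excess≤sum-take [] zero = z≤n
excess≤sum-take [] (suc i) = ≤-reflexive (*-zeroʳ i)
excess≤sum-take {a ∷ μ} (le ∷ dec) zero = ≤-reflexive (trans (+-identityʳ _) (excess-0 (≤-refl ∷ le)))
excess≤sum-take {a ∷ μ} (le ∷ dec) (suc i) = excess-step a (nth μ i) _ _ _ (nth-≤ le i) (excess≤sum-take dec i)

-- The other half of the duality; the number `i` of parts larger than `k` attains it.
excess-at : ∀ {μ} → Decreasing μ → ∀ k → Σ ℕ λ i → excess k μ ℕ.+ i ℕ.* k ≤ sum (take i μ)
excess-at [] k = 0 , z≤n
excess-at {a ∷ μ} (le ∷ dec) k with a ≤? k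
... | yes a≤k = 0 , ≤-reflexive (trans (+-identityʳ _) (excess-0 (a≤k ∷ All.map (λ x≤a → ≤-trans x≤a a≤k) le)))
... | no a≰k = let (i , e) = excess-at dec k in suc i , excess-step a k _ _ _ (<⇒≤ (≰⇒> a≰k)) e

⊑⇒≤ᵈ : ∀ {μ ν} → Decreasing ν → μ ⊑ ν → μ ≤ᵈ ν
⊑⇒≤ᵈ {μ} {ν} dec le i = ≤-trans (sum-take≤excess i (nth ν i) μ) (≤-trans (+-monoˡ-≤ (i ℕ.* nth ν i) (le (nth ν i))) (excess≤sum-take dec i))

≤ᵈ⇒⊑ : ∀ {μ ν} → Decreasing μ → μ ≤ᵈ ν → μ ⊑ ν
≤ᵈ⇒⊑ {μ} {ν} dec le k = let (i , e) = excess-at dec k in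
  ℕP.+-cancelʳ-≤ (i ℕ.* k) (excess k μ) (excess k ν) (≤-trans e (≤-trans (le i) (sum-take≤excess i k ν)))

take-sums-injective : ∀ {μ ν} → All (1 ≤_) μ → All (1 ≤_) ν → (∀ i → sum (take i μ) ≡ sum (take i ν)) → μ ≡ ν
take-sums-injective [] [] e = refl
take-sums-injective {[]} {b ∷ ν} [] (s≤s _ ∷ _) e with e 1
... | ()
take-sums-injective {a ∷ μ} {[]} (s≤s _ ∷ _) [] e with e 1
... | ()
take-sums-injective {a ∷ μ} {b ∷ ν} (_ ∷ ps) (_ ∷ qs) e with trans (sym (+-identityʳ a)) (trans (e 1) (+-identityʳ b))
... | refl = cong (a ∷_) (take-sums-injective ps qs (λ i → +-cancelˡ-≡ a (sum (take i μ)) (sum (take i ν)) (e (suc i))))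

⊑-antisym : ∀ {n μ ν} → IsPartition n μ → IsPartition n ν → μ ⊑ ν → ν ⊑ μ → μ ≡ ν
⊑-antisym p q l l′ = take-sums-injective (positive-parts p) (positive-parts q)
  (λ i → ℕP.≤-antisym (⊑⇒≤ᵈ (decreasing q) l i) (⊑⇒≤ᵈ (decreasing p) l′ i))

⊑-trans : ∀ {μ ν ξ} → μ ⊑ ν → ν ⊑ ξ → μ ⊑ ξ
⊑-trans l l′ k = ≤-trans (l k) (l′ k)

partition⇒isPartition : ∀ {n} (la : Partition n) → IsPartition n (parts la)
partition⇒isPartition la = isPartition (LinkedP.Linked⇒AllPairs (λ b≤a c≤b → ≤-trans c≤b b≤a) (nonincr la)) (positive la) (size la)

isPartition⇒partition : ∀ {n μ} → IsPartition n μ → Σ (Partition n) λ la → parts la ≡ μ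
isPartition⇒partition {μ = μ} p = record { parts = μ ; positive = positive-parts p ; nonincr = LinkedP.AllPairs⇒Linked (decreasing p) ; size = sum≡ p } , refl

-- Both sides count the boxes that lie in rows of `μ` with index at least `k`.
excess-transposed : ∀ k {μ ν} → Transposed μ ν → excess k ν ≡ sum (drop k μ)
excess-transposed zero {μ} {ν} t = trans (cong sum (map-id ν)) (sym (sum-transposed _ μ ν ≤-refl t))
excess-transposed (suc k) {[]} {ν} t = excess-0 (zeros⇒All ν (empty-row t))
  where
  zeros⇒All : ∀ ν → sum ν ≡ 0 → All (_≤ suc k) ν
  zeros⇒All [] e = []
  zeros⇒All (zero ∷ ν) e = z≤n ∷ zeros⇒All ν e
excess-transposed (suc k) {a ∷ μ} {ν} t = trans (cong sum (trans (map-cong (λ x → sym (ℕP.pred[m∸n]≡m∸[1+n] x k)) ν)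
  (trans (map-cong (λ x → pred-∸ x k) ν) (map-∘ ν)))) (excess-transposed k (remove-row t))
  where
  pred-∸ : ∀ x k → ℕ.pred (x ∸ k) ≡ ℕ.pred x ∸ k
  pred-∸ x zero = refl
  pred-∸ zero (suc k) = refl
  pred-∸ (suc x) (suc k) = trans (ℕP.pred[m∸n]≡m∸[1+n] x k) refl

sum-take-drop : ∀ k μ → sum (take k μ) ℕ.+ sum (drop k μ) ≡ sum μ
sum-take-drop k μ = trans (sym (sum-++ (take k μ) (drop k μ))) (cong sum (take++drop≡id k μ))

transposed-unique : ∀ {μ ν ξ} → Transposed μ ν → Transposed μ ξ → ν ⊑ ξ
transposed-unique t t′ k = ≤-reflexive (trans (excess-transposed k t) (sym (excess-transposed k t′)))

-- The excess of a diagram is the tail sum of its transpose. For equal totals, larger initial sums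
-- mean smaller tail sums.
transposed-reverses : ∀ {μ ν μ′ ν′} → sum μ′ ≡ sum ν′ → Transposed μ μ′ → Transposed ν ν′ → μ′ ≤ᵈ ν′ → ν ⊑ μ
transposed-reverses {μ} {ν} {μ′} {ν′} e t t′ le k =
  ≤-trans (≤-reflexive (excess-transposed k (transposed-sym t′)))
    (≤-trans (+-cancelˡ-≤ (sum (take k ν′)) (sum (drop k ν′)) (sum (drop k μ′)) total≤) (≤-reflexive (sym (excess-transposed k (transposed-sym t)))))
  where
  total≤ : sum (take k ν′) ℕ.+ sum (drop k ν′) ≤ sum (take k ν′) ℕ.+ sum (drop k μ′)
  total≤ = ≤-trans (≤-reflexive (trans (sum-take-drop k ν′) (trans (sym e) (sym (sum-take-drop k μ′))))) (+-monoˡ-≤ (sum (drop k μ′)) (le k))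

-- Conjugate partitions

column : List ℕ → ℕ → ℕ
column μ j = length (filter (λ a → suc j ≤? a) μ)

column-none : ∀ {μ j} → All (_≤ j) μ → column μ j ≡ 0
column-none {j = j} les = cong length (ListP.filter-none (λ a → suc j ≤? a) (All.map ℕP.≤⇒≯ les))

column-accept : ∀ {j a} μ → j < a → column (a ∷ μ) j ≡ suc (column μ j)
column-accept {j} μ lt = cong length (ListP.filter-accept (λ a → suc j ≤? a) {xs = μ} lt)

column-reject : ∀ {j a} μ → ¬ (j < a) → column (a ∷ μ) j ≡ column μ j
column-reject {j} μ ≮ = cong length (ListP.filter-reject (λ a → suc j ≤? a) {xs = μ} ≮)

column-mono : ∀ μ {i j} → i ≤ j → column μ j ≤ column μ i
column-mono [] le = z≤n
column-mono (a ∷ μ) {i} {j} le = go (suc j ≤? a) (suc i ≤? a)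
  where
  go : Dec (j < a) → Dec (i < a) → column (a ∷ μ) j ≤ column (a ∷ μ) i
  go (yes j<a) (yes i<a) = transport₂ (column-accept μ j<a) (column-accept μ i<a) (s≤s (column-mono μ le))
    where
    transport₂ : ∀ {x y x′ y′ : ℕ} → x ≡ x′ → y ≡ y′ → x′ ≤ y′ → x ≤ y
    transport₂ refl refl l = l
  go (yes j<a) (no i≮a) = ⊥-elim (i≮a (≤-trans (s≤s le) j<a))
  go (no j≮a) (yes i<a) = ≤-trans (≤-reflexive (column-reject μ j≮a))
    (≤-trans (m≤n⇒m≤1+n (column-mono μ le)) (≤-reflexive (sym (column-accept μ i<a))))
  go (no j≮a) (no i≮a) = ≤-trans (≤-reflexive (column-reject μ j≮a)) (≤-trans (column-mono μ le) (≤-reflexive (sym (column-reject μ i≮a))))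

largest : List ℕ → ℕ
largest = foldr _⊔_ 0

≤largest : ∀ μ → All (_≤ largest μ) μ
≤largest [] = []
≤largest (a ∷ μ) = m≤m⊔n a (largest μ) ∷ All.map (λ le → ≤-trans le (m≤n⊔m a (largest μ))) (≤largest μ)

column-positive : ∀ μ {j} → j < largest μ → 1 ≤ column μ j
column-positive (a ∷ μ) {j} lt = go (suc j ≤? a) (ℕP.⊔-sel a (largest μ))
  where
  go : Dec (j < a) → a ⊔ largest μ ≡ a ⊎ a ⊔ largest μ ≡ largest μ → 1 ≤ column (a ∷ μ) j
  go (yes j<a) _ = ≤-trans (s≤s z≤n) (≤-reflexive (sym (column-accept μ j<a)))
  go (no j≮a) (inj₁ e) = ⊥-elim (j≮a (transport (suc j ≤_) e lt))
  go (no j≮a) (inj₂ e) = ≤-trans (column-positive μ (transport (suc j ≤_) e lt)) (≤-reflexive (sym (column-reject μ j≮a)))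

nth-column : ∀ {μ} → Decreasing μ → ∀ i j → (j < nth μ i → i < column μ j) × (i < column μ j → j < nth μ i)
nth-column [] i j = (λ ()) , (λ ())
nth-column {a ∷ μ} (le ∷ dec) i j = go i (suc j ≤? a)
  where
  go : ∀ i → Dec (j < a) → (j < nth (a ∷ μ) i → i < column (a ∷ μ) j) × (i < column (a ∷ μ) j → j < nth (a ∷ μ) i)
  go zero (yes j<a) = (λ _ → transport (0 <_) (sym (column-accept μ j<a)) (s≤s z≤n)) , (λ _ → j<a)
  go (suc i) (yes j<a) = let (f , g) = nth-column dec i j in
    (λ l → transport (suc i <_) (sym (column-accept μ j<a)) (s≤s (f l))) ,
    (λ l → g (≤-pred (transport (suc i <_) (column-accept μ j<a) l)))
  go i (no j≮a) = (λ l → ⊥-elim (j≮a (≤-trans l (nth-≤ (≤-refl ∷ le) i)))) ,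
    (λ l → ⊥-elim (ℕP.n≮0 (transport (i <_) (column-none {a ∷ μ} (a≤j ∷ All.map (λ x≤a → ≤-trans x≤a a≤j) le)) l)))
    where a≤j = ≤-pred (≰⇒> j≮a)

nth-applyUpTo : ∀ f N j → (∀ j → N ≤ j → f j ≡ 0) → nth (applyUpTo f N) j ≡ f j
nth-applyUpTo f zero j z = sym (z j z≤n)
nth-applyUpTo f (suc N) zero z = refl
nth-applyUpTo f (suc N) (suc j) z = nth-applyUpTo (f ∘ suc) N j (λ j le → z (suc j) (s≤s le))

conj-applyUpTo : ∀ μ → conj μ ≡ applyUpTo (column μ) (largest μ)
conj-applyUpTo μ = map-upTo (column μ) (largest μ)

conj-transposed : ∀ {μ} → Decreasing μ → Transposed μ (conj μ)
conj-transposed {μ} dec = transposed λ i j → transport (λ x → (j < nth μ i → i < x) × (i < x → j < nth μ i)) (sym (nth-conj j)) (nth-column dec i j)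
  where
  nth-conj : ∀ j → nth (conj μ) j ≡ column μ j
  nth-conj j = trans (cong (λ ν → nth ν j) (conj-applyUpTo μ))
    (nth-applyUpTo (column μ) (largest μ) j (λ j le → column-none (All.map (λ a≤ → ≤-trans a≤ le) (≤largest μ))))

conj-isPartition : ∀ {n μ} → IsPartition n μ → IsPartition n (conj μ)
conj-isPartition {n} {μ} p = isPartition
  (transport Decreasing (sym (conj-applyUpTo μ)) (AllPairsP.applyUpTo⁺₁ (column μ) (largest μ) (λ i<j _ → column-mono μ (<⇒≤ i<j))))
  (transport (All (1 ≤_)) (sym (conj-applyUpTo μ)) (applyUpTo⁺₁ (column μ) (largest μ) (column-positive μ)))
  (trans (sym (sum-transposed _ μ (conj μ) ≤-refl (conj-transposed (decreasing p)))) (sum≡ p))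

-- Enumeration of the partitions of n

isPartition? : ∀ n μ → Dec (IsPartition n μ)
isPartition? n μ with AllPairs.allPairs? (λ a b → b ≤? a) μ | All.all? (1 ≤?_) μ | sum μ ℕ.≟ n
... | yes d | yes p | yes e = yes (isPartition d p e)
... | no ¬d | _ | _ = no (¬d ∘ decreasing)
... | yes _ | no ¬p | _ = no (¬p ∘ positive-parts)
... | yes _ | yes _ | no ¬e = no (¬e ∘ sum≡)

boundedLists : ℕ → ℕ → List (List ℕ)
boundedLists n zero = [] ∷ []
boundedLists n (suc k) = [] ∷ concatMap (λ a → map (a ∷_) (boundedLists n k)) (upTo (suc n))

∈-boundedLists : ∀ n k {μ} → All (_≤ n) μ → length μ ≤ k → μ ∈ boundedLists n k
∈-boundedLists n zero {[]} les l = here refl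
∈-boundedLists n (suc k) {[]} les l = here refl
∈-boundedLists n (suc k) {a ∷ μ} (le ∷ les) (s≤s l) = there (MemP.∈-concatMap⁺ (λ a → map (a ∷_) (boundedLists n k))
  (lose (MemP.∈-upTo⁺ (s≤s le)) (∈-map⁺ (a ∷_) (∈-boundedLists n k les l))))

_≟ₗ_ : (μ ν : List ℕ) → Dec (μ ≡ ν)
_≟ₗ_ = ListP.≡-dec ℕ._≟_

partitions : ℕ → List (List ℕ)
partitions n = List.deduplicate _≟ₗ_ (filter (isPartition? n) (boundedLists n n))

partitions-unique : ∀ n → AllPairs _≢_ (partitions n)
partitions-unique n = UniqueP.deduplicate-! _≟ₗ_ (filter (isPartition? n) (boundedLists n n))

partitions-sound : ∀ n → All (IsPartition n) (partitions n)
partitions-sound n = All.tabulate λ μ∈ → proj₂ (MemP.∈-filter⁻ (isPartition? n) {xs = boundedLists n n} (MemP.∈-deduplicate⁻ _≟ₗ_ (filter (isPartition? n) (boundedLists n n)) μ∈))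

length≤sum : ∀ {μ} → All (1 ≤_) μ → length μ ≤ sum μ
length≤sum [] = z≤n
length≤sum (p ∷ ps) = +-mono-≤ p (length≤sum ps)

parts≤sum : ∀ μ → All (_≤ sum μ) μ
parts≤sum [] = []
parts≤sum (a ∷ μ) = m≤m+n a (sum μ) ∷ All.map (λ le → ≤-trans le (m≤n+m (sum μ) a)) (parts≤sum μ)

partitions-complete : ∀ {n μ} → IsPartition n μ → μ ∈ partitions n
partitions-complete {n} {μ} p = MemP.∈-deduplicate⁺ _≟ₗ_ (∈-filter⁺ (isPartition? n)
  (∈-boundedLists n n (transport (λ x → All (_≤ x) μ) (sum≡ p) (parts≤sum μ)) (≤-trans (length≤sum (positive-parts p)) (≤-reflexive (sum≡ p)))) p)

-- The discriminant

opaque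
  unfolding _+_

  vand-swap : ∀ x y X Y V → ((x - y) * X) * (Y * V) ≡ - (((y - x) * Y) * (X * V))
  vand-swap = solve-∀ ringℚ

  neg-*ʳ : ∀ x y → x * (- y) ≡ - (x * y)
  neg-*ʳ = solve-∀ ringℚ

  neg-square : ∀ x → (- x) * (- x) ≡ x * x
  neg-square = solve-∀ ringℚ

  square-def : ∀ x → x * (x * 1ℚ) ≡ x * x
  square-def = solve-∀ ringℚ

  square-product : ∀ a b → (a * b) * (a * b) ≡ (a * a) * (b * b)
  square-product = solve-∀ ringℚ

  neg-neg : ∀ x → - (- x) ≡ x
  neg-neg = solve-∀ ringℚ

differences : ℚ → List ℚ → ℚ
differences x ys = prodℚ (map (λ y → x - y) ys)

vand : List ℚ → ℚ
vand [] = 1ℚ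
vand (x ∷ xs) = differences x xs * vand xs

infix 4 _=±_
_=±_ : ℚ → ℚ → Set
x =± y = x ≡ y ⊎ x ≡ - y

=±-trans : ∀ {x y z} → x =± y → y =± z → x =± z
=±-trans (inj₁ refl) e = e
=±-trans (inj₂ refl) (inj₁ refl) = inj₂ refl
=±-trans {z = z} (inj₂ refl) (inj₂ refl) = inj₁ (neg-neg z)

vand-swapAt : ∀ k zs → vand zs =± vand (swapAt k zs)
vand-swapAt zero [] = inj₁ refl
vand-swapAt zero (x ∷ []) = inj₁ refl
vand-swapAt zero (x ∷ y ∷ zs) = inj₂ (vand-swap x y (differences x zs) (differences y zs) (vand zs))
vand-swapAt (suc k) [] = inj₁ refl
vand-swapAt (suc k) (x ∷ zs) with vand-swapAt k zs
... | inj₁ e = inj₁ (cong₂ _*_ (prodℚ-↭ (PermP.map⁺ (λ y → x - y) (↭-sym (swapAt-↭ k zs)))) e)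
... | inj₂ e = inj₂ (trans (cong₂ _*_ (prodℚ-↭ (PermP.map⁺ (λ y → x - y) (↭-sym (swapAt-↭ k zs)))) e) (neg-*ʳ _ _))

-- Adjacent transpositions change the Vandermonde product by a sign at most, which squaring removes.
vand²-↭ : ∀ {xs ys} → xs ↭ ys → vand xs * vand xs ≡ vand ys * vand ys
vand²-↭ {xs} {ys} e with swaps⇒↭ {n = length xs} _=±_ (inj₁ refl) =±-trans vand (λ k zs _ → vand-swapAt k zs) e refl
... | inj₁ eq = cong₂ _*_ eq eq
... | inj₂ eq = trans (cong₂ _*_ eq eq) (neg-square (vand ys))

upper : ∀ {n} → (Fin n → Fin n → ℚ) → ℚ
upper {n} h = prodℚ (List.tabulate {n = n} (λ i → prodℚ (List.tabulate {n = n} (λ j → if ⌊ toℕ i <? toℕ j ⌋ then h i j else 1ℚ))))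

⌊suc<?suc⌋ : ∀ i j → ⌊ suc i <? suc j ⌋ ≡ ⌊ i <? j ⌋
⌊suc<?suc⌋ i j = trans (isYes≗does (suc i <? suc j)) (sym (isYes≗does (i <? j)))

upper-vand : ∀ {n} (x : Vec ℚ n) → upper (λ i j → (lookup x i - lookup x j) * (lookup x i - lookup x j)) ≡ vand (toList x) * vand (toList x)
upper-vand [] = sym (F.*-identityˡ 1ℚ)
upper-vand {suc n} (x ∷ xs) = trans (cong₂ _*_ first (trans (cong prodℚ (tabulate-cong rest)) (upper-vand xs)))
  (sym (square-product (differences x (toList xs)) (vand (toList xs))))
  where
  h : Fin (suc n) → Fin (suc n) → ℚ
  h i j = (lookup (x ∷ xs) i - lookup (x ∷ xs) j) * (lookup (x ∷ xs) i - lookup (x ∷ xs) j)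
  squares-product : ∀ zs → prodℚ (map (λ z → (x - z) * (x - z)) zs) ≡ differences x zs * differences x zs
  squares-product zs = prodℚ-map-* (λ z → x - z) (λ z → x - z) zs
  first : prodℚ (List.tabulate {n = suc n} (λ j → if ⌊ 0 <? toℕ j ⌋ then h 0F j else 1ℚ)) ≡ differences x (toList xs) * differences x (toList xs)
  first = trans (F.*-identityˡ _) (trans
    (cong prodℚ (trans (tabulate-cong (λ j → cong (λ b → if b then h 0F (Fin.suc j) else 1ℚ) (isYes≗does (0 <? suc (toℕ j)))))
      (sym (trans (cong (map (λ z → (x - z) * (x - z))) (toList-tabulate xs)) (map-tabulate (lookup xs) (λ z → (x - z) * (x - z)))))))
    (squares-product (toList xs)))
  rest : ∀ (i : Fin n) → prodℚ (List.tabulate {n = suc n} (λ j → if ⌊ suc (toℕ i) <? toℕ j ⌋ then h (Fin.suc i) j else 1ℚ)) ≡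
    prodℚ (List.tabulate {n = n} (λ j → if ⌊ toℕ i <? toℕ j ⌋ then h (Fin.suc i) (Fin.suc j) else 1ℚ))
  rest i = trans (F.*-identityˡ _) (cong prodℚ (tabulate-cong (λ j → cong (λ b → if b then h (Fin.suc i) (Fin.suc j) else 1ℚ) (⌊suc<?suc⌋ (toℕ i) (toℕ j)))))

prodℚ-concatMap : ∀ {A B : Set} (g : B → ℚ) (f : A → List B) as → prodℚ (map g (concatMap f as)) ≡ prodℚ (map (λ a → prodℚ (map g (f a))) as)
prodℚ-concatMap g f [] = refl
prodℚ-concatMap g f (a ∷ as) = trans (cong prodℚ (map-++ g (f a) (concatMap f as)))
  (trans (prodℚ-++ (map g (f a)) (map g (concatMap f as))) (cong (prodℚ (map g (f a)) *_) (prodℚ-concatMap g f as)))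

ev-X : ∀ {n} (i : Fin n) a b (x : Vec ℚ n) → ev (X i) (a ∷ b ∷ x) ≡ lookup x i
ev-X i a b x = ev-var (Fin.suc (Fin.suc i)) (a ∷ b ∷ x)

ev-Δ² : ∀ {n} a b (x : Vec ℚ n) → ev (Δ² {n}) (a ∷ b ∷ x) ≡ vand (toList x) * vand (toList x)
ev-Δ² {n} a b x = begin
  ev (Δ² {n}) v ≡⟨ ev-prod (concatMap (λ i → concatMap (entry i) (allFin n)) (allFin n)) v ⟩
  prodℚ (map (λ P → ev P v) (concatMap (λ i → concatMap (entry i) (allFin n)) (allFin n)))
    ≡⟨ prodℚ-concatMap (λ P → ev P v) (λ i → concatMap (entry i) (allFin n)) (allFin n) ⟩
  prodℚ (map (λ i → prodℚ (map (λ P → ev P v) (concatMap (entry i) (allFin n)))) (allFin n))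
    ≡⟨ cong prodℚ (map-cong (λ i → trans (prodℚ-concatMap (λ P → ev P v) (entry i) (allFin n))
         (cong prodℚ (trans (map-cong (entry-value i) (allFin n)) (map-tabulate id (value′ i))))) (allFin n)) ⟩
  prodℚ (map (λ i → prodℚ (List.tabulate (value′ i))) (allFin n))
    ≡⟨ cong prodℚ (map-tabulate id (λ i → prodℚ (List.tabulate (value′ i)))) ⟩
  upper (λ i j → (lookup x i - lookup x j) * (lookup x i - lookup x j)) ≡⟨ upper-vand x ⟩
  vand (toList x) * vand (toList x) ∎
  where
  open ≡-Reasoning
  v = a ∷ b ∷ x
  entry : Fin n → Fin n → List (Poly (2 ℕ.+ n))
  entry i j = if ⌊ toℕ i <? toℕ j ⌋ then ((X i -ₚ X j) ^ₚ 2) ∷ [] else []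
  value′ : Fin n → Fin n → ℚ
  value′ i j = if ⌊ toℕ i <? toℕ j ⌋ then (lookup x i - lookup x j) * (lookup x i - lookup x j) else 1ℚ
  ev-difference : ∀ i j → ev ((X i -ₚ X j) ^ₚ 2) v ≡ (lookup x i - lookup x j) * (lookup x i - lookup x j)
  ev-difference i j = trans (ev-^ (X i -ₚ X j) 2 v) (trans (square-def (ev (X i -ₚ X j) v))
    (cong (λ y → y * y) (trans (ev-sub (X i) (X j) v) (cong₂ _-_ (ev-X i a b x) (ev-X j a b x)))))
  entry-value : ∀ i j → prodℚ (map (λ P → ev P v) (entry i j)) ≡ value′ i j
  entry-value i j = go ⌊ toℕ i <? toℕ j ⌋
    where
    go : ∀ t → prodℚ (map (λ P → ev P v) (if t then ((X i -ₚ X j) ^ₚ 2) ∷ [] else [])) ≡ (if t then (lookup x i - lookup x j) * (lookup x i - lookup x j) else 1ℚ)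
    go true = trans (F.*-identityʳ (ev ((X i -ₚ X j) ^ₚ 2) v)) (ev-difference i j)
    go false = refl

-- Fractions and their representatives

ev-ι : ∀ {n} (D : Poly 2) a b (x : Vec ℚ n) → ev (ι {n} D) (a ∷ b ∷ x) ≡ ev D (a ∷ b ∷ [])
ev-ι {n} D a b x = trans (ev-subst (λ i → var (i Fin.↑ˡ n)) D (a ∷ b ∷ x))
  (cong (ev D) (cong₂ (λ y z → y ∷ z ∷ []) (ev-var (0F Fin.↑ˡ n) (a ∷ b ∷ x)) (ev-var (Fin.suc 0F Fin.↑ˡ n) (a ∷ b ∷ x))))

≉0⇒nonzero : ∀ {m} (P : Poly m) → ¬ (P ≈ 0ₚ) → Σ (Vec ℚ m) λ v → ev P v ≢ 0ℚ
≉0⇒nonzero P ≉0 with poly-zero? (poly-ev P)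
... | inj₁ z = ⊥-elim (≉0 (ev≡0⇒≈0 P z))
... | inj₂ w = w

nonzero⇒≉0 : ∀ {m} (P : Poly m) v → ev P v ≢ 0ℚ → ¬ (P ≈ 0ₚ)
nonzero⇒≉0 P v ne e = ne (ev-resp-≈ {P = P} {0ₚ} e v)

≃-ev : ∀ {m} (f : Frac m) P Q → f ≃[ P / Q ] → ∀ v → ev (num f) v * ev Q v ≡ ev P v * ev (den f) v
≃-ev f P Q e v = trans (sym (ev-* (num f) Q v)) (trans (ev-resp-≈ {P = num f *ₚ Q} {P *ₚ den f} e v) (ev-* P (den f) v))

ev-≃ : ∀ {m} (f : Frac m) P Q → (∀ v → ev (num f) v * ev Q v ≡ ev P v * ev (den f) v) → f ≃[ P / Q ]
ev-≃ f P Q e = ev≡⇒≈ (num f *ₚ Q) (P *ₚ den f) (λ v → trans (ev-* (num f) Q v) (trans (e v) (sym (ev-* P (den f) v))))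

opaque
  unfolding _+_

  cross-multiply : ∀ N D A B C E → N * B ≡ A * D → N * E ≡ C * D → D * (A * E) ≡ D * (C * B)
  cross-multiply N D A B C E e e′ = trans (step₁ D A E) (trans (cong (_* E) (sym e)) (trans (step₂ N B E) (trans (cong (_* B) e′) (step₃ C D B))))
    where
    step₁ : ∀ D A E → D * (A * E) ≡ (A * D) * E
    step₁ = solve-∀ ringℚ
    step₂ : ∀ N B E → (N * B) * E ≡ (N * E) * B
    step₂ = solve-∀ ringℚ
    step₃ : ∀ C D B → (C * D) * B ≡ D * (C * B)
    step₃ = solve-∀ ringℚ

≃-cross : ∀ {m} (f : Frac m) A B C E → f ≃[ A / B ] → f ≃[ C / E ] → ∀ v → ev A v * ev E v ≡ ev C v * ev B v
≃-cross f A B C E e e′ = let (v₀ , ne) = ≉0⇒nonzero (den f) (den≉0 f) in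
  poly-cancel {h = ev (den f)} {λ v → ev A v * ev E v} {λ v → ev C v * ev B v} (poly-ev (den f)) (poly-* (poly-ev A) (poly-ev E)) (poly-* (poly-ev C) (poly-ev B))
    (λ v → cross-multiply (ev (num f) v) (ev (den f) v) (ev A v) (ev B v) (ev C v) (ev E v) (≃-ev f A B e v) (≃-ev f C E e′ v)) v₀ ne

image : ∀ {m n} → (Fin m → Poly n) → Vec ℚ n → Vec ℚ m
image σ v = tabulate (λ i → ev (σ i) v)

poly-image : ∀ {m n} (σ : Fin m → Poly n) {h} → IsPoly m h → IsPoly n (h ∘ image σ)
poly-image σ hp = poly-∘ (image σ) hp (λ i → poly-resp (λ v → sym (VecP.lookup∘tabulate (λ i → ev (σ i) v) i)) (poly-ev (σ i)))

image-nonzero : ∀ {m n} (σ : Fin m → Poly n) Q → ¬ (subst σ Q ≈ 0ₚ) → Σ (Vec ℚ n) λ v → ev Q (image σ v) ≢ 0ℚ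
image-nonzero σ Q ≉0 = let (v , ne) = ≉0⇒nonzero (subst σ Q) ≉0 in v , λ e → ne (trans (ev-subst σ Q v) e)

-- The witness of `Vanishes` is a representative `P′ / Q′` of its own choice. Cross-multiplication
-- with `P / E` holds after substitution as well, and the substituted `Q′` is a nonzero polynomial,
-- so it cancels.
vanishes-numerator : ∀ {m n} (σ : Fin m → Poly n) (f : Frac m) P E → f ≃[ P / E ] → Vanishes σ f → ∀ v → ev P (image σ v) ≡ 0ℚ
vanishes-numerator σ f P E e (P′ , Q′ , e′ , σQ′≉0 , σP′≈0) = let (v₀ , ne) = image-nonzero σ Q′ σQ′≉0 in
  poly-domain {h = λ v → ev Q′ (image σ v)} {λ v → ev P (image σ v)} (poly-image σ (poly-ev Q′)) (poly-image σ (poly-ev P))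
    (λ v → trans (F.*-comm (ev Q′ (image σ v)) (ev P (image σ v))) (trans (sym (≃-cross f P′ Q′ P E e′ e (image σ v)))
      (0*≡0 (trans (sym (ev-subst σ P′ v)) (ev-resp-≈ {P = subst σ P′} {0ₚ} σP′≈0 v))))) v₀ ne

opaque
  unfolding _+_

  invariant-step : ∀ P′ E P Q′ Pσ → P′ * E ≡ Pσ * Q′ → P′ * E ≡ P * Q′ → Q′ * Pσ ≡ Q′ * P
  invariant-step P′ E P Q′ Pσ e e′ = trans (F.*-comm Q′ Pσ) (trans (sym e) (trans e′ (F.*-comm P Q′)))

invariant-numerator : ∀ {m} (σ : Fin m → Poly m) (f : Frac m) P E → (∀ v → ev E (image σ v) ≡ ev E v) → f ≃[ P / E ] → Invariant σ f →
  ∀ v → ev P (image σ v) ≡ ev P v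
invariant-numerator σ f P E sym-E e (P′ , Q′ , e′ , σQ′≉0 , e″) = let (v₀ , ne) = image-nonzero σ Q′ σQ′≉0 in
  poly-cancel {h = λ v → ev Q′ (image σ v)} {λ v → ev P (image σ v)} {ev P} (poly-image σ (poly-ev Q′)) (poly-image σ (poly-ev P)) (poly-ev P)
    (λ v → invariant-step (ev P′ (image σ v)) (ev E v) (ev P v) (ev Q′ (image σ v)) (ev P (image σ v))
      (trans (cong (ev P′ (image σ v) *_) (sym (sym-E v))) (≃-cross f P′ Q′ P E e′ e (image σ v)))
      (trans (cong (_* ev E v) (sym (ev-subst σ P′ v))) (trans (≃-cross f (subst σ P′) (subst σ Q′) P E e″ e v) (cong (ev P v *_) (ev-subst σ Q′ v))))) v₀ ne

-- Degrees of univariate polynomials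

record Deg (n : ℕ) (h : ℚ → ℚ) : Set where
  constructor deg
  field
    coefficient-list : List ℚ
    length≤ : length coefficient-list ≤ n
    expansion′ : ∀ t → h t ≡ horner coefficient-list t

addLists : List ℚ → List ℚ → List ℚ
addLists [] bs = bs
addLists as@(_ ∷ _) [] = as
addLists (a ∷ as) (b ∷ bs) = a + b ∷ addLists as bs

length-addLists : ∀ {n} as bs → length as ≤ n → length bs ≤ n → length (addLists as bs) ≤ n
length-addLists [] bs l l′ = l′
length-addLists (a ∷ as) [] l l′ = l
length-addLists (a ∷ as) (b ∷ bs) (s≤s l) (s≤s l′) = s≤s (length-addLists as bs l l′)

opaque
  unfolding _+_

  0+t*x : ∀ t x → 0ℚ + t * x ≡ t * x
  0+t*x = solve-∀ ringℚ

  c-y*t : ∀ c y t → c - t * y ≡ c + t * (- y)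
  c-y*t = solve-∀ ringℚ

  product-step : ∀ c t x g → (c + t * x) * g ≡ c * g + t * (x * g)
  product-step = solve-∀ ringℚ

  shift-power : ∀ t T x → t * (T * x) ≡ (t * T) * x
  shift-power = solve-∀ ringℚ

  K*[t*T] : ∀ K t T → K * (t * T) ≡ t * (K * T)
  K*[t*T] = solve-∀ ringℚ

  K*[0*T] : ∀ K T c x → K * (0ℚ * T) ≡ c + 0ℚ * x → c ≡ 0ℚ
  K*[0*T] K T c x e = trans (sym (c+0*x≡c c x)) (trans (sym e) (annihilate K T))
    where
    annihilate : ∀ K T → K * (0ℚ * T) ≡ 0ℚ
    annihilate = solve-∀ ringℚ

  top-product : ∀ H f T g c S rs → (H + f * T) * (g + c * S) ≡ rs → (f * c) * (T * S) ≡ (rs + (- 1ℚ) * (H * g)) + ((- c) * (S * H) + (- f) * (T * g))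
  top-product H f T g c S rs refl = expand H f T g c S
    where
    expand : ∀ H f T g c S → (f * c) * (T * S) ≡ ((H + f * T) * (g + c * S) + (- 1ℚ) * (H * g)) + ((- c) * (S * H) + (- f) * (T * g))
    expand = solve-∀ ringℚ

  snoc-step : ∀ a t x c T → a + t * (x + c * T) ≡ (a + t * x) + c * (t * T)
  snoc-step = solve-∀ ringℚ

  0+c*1 : ∀ t c → c + t * 0ℚ ≡ 0ℚ + c * 1ℚ
  0+c*1 = solve-∀ ringℚ

horner-addLists : ∀ as bs t → horner (addLists as bs) t ≡ horner as t + horner bs t
horner-addLists [] bs t = sym (F.+-identityˡ _)
horner-addLists (a ∷ as) [] t = sym (x+0≡x _)
horner-addLists (a ∷ as) (b ∷ bs) t = trans (cong (λ x → a + b + t * x) (horner-addLists as bs t)) (horner-+-step a b t (horner as t) (horner bs t))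

deg-weaken : ∀ {m n h} → m ≤ n → Deg m h → Deg n h
deg-weaken m≤n (deg cs l e) = deg cs (≤-trans l m≤n) e

deg-resp : ∀ {n g h} → (∀ t → g t ≡ h t) → Deg n g → Deg n h
deg-resp eq (deg cs l e) = deg cs l λ t → trans (sym (eq t)) (e t)

deg-+ : ∀ {n g h} → Deg n g → Deg n h → Deg n (λ t → g t + h t)
deg-+ (deg as l e) (deg bs l′ e′) = deg (addLists as bs) (length-addLists as bs l l′)
  λ t → trans (cong₂ _+_ (e t) (e′ t)) (sym (horner-addLists as bs t))

deg-scale : ∀ {n g} c → Deg n g → Deg n (λ t → c * g t)
deg-scale c (deg as l e) = deg (map (c *_) as) (≤-trans (≤-reflexive (length-map (c *_) as)) l)
  λ t → trans (cong (c *_) (e t)) (sym (horner-scale c as t))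

deg-t* : ∀ {n g} → Deg n g → Deg (suc n) (λ t → t * g t)
deg-t* (deg as l e) = deg (0ℚ ∷ as) (s≤s l) λ t → trans (cong (t *_) (e t)) (sym (0+t*x t (horner as t)))

deg-t^* : ∀ {n g} k → Deg n g → Deg (k ℕ.+ n) (λ t → t ^ k * g t)
deg-t^* {g = g} zero d = deg-resp (λ t → sym (F.*-identityˡ (g t))) d
deg-t^* {g = g} (suc k) d = deg-resp (λ t → shift-power t (t ^ k) (g t)) (deg-t* (deg-t^* k d))

deg-linear : ∀ {n g} c y → Deg n g → Deg (suc n) (λ t → (c - t * y) * g t)
deg-linear {n} {g} c y d = deg-resp (λ t → sym (trans (cong (_* g t) (c-y*t c y t)) (product-step c t (- y) (g t))))
  (deg-+ (deg-scale c (deg-weaken (n≤1+n n) d)) (deg-t* (deg-scale (- y) d)))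

deg-* : ∀ {m n g h} → Deg m g → Deg n h → Deg (m ℕ.+ n) (λ t → g t * h t)
deg-* {m} {n} {g} {h} (deg cs l e) d = deg-resp (λ t → cong (_* h t) (sym (e t))) (go m cs l)
  where
  go : ∀ m cs → length cs ≤ m → Deg (m ℕ.+ n) (λ t → horner cs t * h t)
  go m [] l = deg [] z≤n λ t → F.zeroˡ (h t)
  go (suc m) (c ∷ cs) (s≤s l) = deg-resp (λ t → sym (product-step c t (horner cs t) (h t)))
    (deg-+ (deg-scale c (deg-weaken (m≤n+m n (suc m)) d)) (deg-t* (go m cs l)))

deg-monomial : ∀ {M h K} → Deg M h → (∀ t → K * t ^ M ≡ h t) → K ≡ 0ℚ
deg-monomial {M} {h} {K} (deg cs l e) eq = go M cs l (λ t → trans (eq t) (e t))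
  where
  go : ∀ M cs → length cs ≤ M → (∀ t → K * t ^ M ≡ horner cs t) → K ≡ 0ℚ
  go M [] l eq = trans (trans (sym (F.*-identityʳ K)) (cong (K *_) (sym (1^ M)))) (eq 1ℚ)
  go (suc M) (c ∷ cs) (s≤s l) eq = go M cs l (poly₁-cancel {id} poly₁-id (poly-* (poly-const K) (poly-^ M poly₁-id)) (poly-horner-list cs poly₁-id)
    (λ t → trans (sym (K*[t*T] K t (t ^ M))) (trans (eq t) (trans (cong (_+ t * horner cs t) c≡0) (F.+-identityˡ (t * horner cs t))))) 1ℚ (λ ()))
    where
    c≡0 : c ≡ 0ℚ
    c≡0 = K*[0*T] K (0ℚ ^ M) c (horner cs 0ℚ) (eq 0ℚ)

horner-∷ʳ : ∀ cs c t → horner (cs List.∷ʳ c) t ≡ horner cs t + c * t ^ length cs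
horner-∷ʳ [] c t = 0+c*1 t c
horner-∷ʳ (a ∷ cs) c t = trans (cong (λ x → a + t * x) (horner-∷ʳ cs c t)) (snoc-step a t (horner cs t) c (t ^ length cs))

entry : List ℚ → ℕ → ℚ
entry [] j = 0ℚ
entry (c ∷ cs) zero = c
entry (c ∷ cs) (suc j) = entry cs j

entry-applyUpTo : ∀ f {N j} → j < N → entry (applyUpTo f N) j ≡ f j
entry-applyUpTo f {suc N} {zero} l = refl
entry-applyUpTo f {suc N} {suc j} (s≤s l) = entry-applyUpTo (f ∘ suc) l

-- At `t = 0` the right side vanishes and `g` does not, so the constant coefficient is zero; divide
-- by `t` and repeat.
low-coefficients : ∀ e hs {g r} → Poly₁ g → Poly₁ r → (∀ t → horner hs t * g t ≡ t ^ e * r t) → g 0ℚ ≢ 0ℚ → ∀ j → j < e → entry hs j ≡ 0ℚ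
low-coefficients (suc e) [] gp rp eq ne j l = refl
low-coefficients (suc e) (c ∷ hs) {g} {r} gp rp eq ne j l = go j l
  where
  c≡0 : c ≡ 0ℚ
  c≡0 = trans (sym (c+0*x≡c c (horner hs 0ℚ))) (*-cancelʳ-0 ne (trans (eq 0ℚ) (0*≡0 (F.zeroˡ (0ℚ ^ e)))))
  reduced : ∀ t → horner hs t * g t ≡ t ^ e * r t
  reduced = poly₁-cancel {id} poly₁-id (poly-* (poly-horner-list hs poly₁-id) gp) (poly-* (poly-^ e poly₁-id) rp)
    (λ t → trans (sym (F.*-assoc t (horner hs t) (g t)))
      (trans (cong (_* g t) (sym (trans (cong (_+ t * horner hs t) c≡0) (F.+-identityˡ (t * horner hs t)))))
      (trans (eq t) (F.*-assoc t (t ^ e) (r t))))) 1ℚ (λ ())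
  go : ∀ j → j < suc e → entry (c ∷ hs) j ≡ 0ℚ
  go zero l = c≡0
  go (suc j) (s≤s l) = low-coefficients e hs gp rp reduced ne j l

-- The second factor has the nonzero leading coefficient `c` in degree `d`. A nonzero top
-- coefficient of the first factor would push the product beyond its degree bound, so it is zero;
-- drop it and repeat.
high-coefficients : ∀ (f : ℕ → ℚ) N {g d c m} → Deg d g → c ≢ 0ℚ → Deg (m ℕ.+ d) (λ t → horner (applyUpTo f N) t * (g t + c * t ^ d)) →
  ∀ j → m ≤ j → j < N → f j ≡ 0ℚ
high-coefficients f (suc N) {g} {d} {c} {m} dg c≢0 dr j m≤j j<1+N = go (m≤n⇒m<n∨m≡n (≤-pred j<1+N))
  where
  H = horner (applyUpTo f N)
  split : ∀ t → horner (applyUpTo f (suc N)) t ≡ H t + f N * t ^ N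
  split t = trans (cong (λ cs → horner cs t) (sym (ListP.applyUpTo-∷ʳ f N))) (trans (horner-∷ʳ (applyUpTo f N) (f N) t)
    (cong (λ l → H t + f N * t ^ l) (length-applyUpTo f N)))
  dH : Deg N H
  dH = deg (applyUpTo f N) (≤-reflexive (length-applyUpTo f N)) (λ _ → refl)
  top : f N ≡ 0ℚ
  top = *-cancelʳ-0 c≢0 (deg-monomial {N ℕ.+ d}
    (deg-+ (deg-+ (deg-weaken (+-monoˡ-≤ d (≤-trans m≤j (≤-pred j<1+N))) dr) (deg-scale (- 1ℚ) (deg-* dH dg)))
      (deg-+ (deg-scale (- c) (deg-weaken (≤-reflexive (+-comm d N)) (deg-t^* d dH))) (deg-scale (- f N) (deg-t^* N dg))))
    (λ t → trans (cong (f N * c *_) (^-+ t N d)) (top-product (H t) (f N) (t ^ N) (g t) c (t ^ d) _ (cong (_* (g t + c * t ^ d)) (sym (split t))))))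
  go : j < N ⊎ j ≡ N → f j ≡ 0ℚ
  go (inj₂ refl) = top
  go (inj₁ j<N) = high-coefficients f N dg c≢0 (deg-resp (λ t → cong (_* (g t + c * t ^ d))
    (trans (split t) (trans (cong (λ x → H t + x * t ^ N) top) (trans (cong (H t +_) (F.zeroˡ (t ^ N))) (x+0≡x (H t)))))) dr) j m≤j j<N

horner-drop : ∀ (f : ℕ → ℚ) e N t → (∀ j → j < e → f j ≡ 0ℚ) → horner (applyUpTo f (e ℕ.+ N)) t ≡ t ^ e * horner (applyUpTo (λ j → f (e ℕ.+ j)) N) t
horner-drop f zero N t z = sym (F.*-identityˡ _)
horner-drop f (suc e) N t z = trans (cong₂ (λ x y → x + t * y) (z 0 (s≤s z≤n)) (horner-drop (f ∘ suc) e N t (λ j l → z (suc j) (s≤s l))))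
  (trans (0+t*x t _) (shift-power t (t ^ e) _))

horner-truncate : ∀ (f : ℕ → ℚ) m N t → (∀ j → m ≤ j → f j ≡ 0ℚ) → horner (applyUpTo f (m ℕ.+ N)) t ≡ horner (applyUpTo f m) t
horner-truncate f zero N t z = horner-applyUpTo-0 f (λ j → z j z≤n) N t
horner-truncate f (suc m) N t z = cong (λ x → f 0 + t * x) (horner-truncate (f ∘ suc) m N t (λ j l → z (suc j) (s≤s l)))

-- The numerator of an element of 𝒜ₙ

numer : ∀ {n} → Poly (2 ℕ.+ n) → ℚ → ℚ → List ℚ → ℚ
numer {n} P a b zs = ev P (a ∷ b ∷ toVec n zs)

toVec-entry : ∀ n xs → toVec n xs ≡ tabulate (λ i → entry xs (toℕ i))
toVec-entry zero xs = refl
toVec-entry (suc n) [] = cong (0ℚ ∷_) (trans (toVec-entry n []) (VecP.tabulate-cong (λ _ → refl)))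
toVec-entry (suc n) (x ∷ xs) = cong (x ∷_) (toVec-entry n xs)

entry-toList : ∀ {n} (x : Vec ℚ n) i → entry (toList x) (toℕ i) ≡ lookup x i
entry-toList (t ∷ x) 0F = refl
entry-toList (t ∷ x) (Fin.suc i) = entry-toList x i

adjacent : ℕ → ∀ n → Permutation′ n
adjacent zero (suc (suc n)) = Perm.swap Perm.id
adjacent (suc k) (suc n) = Perm.lift₀ (adjacent k n)
adjacent _ _ = Perm.id

toVec-swapAt : ∀ k n zs → length zs ≡ n → toVec n (swapAt k zs) ≡ tabulate (λ i → lookup (toVec n zs) (adjacent k n ⟨$⟩ʳ i))
toVec-swapAt zero zero [] l = refl
toVec-swapAt zero (suc zero) (x ∷ []) l = refl
toVec-swapAt zero (suc (suc n)) (x ∷ y ∷ zs) l = cong (λ v → y ∷ x ∷ v) (sym (tabulate∘lookup (toVec n zs)))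
toVec-swapAt (suc k) zero [] l = refl
toVec-swapAt (suc k) (suc n) (x ∷ zs) l = cong (x ∷_) (toVec-swapAt k n zs (suc-injective l))

cross : List ℚ → List ℚ → ℚ
cross xs ys = prodℚ (map (λ x → differences x ys) xs)

-- The number of pairs among k variables, hence the power of `t` in a Vandermonde product whose k
-- variables are all scaled by `t`.
tri : ℕ → ℕ
tri zero = 0
tri (suc k) = k ℕ.+ tri k

tri+tri : ∀ k → tri k ℕ.+ tri k ≡ k ℕ.* (k ∸ 1)
tri+tri zero = refl
tri+tri (suc zero) = refl
tri+tri (suc (suc k)) = trans (arith k (tri k)) (trans (cong (λ x → 2 ℕ.* suc k ℕ.+ x) (tri+tri (suc k))) (arith′ k))
  where
  arith : ∀ k t → suc k ℕ.+ (k ℕ.+ t) ℕ.+ (suc k ℕ.+ (k ℕ.+ t)) ≡ 2 ℕ.* suc k ℕ.+ ((k ℕ.+ t) ℕ.+ (k ℕ.+ t))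
  arith = ℕSolver.solve-∀
  arith′ : ∀ k → 2 ℕ.* suc k ℕ.+ suc k ℕ.* k ≡ suc (suc k) ℕ.* suc k
  arith′ = ℕSolver.solve-∀

opaque
  unfolding _+_

  vand-++-step : ∀ A B V C W → (A * B) * ((V * C) * W) ≡ ((A * V) * (B * C)) * W
  vand-++-step = solve-∀ ringℚ

  scale-difference : ∀ t x y → t * x - t * y ≡ t * (x - y)
  scale-difference = solve-∀ ringℚ

  scale-vand : ∀ T d S V → (T * d) * (S * V) ≡ (T * S) * (d * V)
  scale-vand = solve-∀ ringℚ

  scale-product : ∀ t x T y → (t * x) * (T * y) ≡ (t * T) * (x * y)
  scale-product = solve-∀ ringℚ

  discriminant-regroup : ∀ Z C T W → ((Z * C) * (T * W)) * ((Z * C) * (T * W)) ≡ (T * T) * ((Z * W) * (Z * W) * (C * C))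
  discriminant-regroup = solve-∀ ringℚ

  pull-power : ∀ P D T R → P * (D * (T * R)) ≡ T * (P * (D * R))
  pull-power = solve-∀ ringℚ

  cross-first : ∀ P D S C → P * (D * (S * (C * C))) ≡ (D * S) * (C * (C * P))
  cross-first = solve-∀ ringℚ

  limit-step : ∀ P Q′ Q₀ P′ E P₀ → P′ * E ≡ P * Q′ → P′ * Q₀ ≡ P₀ * Q′ → Q′ * (P * Q₀) ≡ Q′ * (P₀ * E)
  limit-step P Q′ Q₀ P′ E P₀ e e′ = trans (a Q′ P Q₀) (trans (cong (_* Q₀) (sym e)) (trans (b P′ E Q₀) (trans (cong (_* E) e′) (c P₀ Q′ E))))
    where
    a : ∀ Q′ P Q₀ → Q′ * (P * Q₀) ≡ (P * Q′) * Q₀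
    a = solve-∀ ringℚ
    b : ∀ P′ E Q₀ → (P′ * E) * Q₀ ≡ (P′ * Q₀) * E
    b = solve-∀ ringℚ
    c : ∀ P₀ Q′ E → (P₀ * Q′) * E ≡ Q′ * (P₀ * E)
    c = solve-∀ ringℚ

differences-++ : ∀ x ys zs → differences x (ys ++ zs) ≡ differences x ys * differences x zs
differences-++ x ys zs = prodℚ-map-++ (λ y → x - y) ys zs

vand-++ : ∀ xs ys → vand (xs ++ ys) ≡ (vand xs * cross xs ys) * vand ys
vand-++ [] ys = sym (trans (cong (_* vand ys) (F.*-identityˡ 1ℚ)) (F.*-identityˡ (vand ys)))
vand-++ (x ∷ xs) ys = trans (cong₂ _*_ (differences-++ x xs ys) (vand-++ xs ys))
  (vand-++-step (differences x xs) (differences x ys) (vand xs) (cross xs ys) (vand ys))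

differences-scale : ∀ t x ys → differences (t * x) (map (t *_) ys) ≡ t ^ length ys * differences x ys
differences-scale t x [] = sym (F.*-identityˡ 1ℚ)
differences-scale t x (y ∷ ys) = trans (cong₂ _*_ (scale-difference t x y) (differences-scale t x ys))
  (scale-product t (x - y) (t ^ length ys) (differences x ys))

vand-scale : ∀ t ys → vand (map (t *_) ys) ≡ t ^ tri (length ys) * vand ys
vand-scale t [] = sym (F.*-identityˡ 1ℚ)
vand-scale t (y ∷ ys) = trans (cong₂ _*_ (differences-scale t y ys) (vand-scale t ys))
  (trans (scale-vand (t ^ length ys) (differences y ys) (t ^ tri (length ys)) (vand ys))
    (cong (_* (differences y ys * vand ys)) (sym (^-+ t (length ys) (tri (length ys))))))

deg-differences : ∀ {m g} z ws → Deg m g → Deg (length ws ℕ.+ m) (λ t → differences z (map (t *_) ws) * g t)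
deg-differences {g = g} z [] d = deg-resp (λ t → sym (F.*-identityˡ (g t))) d
deg-differences {g = g} z (w ∷ ws) d = deg-resp (λ t → sym (F.*-assoc (z - t * w) (differences z (map (t *_) ws)) (g t)))
  (deg-linear z w (deg-differences z ws d))

deg-cross : ∀ {m g} zs ws → Deg m g → Deg (length zs ℕ.* length ws ℕ.+ m) (λ t → cross zs (map (t *_) ws) * g t)
deg-cross {g = g} [] ws d = deg-resp (λ t → sym (F.*-identityˡ (g t))) d
deg-cross {m} {g} (z ∷ zs) ws d = deg-weaken (≤-reflexive (sym (+-assoc (length ws) (length zs ℕ.* length ws) m)))
  (deg-resp (λ t → sym (F.*-assoc (differences z (map (t *_) ws)) (cross zs (map (t *_) ws)) (g t))) (deg-differences z ws (deg-cross zs ws d)))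

poly₁-of-deg : ∀ {n h} → Deg n h → Poly₁ h
poly₁-of-deg (deg cs l e) = poly-resp (λ v → sym (e (head v))) (poly-horner-list cs poly₁-id)

entry-scaled : ∀ t m xs j → entry (take m xs ++ map (t *_) (drop m xs)) j ≡ (if ⌊ j <? m ⌋ then entry xs j else t * entry xs j)
entry-scaled t zero xs j = go xs j
  where
  go : ∀ xs j → entry (map (t *_) xs) j ≡ t * entry xs j
  go [] j = sym (F.zeroʳ t)
  go (x ∷ xs) zero = refl
  go (x ∷ xs) (suc j) = go xs j
entry-scaled t (suc m) [] j = go ⌊ j <? suc m ⌋
  where
  go : ∀ b → 0ℚ ≡ (if b then 0ℚ else t * 0ℚ)
  go true = refl
  go false = sym (F.zeroʳ t)
entry-scaled t (suc m) (x ∷ xs) zero = refl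
entry-scaled t (suc m) (x ∷ xs) (suc j) = trans (entry-scaled t m xs j)
  (cong (λ b → if b then entry xs j else t * entry xs j) (sym (⌊suc<?suc⌋ j m)))

scaled : ∀ {n} → ℕ → ℚ → Vec ℚ n → List ℚ
scaled {n} k t x = take (n ∸ k) (toList x) ++ map (t *_) (drop (n ∸ k) (toList x))

image-scaleσ : ∀ n k t a b (x : Vec ℚ n) → image (scaleσ n k) (t ∷ a ∷ b ∷ x) ≡ a ∷ b ∷ toVec n (scaled k t x)
image-scaleσ n k t a b x = cong₂ _∷_ (ev-var 1F v) (cong₂ _∷_ (ev-var 2F v)
  (trans (VecP.tabulate-cong coordinate) (sym (toVec-entry n (scaled k t x)))))
  where
  v = t ∷ a ∷ b ∷ x
  coordinate : ∀ i → ev (scaleσ n k (Fin.suc (Fin.suc i))) v ≡ entry (scaled k t x) (toℕ i)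
  coordinate i = trans (go ⌊ toℕ i <? n ∸ k ⌋) (sym (entry-scaled t (n ∸ k) (toList x) (toℕ i)))
    where
    xi : Poly (3 ℕ.+ n)
    xi = var (Fin.suc (Fin.suc (Fin.suc i)))
    ev-xi : ev xi v ≡ entry (toList x) (toℕ i)
    ev-xi = trans (ev-var (Fin.suc (Fin.suc (Fin.suc i))) v) (sym (entry-toList x i))
    go : ∀ c → ev (if c then xi else var 0F *ₚ xi) v ≡ (if c then entry (toList x) (toℕ i) else t * entry (toList x) (toℕ i))
    go true = ev-xi
    go false = trans (ev-* (var 0F) xi v) (cong₂ _*_ (ev-var 0F v) ev-xi)

ev-coeffξ-zero : ∀ {m} (P : Poly (suc m)) v → ev P (0ℚ ∷ v) ≡ ev (coeffξ 0 P) v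
ev-coeffξ-zero P v = trans (ev-horner P (suc (degBound P)) (n≤1+n _) 0ℚ v) (c+0*x≡c (ev (coeffξ 0 P) v) _)

poly₁-slice : ∀ {m} (P : Poly (suc m)) v → Poly₁ (λ t → ev P (t ∷ v))
poly₁-slice P v = poly-∘ (λ w → head w ∷ v) (poly-ev P) λ { 0F → poly₁-id ; (Fin.suc i) → poly-const (lookup v i) }

slice-deg : ∀ {m} (P : Poly (suc m)) v d → (∀ j → d < j → coeffξ j P ≈ 0ₚ) →
  ∀ t → ev P (t ∷ v) ≡ horner (applyUpTo (λ j → ev (coeffξ j P) v) (suc d)) t
slice-deg P v d z t = trans (ev-horner P (suc d ℕ.+ degBound P) (m≤n+m (degBound P) (suc d)) t v)
  (horner-truncate (λ j → ev (coeffξ j P) v) (suc d) (degBound P) t (λ j l → ev-resp-≈ {P = coeffξ j P} {0ₚ} (z j l) v))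

image-permσ : ∀ {n} (π : Permutation′ n) a b x → image (permσ π) (a ∷ b ∷ x) ≡ a ∷ b ∷ tabulate (λ i → lookup x (π ⟨$⟩ʳ i))
image-permσ π a b x = cong₂ _∷_ (ev-var 0F (a ∷ b ∷ x)) (cong₂ _∷_ (ev-var 1F (a ∷ b ∷ x))
  (VecP.tabulate-cong (λ i → ev-X (π ⟨$⟩ʳ i) a b x)))

module Numerator {n} (f : Frac (2 ℕ.+ n)) (A : InA n f) where

  P : Poly (2 ℕ.+ n)
  P = proj₁ (InA.poles A)

  D : Poly 2
  D = proj₁ (proj₂ (InA.poles A))

  D≉0 : ¬ (D ≈ 0ₚ)
  D≉0 = proj₁ (proj₂ (proj₂ (InA.poles A)))

  f≃ : f ≃[ P / (ι D *ₚ Δ²) ]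
  f≃ = proj₂ (proj₂ (proj₂ (InA.poles A)))

  ev-E : ∀ a b (x : Vec ℚ n) → ev (ι D *ₚ Δ²) (a ∷ b ∷ x) ≡ ev D (a ∷ b ∷ []) * (vand (toList x) * vand (toList x))
  ev-E a b x = trans (ev-* (ι D) Δ² (a ∷ b ∷ x)) (cong₂ _*_ (ev-ι D a b x) (ev-Δ² a b x))

  numer-swap : ∀ a b k zs → length zs ≡ n → numer P a b zs ≡ numer P a b (swapAt k zs)
  numer-swap a b k zs l = sym (trans (cong (λ x → ev P (a ∷ b ∷ x)) (toVec-swapAt k n zs l))
    (trans (cong (ev P) (sym (image-permσ (adjacent k n) a b (toVec n zs)))) (invariant (a ∷ b ∷ toVec n zs))))
    where
    E-symmetric : ∀ v → ev (ι D *ₚ Δ²) (image (permσ (adjacent k n)) v) ≡ ev (ι D *ₚ Δ²) v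
    E-symmetric (a ∷ b ∷ x) = trans (cong (ev (ι D *ₚ Δ²)) (trans (image-permσ (adjacent k n) a b x) (cong (λ y → a ∷ b ∷ y) swapped)))
      (trans (ev-E a b (toVec n (swapAt k (toList x)))) (trans (cong (ev D (a ∷ b ∷ []) *_)
        (trans (cong (λ zs → vand zs * vand zs) (toList-toVec n (swapAt k (toList x)) (trans (↭-length (swapAt-↭ k (toList x))) (length-toList x))))
          (vand²-↭ (swapAt-↭ k (toList x))))) (sym (ev-E a b x))))
      where
      swapped : tabulate (λ i → lookup x (adjacent k n ⟨$⟩ʳ i)) ≡ toVec n (swapAt k (toList x))
      swapped = sym (trans (toVec-swapAt k n (toList x) (length-toList x))
        (VecP.tabulate-cong (λ i → cong (λ y → lookup y (adjacent k n ⟨$⟩ʳ i)) (toVec-toList x))))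
    invariant : ∀ v → ev P (image (permσ (adjacent k n)) v) ≡ ev P v
    invariant = invariant-numerator (permσ (adjacent k n)) f P (ι D *ₚ Δ²) E-symmetric f≃ (InA.symmetric A (adjacent k n))

  numer-symmetric : ∀ a b → SymmetricOn n (numer P a b)
  numer-symmetric a b = swaps⇒symmetric (numer P a b) (numer-swap a b)

  numer-poly : ∀ a b → PolyOn n (numer P a b)
  numer-poly a b = polyOn-toVec (poly-fix b (poly-fix a (poly-ev P)))

  numer-vanishes : ∀ {m} (σ : Fin (2 ℕ.+ n) → Poly m) → Vanishes σ f → ∀ v → ev P (image σ v) ≡ 0ℚ
  numer-vanishes σ = vanishes-numerator σ f P (ι D *ₚ Δ²) f≃

module NumeratorBounds {n} (f : Frac (2 ℕ.+ n)) (A : InA n f) (k : ℕ) (k≤n : k ≤ n) (P′ Q′ : Poly (2 ℕ.+ n))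
  (f≃′ : f ≃[ P′ / Q′ ]) (σQ′≉0 : ¬ (subst (scaleσ n k) Q′ ≈ 0ₚ)) where
  open Numerator f A

  private σ = scaleσ n k

  SP : Poly (3 ℕ.+ n)
  SP = subst σ P

  C : ℕ → Vec ℚ (2 ℕ.+ n) → ℚ
  C j v = ev (coeffξ j SP) v

  e = k ℕ.* (k ∸ 1)
  w = (n ∸ k) ℕ.* k

  -- The limits are certified for the representative `P′ / Q′` chosen in the definition of 𝒜ₙ. This
  -- moves the certificates to the numerator over `ι D *ₚ Δ²`, whose scaling behaviour is explicit.
  limit-transfer : ∀ P₀ Q₀ → subst σ P′ *ₚ Q₀ ≈ P₀ *ₚ subst σ Q′ → ∀ v → ev SP v * ev Q₀ v ≡ ev P₀ v * ev (ι D *ₚ Δ²) (image σ v)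
  limit-transfer P₀ Q₀ eq v = trans (cong (_* ev Q₀ v) (ev-subst σ P v)) (cancelled v)
    where
    cancelled : ∀ v → ev P (image σ v) * ev Q₀ v ≡ ev P₀ v * ev (ι D *ₚ Δ²) (image σ v)
    cancelled = let (v₀ , ne) = image-nonzero σ Q′ σQ′≉0 in
      poly-cancel {h = λ v → ev Q′ (image σ v)} {λ v → ev P (image σ v) * ev Q₀ v} {λ v → ev P₀ v * ev (ι D *ₚ Δ²) (image σ v)}
        (poly-image σ (poly-ev Q′)) (poly-* (poly-image σ (poly-ev P)) (poly-ev Q₀)) (poly-* (poly-ev P₀) (poly-image σ (poly-ev (ι D *ₚ Δ²))))
        (λ v → limit-step (ev P (image σ v)) (ev Q′ (image σ v)) (ev Q₀ v) (ev P′ (image σ v)) (ev (ι D *ₚ Δ²) (image σ v)) (ev P₀ v)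
          (≃-cross f P′ Q′ P (ι D *ₚ Δ²) f≃′ f≃ (image σ v))
          (trans (cong (_* ev Q₀ v) (sym (ev-subst σ P′ v))) (trans (sym (ev-* (subst σ P′) Q₀ v))
            (trans (ev-resp-≈ {P = subst σ P′ *ₚ Q₀} {P₀ *ₚ subst σ Q′} eq v) (trans (ev-* P₀ (subst σ Q′) v) (cong (ev P₀ v *_) (ev-subst σ Q′ v)))))))
        v₀ ne

  module _ (a b : ℚ) (x : Vec ℚ n) where
    private
      zs = take (n ∸ k) (toList x)
      ws = drop (n ∸ k) (toList x)
      v : Vec ℚ (2 ℕ.+ n)
      v = a ∷ b ∷ x
      D₀ = ev D (a ∷ b ∷ [])
      S = (vand zs * vand ws) * (vand zs * vand ws)
      length-zs : length zs ≡ n ∸ k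
      length-zs = trans (ListP.length-take (n ∸ k) (toList x)) (trans (cong ((n ∸ k) ℕ.⊓_) (length-toList x)) (ℕP.m≤n⇒m⊓n≡m (m∸n≤m n k)))
      length-ws : length ws ≡ k
      length-ws = trans (ListP.length-drop (n ∸ k) (toList x)) (trans (cong (_∸ (n ∸ k)) (length-toList x)) (m∸[m∸n]≡n k≤n))
      Cr : ℚ → ℚ
      Cr t = cross zs (map (t *_) ws)

    length-scaled : ∀ t → length (scaled k t x) ≡ n
    length-scaled t = trans (length-++ zs) (trans (cong₂ ℕ._+_ length-zs (trans (length-map (t *_) ws) length-ws)) (m∸n+n≡m k≤n))

    -- Pairs of scaled variables give the power `t ^ e`, pairs of unscaled ones are constant, and
    -- mixed pairs give the square of `Cr`.
    discriminant : ∀ t → ev (ι D *ₚ Δ²) (image σ (t ∷ v)) ≡ D₀ * (t ^ e * (S * (Cr t * Cr t)))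
    discriminant t = trans (cong (ev (ι D *ₚ Δ²)) (image-scaleσ n k t a b x)) (trans (ev-E a b (toVec n (scaled k t x)))
      (cong (D₀ *_) (trans (cong (λ zs → vand zs * vand zs) (toList-toVec n (scaled k t x) (length-scaled t)))
        (trans (cong (λ V → V * V) (trans (vand-++ zs (map (t *_) ws)) (cong (vand zs * Cr t *_) (vand-scale t ws))))
          (trans (discriminant-regroup (vand zs) (Cr t) (t ^ tri (length ws)) (vand ws))
            (cong (_* (S * (Cr t * Cr t))) (trans (sym (^-+ t (tri (length ws)) (tri (length ws))))
              (cong (t ^_) (trans (tri+tri (length ws)) (cong (λ k → k ℕ.* (k ∸ 1)) length-ws))))))))))

    Cr-deg : ∀ {m g} → Deg m g → Deg (w ℕ.+ m) (λ t → Cr t * g t)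
    Cr-deg {m} d = deg-weaken (≤-reflexive (cong (ℕ._+ m) (cong₂ ℕ._*_ length-zs length-ws))) (deg-cross zs ws d)

    Cr-poly : Poly₁ Cr
    Cr-poly = poly-resp (λ v → F.*-identityʳ (Cr (head v))) (poly₁-of-deg (Cr-deg {1} {λ _ → 1ℚ} (deg (1ℚ ∷ []) ≤-refl λ t → sym (trans (cong (1ℚ +_) (F.zeroʳ t)) (x+0≡x 1ℚ)))))

    -- The denominator of the limit certificate is nonzero at 0, so the factor `t ^ e` of the
    -- discriminant must divide the scaled numerator.
    low-at : ∀ P₀ Q₀ → subst σ P′ *ₚ Q₀ ≈ P₀ *ₚ subst σ Q′ → ∀ j → j < e → ev (coeffξ 0 Q₀) v ≢ 0ℚ → C j v ≡ 0ℚ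
    low-at P₀ Q₀ eq j j<e ne = trans (sym (entry-applyUpTo (λ j → C j v) {N} (m≤m⊔n (suc j) (degBound SP))))
      (low-coefficients e (coeffs N SP v) {λ t → ev Q₀ (t ∷ v)} {λ t → ev P₀ (t ∷ v) * (D₀ * (S * (Cr t * Cr t)))}
        (poly₁-slice Q₀ v) (poly-* (poly₁-slice P₀ v) (poly-* (poly-const D₀) (poly-* (poly-const S) (poly-* Cr-poly Cr-poly))))
        (λ t → trans (cong (_* ev Q₀ (t ∷ v)) (sym (ev-horner SP N (m≤n⊔m (suc j) (degBound SP)) t v)))
          (trans (limit-transfer P₀ Q₀ eq (t ∷ v)) (trans (cong (ev P₀ (t ∷ v) *_) (discriminant t))
            (pull-power (ev P₀ (t ∷ v)) D₀ (t ^ e) (S * (Cr t * Cr t))))))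
        (λ z → ne (trans (sym (ev-coeffξ-zero Q₀ v)) z)) j j<e)
      where
      N = suc j ⊔ degBound SP

    -- In the certificate at infinity the denominator has degree exactly `d` and the numerator at
    -- most `d`, so the scaled numerator has at most the degree `e + 2w` of the scaled discriminant.
    high-at : ∀ P∞ Q∞ d → subst σ P′ *ₚ Q∞ ≈ P∞ *ₚ subst σ Q′ → (∀ j → d < j → coeffξ j P∞ ≈ 0ₚ) → (∀ j → d < j → coeffξ j Q∞ ≈ 0ₚ) →
      ∀ j → e ℕ.+ suc (2 ℕ.* w) ≤ j → ev (coeffξ d Q∞) v ≢ 0ℚ → C j v ≡ 0ℚ
    high-at P∞ Q∞ d eq small-P small-Q j l ne = high-coefficients (λ j → C j v) N {λ t → horner (applyUpTo qs d) t} {d} {qs d} {e ℕ.+ suc (2 ℕ.* w)}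
      (deg (applyUpTo qs d) (≤-reflexive (length-applyUpTo qs d)) (λ _ → refl)) ne
      (deg-resp (λ t → sym (trans (cong₂ _*_ (sym (ev-horner SP N (m≤n⊔m (suc j) (degBound SP)) t v)) (sym (Q-top t))) (cleared t)))
        (deg-weaken (≤-reflexive (arith e w d))
          (deg-t^* e (deg-scale (D₀ * S) (Cr-deg (Cr-deg (deg (applyUpTo (λ j → ev (coeffξ j P∞) v) (suc d))
            (≤-reflexive (length-applyUpTo (λ j → ev (coeffξ j P∞) v) (suc d))) (slice-deg P∞ v d small-P))))))))
      j l (m≤m⊔n (suc j) (degBound SP))
      where
      N = suc j ⊔ degBound SP
      qs : ℕ → ℚ
      qs j = ev (coeffξ j Q∞) v
      Q-top : ∀ t → ev Q∞ (t ∷ v) ≡ horner (applyUpTo qs d) t + qs d * t ^ d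
      Q-top t = trans (slice-deg Q∞ v d small-Q t) (trans (cong (λ cs → horner cs t) (sym (ListP.applyUpTo-∷ʳ qs d)))
        (trans (horner-∷ʳ (applyUpTo qs d) (qs d) t) (cong (λ l → horner (applyUpTo qs d) t + qs d * t ^ l) (length-applyUpTo qs d))))
      cleared : ∀ t → ev SP (t ∷ v) * ev Q∞ (t ∷ v) ≡ t ^ e * ((D₀ * S) * (Cr t * (Cr t * ev P∞ (t ∷ v))))
      cleared t = trans (limit-transfer P∞ Q∞ eq (t ∷ v)) (trans (cong (ev P∞ (t ∷ v) *_) (discriminant t))
        (trans (pull-power (ev P∞ (t ∷ v)) D₀ (t ^ e) (S * (Cr t * Cr t))) (cong (t ^ e *_) (cross-first (ev P∞ (t ∷ v)) D₀ S (Cr t)))))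
      arith : ∀ e w d → e ℕ.+ (w ℕ.+ (w ℕ.+ suc d)) ≡ e ℕ.+ suc (2 ℕ.* w) ℕ.+ d
      arith = ℕSolver.solve-∀

  -- The bounds are known where the decisive coefficient of the certificate is nonzero, that is, on
  -- a dense set.
  generic-vanishing : ∀ j Q → ¬ (Q ≈ 0ₚ) → (∀ v → ev Q v ≢ 0ℚ → C j v ≡ 0ℚ) → ∀ v → C j v ≡ 0ℚ
  generic-vanishing j Q Q≉0 h = let (v₀ , ne) = ≉0⇒nonzero Q Q≉0 in
    poly-domain {h = ev Q} {C j} (poly-ev Q) (poly-ev (coeffξ j SP))
      (λ v → case ev Q v ℚP.≟ 0ℚ of λ { (yes z) → 0*≡0 z ; (no ne) → *0≡0 (h v ne) }) v₀ ne

  numer-ranged : (L : Frac (2 ℕ.+ n)) → LimZero (subst σ P′) (subst σ Q′) L → LimInf (subst σ P′) (subst σ Q′) L →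
    ∀ v → Ranged e (suc (2 ℕ.* w)) (λ t → ev SP (t ∷ v))
  numer-ranged L (P₀ , Q₀ , eq₀ , Q₀≉0 , _) (P∞ , Q∞ , d , eq∞ , small-P , small-Q , Q∞≉0 , _) v =
    ranged (applyUpTo (λ j → C (e ℕ.+ j) v) m) (length-applyUpTo (λ j → C (e ℕ.+ j) v) m)
    λ t → trans (ev-horner SP (e ℕ.+ (m ℕ.+ degBound SP)) (≤-trans (m≤n+m (degBound SP) m) (m≤n+m (m ℕ.+ degBound SP) e)) t v)
      (trans (horner-drop (λ j → C j v) e (m ℕ.+ degBound SP) t (λ j l → low j l v))
        (cong (t ^ e *_) (horner-truncate (λ j → C (e ℕ.+ j) v) m (degBound SP) t (λ j l → high (e ℕ.+ j) (+-monoʳ-≤ e l) v))))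
    where
    m = suc (2 ℕ.* w)
    low : ∀ j → j < e → ∀ v → C j v ≡ 0ℚ
    low j j<e = generic-vanishing j (coeffξ 0 Q₀) Q₀≉0 λ { (a ∷ b ∷ x) → low-at a b x P₀ Q₀ eq₀ j j<e }
    high : ∀ j → e ℕ.+ suc (2 ℕ.* w) ≤ j → ∀ v → C j v ≡ 0ℚ
    high j l = generic-vanishing j (coeffξ d Q∞) Q∞≉0 λ { (a ∷ b ∷ x) → high-at a b x P∞ Q∞ d eq∞ small-P small-Q j l }

-- Substitutions evaluated on the numerator

take-length-++ : ∀ {A : Set} (xs ys : List A) → take (length xs) (xs ++ ys) ≡ xs
take-length-++ [] ys = refl
take-length-++ (x ∷ xs) ys = cong (x ∷_) (take-length-++ xs ys)

drop-length-++ : ∀ {A : Set} (xs ys : List A) → drop (length xs) (xs ++ ys) ≡ ys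
drop-length-++ [] ys = refl
drop-length-++ (x ∷ xs) ys = drop-length-++ xs ys

image-wheelσ : ∀ r c p q x y z (w : Vec ℚ r) →
  image (wheelσ r c) (p ∷ q ∷ x ∷ y ∷ z ∷ w) ≡ p ∷ q ∷ x ∷ ev c (p ∷ q ∷ []) * x ∷ p * (q * x) ∷ w
image-wheelσ r c p q x y z w = cong₂ _∷_ (ev-var 0F v) (cong₂ _∷_ (ev-var 1F v) (cong₂ _∷_ ev-x
  (cong₂ _∷_ (trans (ev-* (ι c) (X 0F) v) (cong₂ _*_ (ev-ι c p q (x ∷ y ∷ z ∷ w)) ev-x))
    (cong₂ _∷_ (trans (ev-* (ι (q₁ *ₚ q₂)) (X 0F) v) (trans (cong₂ _*_ (trans (ev-ι (q₁ *ₚ q₂) p q (x ∷ y ∷ z ∷ w))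
        (trans (ev-* q₁ q₂ (p ∷ q ∷ [])) (cong₂ _*_ (ev-var 0F (p ∷ q ∷ [])) (ev-var 1F (p ∷ q ∷ []))))) ev-x) (F.*-assoc p q x)))
      (trans (VecP.tabulate-cong (λ i → ev-X (Fin.suc (Fin.suc (Fin.suc i))) p q (x ∷ y ∷ z ∷ w))) (tabulate∘lookup w))))))
  where
  v = p ∷ q ∷ x ∷ y ∷ z ∷ w
  ev-x : ev (X {3 ℕ.+ r} 0F) v ≡ x
  ev-x = ev-X 0F p q (x ∷ y ∷ z ∷ w)

ev-varℕ : ∀ {m} k (v : Vec ℚ m) → ev (varℕ {m} k) v ≡ entry (toList v) k
ev-varℕ {m} k v with k <? m
... | yes k<m = trans (ev-var (fromℕ< k<m) v) (trans (sym (entry-toList v (fromℕ< k<m))) (cong (entry (toList v)) (FinP.toℕ-fromℕ< k<m)))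
... | no k≮m = sym (beyond v k (≮⇒≥ k≮m))
  where
  beyond : ∀ {m} (v : Vec ℚ m) k → m ≤ k → entry (toList v) k ≡ 0ℚ
  beyond [] k l = refl
  beyond (x ∷ v) (suc k) (s≤s l) = beyond v k l

entry-str : ∀ p a y rest k → k < a → entry (str p a y ++ rest) k ≡ p ^ k * y
entry-str p (suc a) y rest zero l = sym (F.*-identityˡ y)
entry-str p (suc a) y rest (suc k) (s≤s l) = trans (entry-str p a (p * y) rest k l) (str-step p (p ^ k) y)

entry-beyond-str : ∀ p a y rest k → a ≤ k → entry (str p a y ++ rest) k ≡ entry rest (k ∸ a)
entry-beyond-str p zero y rest k l = refl
entry-beyond-str p (suc a) y rest (suc k) (s≤s l) = entry-beyond-str p a (p * y) rest k l

entry-strings : ∀ p μ (y : Vec ℚ (length μ)) k → k < sum μ →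
  entry (strings p (zipBlocks μ y)) k ≡ p ^ proj₂ (blockPos μ k) * entry (toList y) (proj₁ (blockPos μ k))
entry-strings p (a ∷ μ) (y ∷ ys) k l with k <? a
... | yes k<a = entry-str p a y (strings p (zipBlocks μ ys)) k k<a
... | no k≮a = trans (entry-beyond-str p a y (strings p (zipBlocks μ ys)) k (≮⇒≥ k≮a))
  (entry-strings p μ ys (k ∸ a) (ℕP.+-cancelˡ-< a (k ∸ a) (sum μ) (transport (_< a ℕ.+ sum μ) (sym (m+[n∸m]≡n (≮⇒≥ k≮a))) l)))

image-specσ : ∀ {n} c μ a b (y : Vec ℚ (length μ)) → sum μ ≡ n →
  image (specσ {n} c μ) (a ∷ b ∷ y) ≡ a ∷ b ∷ toVec n (strings (ev c (a ∷ b ∷ [])) (zipBlocks μ y))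
image-specσ {n} c μ a b y refl = cong₂ _∷_ (ev-var 0F v) (cong₂ _∷_ (ev-var 1F v)
  (trans (VecP.tabulate-cong coordinate) (sym (toVec-entry n (strings p (zipBlocks μ y))))))
  where
  v = a ∷ b ∷ y
  p = ev c (a ∷ b ∷ [])
  coordinate : ∀ i → ev (specσ {n} c μ (Fin.suc (Fin.suc i))) v ≡ entry (strings p (zipBlocks μ y)) (toℕ i)
  coordinate i = trans (ev-* (ι c ^ₚ proj₂ (blockPos μ (toℕ i))) (varℕ (2 ℕ.+ proj₁ (blockPos μ (toℕ i)))) v)
    (trans (cong₂ _*_ (trans (ev-^ (ι c) (proj₂ (blockPos μ (toℕ i))) v) (cong (_^ proj₂ (blockPos μ (toℕ i))) (ev-ι c a b y)))
      (ev-varℕ (2 ℕ.+ proj₁ (blockPos μ (toℕ i))) v)) (sym (entry-strings p μ y (toℕ i) (FinP.toℕ<n i))))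

ev-q₁ : ∀ a b → ev q₁ (a ∷ b ∷ []) ≡ a
ev-q₁ a b = ev-var 0F (a ∷ b ∷ [])

ev-q₂ : ∀ a b → ev q₂ (a ∷ b ∷ []) ≡ b
ev-q₂ a b = ev-var 1F (a ∷ b ∷ [])

inA-wheel : ∀ {n} (f : Frac (2 ℕ.+ n)) (A : InA n f) a b x zs → 3 ℕ.+ length zs ≡ n →
  numer (Numerator.P f A) a b (x ∷ a * x ∷ a * (b * x) ∷ zs) ≡ 0ℚ × numer (Numerator.P f A) a b (x ∷ b * x ∷ a * (b * x) ∷ zs) ≡ 0ℚ
inA-wheel f A a b x zs refl = at q₁ (ev-q₁ a b) (proj₁ (InA.wheel A)) , at q₂ (ev-q₂ a b) (proj₂ (InA.wheel A))
  where
  r = length zs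
  at : ∀ c {c̄} → ev c (a ∷ b ∷ []) ≡ c̄ → Vanishes (wheelσ r c) f → numer (Numerator.P f A) a b (x ∷ c̄ * x ∷ a * (b * x) ∷ zs) ≡ 0ℚ
  at c refl vanish = trans (cong (ev (Numerator.P f A)) (sym (image-wheelσ r c a b x 0ℚ 0ℚ (toVec r zs))))
    (Numerator.numer-vanishes f A (wheelσ r c) vanish (a ∷ b ∷ x ∷ 0ℚ ∷ 0ℚ ∷ toVec r zs))

inA-wheeled : ∀ {n} (f : Frac (2 ℕ.+ n)) (A : InA n f) a b → Wheeled a b n (numer (Numerator.P f A) a b)
inA-wheeled f A a b = record
  { poly = Numerator.numer-poly f A a b ; symmetric = Numerator.numer-symmetric f A a b
  ; wheel₁ = λ x zs l → proj₁ (inA-wheel f A a b x zs l) ; wheel₂ = λ x zs l → proj₂ (inA-wheel f A a b x zs l) }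

-- This is `numer-ranged` for k = `length ws`. The limit scales the last variables and `Bounded` the
-- first ones, whence the use of symmetry.
inA-bounded : ∀ {n} (f : Frac (2 ℕ.+ n)) (A : InA n f) a b → Bounded n (numer (Numerator.P f A) a b)
inA-bounded {n} f A a b ws zs l = go (InA.limits A k k≤n)
  where
  k = length ws
  k≤n : k ≤ n
  k≤n = ≤-trans (m≤m+n k (length zs)) (≤-reflexive l)
  n∸k : n ∸ k ≡ length zs
  n∸k = trans (cong (_∸ k) (sym l)) (ℕP.m+n∸m≡n k (length zs))
  P = Numerator.P f A
  x = toVec n (zs ++ ws)
  toList-x : toList x ≡ zs ++ ws
  toList-x = toList-toVec n (zs ++ ws) (trans (length-++ zs) (trans (+-comm (length zs) k) l))
  scaled≡ : ∀ t → scaled k t x ≡ zs ++ map (t *_) ws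
  scaled≡ t = cong₂ (λ as bs → as ++ map (t *_) bs)
    (trans (cong₂ take n∸k toList-x) (take-length-++ zs ws)) (trans (cong₂ drop n∸k toList-x) (drop-length-++ zs ws))
  go : LimitsCoincide (scaleσ n k) f → Ranged (k ℕ.* (k ∸ 1)) (suc (2 ℕ.* (k ℕ.* length zs))) (λ t → numer P a b (map (t *_) ws ++ zs))
  go (P′ , Q′ , f≃′ , σQ′≉0 , L , lim₀ , lim∞) =
    transport (λ w → Ranged (k ℕ.* (k ∸ 1)) (suc (2 ℕ.* w)) (λ t → numer P a b (map (t *_) ws ++ zs))) (trans (cong (ℕ._* k) n∸k) (ℕP.*-comm (length zs) k))
      (ranged-resp (λ t → trans (ev-subst (scaleσ n k) P (t ∷ a ∷ b ∷ x)) (trans (cong (ev P) (image-scaleσ n k t a b x))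
          (trans (cong (numer P a b) (scaled≡ t)) (Numerator.numer-symmetric f A a b (PermP.++-comm zs (map (t *_) ws))
            (trans (length-++ zs) (trans (cong (length zs ℕ.+_) (length-map (t *_) ws)) (trans (+-comm (length zs) k) l)))))))
        (NumeratorBounds.numer-ranged f A k k≤n P′ Q′ f≃′ σQ′≉0 L lim₀ lim∞ (a ∷ b ∷ x)))

inA-spec : ∀ {n} (f : Frac (2 ℕ.+ n)) (A : InA n f) c μ → sum μ ≡ n → Vanishes (specσ {n} c μ) f →
  ∀ a b y → numer (Numerator.P f A) a b (strings (ev c (a ∷ b ∷ [])) (zipBlocks μ y)) ≡ 0ℚ
inA-spec {n} f A c μ e vanish a b y = trans (cong (ev (Numerator.P f A)) (sym (image-specσ {n} c μ a b y e)))
  (Numerator.numer-vanishes f A (specσ {n} c μ) vanish (a ∷ b ∷ y))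

-- A Zariski dense set of multiplicatively independent pairs

3^-odd : ∀ y → Σ ℕ λ k → 3 ℕ.^ y ≡ suc (2 ℕ.* k)
3^-odd zero = 0 , refl
3^-odd (suc y) = let (k , e) = 3^-odd y in suc (3 ℕ.* k) , trans (cong (3 ℕ.*_) e) (arith k)
  where
  arith : ∀ k → 3 ℕ.* suc (2 ℕ.* k) ≡ suc (2 ℕ.* suc (3 ℕ.* k))
  arith = ℕSolver.solve-∀

odd≢even : ∀ k m → suc (2 ℕ.* k) ≢ 2 ℕ.* m
odd≢even zero (suc m) e with trans (suc-injective e) (+-suc m (m ℕ.+ 0))
... | ()
odd≢even (suc k) (suc m) e = odd≢even k m (suc-injective (suc-injective (trans (cong suc (sym (arith k))) (trans e (arith m)))))
  where
  arith : ∀ k → 2 ℕ.* suc k ≡ suc (suc (2 ℕ.* k))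
  arith = ℕSolver.solve-∀

3^-injective : ∀ y y′ → 3 ℕ.^ y ≡ 3 ℕ.^ y′ → y ≡ y′
3^-injective y y′ e with ℕP.<-cmp y y′
... | Tri.tri< l _ _ = ⊥-elim (<⇒≢ (ℕP.^-monoʳ-< 3 (s≤s (s≤s z≤n)) l) e)
... | Tri.tri≈ _ eq _ = eq
... | Tri.tri> _ _ l = ⊥-elim (<⇒≢ (ℕP.^-monoʳ-< 3 (s≤s (s≤s z≤n)) l) (sym e))

-- Parity alone is enough: powers of 3 are odd, so the exponents of 2 can be lowered together.
2^3^-injective : ∀ x y x′ y′ → 2 ℕ.^ x ℕ.* 3 ℕ.^ y ≡ 2 ℕ.^ x′ ℕ.* 3 ℕ.^ y′ → x ≡ x′ × y ≡ y′
2^3^-injective zero y zero y′ e = refl , 3^-injective y y′ (trans (sym (*-identityˡ _)) (trans e (*-identityˡ _)))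
2^3^-injective zero y (suc x′) y′ e = let (k , odd) = 3^-odd y in
  ⊥-elim (odd≢even k (2 ℕ.^ x′ ℕ.* 3 ℕ.^ y′) (trans (sym odd) (trans (sym (*-identityˡ _)) (trans e (*-assoc 2 (2 ℕ.^ x′) (3 ℕ.^ y′))))))
2^3^-injective (suc x) y zero y′ e = let (k , odd) = 3^-odd y′ in
  ⊥-elim (odd≢even k (2 ℕ.^ x ℕ.* 3 ℕ.^ y) (trans (sym odd) (trans (sym (*-identityˡ _)) (trans (sym e) (*-assoc 2 (2 ℕ.^ x) (3 ℕ.^ y))))))
2^3^-injective (suc x) y (suc x′) y′ e = cong suc (proj₁ smaller) , proj₂ smaller
  where
  smaller = 2^3^-injective x y x′ y′ (ℕP.*-cancelˡ-≡ (2 ℕ.^ x ℕ.* 3 ℕ.^ y) (2 ℕ.^ x′ ℕ.* 3 ℕ.^ y′) 2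
    (trans (sym (*-assoc 2 (2 ℕ.^ x) (3 ℕ.^ y))) (trans e (*-assoc 2 (2 ℕ.^ x′) (3 ℕ.^ y′)))))

-- Exponents start at 1, since the value 1 would not be multiplicatively independent of anything.
grid₁ grid₂ : ℕ → ℚ
grid₁ i = fromℕ (2 ℕ.^ suc i)
grid₂ j = fromℕ (3 ℕ.^ suc j)

grid₁-injective : ∀ i j → grid₁ i ≡ grid₁ j → i ≡ j
grid₁-injective i j e = suc-injective (proj₁ (2^3^-injective (suc i) 0 (suc j) 0 (cong (ℕ._* 1) (fromℕ-injective (2 ℕ.^ suc i) (2 ℕ.^ suc j) e))))

grid₂-injective : ∀ i j → grid₂ i ≡ grid₂ j → i ≡ j
grid₂-injective i j e = suc-injective (3^-injective (suc i) (suc j) (fromℕ-injective (3 ℕ.^ suc i) (3 ℕ.^ suc j) e))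

fromℕ-pos : ∀ n → 1 ≤ n → fromℕ n ≢ 0ℚ
fromℕ-pos (suc n) _ = fromℕ-suc≢0 n

grid-generic : ∀ i j → Generic (grid₁ i) (grid₂ j)
grid-generic i j = record
  { p≢0 = fromℕ-pos (2 ℕ.^ suc i) (ℕP.m^n>0 2 (suc i))
  ; q≢0 = fromℕ-pos (3 ℕ.^ suc j) (ℕP.m^n>0 3 (suc j))
  ; independent = λ a b c d e →
      let (x , y) = 2^3^-injective (suc i ℕ.* a) (suc j ℕ.* b) (suc i ℕ.* c) (suc j ℕ.* d)
            (fromℕ-injective (2 ℕ.^ (suc i ℕ.* a) ℕ.* 3 ℕ.^ (suc j ℕ.* b)) (2 ℕ.^ (suc i ℕ.* c) ℕ.* 3 ℕ.^ (suc j ℕ.* d)) (trans (sym (monomial a b)) (trans e (monomial c d))))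
      in ℕP.*-cancelˡ-≡ a c (suc i) x , ℕP.*-cancelˡ-≡ b d (suc j) y }
  where
  monomial : ∀ a b → grid₁ i ^ a * grid₂ j ^ b ≡ fromℕ (2 ℕ.^ (suc i ℕ.* a) ℕ.* 3 ℕ.^ (suc j ℕ.* b))
  monomial a b = trans (cong₂ _*_ (trans (sym (fromℕ-^ (2 ℕ.^ suc i) a)) (cong fromℕ (ℕP.^-*-assoc 2 (suc i) a)))
    (trans (sym (fromℕ-^ (3 ℕ.^ suc j) b)) (cong fromℕ (ℕP.^-*-assoc 3 (suc j) b)))) (sym (fromℕ-* (2 ℕ.^ (suc i ℕ.* a)) (3 ℕ.^ (suc j ℕ.* b))))

grid-dense : ∀ {m} {h : Vec ℚ (2 ℕ.+ m) → ℚ} → IsPoly (2 ℕ.+ m) h → (∀ i j v → h (grid₁ i ∷ grid₂ j ∷ v) ≡ 0ℚ) → ∀ v → h v ≡ 0ℚ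
grid-dense {h = h} hp z (a ∷ b ∷ v) =
  let (bs , hb) = poly-horner {h = λ w → h (a ∷ w)} (poly-fix a hp) v in
  trans (hb b) (horner-zero-at grid₂ grid₂-injective bs (λ j → trans (sym (hb (grid₂ j)))
    (let (as , ha) = poly-horner hp (grid₂ j ∷ v) in
     trans (ha a) (horner-zero-at grid₁ grid₁-injective as (λ i → trans (sym (ha (grid₁ i))) (z i j v)) a))) b)

-- Uniqueness

ranged-+ : ∀ {e l g h} → Ranged e l g → Ranged e l h → Ranged e l (λ t → g t + h t)
ranged-+ {e} (ranged as la ea) (ranged bs lb eb) = ranged (addLists as bs) (exact as bs la lb)
  λ t → trans (cong₂ _+_ (ea t) (eb t)) (trans (sym (F.distribˡ (t ^ e) (horner as t) (horner bs t))) (cong (t ^ e *_) (sym (horner-addLists as bs t))))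
  where
  exact : ∀ {l} as bs → length as ≡ l → length bs ≡ l → length (addLists as bs) ≡ l
  exact [] bs refl l′ = l′
  exact (a ∷ as) (b ∷ bs) refl l′ = cong suc (exact as bs refl (suc-injective l′))

ranged-scale : ∀ {e l g} c → Ranged e l g → Ranged e l (λ t → c * g t)
ranged-scale {e} c (ranged as la ea) = ranged (map (c *_) as) (trans (length-map (c *_) as) la)
  λ t → trans (cong (c *_) (ea t)) (trans (swap-power c (t ^ e) (horner as t)) (cong (t ^ e *_) (sym (horner-scale c as t))))

bounded-linear : ∀ {n F G} c d → Bounded n F → Bounded n G → Bounded n (λ zs → c * F zs + d * G zs)
bounded-linear c d bF bG ws zs l = ranged-+ (ranged-scale c (bF ws zs l)) (ranged-scale d (bG ws zs l))

ones-isPartition : ∀ n → IsPartition n (List.replicate n 1)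
ones-isPartition n = isPartition (decreasing-ones n) (all-ones n) (sum-ones n)
  where
  all-ones : ∀ n → All (1 ≤_) (List.replicate n 1)
  all-ones zero = []
  all-ones (suc n) = s≤s z≤n ∷ all-ones n
  below-ones : ∀ n → All (_≤ 1) (List.replicate n 1)
  below-ones zero = []
  below-ones (suc n) = s≤s z≤n ∷ below-ones n
  decreasing-ones : ∀ n → Decreasing (List.replicate n 1)
  decreasing-ones zero = []
  decreasing-ones (suc n) = below-ones n ∷ decreasing-ones n
  sum-ones : ∀ n → sum (List.replicate n 1) ≡ n
  sum-ones zero = refl
  sum-ones (suc n) = cong suc (sum-ones n)

strings-ones : ∀ p n xs → length xs ≡ n → Σ (Vec ℚ (length (List.replicate n 1))) λ y → strings p (zipBlocks (List.replicate n 1) y) ≡ xs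
strings-ones p zero [] l = [] , refl
strings-ones p (suc n) (x ∷ xs) l = let (y , e) = strings-ones p n xs (suc-injective l) in x ∷ y , cong (x ∷_) e

opaque
  unfolding _+_

  eF*[F*G′] : ∀ e F G′ → e * (F * G′) ≡ F * (e * G′)
  eF*[F*G′] = solve-∀ ringℚ

  eF*[F′*G] : ∀ c F F′ → F * (c * F′) ≡ F′ * (c * F)
  eF*[F′*G] = solve-∀ ringℚ

  combination-zero : ∀ x y → x * y + (- y) * x ≡ 0ℚ
  combination-zero = solve-∀ ringℚ

  combination⇒≡ : ∀ a F b G → a * F + (- b) * G ≡ 0ℚ → b * G ≡ a * F
  combination⇒≡ a F b G e = sym (x-y≡0⇒x≡y (trans (regroup a F b G) e))
    where
    regroup : ∀ a F b G → a * F - b * G ≡ a * F + (- b) * G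
    regroup = solve-∀ ringℚ

  combination-of-zeros : ∀ a b → a * 0ℚ + b * 0ℚ ≡ 0ℚ
  combination-of-zeros = solve-∀ ringℚ

module Pointwise (p q : ℚ) (gen : Generic p q) where
  module R = RowTheory p q gen
  module C = RowTheory q p (generic-swap gen)
  module FR = Filtration p q gen
  module FC = Filtration q p (generic-swap gen)
  module DR = Diagonal p q gen
  module DC = Diagonal q p (generic-swap gen)

  1≢0 : 1ℚ ≢ 0ℚ
  1≢0 ()

  rowValue-unique : ∀ μ {F e e′} → R.RowValue μ 1ℚ F e → R.RowValue μ 1ℚ F e′ → e ≡ e′
  rowValue-unique μ {F} {e} {e′} v v′ = trans (sym (simplify e)) (trans
    (R.rowValue-compare μ {F = F} {F} 1≢0 v v′ 1ℚ 1ℚ (λ _ → 1ℚ) (λ _ → 1ℚ) (λ _ → poly-const 1ℚ) (λ _ → poly-const 1ℚ) (λ zs l → refl)) (simplify e′))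
    where
    simplify : ∀ e → 1ℚ * (e * prodℚ (map (λ _ → 1ℚ) (R.boxes μ 1ℚ))) ≡ e
    simplify e = trans (F.*-identityˡ _) (trans (cong (e *_) (prodℚ-1 (R.boxes μ 1ℚ))) (F.*-identityʳ e))

  -- For the partition into ones the strings are single points, so vanishing there is vanishing
  -- everywhere; the filtration is applied to the set of all diagrams.
  zero-from-row-values : ∀ {n F} → Wheeled p q n F → Bounded n F → (∀ μ → IsPartition n μ → ∀ e → R.RowValue μ 1ℚ F e → e ≡ 0ℚ) →
    ∀ xs → length xs ≡ n → F xs ≡ 0ℚ
  zero-from-row-values {n} {F} w b z xs l = let (y , e) = strings-ones p n xs l in
    trans (cong F (sym e)) (FR.filtration-vanishing {n} {F} 1≢0 w b (λ _ → ⊤) (λ _ _ → tt) (λ μ part _ → z μ part) (List.replicate n 1) (ones-isPartition n) tt y)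

  module _ {n} {la : List ℕ} (la-part : IsPartition n la) where

    OnlyAt : (List ℚ → ℚ) → Set
    OnlyAt F = ∀ μ → IsPartition n μ → μ ≢ la → ∀ e → R.RowValue μ 1ℚ F e → e ≡ 0ℚ

    -- A nonzero row value at `μ` forces `μ ≤ᵈ la` by the first filter. By transposition the column
    -- value at `conj μ` is nonzero too, so the second filter gives `conj μ ≤ᵈ conj la`. Conjugation
    -- reverses dominance, so the two together mean `μ ≡ la`.
    only-at : ∀ {F} → Wheeled p q n F → (∀ μ → IsPartition n μ → ¬ (μ ≤ᵈ la) → FR.Vanishing μ F) →
      (∀ ν → IsPartition n ν → ¬ (ν ≤ᵈ conj la) → FC.Vanishing ν F) → OnlyAt F
    -- Dominance, quantified over all `i`, is used only inside negations; equality in ℚ is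
    -- decidable, so the argument may run under a double negation.
    only-at {F} w V₁ V₂ μ part μ≢la e v = decidable-stable (e ℚP.≟ 0ℚ) λ e≢0 →
      (λ k → e≢0 (DR.rowValue-zero μ {F = F} 1≢0 v (V₁ μ part k))) λ μ≤la →
      (λ k → e≢0 (column-zero k)) λ μ′≤la′ →
      μ≢la (⊑-antisym part la-part (≤ᵈ⇒⊑ (decreasing part) μ≤la)
        (transposed-reverses (trans (sum≡ (conj-isPartition part)) (sym (sum≡ (conj-isPartition la-part))))
          (conj-transposed (decreasing part)) (conj-transposed (decreasing la-part)) μ′≤la′))
      where
      μ′ = conj μ
      μ′-part = conj-isPartition part
      column-zero : ¬ (μ′ ≤ᵈ conj la) → e ≡ 0ℚ
      column-zero k = let (e′ , v′) = C.rowValue-exists μ′ {1ℚ} {F} 1≢0 (wheeled-size (sym (sum≡ μ′-part)) (wheeled-swap w)) in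
        rowValue-transpose _ q p (generic-swap gen) μ′ μ {1ℚ} {F} ≤-refl (transposed-sym (conj-transposed (decreasing part))) 1≢0
          (wheeled-size (sym (sum≡ μ′-part)) (wheeled-swap w)) v′ v (DC.rowValue-zero μ′ {F = F} 1≢0 v′ (V₂ μ′ μ′-part k))

    -- The combination `H` that cancels the row values at `la` has no nonzero row value at all,
    -- hence is zero. If the row value of `F` at `la` is zero, so is `F` itself.
    proportional : ∀ {F G} → Wheeled p q n F → Wheeled p q n G → Bounded n F → Bounded n G → OnlyAt F → OnlyAt G →
      ∀ xs ys → length xs ≡ n → length ys ≡ n → F xs * G ys ≡ F ys * G xs
    proportional {F} {G} wF wG bF bG oF oG xs ys lx ly = go (eF ℚP.≟ 0ℚ)
      where
      valF = R.rowValue-exists la {1ℚ} {F} 1≢0 (wheeled-size (sym (sum≡ la-part)) wF)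
      valG = R.rowValue-exists la {1ℚ} {G} 1≢0 (wheeled-size (sym (sum≡ la-part)) wG)
      eF = proj₁ valF
      eG = proj₁ valG
      H : List ℚ → ℚ
      H zs = eG * F zs + (- eF) * G zs
      H-values : ∀ μ → IsPartition n μ → ∀ e → R.RowValue μ 1ℚ H e → e ≡ 0ℚ
      H-values μ part e v with μ ≟ₗ la
      ... | yes refl = trans (rowValue-unique la {H} v (R.rowValue-linear la {F = F} {G} eG (- eF) (proj₂ valF) (proj₂ valG))) (combination-zero eG eF)
      ... | no μ≢la = let (x , vx) = R.rowValue-exists μ {1ℚ} {F} 1≢0 (wheeled-size (sym (sum≡ part)) wF)
                          (y , vy) = R.rowValue-exists μ {1ℚ} {G} 1≢0 (wheeled-size (sym (sum≡ part)) wG) in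
        trans (rowValue-unique μ {H} v (R.rowValue-linear μ {F = F} {G} eG (- eF) vx vy))
          (trans (cong₂ (λ x y → eG * x + (- eF) * y) (oF μ part μ≢la x vx) (oG μ part μ≢la y vy)) (combination-of-zeros eG (- eF)))
      H-zero : ∀ zs → length zs ≡ n → eF * G zs ≡ eG * F zs
      H-zero zs l = combination⇒≡ eG (F zs) eF (G zs) (zero-from-row-values {n} {H} (wheeled-linear {F = F} {G} eG (- eF) wF wG) (bounded-linear {F = F} {G} eG (- eF) bF bG) H-values zs l)
      F-zero : eF ≡ 0ℚ → ∀ zs → length zs ≡ n → F zs ≡ 0ℚ
      F-zero z = zero-from-row-values {n} {F} wF bF λ μ part e v → case μ ≟ₗ la of λ
        { (yes refl) → trans (rowValue-unique la {F} v (proj₂ valF)) z ; (no μ≢la) → oF μ part μ≢la e v }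
      go : Dec (eF ≡ 0ℚ) → F xs * G ys ≡ F ys * G xs
      go (yes z) = trans (0*≡0 (F-zero z xs lx)) (sym (0*≡0 (F-zero z ys ly)))
      go (no ne) = *-cancelˡ-≡ ne (begin
        eF * (F xs * G ys)   ≡⟨ eF*[F*G′] eF (F xs) (G ys) ⟩
        F xs * (eF * G ys)   ≡⟨ cong (F xs *_) (H-zero ys ly) ⟩
        F xs * (eG * F ys)   ≡⟨ eF*[F′*G] eG (F xs) (F ys) ⟩
        F ys * (eG * F xs)   ≡⟨ cong (F ys *_) (sym (H-zero xs lx)) ⟩
        F ys * (eF * G xs)   ≡⟨ sym (eF*[F*G′] eF (F ys) (G xs)) ⟩
        eF * (F ys * G xs)   ∎)
        where open ≡-Reasoning

-- Colored products

data Comparison : Set where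
  less same more : Comparison

compare : ℕ → ℕ → Comparison
compare zero zero = same
compare zero (suc _) = less
compare (suc _) zero = more
compare (suc m) (suc n) = compare m n

flipped : Comparison → Comparison
flipped less = more
flipped same = same
flipped more = less

compare-flip : ∀ m n → compare n m ≡ flipped (compare m n)
compare-flip zero zero = refl
compare-flip zero (suc n) = refl
compare-flip (suc m) zero = refl
compare-flip (suc m) (suc n) = compare-flip m n

compare-less : ∀ m n → compare m n ≡ less → m < n
compare-less zero (suc n) e = s≤s z≤n
compare-less (suc m) (suc n) e = s≤s (compare-less m n e)

less-compare : ∀ {m n} → m < n → compare m n ≡ less
less-compare {zero} {suc n} (s≤s l) = refl
less-compare {suc m} {suc n} (s≤s l) = less-compare l

more-compare : ∀ {m n} → n < m → compare m n ≡ more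
more-compare {m} {n} l = trans (compare-flip n m) (cong flipped (less-compare l))

-- Up to (x - y)³, same is the pair factor of ε(q₁; x) and less, more are (multiples of) ω(x, y), ω(y, x).
pairFactor : ℚ → ℚ → Comparison → ℚ → ℚ → ℚ
pairFactor a b less x y = (x - a * y) * (x - b * y) * (a * b * x - y)
pairFactor a b same x y = (x - a * y) * (y - a * x) * (x - y)
pairFactor a b more x y = - ((y - a * x) * (y - b * x) * (a * b * y - x))

Colored : Set
Colored = List (ℕ × ℚ)

factor : ℚ → ℚ → ℕ × ℚ → ℕ × ℚ → ℚ
factor a b (c , x) (d , y) = pairFactor a b (compare c d) x y

factors : ℚ → ℚ → ℕ × ℚ → Colored → ℚ
factors a b u us = prodℚ (map (factor a b u) us)

coloredProduct : ℚ → ℚ → Colored → ℚ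
coloredProduct a b [] = 1ℚ
coloredProduct a b (u ∷ us) = factors a b u us * coloredProduct a b us

opaque
  unfolding _+_

  same-flip : ∀ a x y → (y - a * x) * (x - a * y) * (y - x) ≡ - ((x - a * y) * (y - a * x) * (x - y))
  same-flip = solve-∀ ringℚ

  colored-swap-step : ∀ f X Y V → ((- f) * X) * (Y * V) ≡ - ((f * Y) * (X * V))
  colored-swap-step = solve-∀ ringℚ

  colored-keep-step : ∀ X V → X * (- V) ≡ - (X * V)
  colored-keep-step = solve-∀ ringℚ

  scale-less : ∀ a b t x y → (t * x - a * (t * y)) * (t * x - b * (t * y)) * (a * b * (t * x) - t * y) ≡
    (t * (t * (t * 1ℚ))) * ((x - a * y) * (x - b * y) * (a * b * x - y))
  scale-less = solve-∀ ringℚ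

  scale-same : ∀ a t x y → (t * x - a * (t * y)) * (t * y - a * (t * x)) * (t * x - t * y) ≡
    (t * (t * (t * 1ℚ))) * ((x - a * y) * (y - a * x) * (x - y))
  scale-same = solve-∀ ringℚ

  neg-move : ∀ T x → - (T * x) ≡ T * (- x)
  neg-move = solve-∀ ringℚ

  -- leading and trailing coefficients of the pair factor at (z, tw)
  less-expand : ∀ a b t z w → (z - a * (t * w)) * (z - b * (t * w)) * (a * b * z - t * w) ≡
    (a * b * (z * (z * z)) + t * ((- ((a + b) * (a * b) + 1ℚ)) * (z * (z * w)) + t * (((a * b) * (a * b) + (a + b)) * (z * (w * w)) + t * 0ℚ))) + ((a * b) * (- (w * (w * w)))) * (t * (t * (t * 1ℚ)))
  less-expand = solve-∀ ringℚ

  same-expand : ∀ a t z w → (z - a * (t * w)) * (t * w - a * z) * (z - t * w) ≡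
    ((- a) * (z * (z * z)) + t * ((1ℚ + a + a * a) * (z * (z * w)) + t * ((- (1ℚ + a + a * a)) * (z * (w * w)) + t * 0ℚ))) + ((- a) * (- (w * (w * w)))) * (t * (t * (t * 1ℚ)))
  same-expand = solve-∀ ringℚ

  more-expand : ∀ a b t z w → - ((t * w - a * z) * (t * w - b * z) * (a * b * (t * w) - z)) ≡
    (a * b * (z * (z * z)) + t * ((- ((a * b) * (a * b) + (a + b))) * (z * (z * w)) + t * (((a + b) * (a * b) + 1ℚ) * (z * (w * w)) + t * 0ℚ))) + ((a * b) * (- (w * (w * w)))) * (t * (t * (t * 1ℚ)))
  more-expand = solve-∀ ringℚ

  cube-expand : ∀ t z w → (z - t * w) * ((z - t * w) * (z - t * w)) ≡
    (1ℚ * (z * (z * z)) + t * ((- (1ℚ + 1ℚ + 1ℚ)) * (z * (z * w)) + t * ((1ℚ + 1ℚ + 1ℚ) * (z * (w * w)) + t * 0ℚ))) + (1ℚ * (- (w * (w * w)))) * (t * (t * (t * 1ℚ)))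
  cube-expand = solve-∀ ringℚ

  expand-at-0 : ∀ k r c → (k + 0ℚ * r) + c * (0ℚ * (0ℚ * (0ℚ * 1ℚ))) ≡ k
  expand-at-0 = solve-∀ ringℚ

pairFactor-flip : ∀ a b o x y → pairFactor a b (flipped o) y x ≡ - pairFactor a b o x y
pairFactor-flip a b less x y = refl
pairFactor-flip a b same x y = same-flip a x y
pairFactor-flip a b more x y = sym (neg-neg ((y - a * x) * (y - b * x) * (a * b * y - x)))

factor-flip : ∀ a b u w → factor a b w u ≡ - factor a b u w
factor-flip a b (c , x) (d , y) = trans (cong (λ o → pairFactor a b o y x) (compare-flip c d)) (pairFactor-flip a b (compare c d) x y)

-- Each pair factor is antisymmetric in its two colored points, and the swap of neighbours turns
-- round exactly one pair. This is why the case `more` carries a sign.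
coloredProduct-swap : ∀ a b k us → suc k < length us → coloredProduct a b (swapAt k us) ≡ - coloredProduct a b us
coloredProduct-swap a b zero (u ∷ w ∷ us) l = trans (cong (λ f → (f * factors a b w us) * (factors a b u us * coloredProduct a b us)) (factor-flip a b u w))
  (colored-swap-step (factor a b u w) (factors a b w us) (factors a b u us) (coloredProduct a b us))
coloredProduct-swap a b zero (u ∷ []) (s≤s ())
coloredProduct-swap a b (suc k) (u ∷ us) (s≤s l) = trans
  (cong₂ _*_ (prodℚ-↭ (PermP.map⁺ (factor a b u) (swapAt-↭ k us))) (coloredProduct-swap a b k us l)) (colored-keep-step (factors a b u us) (coloredProduct a b us))

crossFactors : ℚ → ℚ → Colored → Colored → ℚ
crossFactors a b us ws = prodℚ (map (λ u → factors a b u ws) us)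

coloredProduct-++ : ∀ a b us ws → coloredProduct a b (us ++ ws) ≡ (coloredProduct a b us * crossFactors a b us ws) * coloredProduct a b ws
coloredProduct-++ a b [] ws = sym (trans (cong (_* coloredProduct a b ws) (F.*-identityˡ 1ℚ)) (F.*-identityˡ (coloredProduct a b ws)))
coloredProduct-++ a b (u ∷ us) ws = trans (cong₂ _*_ factors-++ (coloredProduct-++ a b us ws))
  (vand-++-step (factors a b u us) (factors a b u ws) (coloredProduct a b us) (crossFactors a b us ws) (coloredProduct a b ws))
  where
  factors-++ : factors a b u (us ++ ws) ≡ factors a b u us * factors a b u ws
  factors-++ = trans (cong prodℚ (map-++ (factor a b u) us ws)) (prodℚ-++ (map (factor a b u) us) (map (factor a b u) ws))

scaleColored : ℚ → Colored → Colored
scaleColored t = map (λ { (c , x) → c , t * x })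

pairFactor-scale : ∀ a b o t x y → pairFactor a b o (t * x) (t * y) ≡ t ^ 3 * pairFactor a b o x y
pairFactor-scale a b less t x y = scale-less a b t x y
pairFactor-scale a b same t x y = scale-same a t x y
pairFactor-scale a b more t x y = trans (cong -_ (scale-less a b t y x)) (neg-move (t ^ 3) _)

factors-scale : ∀ a b t c x us → factors a b (c , t * x) (scaleColored t us) ≡ (t ^ 3) ^ length us * factors a b (c , x) us
factors-scale a b t c x [] = sym (F.*-identityˡ 1ℚ)
factors-scale a b t c x ((d , y) ∷ us) = trans (cong₂ _*_ (pairFactor-scale a b (compare c d) t x y) (factors-scale a b t c x us))
  (scale-product (t ^ 3) (factor a b (c , x) (d , y)) ((t ^ 3) ^ length us) (factors a b (c , x) us))

coloredProduct-scale : ∀ a b t us → coloredProduct a b (scaleColored t us) ≡ (t ^ 3) ^ tri (length us) * coloredProduct a b us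
coloredProduct-scale a b t [] = sym (F.*-identityˡ 1ℚ)
coloredProduct-scale a b t ((c , x) ∷ us) = trans (cong₂ _*_ (factors-scale a b t c x us) (coloredProduct-scale a b t us))
  (trans (scale-vand ((t ^ 3) ^ length us) (factors a b (c , x) us) ((t ^ 3) ^ tri (length us)) (coloredProduct a b us))
    (cong (_* (factors a b (c , x) us * coloredProduct a b us)) (sym (^-+ (t ^ 3) (length us) (tri (length us))))))

-- r has degree ≤ d, and its constant and leading coefficients are proportional to q₀ and q₁: the limits of r over a
-- product of the same kind at 0 and at ∞ coincide.
record Balanced (d : ℕ) (q₀ q₁ : ℚ) (r : ℚ → ℚ) : Set where
  constructor balanced
  field
    κ : ℚ
    lower : ℚ → ℚ
    lower-deg : Deg d lower
    split-top : ∀ t → r t ≡ lower t + (κ * q₁) * t ^ d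
    at-0 : r 0ℚ ≡ κ * q₀

opaque
  unfolding _+_

  balanced-product : ∀ g c T h d S → (g + c * T) * (h + d * S) ≡ (g * h + (d * (S * g) + c * (T * h))) + (c * d) * (T * S)
  balanced-product = solve-∀ ringℚ

  balanced-sum : ∀ g κ h κ′ q T → (g + (κ * q) * T) + (h + (κ′ * q) * T) ≡ (g + h) + ((κ + κ′) * q) * T
  balanced-sum = solve-∀ ringℚ

  balanced-scale : ∀ c g κ q T → c * (g + (κ * q) * T) ≡ c * g + ((c * κ) * q) * T
  balanced-scale = solve-∀ ringℚ

  balanced-one : 1ℚ ≡ 0ℚ + (1ℚ * 1ℚ) * 1ℚ
  balanced-one = refl

balanced-resp : ∀ {d q₀ q₁ g h} → (∀ t → g t ≡ h t) → Balanced d q₀ q₁ g → Balanced d q₀ q₁ h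
balanced-resp e (balanced κ lo dl st z) = balanced κ lo dl (λ t → trans (sym (e t)) (st t)) (trans (sym (e 0ℚ)) z)

balanced-* : ∀ {d e q₀ q₁ s₀ s₁ g h} → Balanced d q₀ q₁ g → Balanced e s₀ s₁ h → Balanced (d ℕ.+ e) (q₀ * s₀) (q₁ * s₁) (λ t → g t * h t)
balanced-* {d} {e} {q₀} {q₁} {s₀} {s₁} (balanced κ lo dl st z) (balanced κ′ lo′ dl′ st′ z′) = balanced (κ * κ′)
  (λ t → lo t * lo′ t + ((κ′ * s₁) * (t ^ e * lo t) + (κ * q₁) * (t ^ d * lo′ t)))
  (deg-+ (deg-* dl dl′) (deg-+ (deg-scale (κ′ * s₁) (deg-weaken (≤-reflexive (+-comm e d)) (deg-t^* e dl))) (deg-scale (κ * q₁) (deg-t^* d dl′))))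
  (λ t → trans (cong₂ _*_ (st t) (st′ t)) (trans (balanced-product (lo t) (κ * q₁) (t ^ d) (lo′ t) (κ′ * s₁) (t ^ e))
    (cong₂ (λ x y → (lo t * lo′ t + ((κ′ * s₁) * (t ^ e * lo t) + (κ * q₁) * (t ^ d * lo′ t))) + x * y) (ladder-pair κ q₁ κ′ s₁) (sym (^-+ t d e)))))
  (trans (cong₂ _*_ z z′) (ladder-pair κ q₀ κ′ s₀))

balanced-+ : ∀ {d q₀ q₁ g h} → Balanced d q₀ q₁ g → Balanced d q₀ q₁ h → Balanced d q₀ q₁ (λ t → g t + h t)
balanced-+ {d} {q₀} {q₁} (balanced κ lo dl st z) (balanced κ′ lo′ dl′ st′ z′) = balanced (κ + κ′) (λ t → lo t + lo′ t) (deg-+ dl dl′)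
  (λ t → trans (cong₂ _+_ (st t) (st′ t)) (balanced-sum (lo t) κ (lo′ t) κ′ q₁ (t ^ d))) (trans (cong₂ _+_ z z′) (sym ([x+y]*z κ κ′ q₀)))

balanced-scalar : ∀ {d q₀ q₁ g} c → Balanced d q₀ q₁ g → Balanced d q₀ q₁ (λ t → c * g t)
balanced-scalar {d} {q₀} {q₁} c (balanced κ lo dl st z) = balanced (c * κ) (λ t → c * lo t) (deg-scale c dl)
  (λ t → trans (cong (c *_) (st t)) (balanced-scale c (lo t) κ q₁ (t ^ d))) (trans (cong (c *_) z) (sym (F.*-assoc c κ q₀)))

balanced-1 : Balanced 0 1ℚ 1ℚ (λ _ → 1ℚ)
balanced-1 = balanced 1ℚ (λ _ → 0ℚ) (deg [] z≤n (λ _ → refl)) (λ t → balanced-one) (sym (F.*-identityˡ 1ℚ))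

cube : ℚ → ℚ
cube z = z * (z * z)

cubic : ∀ {r : ℚ → ℚ} κ x₀ x₁ x₂ y → (∀ t → r t ≡ (κ * x₀ + t * (x₁ + t * (x₂ + t * 0ℚ))) + (κ * y) * (t * (t * (t * 1ℚ)))) → Balanced 3 x₀ y r
cubic κ x₀ x₁ x₂ y e = balanced κ (horner (κ * x₀ ∷ x₁ ∷ x₂ ∷ [])) (deg (κ * x₀ ∷ x₁ ∷ x₂ ∷ []) ≤-refl (λ _ → refl)) e
  (trans (e 0ℚ) (expand-at-0 (κ * x₀) (x₁ + 0ℚ * (x₂ + 0ℚ * 0ℚ)) (κ * y)))

-- In each of the three cases the two end coefficients are the same multiple of those of
-- `(z - t * w)³`. Hence every pair factor over that cube has equal limits at 0 and at infinity.
pairFactor-balanced : ∀ a b o z w → Balanced 3 (cube z) (- cube w) (λ t → pairFactor a b o z (t * w))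
pairFactor-balanced a b less z w = cubic (a * b) (cube z) _ _ (- cube w) (λ t → less-expand a b t z w)
pairFactor-balanced a b same z w = cubic (- a) (cube z) _ _ (- cube w) (λ t → same-expand a t z w)
pairFactor-balanced a b more z w = cubic (a * b) (cube z) _ _ (- cube w) (λ t → more-expand a b t z w)

trailing : List ℚ → List ℚ → ℚ
trailing zs ws = prodℚ (map (λ z → prodℚ (map (λ _ → cube z) ws)) zs)

leading : List ℚ → List ℚ → ℚ
leading zs ws = prodℚ (map (λ _ → prodℚ (map (λ w → - cube w) ws)) zs)

factors-balanced : ∀ a b c z us → Balanced (length us ℕ.* 3) (prodℚ (map (λ _ → cube z) (map proj₂ us))) (prodℚ (map (λ w → - cube w) (map proj₂ us)))
  (λ t → factors a b (c , z) (scaleColored t us))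
factors-balanced a b c z [] = balanced-1
factors-balanced a b c z ((d , w) ∷ us) = balanced-* (pairFactor-balanced a b (compare c d) z w) (factors-balanced a b c z us)

crossFactors-balanced : ∀ a b uz uw → Balanced (length uz ℕ.* (length uw ℕ.* 3)) (trailing (map proj₂ uz) (map proj₂ uw)) (leading (map proj₂ uz) (map proj₂ uw))
  (λ t → crossFactors a b uz (scaleColored t uw))
crossFactors-balanced a b [] uw = balanced-1
crossFactors-balanced a b ((c , z) ∷ uz) uw = balanced-* (factors-balanced a b c z uw) (crossFactors-balanced a b uz uw)

cross³-balanced : ∀ zs ws → Balanced (length zs ℕ.* (length ws ℕ.* 3)) (trailing zs ws) (leading zs ws)
  (λ t → cross zs (map (t *_) ws) * (cross zs (map (t *_) ws) * cross zs (map (t *_) ws)))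
cross³-balanced [] ws = balanced-resp (λ t → sym (trans (F.*-identityˡ _) (F.*-identityˡ 1ℚ))) balanced-1
cross³-balanced (z ∷ zs) ws = balanced-resp (λ t → sym (cubes (differences z (map (t *_) ws)) (cross zs (map (t *_) ws)))) (balanced-* (row ws) (cross³-balanced zs ws))
  where
  cubes : ∀ x y → (x * y) * ((x * y) * (x * y)) ≡ (x * (x * x)) * (y * (y * y))
  cubes x y = trans (cong (x * y *_) (ladder-pair x y x y)) (ladder-pair x y (x * x) (y * y))
  row : ∀ ws → Balanced (length ws ℕ.* 3) (prodℚ (map (λ _ → cube z) ws)) (prodℚ (map (λ w → - cube w) ws)) (λ t → differences z (map (t *_) ws) * (differences z (map (t *_) ws) * differences z (map (t *_) ws)))
  row [] = balanced-resp (λ t → sym (trans (F.*-identityˡ _) (F.*-identityˡ 1ℚ))) balanced-1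
  row (w ∷ ws) = balanced-resp (λ t → sym (cubes (z - t * w) (differences z (map (t *_) ws))))
    (balanced-* (cubic 1ℚ (cube z) _ _ (- cube w) (λ t → cube-expand t z w)) (row ws))

-- Sums over colorings

sumBelow : ℕ → (ℕ → ℚ) → ℚ
sumBelow zero f = 0ℚ
sumBelow (suc l) f = f l + sumBelow l f

sumBelow-cong : ∀ l {f g} → (∀ c → c < l → f c ≡ g c) → sumBelow l f ≡ sumBelow l g
sumBelow-cong zero e = refl
sumBelow-cong (suc l) e = cong₂ _+_ (e l ≤-refl) (sumBelow-cong l (λ c c<l → e c (m≤n⇒m≤1+n c<l)))

sumBelow-0 : ∀ l {f} → (∀ c → c < l → f c ≡ 0ℚ) → sumBelow l f ≡ 0ℚ
sumBelow-0 zero e = refl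
sumBelow-0 (suc l) e = trans (cong₂ _+_ (e l ≤-refl) (sumBelow-0 l (λ c c<l → e c (m≤n⇒m≤1+n c<l)))) 0+0≡0

sumBelow-+ : ∀ l f g → sumBelow l (λ c → f c + g c) ≡ sumBelow l f + sumBelow l g
sumBelow-+ zero f g = sym 0+0≡0
sumBelow-+ (suc l) f g = trans (cong (f l + g l +_) (sumBelow-+ l f g)) (interchange+ (f l) (g l) (sumBelow l f) (sumBelow l g))

sumBelow-swap : ∀ l m (h : ℕ → ℕ → ℚ) → sumBelow l (λ c → sumBelow m (h c)) ≡ sumBelow m (λ d → sumBelow l (λ c → h c d))
sumBelow-swap zero m h = sym (sumBelow-0 m (λ _ _ → refl))
sumBelow-swap (suc l) m h = trans (cong (sumBelow m (h l) +_) (sumBelow-swap l m h)) (sym (sumBelow-+ m (h l) (λ d → sumBelow l (λ c → h c d))))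

sumBelow-single : ∀ l {f} c₀ → c₀ < l → (∀ c → c < l → c ≢ c₀ → f c ≡ 0ℚ) → sumBelow l f ≡ f c₀
sumBelow-single (suc l) {f} c₀ c₀<l e with l ℕ.≟ c₀
... | yes refl = trans (cong (f l +_) (sumBelow-0 l (λ c c<l → e c (m≤n⇒m≤1+n c<l) (<⇒≢ c<l)))) (x+0≡x (f l))
... | no l≢c₀ = trans (cong₂ _+_ (e l ≤-refl l≢c₀) (sumBelow-single l c₀ (ℕP.≤∧≢⇒< (≤-pred c₀<l) (l≢c₀ ∘ sym)) (λ c c<l → e c (m≤n⇒m≤1+n c<l))))
  (F.+-identityˡ (f c₀))

colorSum : ℕ → List ℚ → (Colored → ℚ) → ℚ
colorSum l [] g = g []
colorSum l (x ∷ xs) g = sumBelow l (λ c → colorSum l xs (λ us → g ((c , x) ∷ us)))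

Coloring : ℕ → List ℚ → Colored → Set
Coloring l xs us = map proj₂ us ≡ xs × All (λ u → proj₁ u < l) us

coloring-∷ : ∀ {l c x xs us} → c < l → Coloring l xs us → Coloring l (x ∷ xs) ((c , x) ∷ us)
coloring-∷ {x = x} c<l (e , below) = cong (x ∷_) e , c<l ∷ below

colorSum-cong : ∀ l xs {g h} → (∀ us → Coloring l xs us → g us ≡ h us) → colorSum l xs g ≡ colorSum l xs h
colorSum-cong l [] e = e [] (refl , [])
colorSum-cong l (x ∷ xs) e = sumBelow-cong l (λ c c<l → colorSum-cong l xs (λ us col → e ((c , x) ∷ us) (coloring-∷ c<l col)))

colorSum-0 : ∀ l xs {g} → (∀ us → Coloring l xs us → g us ≡ 0ℚ) → colorSum l xs g ≡ 0ℚ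
colorSum-0 l [] e = e [] (refl , [])
colorSum-0 l (x ∷ xs) e = sumBelow-0 l (λ c c<l → colorSum-0 l xs (λ us col → e ((c , x) ∷ us) (coloring-∷ c<l col)))

sumBelow-scale : ∀ l k f → sumBelow l (λ c → k * f c) ≡ k * sumBelow l f
sumBelow-scale zero k f = sym (F.zeroʳ k)
sumBelow-scale (suc l) k f = trans (cong (k * f l +_) (sumBelow-scale l k f)) (sym (F.distribˡ k (f l) (sumBelow l f)))

colorSum-scale : ∀ l xs k g → colorSum l xs (λ us → k * g us) ≡ k * colorSum l xs g
colorSum-scale l [] k g = refl
colorSum-scale l (x ∷ xs) k g = trans (sumBelow-cong l (λ c _ → colorSum-scale l xs k (λ us → g ((c , x) ∷ us))))
  (sumBelow-scale l k (λ c → colorSum l xs (λ us → g ((c , x) ∷ us))))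

colorSum-swapAt : ∀ l k xs g → colorSum l (swapAt k xs) g ≡ colorSum l xs (g ∘ swapAt k)
colorSum-swapAt l zero [] g = refl
colorSum-swapAt l zero (x ∷ []) g = refl
colorSum-swapAt l zero (x ∷ y ∷ xs) g = sumBelow-swap l l (λ c d → colorSum l xs (λ us → g ((c , y) ∷ (d , x) ∷ us)))
colorSum-swapAt l (suc k) [] g = refl
colorSum-swapAt l (suc k) (x ∷ xs) g = sumBelow-cong l (λ c _ → colorSum-swapAt l k xs (λ us → g ((c , x) ∷ us)))

colorSum-single : ∀ l xs {g} u₀ → Coloring l xs u₀ → (∀ us → Coloring l xs us → us ≢ u₀ → g us ≡ 0ℚ) → colorSum l xs g ≡ g u₀
colorSum-single l [] [] col e = refl
colorSum-single l (x ∷ xs) {g} ((c₀ , x₀) ∷ u₀) (refl , c₀<l ∷ below) e = trans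
  (sumBelow-single l c₀ c₀<l (λ c c<l c≢c₀ → colorSum-0 l xs (λ us col → e ((c , x) ∷ us) (coloring-∷ c<l col) λ { refl → c≢c₀ refl })))
  (colorSum-single l xs u₀ (refl , below) (λ us col us≢u₀ → e ((c₀ , x) ∷ us) (coloring-∷ c₀<l col) λ { refl → us≢u₀ refl }))

colorSum-map : ∀ l t xs g → colorSum l (map (t *_) xs) g ≡ colorSum l xs (g ∘ scaleColored t)
colorSum-map l t [] g = refl
colorSum-map l t (x ∷ xs) g = sumBelow-cong l (λ c _ → colorSum-map l t xs (λ us → g ((c , t * x) ∷ us)))

splitScale : ℕ → ℚ → Colored → Colored
splitScale m t us = take m us ++ scaleColored t (drop m us)

colorSum-split : ∀ l m t xs g → colorSum l (take m xs ++ map (t *_) (drop m xs)) g ≡ colorSum l xs (g ∘ splitScale m t)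
colorSum-split l zero t xs g = colorSum-map l t xs g
colorSum-split l (suc m) t [] g = refl
colorSum-split l (suc m) t (x ∷ xs) g = sumBelow-cong l (λ c _ → colorSum-split l m t xs (λ us → g ((c , x) ∷ us)))

balanced-0 : ∀ {d q₀ q₁} → Balanced d q₀ q₁ (λ _ → 0ℚ)
balanced-0 {d} {q₀} {q₁} = balanced 0ℚ (λ _ → 0ℚ) (deg [] z≤n (λ _ → refl))
  (λ t → sym (trans (F.+-identityˡ _) (0*≡0 (F.zeroˡ q₁)))) (sym (F.zeroˡ q₀))

sumBelow-balanced : ∀ {d q₀ q₁} l {f : ℕ → ℚ → ℚ} → (∀ c → c < l → Balanced d q₀ q₁ (f c)) → Balanced d q₀ q₁ (λ t → sumBelow l (λ c → f c t))
sumBelow-balanced zero b = balanced-0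
sumBelow-balanced (suc l) b = balanced-+ (b l ≤-refl) (sumBelow-balanced l (λ c c<l → b c (m≤n⇒m≤1+n c<l)))

colorSum-balanced : ∀ {d q₀ q₁} l xs {g : ℚ → Colored → ℚ} → (∀ us → Coloring l xs us → Balanced d q₀ q₁ (λ t → g t us)) →
  Balanced d q₀ q₁ (λ t → colorSum l xs (g t))
colorSum-balanced l [] b = b [] (refl , [])
colorSum-balanced l (x ∷ xs) {g} b = sumBelow-balanced l (λ c c<l → colorSum-balanced l xs {λ t us → g t ((c , x) ∷ us)} (λ us col → b ((c , x) ∷ us) (coloring-∷ c<l col)))

-- The colors stay fixed while the points vary, so that comparisons of colors do not interfere with
-- polynomiality.
PolyColored : ℕ → Set
PolyColored m = List (ℕ × Σ (Vec ℚ m → ℚ) (IsPoly m))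

evalColored : ∀ {m} → Vec ℚ m → PolyColored m → Colored
evalColored v = map (λ { (c , f , _) → c , f v })

sumBelow-poly : ∀ {m} l {f : ℕ → Vec ℚ m → ℚ} → (∀ c → IsPoly m (f c)) → IsPoly m (λ v → sumBelow l (λ c → f c v))
sumBelow-poly zero p = poly-const 0ℚ
sumBelow-poly (suc l) p = poly-+ (p l) (sumBelow-poly l p)

colorSum-poly : ∀ {m n xs} l {g : Vec ℚ m → Colored → ℚ} → PolyList m n xs → (∀ cf → IsPoly m (λ v → g v (evalColored v cf))) →
  IsPoly m (λ v → colorSum l (xs v) (g v))
colorSum-poly {m} l {g} (fs , _ , ps , eq) gp = poly-resp (λ v → cong (λ xs → colorSum l xs (g v)) (sym (eq v))) (go fs ps gp)
  where
  go : ∀ fs → All (IsPoly m) fs → ∀ {g : Vec ℚ m → Colored → ℚ} → (∀ cf → IsPoly m (λ v → g v (evalColored v cf))) → IsPoly m (λ v → colorSum l (map (λ f → f v) fs) (g v))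
  go [] [] gp = gp []
  go (f ∷ fs) (p ∷ ps) {g} gp = sumBelow-poly l {λ c v → colorSum l (map (λ f → f v) fs) (λ us → g v ((c , f v) ∷ us))}
    (λ c → go fs ps {λ v us → g v ((c , f v) ∷ us)} (λ cf → gp ((c , f , p) ∷ cf)))

module _ {m} {a b : Vec ℚ m → ℚ} (ap : IsPoly m a) (bp : IsPoly m b) where

  poly-pairFactor : ∀ o {f g} → IsPoly m f → IsPoly m g → IsPoly m (λ v → pairFactor (a v) (b v) o (f v) (g v))
  poly-pairFactor less fp gp = poly-* (poly-* (poly-- fp (poly-* ap gp)) (poly-- fp (poly-* bp gp))) (poly-- (poly-* (poly-* ap bp) fp) gp)
  poly-pairFactor same fp gp = poly-* (poly-* (poly-- fp (poly-* ap gp)) (poly-- gp (poly-* ap fp))) (poly-- fp gp)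
  poly-pairFactor more {f} {g} fp gp = poly-resp (λ v → sym (neg-as-product _))
    (poly-* (poly-const (- 1ℚ)) (poly-* (poly-* (poly-- gp (poly-* ap fp)) (poly-- gp (poly-* bp fp))) (poly-- (poly-* (poly-* ap bp) gp) fp)))
    where
    neg-as-product : ∀ x → - x ≡ (- 1ℚ) * x
    neg-as-product x = trans (cong -_ (sym (F.*-identityˡ x))) (trans (neg-move 1ℚ x) (trans (F.*-identityˡ (- x)) (one-neg x)))
      where
      opaque
        unfolding _+_
        one-neg : ∀ x → - x ≡ (- 1ℚ) * x
        one-neg = solve-∀ ringℚ

  poly-factors : ∀ c {f} → IsPoly m f → ∀ (cf : PolyColored m) → IsPoly m (λ v → factors (a v) (b v) (c , f v) (evalColored v cf))
  poly-factors c fp [] = poly-const 1ℚ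
  poly-factors c fp ((d , g , gp) ∷ cf) = poly-* (poly-pairFactor (compare c d) fp gp) (poly-factors c fp cf)

  poly-coloredProduct : ∀ (cf : PolyColored m) → IsPoly m (λ v → coloredProduct (a v) (b v) (evalColored v cf))
  poly-coloredProduct [] = poly-const 1ℚ
  poly-coloredProduct ((c , f , fp) ∷ cf) = poly-* (poly-factors c fp cf) (poly-coloredProduct cf)

  poly-crossFactors : ∀ (cf dg : PolyColored m) → IsPoly m (λ v → crossFactors (a v) (b v) (evalColored v cf) (evalColored v dg))
  poly-crossFactors [] dg = poly-const 1ℚ
  poly-crossFactors ((c , f , fp) ∷ cf) dg = poly-* (poly-factors c fp dg) (poly-crossFactors cf dg)

-- The elements ε_ν: colorings in which, for every k, the number of variables of color ≥ k is Σᵢ max(νᵢ - k, 0); that is,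
-- color c (counted from 0) is used ν′_{c+1} times.

above : ℕ → ℕ → ℕ
above k c = if ⌊ k ≤? c ⌋ then 1 else 0

colors : Colored → List ℕ
colors = map proj₁

content : ℕ → List ℕ → List ℕ
content n cs = map (λ k → weight (above k) cs) (upTo n)

target : ℕ → List ℕ → List ℕ
target n ν = map (λ k → excess k ν) (upTo n)

indicator : ℕ → List ℕ → Colored → ℚ
indicator n ν us = if ⌊ content n (colors us) ≟ₗ target n ν ⌋ then 1ℚ else 0ℚ

εNum : ℕ → List ℕ → ℚ → ℚ → List ℚ → ℚ
εNum n ν a b xs = colorSum n xs (λ us → indicator n ν us * coloredProduct a b us)

indicator-cong : ∀ n ν {us ws} → content n (colors us) ≡ content n (colors ws) → indicator n ν us ≡ indicator n ν ws
indicator-cong n ν e = cong (λ l → if ⌊ l ≟ₗ target n ν ⌋ then 1ℚ else 0ℚ) e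

content-↭ : ∀ n {us ws} → us ↭ ws → content n (colors us) ≡ content n (colors ws)
content-↭ n p = map-cong (λ k → weight-↭ (above k) (PermP.map⁺ proj₁ p)) (upTo n)

εNum-swap : ∀ n ν a b k xs → suc k < length xs → εNum n ν a b (swapAt k xs) ≡ - εNum n ν a b xs
εNum-swap n ν a b k xs l = begin
  εNum n ν a b (swapAt k xs) ≡⟨ colorSum-swapAt n k xs (λ us → indicator n ν us * coloredProduct a b us) ⟩
  colorSum n xs (λ us → indicator n ν (swapAt k us) * coloredProduct a b (swapAt k us))
    ≡⟨ colorSum-cong n xs (λ us col → trans (cong₂ _*_ (indicator-cong n ν {swapAt k us} {us} (content-↭ n (swapAt-↭ k us)))
         (coloredProduct-swap a b k us (<-≤-trans l (≤-reflexive (trans (cong length (sym (proj₁ col))) (length-map proj₂ us))))))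
         (negate (indicator n ν us) (coloredProduct a b us))) ⟩
  colorSum n xs (λ us → (- 1ℚ) * (indicator n ν us * coloredProduct a b us)) ≡⟨ colorSum-scale n xs (- 1ℚ) (λ us → indicator n ν us * coloredProduct a b us) ⟩
  (- 1ℚ) * εNum n ν a b xs ≡⟨ minus-one (εNum n ν a b xs) ⟩
  - εNum n ν a b xs ∎
  where
  open ≡-Reasoning
  opaque
    unfolding _+_
    negate : ∀ i P → i * (- P) ≡ (- 1ℚ) * (i * P)
    negate = solve-∀ ringℚ
    minus-one : ∀ x → (- 1ℚ) * x ≡ - x
    minus-one = solve-∀ ringℚ

coloredProduct-zero₁ : ∀ a b u {w us} → w ∈ us → factor a b u w ≡ 0ℚ → coloredProduct a b (u ∷ us) ≡ 0ℚ
coloredProduct-zero₁ a b u w∈ e = 0*≡0 (go w∈ e)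
  where
  go : ∀ {w us} → w ∈ us → factor a b u w ≡ 0ℚ → factors a b u us ≡ 0ℚ
  go (here refl) e = 0*≡0 e
  go (there w∈) e = *0≡0 (go w∈ e)

module _ (a b : ℚ) where

  opaque
    unfolding _+_

    less-root : ∀ x → a * b * x - a * (b * x) ≡ 0ℚ
    less-root x = trans (cong (_- a * (b * x)) (F.*-assoc a b x)) (x-x≡0 (a * (b * x)))

  pair-less-vanish : ∀ x z → z ≡ a * (b * x) → pairFactor a b less x z ≡ 0ℚ
  pair-less-vanish x z refl = *0≡0 (less-root x)

  pair-same-vanish : ∀ x y → y ≡ a * x → pairFactor a b same x y ≡ 0ℚ
  pair-same-vanish x y refl = 0*≡0 (*0≡0 (x-x≡0 (a * x)))

  pair-more-vanish : ∀ x y → y ≡ a * x ⊎ y ≡ b * x → pairFactor a b more x y ≡ 0ℚ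
  pair-more-vanish x y (inj₁ refl) = trans (cong -_ (0*≡0 (0*≡0 (x-x≡0 (a * x))))) -0≡0
  pair-more-vanish x y (inj₂ refl) = trans (cong -_ (0*≡0 (*0≡0 (x-x≡0 (b * x))))) -0≡0

  compare-less-trans₁ : ∀ c d e → compare c d ≡ less → compare d e ≢ more → compare c e ≡ less
  compare-less-trans₁ c d e l n = less-compare (<-≤-trans (compare-less c d l) (≮⇒≥ (n ∘ more-compare {d} {e})))

  compare-less-trans₂ : ∀ c d e → compare c d ≢ more → compare d e ≡ less → compare c e ≡ less
  compare-less-trans₂ c d e n l = less-compare (ℕP.≤-<-trans (≮⇒≥ (n ∘ more-compare {c} {d})) (compare-less d e l))

  -- A nonzero term would have c < d ≤ e along (x, q₁x, q₁q₂x), which the factor at (x, q₁q₂x) forbids.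
  colored-wheel₁ : ∀ c d e x us → coloredProduct a b ((c , x) ∷ (d , a * x) ∷ (e , a * (b * x)) ∷ us) ≡ 0ℚ
  colored-wheel₁ c d e x us with compare c d in cd | compare d e in de
  ... | same | _ = 0*≡0 (0*≡0 (pair-same-vanish x (a * x) refl))
  ... | more | _ = 0*≡0 (0*≡0 (pair-more-vanish x (a * x) (inj₁ refl)))
  ... | less | more = *0≡0 (0*≡0 (0*≡0 (pair-more-vanish (a * x) (a * (b * x)) (inj₂ (t*[p*s] a b x)))))
  ... | less | less = 0*≡0 (*0≡0 (0*≡0 (trans (cong (λ o → pairFactor a b o x (a * (b * x)))
        (compare-less-trans₁ c d e cd (λ m → case trans (sym de) m of λ ()))) (pair-less-vanish x (a * (b * x)) refl))))
  ... | less | same = 0*≡0 (*0≡0 (0*≡0 (trans (cong (λ o → pairFactor a b o x (a * (b * x)))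
        (compare-less-trans₁ c d e cd (λ m → case trans (sym de) m of λ ()))) (pair-less-vanish x (a * (b * x)) refl))))

  colored-wheel₂ : ∀ c d e x us → coloredProduct a b ((c , x) ∷ (d , b * x) ∷ (e , a * (b * x)) ∷ us) ≡ 0ℚ
  colored-wheel₂ c d e x us with compare c d in cd | compare d e in de
  ... | more | _ = 0*≡0 (0*≡0 (pair-more-vanish x (b * x) (inj₂ refl)))
  ... | _ | same = *0≡0 (0*≡0 (0*≡0 (pair-same-vanish (b * x) (a * (b * x)) refl)))
  ... | _ | more = *0≡0 (0*≡0 (0*≡0 (pair-more-vanish (b * x) (a * (b * x)) (inj₁ refl))))
  ... | less | less = 0*≡0 (*0≡0 (0*≡0 (trans (cong (λ o → pairFactor a b o x (a * (b * x)))
        (compare-less-trans₂ c d e (λ m → case trans (sym cd) m of λ ()) de)) (pair-less-vanish x (a * (b * x)) refl))))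
  ... | same | less = 0*≡0 (*0≡0 (0*≡0 (trans (cong (λ o → pairFactor a b o x (a * (b * x)))
        (compare-less-trans₂ c d e (λ m → case trans (sym cd) m of λ ()) de)) (pair-less-vanish x (a * (b * x)) refl))))

  εNum-wheel₁ : ∀ n ν x zs → εNum n ν a b (x ∷ a * x ∷ a * (b * x) ∷ zs) ≡ 0ℚ
  εNum-wheel₁ n ν x zs = sumBelow-0 n (λ c _ → sumBelow-0 n (λ d _ → sumBelow-0 n (λ e _ → colorSum-0 n zs (λ us _ → *0≡0 (colored-wheel₁ c d e x us)))))

  εNum-wheel₂ : ∀ n ν x zs → εNum n ν a b (x ∷ b * x ∷ a * (b * x) ∷ zs) ≡ 0ℚ
  εNum-wheel₂ n ν x zs = sumBelow-0 n (λ c _ → sumBelow-0 n (λ d _ → sumBelow-0 n (λ e _ → colorSum-0 n zs (λ us _ → *0≡0 (colored-wheel₂ c d e x us)))))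

-- ε_ν on strings: a nonzero term needs strictly increasing colors along every string

above-yes : ∀ {k c} → k ≤ c → above k c ≡ 1
above-yes {k} {c} le with k ≤? c
... | yes _ = refl
... | no ≰ = ⊥-elim (≰ le)

above-no : ∀ {k c} → c < k → above k c ≡ 0
above-no {k} {c} lt with k ≤? c
... | yes le = ⊥-elim (<⇒≱ lt le)
... | no _ = refl

weight-above≤length : ∀ k cs → weight (above k) cs ≤ length cs
weight-above≤length k [] = z≤n
weight-above≤length k (c ∷ cs) with k ≤? c
... | yes _ = s≤s (weight-above≤length k cs)
... | no _ = m≤n⇒m≤1+n (weight-above≤length k cs)

weight-++ : ∀ g xs ys → weight g (xs ++ ys) ≡ weight g xs ℕ.+ weight g ys
weight-++ g xs ys = trans (cong sum (map-++ g xs ys)) (sum-++ (map g xs) (map g ys))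

-- A strictly increasing sequence of numbers that are at least `m` has at most `k ∸ m` entries below
-- `k`.
increasing-count : ∀ m k cs → AllPairs _<_ cs → All (m ≤_) cs → length cs ∸ (k ∸ m) ≤ weight (above k) cs
increasing-count m k [] [] [] = ≤-reflexive (0∸n≡0 (k ∸ m))
increasing-count m k (c ∷ cs) (lt ∷ inc) (m≤c ∷ m≤cs) with ≤-total k m
... | inj₁ k≤m = ≤-trans (m∸n≤m (suc (length cs)) (k ∸ m)) (+-mono-≤ (≤-reflexive (sym (above-yes (≤-trans k≤m m≤c))))
  (transport (λ x → length cs ∸ x ≤ weight (above k) cs) (m≤n⇒m∸n≡0 (m≤n⇒m≤1+n k≤m))
    (increasing-count (suc m) k cs inc (All.map (λ c<d → ≤-trans (s≤s m≤c) c<d) lt))))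
... | inj₂ m≤k with m≤n⇒m<n∨m≡n m≤k
... | inj₂ refl = ≤-trans (m∸n≤m (suc (length cs)) (k ∸ k)) (+-mono-≤ (≤-reflexive (sym (above-yes m≤c)))
  (transport (λ x → length cs ∸ x ≤ weight (above k) cs) (m≤n⇒m∸n≡0 (n≤1+n k))
    (increasing-count (suc k) k cs inc (All.map (λ c<d → ≤-trans (s≤s m≤c) c<d) lt))))
... | inj₁ m<k = ≤-trans (≤-reflexive (cong (suc (length cs) ∸_) (+-∸-assoc 1 m<k)))
  (≤-trans (increasing-count (suc m) k cs inc (All.map (λ c<d → ≤-trans (s≤s m≤c) c<d) lt)) (m≤n+m _ (above k c)))

upFrom : ℕ → ℕ → List ℕ
upFrom m zero = []
upFrom m (suc n) = m ∷ upFrom (suc m) n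

-- The case of equality: a first entry above `m` would put every entry at `m + 1` or higher, against
-- the bound for `k = m + 1`.
increasing-canonical : ∀ m cs → AllPairs _<_ cs → All (m ≤_) cs → (∀ k → weight (above k) cs ≤ length cs ∸ (k ∸ m)) → cs ≡ upFrom m (length cs)
increasing-canonical m [] inc les h = refl
increasing-canonical m (c ∷ cs) (lt ∷ inc) (m≤c ∷ m≤cs) h = cong₂ _∷_ c≡m (increasing-canonical (suc m) cs inc rest h′)
  where
  rest : All (suc m ≤_) cs
  rest = All.map (λ c<d → ≤-trans (s≤s m≤c) c<d) lt
  c≡m : c ≡ m
  c≡m with m≤n⇒m<n∨m≡n m≤c
  ... | inj₂ e = sym e
  ... | inj₁ m<c = ⊥-elim (<⇒≱ (ℕP.n<1+n (length cs)) (≤-trans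
    (+-mono-≤ (≤-reflexive (sym (above-yes m<c))) (transport (λ x → length cs ∸ x ≤ weight (above (suc m)) cs) (n∸n≡0 m) (increasing-count (suc m) (suc m) cs inc rest)))
    (≤-trans (h (suc m)) (≤-reflexive (cong (suc (length cs) ∸_) (trans (+-∸-assoc 1 (≤-refl {m})) (cong suc (n∸n≡0 m))))))))
  h′ : ∀ k → weight (above k) cs ≤ length cs ∸ (k ∸ suc m)
  h′ k with ≤-total k m
  ... | inj₁ k≤m = ≤-trans (weight-above≤length k cs) (≤-reflexive (cong (length cs ∸_) (sym (m≤n⇒m∸n≡0 (m≤n⇒m≤1+n k≤m)))))
  ... | inj₂ m≤k with m≤n⇒m<n∨m≡n m≤k
  ... | inj₂ refl = ≤-trans (weight-above≤length k cs) (≤-reflexive (cong (length cs ∸_) (sym (m≤n⇒m∸n≡0 (n≤1+n k)))))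
  ... | inj₁ m<k = ≤-trans (m≤n+m _ (above k c)) (≤-trans (h k) (≤-reflexive (cong (suc (length cs) ∸_) (+-∸-assoc 1 m<k))))

strColored : ℚ → ℕ → ℕ → ℚ → Colored
strColored p m zero y = []
strColored p m (suc a) y = (m , y) ∷ strColored p (suc m) a (p * y)

canonical : ℚ → (μ : List ℕ) → Vec ℚ (length μ) → Colored
canonical p [] [] = []
canonical p (a ∷ μ) (y ∷ ys) = strColored p 0 a y ++ canonical p μ ys

colors-strColored : ∀ p m a y → colors (strColored p m a y) ≡ upFrom m a
colors-strColored p m zero y = refl
colors-strColored p m (suc a) y = cong (m ∷_) (colors-strColored p (suc m) a (p * y))

values-strColored : ∀ p m a y → map proj₂ (strColored p m a y) ≡ str p a y
values-strColored p m zero y = refl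
values-strColored p m (suc a) y = cong (y ∷_) (values-strColored p (suc m) a (p * y))

values-canonical : ∀ p μ y → map proj₂ (canonical p μ y) ≡ strings p (zipBlocks μ y)
values-canonical p [] [] = refl
values-canonical p (a ∷ μ) (y ∷ ys) = trans (map-++ proj₂ (strColored p 0 a y) (canonical p μ ys))
  (cong₂ _++_ (values-strColored p 0 a y) (values-canonical p μ ys))

weight-upFrom : ∀ k m a → weight (above k) (upFrom m a) ≡ a ∸ (k ∸ m)
weight-upFrom k m zero = sym (0∸n≡0 (k ∸ m))
weight-upFrom k m (suc a) with ≤-total (suc m) k
... | inj₁ m<k = trans (cong₂ ℕ._+_ (above-no m<k) (weight-upFrom k (suc m) a)) (cong (suc a ∸_) (sym (+-∸-assoc 1 m<k)))
... | inj₂ k≤1+m with m≤n⇒m<n∨m≡n k≤1+m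
... | inj₁ (s≤s k≤m) = trans (cong₂ ℕ._+_ (above-yes k≤m) (trans (weight-upFrom k (suc m) a) (cong (a ∸_) (m≤n⇒m∸n≡0 k≤1+m))))
  (cong (suc a ∸_) (sym (m≤n⇒m∸n≡0 k≤m)))
... | inj₂ refl = trans (cong₂ ℕ._+_ (above-no {suc m} ≤-refl) (trans (weight-upFrom (suc m) (suc m) a) (cong (a ∸_) (n∸n≡0 m))))
  (cong (suc a ∸_) (sym (trans (+-∸-assoc 1 (≤-refl {m})) (cong suc (n∸n≡0 m)))))

weight-canonical : ∀ p μ y k → weight (above k) (colors (canonical p μ y)) ≡ excess k μ
weight-canonical p [] [] k = refl
weight-canonical p (a ∷ μ) (y ∷ ys) k = trans (cong (weight (above k)) (map-++ proj₁ (strColored p 0 a y) (canonical p μ ys)))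
  (trans (weight-++ (above k) (colors (strColored p 0 a y)) (colors (canonical p μ ys)))
    (cong₂ ℕ._+_ (trans (cong (weight (above k)) (colors-strColored p 0 a y)) (weight-upFrom k 0 a)) (weight-canonical p μ ys k)))

strColored-unique : ∀ p m a y cs → colors cs ≡ upFrom m a → map proj₂ cs ≡ str p a y → cs ≡ strColored p m a y
strColored-unique p m zero y [] e e′ = refl
strColored-unique p m (suc a) y ((c , x) ∷ cs) e e′ = cong₂ _∷_ (cong₂ _,_ (∷-injectiveˡ e) (∷-injectiveˡ e′))
  (strColored-unique p (suc m) a (p * y) cs (∷-injectiveʳ e) (∷-injectiveʳ e′))

data Increasing (p : ℚ) : (μ : List ℕ) → Vec ℚ (length μ) → Colored → Set where
  nil : Increasing p [] [] []
  cons : ∀ {a μ y ys cs vs} → map proj₂ cs ≡ str p a y → AllPairs _<_ (colors cs) → Increasing p μ ys vs → Increasing p (a ∷ μ) (y ∷ ys) (cs ++ vs)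

length-colors : ∀ {p a y cs} → map proj₂ cs ≡ str p a y → length (colors cs) ≡ a
length-colors {p} {a} {y} {cs} e = trans (length-map proj₁ cs) (trans (sym (length-map proj₂ cs)) (trans (cong length e) (length-str p a y)))

weight-colors-++ : ∀ k cs vs → weight (above k) (colors (cs ++ vs)) ≡ weight (above k) (colors cs) ℕ.+ weight (above k) (colors vs)
weight-colors-++ k cs vs = trans (cong (weight (above k)) (map-++ proj₁ cs vs)) (weight-++ (above k) (colors cs) (colors vs))

string-count : ∀ {p a y cs} → map proj₂ cs ≡ str p a y → AllPairs _<_ (colors cs) → ∀ k → a ∸ k ≤ weight (above k) (colors cs)
string-count {p} {a} {y} {cs} e inc k = transport (λ l → l ∸ k ≤ weight (above k) (colors cs)) (length-colors {p} {a} {y} {cs} e)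
  (increasing-count 0 k (colors cs) inc (All.universal (λ _ → z≤n) (colors cs)))

increasing⇒excess : ∀ {p μ y us} → Increasing p μ y us → ∀ k → excess k μ ≤ weight (above k) (colors us)
increasing⇒excess nil k = z≤n
increasing⇒excess (cons {cs = cs} {vs} e inc i) k = ≤-trans (+-mono-≤ (string-count {cs = cs} e inc k) (increasing⇒excess i k)) (≤-reflexive (sym (weight-colors-++ k cs vs)))

increasing⇒canonical : ∀ {p μ y us} → Increasing p μ y us → (∀ k → weight (above k) (colors us) ≤ excess k μ) → us ≡ canonical p μ y
increasing⇒canonical nil h = refl
increasing⇒canonical {p} (cons {a} {μ} {y} {ys} {cs} {vs} e inc i) h = cong₂ _++_
  (strColored-unique p 0 a y cs (trans (increasing-canonical 0 (colors cs) inc (All.universal (λ _ → z≤n) (colors cs)) (λ k → ≤-trans (first k) (≤-reflexive (cong (_∸ k) (sym len)))))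
    (cong (upFrom 0) len)) e)
  (increasing⇒canonical i second)
  where
  len = length-colors {p} {a} {y} {cs} e
  both : ∀ k → weight (above k) (colors cs) ℕ.+ weight (above k) (colors vs) ≤ (a ∸ k) ℕ.+ excess k μ
  both k = ≤-trans (≤-reflexive (sym (weight-colors-++ k cs vs))) (h k)
  first : ∀ k → weight (above k) (colors cs) ≤ a ∸ k
  first k = ℕP.+-cancelʳ-≤ (excess k μ) (weight (above k) (colors cs)) (a ∸ k) (≤-trans (+-monoʳ-≤ (weight (above k) (colors cs)) (increasing⇒excess i k)) (both k))
  second : ∀ k → weight (above k) (colors vs) ≤ excess k μ
  second k = +-cancelˡ-≤ (a ∸ k) (weight (above k) (colors vs)) (excess k μ) (≤-trans (+-monoˡ-≤ (weight (above k) (colors vs)) (string-count {cs = cs} e inc k)) (both k))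

content-pointwise : ∀ n ν cs → content n cs ≡ target n ν → ∀ k → k < n → weight (above k) cs ≡ excess k ν
content-pointwise n ν cs e k k<n = applyUpTo-injective n (trans (sym (map-upTo (λ k → weight (above k) cs) n)) (trans e (map-upTo (λ k → excess k ν) n))) k k<n
  where
  applyUpTo-injective : ∀ n {f g : ℕ → ℕ} → applyUpTo f n ≡ applyUpTo g n → ∀ k → k < n → f k ≡ g k
  applyUpTo-injective (suc n) e zero _ = ∷-injectiveˡ e
  applyUpTo-injective (suc n) e (suc k) (s≤s l) = applyUpTo-injective n (∷-injectiveʳ e) k l

excess-beyond : ∀ {n μ} → sum μ ≡ n → ∀ k → n ≤ k → excess k μ ≡ 0
excess-beyond {μ = μ} refl k n≤k = excess-0 (All.map (λ le → ≤-trans le n≤k) (parts≤sum μ))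

module _ (a b : ℚ) where

  -- At a pair `(x, a * x)` the factor vanishes for equal and for decreasing colors.
  nonzero⇒less : ∀ {c c′ x us} → coloredProduct a b ((c , x) ∷ (c′ , a * x) ∷ us) ≢ 0ℚ → c < c′
  nonzero⇒less {c} {c′} {x} {us} ne = go (compare c c′) refl
    where
    go : ∀ o → compare c c′ ≡ o → c < c′
    go less e = compare-less c c′ e
    go same e = ⊥-elim (ne (coloredProduct-zero₁ a b (c , x) {us = (c′ , a * x) ∷ us} (here refl) (trans (cong (λ o → pairFactor a b o x (a * x)) e) (pair-same-vanish a b x (a * x) refl))))
    go more e = ⊥-elim (ne (coloredProduct-zero₁ a b (c , x) {us = (c′ , a * x) ∷ us} (here refl) (trans (cong (λ o → pairFactor a b o x (a * x)) e) (pair-more-vanish a b x (a * x) (inj₁ refl)))))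

  data Prefixed (k : ℕ) (y : ℚ) (rest : List ℚ) : Colored → Set where
    prefixed : ∀ cs vs → map proj₂ cs ≡ str a k y → map proj₂ vs ≡ rest → Linked _<_ (colors cs) → coloredProduct a b vs ≢ 0ℚ → Prefixed k y rest (cs ++ vs)

  prefixed-∷ : ∀ k {c x y us rest} → x ≡ y → coloredProduct a b ((c , x) ∷ us) ≢ 0ℚ → Prefixed k (a * y) rest us → Prefixed (suc k) y rest ((c , x) ∷ us)
  prefixed-∷ k {c} {x} refl ne (prefixed [] vs e er linked ne′) = prefixed ((c , x) ∷ []) vs (cong (x ∷_) e) er [-] ne′
  prefixed-∷ (suc k) {c} {x} refl ne (prefixed ((c′ , x′) ∷ cs) vs e er linked ne′) = prefixed ((c , x) ∷ (c′ , x′) ∷ cs) vs (cong (x ∷_) e) er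
    (nonzero⇒less {c} {c′} {x} {cs ++ vs} (λ z → ne (trans (cong (λ z → coloredProduct a b ((c , x) ∷ (c′ , z) ∷ cs ++ vs)) (∷-injectiveˡ e)) z)) ∷ linked) ne′

  string-increasing : ∀ k y us {rest} → map proj₂ us ≡ str a k y ++ rest → coloredProduct a b us ≢ 0ℚ → Prefixed k y rest us
  string-increasing zero y us e ne = prefixed [] us refl e [] ne
  string-increasing (suc k) y ((c , x) ∷ us) e ne = prefixed-∷ k {c} {x} {y} {us} (∷-injectiveˡ e) ne
    (string-increasing k (a * y) us (∷-injectiveʳ e) (λ z → ne (*0≡0 z)))

  nonzero⇒increasing : ∀ μ y us → map proj₂ us ≡ strings a (zipBlocks μ y) → coloredProduct a b us ≢ 0ℚ → Increasing a μ y us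
  nonzero⇒increasing [] [] [] e ne = nil
  nonzero⇒increasing (k ∷ μ) (y ∷ ys) us e ne = go (string-increasing k y us e ne)
    where
    go : ∀ {us} → Prefixed k y (strings a (zipBlocks μ ys)) us → Increasing a (k ∷ μ) (y ∷ ys) us
    go (prefixed cs vs e er linked ne′) = cons e (LinkedP.Linked⇒AllPairs ℕP.<-trans linked) (nonzero⇒increasing μ ys vs er ne′)

  term-zero : ∀ n ν us → (content n (colors us) ≡ target n ν → coloredProduct a b us ≢ 0ℚ → ⊥) → indicator n ν us * coloredProduct a b us ≡ 0ℚ
  term-zero n ν us h with content n (colors us) ≟ₗ target n ν
  ... | no _ = F.zeroˡ (coloredProduct a b us)
  ... | yes e = *0≡0 (decidable-stable (coloredProduct a b us ℚP.≟ 0ℚ) (h e))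

  -- A nonzero term has increasing colors along each string, so at least `excess k μ` of its colors
  -- are `≥ k`; its content says that there are `excess k ν` of them. This is the triangularity of
  -- the family.
  εNum-vanishes : ∀ {n} μ ν y → sum μ ≡ n → ¬ (μ ⊑ ν) → εNum n ν a b (strings a (zipBlocks μ y)) ≡ 0ℚ
  εNum-vanishes {n} μ ν y s μ⋢ν = colorSum-0 n (strings a (zipBlocks μ y)) λ us col → term-zero n ν us λ e ne →
    μ⋢ν λ k → case k <? n of λ
      { (yes k<n) → ≤-trans (increasing⇒excess (nonzero⇒increasing μ y us (proj₁ col) ne) k) (≤-reflexive (content-pointwise n ν (colors us) e k k<n))
      ; (no k≮n) → ≤-trans (≤-reflexive (excess-beyond {μ = μ} s k (≮⇒≥ k≮n))) z≤n }

  canonical-coloring : ∀ {n} μ y → sum μ ≡ n → Coloring n (strings a (zipBlocks μ y)) (canonical a μ y)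
  canonical-coloring {n} μ y s = values-canonical a μ y , All.map (λ c<s → <-≤-trans c<s (≤-reflexive s)) (below μ y)
    where
    below-str : ∀ m k y → All (λ u → proj₁ u < m ℕ.+ k) (strColored a m k y)
    below-str m zero y = []
    below-str m (suc k) y = ℕP.m<m+n m (s≤s z≤n) ∷ All.map (λ l → <-≤-trans l (≤-reflexive (sym (+-suc m k)))) (below-str (suc m) k (a * y))
    below : ∀ μ y → All (λ u → proj₁ u < sum μ) (canonical a μ y)
    below [] [] = []
    below (k ∷ μ) (y ∷ ys) = ++⁺ (All.map (λ l → <-≤-trans l (m≤m+n k (sum μ))) (below-str 0 k y))
      (All.map (λ l → <-≤-trans l (m≤n+m (sum μ) k)) (below μ ys))

  -- For `ν = μ` the counts have to be minimal on every string, so the one surviving coloring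
  -- numbers each string 0, 1, 2 and so on.
  εNum-canonical : ∀ {n} μ y → sum μ ≡ n → εNum n μ a b (strings a (zipBlocks μ y)) ≡ coloredProduct a b (canonical a μ y)
  εNum-canonical {n} μ y s = trans
    (colorSum-single n (strings a (zipBlocks μ y)) (canonical a μ y) (canonical-coloring μ y s) (λ us col us≢ → term-zero n μ us λ e ne →
      us≢ (increasing⇒canonical (nonzero⇒increasing μ y us (proj₁ col) ne) λ k → case k <? n of λ
        { (yes k<n) → ≤-reflexive (content-pointwise n μ (colors us) e k k<n)
        ; (no k≮n) → ≤-trans (≤-reflexive (none k (colors us) (map⁺ (All.map (λ c<n → <-≤-trans c<n (≮⇒≥ k≮n)) (proj₂ col))))) z≤n })))
    (trans (cong (_* coloredProduct a b (canonical a μ y)) (indicator-1 (map-cong (weight-canonical a μ y) (upTo n)))) (F.*-identityˡ _))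
    where
    none : ∀ k cs → All (_< k) cs → weight (above k) cs ≡ 0
    none k [] [] = refl
    none k (c ∷ cs) (l ∷ ls) = cong₂ ℕ._+_ (above-no l) (none k cs ls)
    indicator-1 : content n (colors (canonical a μ y)) ≡ target n μ → indicator n μ (canonical a μ y) ≡ 1ℚ
    indicator-1 e with content n (colors (canonical a μ y)) ≟ₗ target n μ
    ... | yes _ = refl
    ... | no ne = ⊥-elim (ne e)

differences-≢0 : ∀ {x xs} → All (x ≢_) xs → differences x xs ≢ 0ℚ
differences-≢0 ne = prodℚ-≢0 (map⁺ (All.map (λ x≢y e → x≢y (x-y≡0⇒x≡y e)) ne))

vand-≢0 : ∀ {xs} → AllPairs _≢_ xs → vand xs ≢ 0ℚ
vand-≢0 [] ()
vand-≢0 (ne ∷ d) = *-≢0 (differences-≢0 ne) (vand-≢0 d)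

coloredProduct-≢0 : ∀ {a b us} → AllPairs (λ u w → factor a b u w ≢ 0ℚ) us → coloredProduct a b us ≢ 0ℚ
coloredProduct-≢0 [] ()
coloredProduct-≢0 (ne ∷ ps) = *-≢0 (prodℚ-≢0 (map⁺ ne)) (coloredProduct-≢0 ps)

-- Along the points yᵢ = q^{2i} every entry of a string is a monomial in p and q with an even exponent of q.
module _ {a b} (gen : Generic a b) where

  open Generic gen renaming (p≢0 to a≢0; q≢0 to b≢0; independent to exponents-unique)

  Monomial-at : ℕ → ℕ × ℚ → Set
  Monomial-at e (c , x) = x ≡ a ^ c * b ^ (2 ℕ.* e)

  opaque
    unfolding _+_

    two-powers : ∀ a b A B → (a * A) * (b * B) ≡ a * b * (A * B)
    two-powers = solve-∀ ringℚ

    third-power : ∀ b A B → b * (A * B) ≡ A * (b * B)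
    third-power = solve-∀ ringℚ

  -- For different colors the first two brackets are separated by the exponent of `a`, and the third
  -- by the parity of the exponent of `b`. For equal colors the exponent of `a` settles the first
  -- two, and the difference of `e` and `e′` the third.
  factor-≢0 : ∀ {e e′ u w} → Monomial-at e u → Monomial-at e′ w → (proj₁ u ≡ proj₁ w → e ≢ e′) → factor a b u w ≢ 0ℚ
  factor-≢0 {e} {e′} {c , .(a ^ c * b ^ (2 ℕ.* e))} {d , .(a ^ d * b ^ (2 ℕ.* e′))} refl refl diff = go (compare c d) refl
    where
    x = a ^ c * b ^ (2 ℕ.* e)
    y = a ^ d * b ^ (2 ℕ.* e′)
    shift₁ : ∀ {c d m n} → a ^ c * b ^ m - a * (a ^ d * b ^ n) ≡ 0ℚ → c ≡ suc d
    shift₁ {c} {d} {m} {n} z = proj₁ (exponents-unique c m (suc d) n (trans (x-y≡0⇒x≡y z) (sym (F.*-assoc a (a ^ d) (b ^ n)))))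
    shift₂ : ∀ {c d m n} → a ^ c * b ^ m - b * (a ^ d * b ^ n) ≡ 0ℚ → c ≡ d
    shift₂ {c} {d} {m} {n} z = proj₁ (exponents-unique c m d (suc n) (trans (x-y≡0⇒x≡y z) (third-power b (a ^ d) (b ^ n))))
    shift₃ : ∀ {c d m n} → a * b * (a ^ c * b ^ m) - a ^ d * b ^ n ≡ 0ℚ → suc m ≡ n
    shift₃ {c} {d} {m} {n} z = proj₂ (exponents-unique (suc c) (suc m) d n (trans (two-powers a b (a ^ c) (b ^ m)) (x-y≡0⇒x≡y z)))
    go : ∀ o → compare c d ≡ o → pairFactor a b o x y ≢ 0ℚ
    go less l = *-≢0 (*-≢0 (λ z → <-irrefl (shift₁ {c} {d} {2 ℕ.* e} {2 ℕ.* e′} z) (m≤n⇒m≤1+n (compare-less c d l))) (λ z → <-irrefl (shift₂ {c} {d} {2 ℕ.* e} {2 ℕ.* e′} z) (compare-less c d l)))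
      (λ z → odd≢even e e′ (shift₃ {c} {d} {2 ℕ.* e} {2 ℕ.* e′} z))
    go same l = *-≢0 (*-≢0 (λ z → ℕP.m≢1+m+n d {0} (trans (sym c≡d) (trans (shift₁ {c} {d} {2 ℕ.* e} {2 ℕ.* e′} z) (cong suc (sym (+-identityʳ d))))))
        (λ z → ℕP.m≢1+m+n c {0} (trans c≡d (trans (shift₁ {d} {c} {2 ℕ.* e′} {2 ℕ.* e} z) (cong suc (sym (+-identityʳ c)))))))
      (λ z → diff c≡d (ℕP.*-cancelˡ-≡ e e′ 2 (proj₂ (exponents-unique c (2 ℕ.* e) d (2 ℕ.* e′) (x-y≡0⇒x≡y z)))))
      where
      compare-same : ∀ m n → compare m n ≡ same → m ≡ n
      compare-same zero zero _ = refl
      compare-same (suc m) (suc n) e = cong suc (compare-same m n e)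
      c≡d = compare-same c d l
    go more l = neg-≢0 (*-≢0 (*-≢0 (λ z → <-irrefl (shift₁ {d} {c} {2 ℕ.* e′} {2 ℕ.* e} z) (m≤n⇒m≤1+n d<c)) (λ z → <-irrefl (shift₂ {d} {c} {2 ℕ.* e′} {2 ℕ.* e} z) d<c))
      (λ z → odd≢even e′ e (shift₃ {d} {c} {2 ℕ.* e′} {2 ℕ.* e} z)))
      where d<c = compare-less d c (trans (compare-flip c d) (cong flipped l))

  strColored-monomial : ∀ e c k → All (Monomial-at e) (strColored a c k (a ^ c * b ^ (2 ℕ.* e)))
  strColored-monomial e c zero = []
  strColored-monomial e c (suc k) = refl ∷ transport (λ z → All (Monomial-at e) (strColored a (suc c) k z)) (F.*-assoc a (a ^ c) (b ^ (2 ℕ.* e))) (strColored-monomial e (suc c) k)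

  strColored-above : ∀ c k y → All (λ u → c ≤ proj₁ u) (strColored a c k y)
  strColored-above c zero y = []
  strColored-above c (suc k) y = ≤-refl ∷ All.map (≤-trans (n≤1+n c)) (strColored-above (suc c) k (a * y))

  strColored-increasing : ∀ c k y → AllPairs (λ u w → proj₁ u < proj₁ w) (strColored a c k y)
  strColored-increasing c zero y = []
  strColored-increasing c (suc k) y = strColored-above (suc c) k (a * y) ∷ strColored-increasing (suc c) k (a * y)

  evenPowers : ∀ m → ℕ → Vec ℚ m
  evenPowers zero e = []
  evenPowers (suc m) e = b ^ (2 ℕ.* e) ∷ evenPowers m (suc e)

  Apart : ℕ × ℚ → ℕ × ℚ → Set
  Apart u w = Σ ℕ λ e → Σ ℕ λ e′ → Monomial-at e u × Monomial-at e′ w × (proj₁ u ≡ proj₁ w → e ≢ e′)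

  canonical-apart : ∀ μ e → let us = canonical a μ (evenPowers (length μ) e) in
    All (λ u → Σ ℕ λ e′ → e ≤ e′ × Monomial-at e′ u) us × AllPairs Apart us
  canonical-apart [] e = [] , []
  canonical-apart (k ∷ μ) e = let (mono , distinct) = canonical-apart μ (suc e) in
    ++⁺ (All.map (λ m → e , ≤-refl , m) first) (All.map (λ { (e′ , le , m) → e′ , ≤-trans (n≤1+n e) le , m }) mono) ,
    AllPairsP.++⁺ (within _ first (strColored-increasing 0 k y)) distinct
      (All.map (λ m → All.map (λ { (e′ , le , m′) → e , e′ , m , m′ , (λ _ → <⇒≢ le) }) mono) first)
    where
    y = b ^ (2 ℕ.* e)
    first : All (Monomial-at e) (strColored a 0 k y)
    first = transport (λ z → All (Monomial-at e) (strColored a 0 k z)) (F.*-identityˡ y) (strColored-monomial e 0 k)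
    within : ∀ us → All (Monomial-at e) us → AllPairs (λ u w → proj₁ u < proj₁ w) us → AllPairs Apart us
    within [] [] [] = []
    within (u ∷ us) (m ∷ ms) (l ∷ ls) = All.zipWith (λ (m′ , c<d) → e , e , m , m′ , (λ c≡d _ → <⇒≢ c<d c≡d)) (ms , l) ∷ within us ms ls

  apart-values : ∀ {u w} → Apart u w → proj₂ u ≢ proj₂ w
  apart-values {c , _} {d , _} (e , e′ , refl , refl , diff) z = let (c≡d , 2e≡2e′) = exponents-unique c (2 ℕ.* e) d (2 ℕ.* e′) z in diff c≡d (ℕP.*-cancelˡ-≡ e e′ 2 2e≡2e′)

  strings-distinct : ∀ μ → AllPairs _≢_ (strings a (zipBlocks μ (evenPowers (length μ) 0)))
  strings-distinct μ = transport (AllPairs _≢_) (values-canonical a μ (evenPowers (length μ) 0)) (AllPairsP.map⁺ (AllPairs.map (λ {u} {w} → apart-values {u} {w}) (proj₂ (canonical-apart μ 0))))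

  canonical-≢0 : ∀ μ → coloredProduct a b (canonical a μ (evenPowers (length μ) 0)) ≢ 0ℚ
  canonical-≢0 μ = coloredProduct-≢0 (AllPairs.map (λ { {u} {w} (e , e′ , m , m′ , diff) → factor-≢0 {e} {e′} {u} {w} m m′ diff }) (proj₂ (canonical-apart μ 0)))

-- Elements of 𝒜ₙ with denominator Δ², described through the numerator over the cube of the Vandermonde product

horner-unique : ∀ as bs → (∀ t → horner as t ≡ horner bs t) → ∀ j → entry as j ≡ entry bs j
horner-unique as bs e j = x-y≡0⇒x≡y (trans (sub-scale (entry as j) (entry bs j)) (trans (sym (entry-combination as bs j)) (zero-entry (horner-coeffs-0 (addLists as (map ((- 1ℚ) *_) bs)) vanishes) j)))
  where
  opaque
    unfolding _+_
    sub-scale : ∀ x y → x - y ≡ x + (- 1ℚ) * y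
    sub-scale = solve-∀ ringℚ
    cancel : ∀ x → x + (- 1ℚ) * x ≡ 0ℚ
    cancel = solve-∀ ringℚ
    0+ : ∀ y → (- 1ℚ) * y ≡ 0ℚ + (- 1ℚ) * y
    0+ = solve-∀ ringℚ
    +0 : ∀ x → x ≡ x + (- 1ℚ) * 0ℚ
    +0 = solve-∀ ringℚ
  vanishes : ∀ t → horner (addLists as (map ((- 1ℚ) *_) bs)) t ≡ 0ℚ
  vanishes t = trans (horner-addLists as (map ((- 1ℚ) *_) bs) t) (trans (cong (horner as t +_) (horner-scale (- 1ℚ) bs t))
    (trans (cong (λ z → z + (- 1ℚ) * horner bs t) (e t)) (cancel (horner bs t))))
  entry-scale : ∀ bs j → entry (map ((- 1ℚ) *_) bs) j ≡ (- 1ℚ) * entry bs j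
  entry-scale [] j = sym (F.zeroʳ (- 1ℚ))
  entry-scale (b ∷ bs) zero = refl
  entry-scale (b ∷ bs) (suc j) = entry-scale bs j
  entry-combination : ∀ as bs j → entry (addLists as (map ((- 1ℚ) *_) bs)) j ≡ entry as j + (- 1ℚ) * entry bs j
  entry-combination [] bs j = trans (entry-scale bs j) (0+ (entry bs j))
  entry-combination (a ∷ as) [] j = +0 (entry (a ∷ as) j)
  entry-combination (a ∷ as) (b ∷ bs) zero = refl
  entry-combination (a ∷ as) (b ∷ bs) (suc j) = entry-combination as bs j
  zero-entry : ∀ {cs} → All (_≡ 0ℚ) cs → ∀ j → entry cs j ≡ 0ℚ
  zero-entry [] j = refl
  zero-entry (e ∷ es) zero = e
  zero-entry (e ∷ es) (suc j) = zero-entry es j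

entry-∷ʳ : ∀ cs c → entry (cs List.∷ʳ c) (length cs) ≡ c
entry-∷ʳ [] c = refl
entry-∷ʳ (d ∷ cs) c = entry-∷ʳ cs c

entry-beyond : ∀ cs j → length cs ≤ j → entry cs j ≡ 0ℚ
entry-beyond [] j l = refl
entry-beyond (c ∷ cs) (suc j) (s≤s l) = entry-beyond cs j l

padded : ∀ d cs → length cs ≤ d → Σ (List ℚ) λ cs′ → length cs′ ≡ d × ∀ t → horner cs t ≡ horner cs′ t
padded zero [] l = [] , refl , λ _ → refl
padded (suc d) [] l = let (cs , e , h) = padded d [] z≤n in 0ℚ ∷ cs , cong suc e , λ t → sym (trans (cong (λ z → 0ℚ + t * z) (sym (h t))) (trans (F.+-identityˡ _) (F.zeroʳ t)))
padded (suc d) (c ∷ cs) (s≤s l) = let (cs′ , e , h) = padded d cs l in c ∷ cs′ , cong suc e , λ t → cong (λ z → c + t * z) (h t)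

balanced-coefficients : ∀ {m d q₀ q₁} (P : Poly (suc m)) v → Balanced d q₀ q₁ (λ t → ev P (t ∷ v)) →
  (∀ j → d < j → ev (coeffξ j P) v ≡ 0ℚ) × Σ ℚ λ κ → ev (coeffξ d P) v ≡ κ * q₁ × ev (coeffξ 0 P) v ≡ κ * q₀
balanced-coefficients {m} {d} {q₀} {q₁} P v (balanced κ lower (deg cs l e) top z) =
  let (cs′ , l′ , h) = padded d cs l
      N = λ j → suc j ℕ.+ degBound P
      unique : ∀ j → ev (coeffξ j P) v ≡ entry (cs′ List.∷ʳ (κ * q₁)) j
      unique j = trans (sym (entry-applyUpTo (λ j → ev (coeffξ j P) v) (m≤m+n (suc j) (degBound P))))
        (horner-unique (coeffs (N j) P v) (cs′ List.∷ʳ (κ * q₁)) (λ t → trans (sym (ev-horner P (N j) (m≤n+m (degBound P) (suc j)) t v))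
          (trans (top t) (trans (cong₂ (λ x k → x + (κ * q₁) * t ^ k) (trans (e t) (h t)) (sym l′)) (sym (horner-∷ʳ cs′ (κ * q₁) t))))) j)
  in (λ j d<j → trans (unique j) (entry-beyond (cs′ List.∷ʳ (κ * q₁)) j (≤-trans (≤-reflexive (trans (length-++ cs′) (trans (+-comm (length cs′) 1) (cong suc l′)))) d<j)))
    , κ , trans (unique d) (transport (λ k → entry (cs′ List.∷ʳ (κ * q₁)) k ≡ κ * q₁) l′ (entry-∷ʳ cs′ (κ * q₁))) , trans (sym (ev-coeffξ-zero P v)) z

front back : ∀ {n} → ℕ → Vec ℚ n → List ℚ
front {n} k x = take (n ∸ k) (toList x)
back {n} k x = drop (n ∸ k) (toList x)

-- One more Vandermonde factor puts the numerator over the cube of the Vandermonde product. The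
-- scaled cube carries the same power of `t`, and its end coefficients are proportional to the same
-- two quantities as those of `reduced`.
record Scaling {n} (P : Poly (2 ℕ.+ n)) (k : ℕ) : Set where
  field
    reduced : Vec ℚ (3 ℕ.+ n) → ℚ
    poly-reduced : IsPoly (3 ℕ.+ n) reduced
    scaling : ∀ t a b (x : Vec ℚ n) → vand (scaled k t x) * numer P a b (scaled k t x) ≡ (t ^ 3) ^ tri k * reduced (t ∷ a ∷ b ∷ x)
    balance : ∀ a b (x : Vec ℚ n) → Balanced ((n ∸ k) ℕ.* (k ℕ.* 3)) (trailing (front k x) (back k x)) (leading (front k x) (back k x)) (λ t → reduced (t ∷ a ∷ b ∷ x))

record Element (n : ℕ) : Set where
  field
    numerator : Poly (2 ℕ.+ n)
    symmetric : ∀ a b → SymmetricOn n (numer numerator a b)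
    wheel₁ : ∀ a b x zs → 3 ℕ.+ length zs ≡ n → numer numerator a b (x ∷ a * x ∷ a * (b * x) ∷ zs) ≡ 0ℚ
    wheel₂ : ∀ a b x zs → 3 ℕ.+ length zs ≡ n → numer numerator a b (x ∷ b * x ∷ a * (b * x) ∷ zs) ≡ 0ℚ
    scalings : ∀ k → k ≤ n → Scaling numerator k
open Element using (numerator) public

samples : ∀ n → ℕ → Vec ℚ n
samples zero m = []
samples (suc n) m = fromℕ m ∷ samples n (suc m)

samples-≥ : ∀ n m → All (λ x → Σ ℕ λ k → m ≤ k × x ≡ fromℕ k) (toList (samples n m))
samples-≥ zero m = []
samples-≥ (suc n) m = (m , ≤-refl , refl) ∷ All.map (λ { (k , le , e) → k , ≤-trans (n≤1+n m) le , e }) (samples-≥ n (suc m))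

samples-distinct : ∀ n m → AllPairs _≢_ (toList (samples n m))
samples-distinct zero m = []
samples-distinct (suc n) m = All.map (λ { (k , le , refl) e → <⇒≢ le (fromℕ-injective m k e) }) (samples-≥ n (suc m)) ∷ samples-distinct n (suc m)

samples-≢0 : ∀ n m → 1 ≤ m → All (_≢ 0ℚ) (toList (samples n m))
samples-≢0 n m l = All.map (λ { (k , le , refl) → fromℕ-pos k (≤-trans l le) }) (samples-≥ n m)

tabulate-punchIn : ∀ {A : Set} {n} (f : Fin (suc n) → A) i → List.tabulate f ↭ f i ∷ List.tabulate (f ∘ Fin.punchIn i)
tabulate-punchIn f 0F = ↭-refl
tabulate-punchIn {n = suc n} f (Fin.suc i) = ↭-trans (Permutation.prep (f 0F) (tabulate-punchIn (f ∘ Fin.suc) i)) (Permutation.swap (f 0F) (f (Fin.suc i)) ↭-refl)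

tabulate-permute : ∀ {A : Set} n (π : Permutation′ n) (f : Fin n → A) → List.tabulate (λ i → f (π ⟨$⟩ʳ i)) ↭ List.tabulate f
tabulate-permute zero π f = ↭-refl
tabulate-permute (suc n) π f = ↭-trans (tabulate-punchIn (λ j → f (π ⟨$⟩ʳ j)) i) (↭-trans
  (↭-reflexive (cong₂ _∷_ (cong f (Perm.inverseʳ π)) (tabulate-cong (λ j → cong f (trans (Perm.punchIn-permute π i j) (cong (λ z → Fin.punchIn z (Perm.remove i π ⟨$⟩ʳ j)) (Perm.inverseʳ π)))))))
  (Permutation.prep (f 0F) (tabulate-permute n (Perm.remove i π) (f ∘ Fin.suc))))
  where i = π ⟨$⟩ˡ 0F

permuted-↭ : ∀ {n} (π : Permutation′ n) (x : Vec ℚ n) → toList (tabulate (λ i → lookup x (π ⟨$⟩ʳ i))) ↭ toList x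
permuted-↭ {n} π x = ↭-trans (↭-reflexive (trans (toList-tabulate _) (tabulate-cong (VecP.lookup∘tabulate (λ i → lookup x (π ⟨$⟩ʳ i))))))
  (↭-trans (tabulate-permute n π (lookup x)) (↭-reflexive (sym (toList-tabulate x))))

polyList-take : ∀ {m n xs} k → PolyList m n xs → Σ ℕ λ l → PolyList m l (take k ∘ xs)
polyList-take k (fs , _ , ps , e) = length (take k fs) , take k fs , refl , AllP.take⁺ k ps , λ v → trans (cong (take k) (e v)) (take-map k fs)

polyList-drop : ∀ {m n xs} k → PolyList m n xs → Σ ℕ λ l → PolyList m l (drop k ∘ xs)
polyList-drop k (fs , _ , ps , e) = length (drop k fs) , drop k fs , refl , AllP.drop⁺ k ps , λ v → trans (cong (drop k) (e v)) (drop-map k fs)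

polyList-scale : ∀ {m n xs t} → IsPoly m t → PolyList m n xs → PolyList m n (λ v → map (t v *_) (xs v))
polyList-scale {t = t} tp (fs , l , ps , e) = map (λ f v → t v * f v) fs , trans (length-map _ fs) l , map⁺ (All.map (poly-* tp) ps) ,
  λ v → trans (cong (map (t v *_)) (e v)) (trans (sym (map-∘ fs)) (map-∘ fs))

poly-differences : ∀ {m n f xs} → IsPoly m f → PolyList m n xs → IsPoly m (λ v → differences (f v) (xs v))
poly-differences {f = f} fp = poly-prodList′ (λ v y → f v - y) (poly-- fp)

poly-cross : ∀ {m k n xs ys} → PolyList m k xs → PolyList m n ys → IsPoly m (λ v → cross (xs v) (ys v))
poly-cross {ys = ys} xp yp = poly-prodList′ (λ v x → differences x (ys v)) (λ fp → poly-differences fp yp) xp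

poly-vand : ∀ {m n xs} → PolyList m n xs → IsPoly m (λ v → vand (xs v))
poly-vand {m} (fs , _ , ps , e) = poly-resp (λ v → cong vand (sym (e v))) (go fs ps)
  where
  go : ∀ fs → All (IsPoly m) fs → IsPoly m (λ v → vand (map (λ f → f v) fs))
  go [] [] = poly-const 1ℚ
  go (f ∷ fs) (p ∷ ps) = poly-* (poly-differences p (fs , refl , ps , λ _ → refl)) (go fs ps)

poly-cube : ∀ {m f} → IsPoly m f → IsPoly m (cube ∘ f)
poly-cube p = poly-* p (poly-* p p)

polyList-xs : ∀ n → PolyList (2 ℕ.+ n) n (λ w → toList (tail (tail w)))
polyList-xs n = polyList-∘ (tail ∘ tail) (λ p → poly-tail (poly-tail p)) (polyList-toList n)

length-scaled : ∀ {n} k t (x : Vec ℚ n) → length (scaled k t x) ≡ n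
length-scaled {n} k t x = trans (length-++ (front k x)) (trans (cong (length (front k x) ℕ.+_) (length-map (t *_) (back k x)))
  (trans (sym (length-++ (front k x))) (trans (cong length (take++drop≡id (n ∸ k) (toList x))) (length-toList x))))

length-front : ∀ {n} k (x : Vec ℚ n) → length (front k x) ≡ n ∸ k
length-front {n} k x = trans (ListP.length-take (n ∸ k) (toList x)) (trans (cong ((n ∸ k) ℕ.⊓_) (length-toList x)) (ℕP.m≤n⇒m⊓n≡m (m∸n≤m n k)))

length-back : ∀ {n} k (x : Vec ℚ n) → k ≤ n → length (back k x) ≡ k
length-back {n} k x k≤n = trans (ListP.length-drop (n ∸ k) (toList x)) (trans (cong (_∸ (n ∸ k)) (length-toList x)) (m∸[m∸n]≡n k≤n))

scaled-1 : ∀ {n} k (x : Vec ℚ n) → scaled k 1ℚ x ≡ toList x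
scaled-1 {n} k x = trans (cong (front k x ++_) (trans (map-cong F.*-identityˡ (back k x)) (map-id (back k x)))) (take++drop≡id (n ∸ k) (toList x))

ev-Δ²-≢0 : ∀ {n} a b (x : Vec ℚ n) → AllPairs _≢_ (toList x) → ev (Δ² {n}) (a ∷ b ∷ x) ≢ 0ℚ
ev-Δ²-≢0 a b x d e = *-≢0 (vand-≢0 d) (vand-≢0 d) (trans (sym (ev-Δ² a b x)) e)

-- The value of (t³)^{tri k} R / (V³ at the scaled point) is R / scaledCube, so the limits are read off R and scaledCube.
scaledCube : ∀ {n} → ℕ → Vec ℚ (3 ℕ.+ n) → ℚ
scaledCube k (t ∷ a ∷ b ∷ x) = cube (vand (front k x)) * (cube (cross (front k x) (map (t *_) (back k x))) * cube (vand (back k x)))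

poly-scaledCube : ∀ n k → IsPoly (3 ℕ.+ n) (scaledCube {n} k)
poly-scaledCube n k = poly-resp (λ { (t ∷ a ∷ b ∷ x) → refl })
  (poly-* (poly-cube (poly-vand frontP)) (poly-* (poly-cube (poly-cross frontP (polyList-scale {t = head} (poly-resp (λ { (t ∷ v) → refl }) (poly-var 0F)) backP))) (poly-cube (poly-vand backP))))
  where
  xsP = polyList-∘ tail poly-tail (polyList-xs n)
  frontP = proj₂ (polyList-take (n ∸ k) xsP)
  backP = proj₂ (polyList-drop (n ∸ k) xsP)

opaque
  unfolding _+_

  cube-product : ∀ Z C T W → ((Z * C) * (T * W)) * (((Z * C) * (T * W)) * ((Z * C) * (T * W))) ≡ (T * (T * (T * 1ℚ))) * ((Z * (Z * Z)) * ((C * (C * C)) * (W * (W * W))))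
  cube-product = solve-∀ ringℚ

  cube-reorder : ∀ Z W C → (Z * W) * C ≡ Z * (C * W)
  cube-reorder = solve-∀ ringℚ

  cancel-square : ∀ P V → P * (V * (V * V)) ≡ (V * P) * (V * V)
  cancel-square = solve-∀ ringℚ

  limits-equal : ∀ κ κ′ x y → (κ * x) * (κ′ * y) ≡ (κ * y) * (κ′ * x)
  limits-equal = solve-∀ ringℚ

  swap-power³ : ∀ T R S → (T * R) * S ≡ R * (T * S)
  swap-power³ = solve-∀ ringℚ

^-swap : ∀ t m k → (t ^ m) ^ k ≡ (t ^ k) ^ m
^-swap t m zero = sym (1^ m)
^-swap t m (suc k) = trans (cong (t ^ m *_) (^-swap t m k)) (sym (^-* t (t ^ k) m))

vand-scaled : ∀ {n} k (x : Vec ℚ n) → k ≤ n → ∀ t a b → cube (vand (scaled k t x)) ≡ (t ^ 3) ^ tri k * scaledCube k (t ∷ a ∷ b ∷ x)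
vand-scaled {n} k x k≤n t a b = trans (cong cube (trans (vand-++ (front k x) (map (t *_) (back k x))) (cong (vand (front k x) * cross (front k x) (map (t *_) (back k x)) *_) (vand-scale t (back k x)))))
  (trans (cube-product (vand (front k x)) (cross (front k x) (map (t *_) (back k x))) (t ^ tri (length (back k x))) (vand (back k x)))
    (cong (_* scaledCube k (t ∷ a ∷ b ∷ x)) (trans (cong (λ l → (t ^ tri l) ^ 3) (length-back k x k≤n)) (^-swap t (tri k) 3))))

scaledCube-balanced : ∀ {n} k → k ≤ n → ∀ a b (x : Vec ℚ n) →
  Balanced ((n ∸ k) ℕ.* (k ℕ.* 3)) (trailing (front k x) (back k x)) (leading (front k x) (back k x)) (λ t → scaledCube k (t ∷ a ∷ b ∷ x))
scaledCube-balanced {n} k k≤n a b x = transport (λ d → Balanced d (trailing (front k x) (back k x)) (leading (front k x) (back k x)) (λ t → scaledCube k (t ∷ a ∷ b ∷ x)))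
  (cong₂ (λ i j → i ℕ.* (j ℕ.* 3)) (length-front k x) (length-back k x k≤n))
  (balanced-resp (λ t → cube-reorder (cube (vand (front k x))) (cube (vand (back k x))) (cube (cross (front k x) (map (t *_) (back k x)))))
    (balanced-scalar (cube (vand (front k x)) * cube (vand (back k x))) (cross³-balanced (front k x) (back k x))))

cube-≢0 : ∀ {x} → x ≢ 0ℚ → cube x ≢ 0ℚ
cube-≢0 x≢0 = *-≢0 x≢0 (*-≢0 x≢0 x≢0)

scaledCube-0≢0 : ∀ {n} k (x : Vec ℚ n) → AllPairs _≢_ (toList x) → All (_≢ 0ℚ) (toList x) → ∀ a b → scaledCube k (0ℚ ∷ a ∷ b ∷ x) ≢ 0ℚ
scaledCube-0≢0 {n} k x d ne a b = *-≢0 (cube-≢0 (vand-≢0 (AllPairsP.take⁺ (n ∸ k) d))) (*-≢0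
  (cube-≢0 (prodℚ-≢0 (map⁺ (All.map (λ {z} z≢0 → prodℚ-≢0 (map⁺ (map⁺ (All.universal (λ w e → z≢0 (trans (sym (minus-0 z w)) e)) (back k x))))) (AllP.take⁺ (n ∸ k) ne)))))
  (cube-≢0 (vand-≢0 (AllPairsP.drop⁺ (n ∸ k) d))))
  where
  opaque
    unfolding _+_
    minus-0 : ∀ z w → z - 0ℚ * w ≡ z
    minus-0 = solve-∀ ringℚ

leading-≢0 : ∀ zs {ws} → All (_≢ 0ℚ) ws → leading zs ws ≢ 0ℚ
leading-≢0 zs {ws} ne = prodℚ-≢0 (map⁺ (All.universal (λ _ → prodℚ-≢0 (map⁺ (All.map (λ w≢0 → neg-≢0 (cube-≢0 w≢0)) ne))) zs))

module _ {n} (E : Element n) where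

  private module E = Element E

  element-frac : Frac (2 ℕ.+ n)
  element-frac = record { num = numerator E ; den = Δ² {n} ; den≉0 = nonzero⇒≉0 (Δ² {n}) (0ℚ ∷ 0ℚ ∷ samples n 1) (ev-Δ²-≢0 0ℚ 0ℚ (samples n 1) (samples-distinct n 1)) }

  Δ²-image : ∀ {m} (σ : Fin (2 ℕ.+ n) → Poly m) v {a b x} → image σ v ≡ a ∷ b ∷ x → AllPairs _≢_ (toList x) → ¬ (subst σ (Δ² {n}) ≈ 0ₚ)
  Δ²-image σ v {a} {b} {x} e d = nonzero⇒≉0 (subst σ (Δ² {n})) v λ z → ev-Δ²-≢0 a b x d (trans (cong (ev (Δ² {n})) (sym e)) (trans (sym (ev-subst σ (Δ² {n}) v)) z))

  element-symmetric : ∀ π → Invariant (permσ π) element-frac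
  element-symmetric π = numerator E , Δ² , (λ _ → refl) ,
    nonzero⇒≉0 (subst (permσ π) Δ²) (0ℚ ∷ 0ℚ ∷ samples n 1) (λ e → ev-Δ²-≢0 0ℚ 0ℚ (samples n 1) (samples-distinct n 1) (trans (sym (Δ²-permuted 0ℚ 0ℚ (samples n 1))) e)) ,
    ev-≃ element-frac (subst (permσ π) (numerator E)) (subst (permσ π) Δ²) λ { (a ∷ b ∷ x) → trans (cong (ev (numerator E) (a ∷ b ∷ x) *_) (Δ²-permuted a b x))
      (cong (_* ev (Δ² {n}) (a ∷ b ∷ x)) (trans (sym (same-value x a b)) (trans (cong (ev (numerator E)) (sym (image-permσ π a b x))) (sym (ev-subst (permσ π) (numerator E) (a ∷ b ∷ x)))))) }
    where
    permuted : Vec ℚ n → Vec ℚ n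
    permuted x = tabulate (λ i → lookup x (π ⟨$⟩ʳ i))
    Δ²-permuted : ∀ a b x → ev (subst (permσ π) (Δ² {n})) (a ∷ b ∷ x) ≡ ev (Δ² {n}) (a ∷ b ∷ x)
    Δ²-permuted a b x = trans (ev-subst (permσ π) (Δ² {n}) (a ∷ b ∷ x)) (trans (cong (ev (Δ² {n})) (image-permσ π a b x)) (trans (ev-Δ² a b (permuted x)) (trans (vand²-↭ (permuted-↭ π x)) (sym (ev-Δ² a b x)))))
    same-value : ∀ x a b → ev (numerator E) (a ∷ b ∷ permuted x) ≡ ev (numerator E) (a ∷ b ∷ x)
    same-value x a b = trans (cong (λ y → ev (numerator E) (a ∷ b ∷ y)) (sym (toVec-toList (permuted x))))
      (trans (E.symmetric a b (permuted-↭ π x) (length-toList (permuted x))) (cong (λ y → ev (numerator E) (a ∷ b ∷ y)) (toVec-toList x)))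

  -- Over the cube of the Vandermonde product the common power of `t` cancels, leaving two balanced
  -- functions with the same end data. The limit `L` is the quotient of their constant coefficients;
  -- at infinity it is the quotient of the coefficients of degree `d`, and both are the ratio of the
  -- two factors `κ`.
  element-limits : ∀ k → k ≤ n → LimitsCoincide (scaleσ n k) element-frac
  element-limits k k≤n = P′ , Q′ , P′/Q′ , σQ′≉0 , L , (R , Q₀ , relation , Q₀-low , λ _ → refl) ,
    (R , Q₀ , d , relation , (λ j l → ev≡0⇒≈0 (coeffξ j R) λ { (a ∷ b ∷ x) → proj₁ (R-coefficients a b x) j l }) ,
      (λ j l → ev≡0⇒≈0 (coeffξ j Q₀) λ { (a ∷ b ∷ x) → proj₁ (Q₀-coefficients a b x) j l }) ,
      nonzero⇒≉0 (coeffξ d Q₀) (0ℚ ∷ 0ℚ ∷ x₀) Q₀-high ,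
      ev-≃ L (coeffξ d R) (coeffξ d Q₀) λ { (a ∷ b ∷ x) → let (_ , κ , r₁ , r₀) = R-coefficients a b x ; (_ , κ′ , s₁ , s₀) = Q₀-coefficients a b x in
        trans (cong₂ _*_ r₀ s₁) (trans (limits-equal κ κ′ (trailing (front k x) (back k x)) (leading (front k x) (back k x))) (sym (cong₂ _*_ r₁ s₀))) })
    where
    σ = scaleσ n k
    S = E.scalings k k≤n
    open Scaling S
    d = (n ∸ k) ℕ.* (k ℕ.* 3)
    x₀ = samples n 1
    V : Vec ℚ (2 ℕ.+ n) → ℚ
    V w = vand (toList (tail (tail w)))
    P′-poly : IsPoly (2 ℕ.+ n) (λ w → V w * ev (numerator E) w)
    P′-poly = poly-* (poly-vand (polyList-xs n)) (poly-ev (numerator E))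
    Q′-poly : IsPoly (2 ℕ.+ n) (cube ∘ V)
    Q′-poly = poly-cube (poly-vand (polyList-xs n))
    P′ = proj₁ P′-poly
    Q′ = proj₁ Q′-poly
    R = proj₁ poly-reduced
    Q₀ = proj₁ (poly-scaledCube n k)
    P′/Q′ : element-frac ≃[ P′ / Q′ ]
    P′/Q′ = ev-≃ element-frac P′ Q′ λ { (a ∷ b ∷ x) → trans (cong (ev (numerator E) (a ∷ b ∷ x) *_) (sym (proj₂ Q′-poly (a ∷ b ∷ x))))
      (trans (cancel-square (ev (numerator E) (a ∷ b ∷ x)) (vand (toList x))) (cong₂ _*_ (proj₂ P′-poly (a ∷ b ∷ x)) (sym (ev-Δ² a b x)))) }
    at-scaled : ∀ (h : Vec ℚ (2 ℕ.+ n) → ℚ) (H : IsPoly (2 ℕ.+ n) h) t a b x → ev (subst σ (proj₁ H)) (t ∷ a ∷ b ∷ x) ≡ h (a ∷ b ∷ toVec n (scaled k t x))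
    at-scaled h H t a b x = trans (ev-subst σ (proj₁ H) (t ∷ a ∷ b ∷ x)) (trans (cong (ev (proj₁ H)) (image-scaleσ n k t a b x)) (sym (proj₂ H (a ∷ b ∷ toVec n (scaled k t x)))))
    σP′ : ∀ t a b x → ev (subst σ P′) (t ∷ a ∷ b ∷ x) ≡ (t ^ 3) ^ tri k * reduced (t ∷ a ∷ b ∷ x)
    σP′ t a b x = trans (at-scaled (λ w → V w * ev (numerator E) w) P′-poly t a b x)
      (trans (cong (λ zs → vand zs * numer (numerator E) a b (scaled k t x)) (toList-toVec n (scaled k t x) (length-scaled k t x))) (scaling t a b x))
    σQ′ : ∀ t a b x → ev (subst σ Q′) (t ∷ a ∷ b ∷ x) ≡ (t ^ 3) ^ tri k * scaledCube k (t ∷ a ∷ b ∷ x)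
    σQ′ t a b x = trans (at-scaled (cube ∘ V) Q′-poly t a b x) (trans (cong (cube ∘ vand) (toList-toVec n (scaled k t x) (length-scaled k t x))) (vand-scaled k x k≤n t a b))
    σQ′≉0 : ¬ (subst σ Q′ ≈ 0ₚ)
    σQ′≉0 = nonzero⇒≉0 (subst σ Q′) (1ℚ ∷ 0ℚ ∷ 0ℚ ∷ x₀) λ e → cube-≢0 (vand-≢0 (samples-distinct n 1))
      (trans (cong (cube ∘ vand) (sym (trans (toList-toVec n (scaled k 1ℚ x₀) (length-scaled k 1ℚ x₀)) (scaled-1 k x₀)))) (trans (sym (at-scaled (cube ∘ V) Q′-poly 1ℚ 0ℚ 0ℚ x₀)) e))
    relation : subst σ P′ *ₚ Q₀ ≈ R *ₚ subst σ Q′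
    relation = ev≡⇒≈ (subst σ P′ *ₚ Q₀) (R *ₚ subst σ Q′) λ { (t ∷ a ∷ b ∷ x) → let w = t ∷ a ∷ b ∷ x in
      trans (ev-* (subst σ P′) Q₀ w) (trans (cong₂ _*_ (σP′ t a b x) (sym (proj₂ (poly-scaledCube n k) w))) (trans (swap-power³ ((t ^ 3) ^ tri k) (reduced w) (scaledCube k w))
        (trans (cong₂ _*_ (proj₂ poly-reduced w) (sym (σQ′ t a b x))) (sym (ev-* R (subst σ Q′) w))))) }
    R-coefficients = λ a b x → balanced-coefficients R (a ∷ b ∷ x) (balanced-resp (λ t → proj₂ poly-reduced (t ∷ a ∷ b ∷ x)) (balance a b x))
    Q₀-coefficients = λ a b x → balanced-coefficients Q₀ (a ∷ b ∷ x) (balanced-resp (λ t → proj₂ (poly-scaledCube n k) (t ∷ a ∷ b ∷ x)) (scaledCube-balanced k k≤n a b x))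
    Q₀-at-0 : ev (coeffξ 0 Q₀) (0ℚ ∷ 0ℚ ∷ x₀) ≢ 0ℚ
    Q₀-at-0 e = scaledCube-0≢0 k x₀ (samples-distinct n 1) (samples-≢0 n 1 ≤-refl) 0ℚ 0ℚ
      (trans (proj₂ (poly-scaledCube n k) (0ℚ ∷ 0ℚ ∷ 0ℚ ∷ x₀)) (trans (ev-coeffξ-zero Q₀ (0ℚ ∷ 0ℚ ∷ x₀)) e))
    Q₀-low : ¬ (coeffξ 0 Q₀ ≈ 0ₚ)
    Q₀-low = nonzero⇒≉0 (coeffξ 0 Q₀) (0ℚ ∷ 0ℚ ∷ x₀) Q₀-at-0
    Q₀-high : ev (coeffξ d Q₀) (0ℚ ∷ 0ℚ ∷ x₀) ≢ 0ℚ
    Q₀-high e = let (_ , κ , s₁ , s₀) = Q₀-coefficients 0ℚ 0ℚ x₀ in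
      Q₀-at-0 (trans s₀ (0*≡0 (*-cancelʳ-0 (leading-≢0 (front k x₀) (AllP.drop⁺ (n ∸ k) (samples-≢0 n 1 ≤-refl))) (trans (sym s₁) e))))
    L : Frac (2 ℕ.+ n)
    L = record { num = coeffξ 0 R ; den = coeffξ 0 Q₀ ; den≉0 = Q₀-low }

  -- The point `v₀` with distinct coordinates certifies that the denominator does not become zero
  -- under the substitution.
  element-vanishes : ∀ {m} (σ : Fin (2 ℕ.+ n) → Poly m) v₀ {a b x} → image σ v₀ ≡ a ∷ b ∷ x → AllPairs _≢_ (toList x) →
    (∀ v → ev (numerator E) (image σ v) ≡ 0ℚ) → Vanishes σ element-frac
  element-vanishes σ v₀ e d z = numerator E , Δ² , (λ _ → refl) , Δ²-image σ v₀ e d , ev≡0⇒≈0 (subst σ (numerator E)) (λ v → trans (ev-subst σ (numerator E) v) (z v))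

-- At the parameters 2 and 3 with `x = 1` the wheels are 1, 2, 6 and 1, 3, 6; the remaining
-- coordinates are 7, 8 and so on.
wheel-point-distinct : ∀ r k {y} → y ≡ fromℕ k → 1 < k → k < 6 → AllPairs _≢_ (fromℕ 1 ∷ y ∷ fromℕ 2 * (fromℕ 3 * fromℕ 1) ∷ toList (samples r 7))
wheel-point-distinct r k refl 1<k k<6 = transport (λ z → AllPairs _≢_ (fromℕ 1 ∷ fromℕ k ∷ z ∷ toList (samples r 7))) (trans (fromℕ-* 2 3) (cong (fromℕ 2 *_) (fromℕ-* 3 1)))
  ((apart {1} {k} 1<k ∷ apart {1} {6} (s≤s (s≤s z≤n)) ∷ beyond 1 (s≤s (s≤s z≤n))) ∷ (apart {k} {6} k<6 ∷ beyond k (m≤n⇒m≤1+n k<6)) ∷ beyond 6 ≤-refl ∷ samples-distinct r 7)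
  where
  apart : ∀ {i j} → i < j → fromℕ i ≢ fromℕ j
  apart {i} {j} l e = <⇒≢ l (fromℕ-injective i j e)
  beyond : ∀ i → i < 7 → All (fromℕ i ≢_) (toList (samples r 7))
  beyond i l = All.map (λ { (j , le , refl) → apart {i} {j} (≤-trans l le) }) (samples-≥ r 7)

element-wheel : ∀ {n} (E : Element n) → Wheel n (element-frac E)
element-wheel {zero} E = tt
element-wheel {suc zero} E = tt
element-wheel {suc (suc zero)} E = tt
element-wheel {suc (suc (suc r))} E =
  element-vanishes E (wheelσ r q₁) (point (samples r 7)) (image-wheelσ r q₁ (fromℕ 2) (fromℕ 3) (fromℕ 1) 0ℚ 0ℚ (samples r 7))
    (wheel-point-distinct r 2 (trans (cong (_* fromℕ 1) (ev-q₁ (fromℕ 2) (fromℕ 3))) (sym (fromℕ-* 2 1))) (s≤s (s≤s z≤n)) (s≤s (s≤s (s≤s z≤n)))) (zero-at q₁ ev-q₁ (Element.wheel₁ E)) ,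
  element-vanishes E (wheelσ r q₂) (point (samples r 7)) (image-wheelσ r q₂ (fromℕ 2) (fromℕ 3) (fromℕ 1) 0ℚ 0ℚ (samples r 7))
    (wheel-point-distinct r 3 (trans (cong (_* fromℕ 1) (ev-q₂ (fromℕ 2) (fromℕ 3))) (sym (fromℕ-* 3 1))) (s≤s (s≤s z≤n)) (s≤s (s≤s (s≤s (s≤s z≤n))))) (zero-at q₂ ev-q₂ (Element.wheel₂ E))
  where
  point : Vec ℚ r → Vec ℚ (5 ℕ.+ r)
  point w = fromℕ 2 ∷ fromℕ 3 ∷ fromℕ 1 ∷ 0ℚ ∷ 0ℚ ∷ w
  zero-at : ∀ c {c̄ : ℚ → ℚ → ℚ} → (∀ a b → ev c (a ∷ b ∷ []) ≡ c̄ a b) → (∀ a b x zs → 3 ℕ.+ length zs ≡ 3 ℕ.+ r → numer (numerator E) a b (x ∷ c̄ a b * x ∷ a * (b * x) ∷ zs) ≡ 0ℚ) →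
    ∀ v → ev (numerator E) (image (wheelσ r c) v) ≡ 0ℚ
  zero-at c e h (a ∷ b ∷ x ∷ y ∷ z ∷ w) = trans (cong (ev (numerator E)) (trans (image-wheelσ r c a b x y z w)
    (cong₂ (λ k w → a ∷ b ∷ x ∷ k * x ∷ a * (b * x) ∷ w) (e a b) (sym (toVec-toList w))))) (h a b x (toList w) (cong (3 ℕ.+_) (length-toList w)))

1ₚ≉0 : ∀ {m} → ¬ (1ₚ {m} ≈ 0ₚ)
1ₚ≉0 {m} = nonzero⇒≉0 (1ₚ {m}) (Vec.replicate m 0ℚ) λ e → case trans (sym (ev-const 1ℚ (Vec.replicate m 0ℚ))) e of λ ()

element-inA : ∀ {n} (E : Element n) → InA n (element-frac E)
element-inA {n} E = record
  { symmetric = element-symmetric E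
  ; limits = element-limits E
  ; poles = numerator E , 1ₚ , 1ₚ≉0 {2} , ev-≃ (element-frac E) (numerator E) (ι 1ₚ *ₚ Δ²) λ { (a ∷ b ∷ x) →
      cong (ev (numerator E) (a ∷ b ∷ x) *_) (trans (ev-* (ι 1ₚ) Δ² (a ∷ b ∷ x)) (trans (cong (_* ev (Δ² {n}) (a ∷ b ∷ x)) (trans (ev-ι 1ₚ a b x) (ev-const 1ℚ (a ∷ b ∷ [])))) (F.*-identityˡ _))) }
  ; wheel = element-wheel E }

-- 𝔽-linear combinations

∑ : ∀ m → (Fin m → ℚ) → ℚ
∑ zero f = 0ℚ
∑ (suc m) f = f 0F + ∑ m (f ∘ Fin.suc)

∑-cong : ∀ m {f g} → (∀ i → f i ≡ g i) → ∑ m f ≡ ∑ m g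
∑-cong zero e = refl
∑-cong (suc m) e = cong₂ _+_ (e 0F) (∑-cong m (e ∘ Fin.suc))

∑-0 : ∀ m {f} → (∀ i → f i ≡ 0ℚ) → ∑ m f ≡ 0ℚ
∑-0 zero e = refl
∑-0 (suc m) e = trans (cong₂ _+_ (e 0F) (∑-0 m (e ∘ Fin.suc))) 0+0≡0

∑-scale : ∀ m c f → ∑ m (λ i → c * f i) ≡ c * ∑ m f
∑-scale zero c f = sym (F.zeroʳ c)
∑-scale (suc m) c f = trans (cong (c * f 0F +_) (∑-scale m c (f ∘ Fin.suc))) (sym (F.distribˡ c (f 0F) (∑ m (f ∘ Fin.suc))))

∑-+ : ∀ m f g → ∑ m (λ i → f i + g i) ≡ ∑ m f + ∑ m g
∑-+ zero f g = sym 0+0≡0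
∑-+ (suc m) f g = trans (cong (f 0F + g 0F +_) (∑-+ m (f ∘ Fin.suc) (g ∘ Fin.suc))) (interchange+ (f 0F) (g 0F) (∑ m (f ∘ Fin.suc)) (∑ m (g ∘ Fin.suc)))

∑-poly : ∀ {k} m {f : Fin m → Vec ℚ k → ℚ} → (∀ i → IsPoly k (f i)) → IsPoly k (λ v → ∑ m (λ i → f i v))
∑-poly zero p = poly-const 0ℚ
∑-poly (suc m) p = poly-+ (p 0F) (∑-poly m (p ∘ Fin.suc))

∑-balanced : ∀ {d q₀ q₁} m {f : Fin m → ℚ → ℚ} → (∀ i → Balanced d q₀ q₁ (f i)) → Balanced d q₀ q₁ (λ t → ∑ m (λ i → f i t))
∑-balanced zero b = balanced-0
∑-balanced (suc m) b = balanced-+ (b 0F) (∑-balanced m (b ∘ Fin.suc))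

module _ {n} m (c : Fin m → Poly 2) (E : Fin m → Element n) where

  combination-poly : IsPoly (2 ℕ.+ n) (λ w → ∑ m (λ i → ev (ι (c i)) w * ev (numerator (E i)) w))
  combination-poly = ∑-poly m (λ i → poly-* (poly-ev (ι (c i))) (poly-ev (numerator (E i))))

  numer-combination : ∀ a b zs → numer (proj₁ combination-poly) a b zs ≡ ∑ m (λ i → ev (c i) (a ∷ b ∷ []) * numer (numerator (E i)) a b zs)
  numer-combination a b zs = trans (sym (proj₂ combination-poly (a ∷ b ∷ toVec n zs))) (∑-cong m (λ i → cong (_* numer (numerator (E i)) a b zs) (ev-ι (c i) a b (toVec n zs))))

  combination : Element n
  combination = record
    { numerator = proj₁ combination-poly
    ; symmetric = λ a b {xs} {ys} p l → trans (numer-combination a b xs) (trans (∑-cong m (λ i → cong (ev (c i) (a ∷ b ∷ []) *_) (Element.symmetric (E i) a b p l))) (sym (numer-combination a b ys)))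
    ; wheel₁ = λ a b x zs l → trans (numer-combination a b _) (∑-0 m (λ i → *0≡0 (Element.wheel₁ (E i) a b x zs l)))
    ; wheel₂ = λ a b x zs l → trans (numer-combination a b _) (∑-0 m (λ i → *0≡0 (Element.wheel₂ (E i) a b x zs l)))
    ; scalings = λ k k≤n → let open Scaling in record
      { reduced = R k k≤n
      ; poly-reduced = poly-resp (λ { (t ∷ a ∷ b ∷ x) → refl }) (∑-poly m (λ i → poly-* (poly-tail (coefficient i)) (poly-reduced (Element.scalings (E i) k k≤n))))
      ; scaling = λ t a b x → trans (cong (vand (scaled k t x) *_) (numer-combination a b (scaled k t x)))
          (trans (sym (∑-scale m (vand (scaled k t x)) (λ i → ev (c i) (a ∷ b ∷ []) * numer (numerator (E i)) a b (scaled k t x))))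
          (trans (∑-cong m (λ i → trans (swap-factor (vand (scaled k t x)) (ev (c i) (a ∷ b ∷ [])) (numer (numerator (E i)) a b (scaled k t x)))
            (trans (cong (ev (c i) (a ∷ b ∷ []) *_) (scaling (Element.scalings (E i) k k≤n) t a b x)) (swap-factor (ev (c i) (a ∷ b ∷ [])) ((t ^ 3) ^ tri k) _))))
            (∑-scale m ((t ^ 3) ^ tri k) (λ i → ev (c i) (a ∷ b ∷ []) * reduced (Element.scalings (E i) k k≤n) (t ∷ a ∷ b ∷ x)))))
      ; balance = λ a b x → ∑-balanced m {λ i t → ev (c i) (a ∷ b ∷ []) * reduced (Element.scalings (E i) k k≤n) (t ∷ a ∷ b ∷ x)} (λ i → balanced-scalar (ev (c i) (a ∷ b ∷ [])) (balance (Element.scalings (E i) k k≤n) a b x)) } }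
    where
    opaque
      unfolding _+_
      swap-factor : ∀ V c N → V * (c * N) ≡ c * (V * N)
      swap-factor = solve-∀ ringℚ
    coefficient : ∀ i → IsPoly (2 ℕ.+ n) (λ w → ev (c i) (head w ∷ head (tail w) ∷ []))
    coefficient i = poly-resp (λ { (a ∷ b ∷ x) → ev-ι (c i) a b x }) (poly-ev (ι {n} (c i)))
    R : ∀ k → k ≤ n → Vec ℚ (3 ℕ.+ n) → ℚ
    R k k≤n (t ∷ a ∷ b ∷ x) = ∑ m (λ i → ev (c i) (a ∷ b ∷ []) * Scaling.reduced (Element.scalings (E i) k k≤n) (t ∷ a ∷ b ∷ x))

-- ε_ν is an element: divide the alternating numerator by the Vandermonde product

opaque
  unfolding _+_

  value-difference : ∀ x y → (- 1ℚ) * y - (- 1ℚ) * x ≡ x - y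
  value-difference = solve-∀ ringℚ

module _ {m : ℕ} where

  -- Both coefficients are -1 because a form subtracts its lower coordinate, while `vand` multiplies
  -- differences of an earlier minus a later entry.
  differenceForm : ∀ {i j : Fin m} → i Fin.< j → Form m
  differenceForm {i} {j} i<j = form j i i<j (- 1ℚ) (- 1ℚ) (neg-≢0 λ ()) (neg-≢0 λ ())

  rowForms : ∀ i is → All (i Fin.<_) is → List (Form m)
  rowForms i [] [] = []
  rowForms i (j ∷ is) (l ∷ ls) = differenceForm l ∷ rowForms i is ls

  pairForms : ∀ is → AllPairs Fin._<_ is → List (Form m)
  pairForms [] [] = []
  pairForms (i ∷ is) (l ∷ ls) = rowForms i is l ++ pairForms is ls

  product-rowForms : ∀ i is l v → product (rowForms i is l) v ≡ differences (lookup v i) (map (lookup v) is)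
  product-rowForms i [] [] v = refl
  product-rowForms i (j ∷ is) (l ∷ ls) v = cong₂ _*_ (value-difference (lookup v i) (lookup v j)) (product-rowForms i is ls v)

  product-pairForms : ∀ is l v → product (pairForms is l) v ≡ vand (map (lookup v) is)
  product-pairForms [] [] v = refl
  product-pairForms (i ∷ is) (l ∷ ls) v = trans (product-++ (rowForms i is l) (pairForms is ls) v) (cong₂ _*_ (product-rowForms i is l v) (product-pairForms is ls v))

  rowForms-all : ∀ (S : Form m → Set) i is l → All (λ j → ∀ (i<j : i Fin.< j) → S (differenceForm i<j)) is → All S (rowForms i is l)
  rowForms-all S i [] [] [] = []
  rowForms-all S i (j ∷ is) (l ∷ ls) (s ∷ ss) = s l ∷ rowForms-all S i is ls ss

  pairForms-all : ∀ (T : Fin m → Set) (S : Form m → Set) is l → All T is → (∀ {i j} → T i → T j → (i<j : i Fin.< j) → S (differenceForm i<j)) → All S (pairForms is l)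
  pairForms-all T S [] [] [] h = []
  pairForms-all T S (i ∷ is) (l ∷ ls) (t ∷ ts) h = ++⁺ (rowForms-all S i is l (All.map (h t) ts)) (pairForms-all T S is ls ts h)

  rowForms-distinct : ∀ i is l → AllPairs Fin._<_ is → AllPairs Distinct (rowForms i is l)
  rowForms-distinct i [] [] [] = []
  rowForms-distinct i (j ∷ is) (l ∷ ls) (lt ∷ lts) = rowForms-all (Distinct (differenceForm l)) i is ls (All.map (λ j<k i<k e → ⊥-elim (FinP.<⇒≢ j<k e)) lt) ∷ rowForms-distinct i is ls lts

  pairForms-distinct : ∀ is l → AllPairs Distinct (pairForms is l)
  pairForms-distinct [] [] = []
  pairForms-distinct (i ∷ is) (l ∷ ls) = AllPairsP.++⁺ (rowForms-distinct i is l ls) (pairForms-distinct is ls)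
    (rowForms-all (λ f → All (Distinct f) (pairForms is ls)) i is l (All.universal (λ j i<j →
      pairForms-all (i Fin.<_) (Distinct (differenceForm i<j)) is ls l (λ i<k _ k<o _ e → ⊥-elim (FinP.<⇒≢ i<k e))) is))

pick₂ : ∀ {n} (x : Vec ℚ n) {i j} → i Fin.< j → Σ (List ℚ) λ R → toList x ↭ lookup x i ∷ lookup x j ∷ R
pick₂ (y ∷ x) {0F} {Fin.suc j} _ = let (R , e) = pick x j in R , Permutation.prep y e
pick₂ (y ∷ x) {Fin.suc i} {Fin.suc j} (s≤s l) = let (R , e) = pick₂ x {i} {j} l in y ∷ R ,
  ↭-trans (Permutation.prep y e) (↭-trans (Permutation.swap y (lookup x i) ↭-refl) (Permutation.prep (lookup x i) (Permutation.swap y (lookup x j) ↭-refl)))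

swapAt-beyond : ∀ {A : Set} k (zs : List A) → ¬ (suc k < length zs) → swapAt k zs ≡ zs
swapAt-beyond zero [] h = refl
swapAt-beyond zero (x ∷ []) h = refl
swapAt-beyond zero (x ∷ y ∷ zs) h = ⊥-elim (h (s≤s (s≤s z≤n)))
swapAt-beyond (suc k) [] h = refl
swapAt-beyond (suc k) (x ∷ zs) h = cong (x ∷_) (swapAt-beyond k zs (λ l → h (s≤s l)))

vand-alternating : ∀ k zs → suc k < length zs → vand (swapAt k zs) ≡ - vand zs
vand-alternating zero (x ∷ y ∷ zs) l = vand-swap y x (differences y zs) (differences x zs) (vand zs)
vand-alternating zero (x ∷ []) (s≤s ())
vand-alternating (suc k) (x ∷ zs) (s≤s l) = trans (cong₂ _*_ (prodℚ-↭ (PermP.map⁺ (λ y → x - y) (swapAt-↭ k zs))) (vand-alternating k zs l)) (neg-*ʳ (differences x zs) (vand zs))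

opaque
  unfolding _+_

  doubled : ∀ x → (1ℚ + (1ℚ + 0ℚ)) * x ≡ x + x
  doubled = solve-∀ ringℚ

  x+-x : ∀ x → x + (- x) ≡ 0ℚ
  x+-x = solve-∀ ringℚ

  cancel-signs : ∀ V P → - ((- V) * P) ≡ V * P
  cancel-signs = solve-∀ ringℚ

  collect-power : ∀ i A C T B → i * ((A * C) * (T * B)) ≡ T * (i * ((A * C) * B))
  collect-power = solve-∀ ringℚ

  crossing-middle : ∀ i A C B → i * ((A * C) * B) ≡ (i * (A * B)) * C
  crossing-middle = solve-∀ ringℚ

x≡-x⇒0 : ∀ {x} → x ≡ - x → x ≡ 0ℚ
x≡-x⇒0 {x} e = *-cancelˡ-0 {fromℕ 2} (fromℕ-suc≢0 1) (trans (doubled x) (trans (cong (x +_) e) (x+-x x)))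

poly-head : ∀ {m} → IsPoly (suc m) head
poly-head = poly-resp (λ { (t ∷ v) → refl }) (poly-var 0F)

poly-second : ∀ {m} → IsPoly (2 ℕ.+ m) (head ∘ tail)
poly-second = poly-resp (λ { (t ∷ s ∷ v) → refl }) (poly-var 1F)

poly-third : ∀ {m} → IsPoly (3 ℕ.+ m) (head ∘ tail ∘ tail)
poly-third = poly-resp (λ { (t ∷ s ∷ r ∷ v) → refl }) (poly-var 2F)

module _ (n : ℕ) (ν : List ℕ) where

  poly-indicator : ∀ {m} (cf : PolyColored m) → IsPoly m (λ v → indicator n ν (evalColored v cf))
  poly-indicator cf = poly-resp (λ v → cong (λ cs → if ⌊ content n cs ≟ₗ target n ν ⌋ then 1ℚ else 0ℚ) (map-∘ cf))
    (poly-const (if ⌊ content n (map proj₁ cf) ≟ₗ target n ν ⌋ then 1ℚ else 0ℚ))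

  xsOf : Vec ℚ (2 ℕ.+ n) → List ℚ
  xsOf v = toList (tail (tail v))

  εValue : Vec ℚ (2 ℕ.+ n) → ℚ
  εValue v = εNum n ν (head v) (head (tail v)) (xsOf v)

  poly-ε : IsPoly (2 ℕ.+ n) εValue
  poly-ε = colorSum-poly n {λ v us → indicator n ν us * coloredProduct (head v) (head (tail v)) us} (polyList-xs n)
    (λ cf → poly-* (poly-indicator cf) (poly-coloredProduct {b = head ∘ tail} poly-head poly-second cf))

  ε-repeated : ∀ a b y zs → length (y ∷ y ∷ zs) ≡ n → εNum n ν a b (y ∷ y ∷ zs) ≡ 0ℚ
  ε-repeated a b y zs l = x≡-x⇒0 (εNum-swap n ν a b 0 (y ∷ y ∷ zs) (s≤s (s≤s z≤n)))

  ε-↭ : ∀ a b {xs ys} → xs ↭ ys → length xs ≡ n → εNum n ν a b xs =± εNum n ν a b ys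
  ε-↭ a b = swaps⇒↭ _=±_ (inj₁ refl) =±-trans (εNum n ν a b) λ k zs l → case suc k <? length zs of λ
    { (yes k< ) → inj₂ (sym (trans (cong -_ (εNum-swap n ν a b k zs k<)) (neg-neg (εNum n ν a b zs))))
    ; (no k≮) → inj₁ (cong (εNum n ν a b) (sym (swapAt-beyond k zs k≮))) }

  ε-diagonal : ∀ a b (x : Vec ℚ n) {i j} → i Fin.< j → lookup x i ≡ lookup x j → εNum n ν a b (toList x) ≡ 0ℚ
  ε-diagonal a b x {i} {j} i<j e = let (R , perm) = pick₂ x {i} {j} i<j in
    go R (transport (λ y → toList x ↭ lookup x i ∷ y ∷ R) (sym e) perm)
    where
    go : ∀ R → toList x ↭ lookup x i ∷ lookup x i ∷ R → εNum n ν a b (toList x) ≡ 0ℚ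
    go R perm = case ε-↭ a b perm (length-toList x) of λ
      { (inj₁ e) → trans e zero-value ; (inj₂ e) → trans e (trans (cong -_ zero-value) -0≡0) }
      where
      zero-value = ε-repeated a b (lookup x i) R (trans (sym (↭-length perm)) (length-toList x))

  xIndices : List (Fin (2 ℕ.+ n))
  xIndices = List.tabulate (λ (i : Fin n) → Fin.suc (Fin.suc i))

  xIndices-< : AllPairs Fin._<_ xIndices
  xIndices-< = AllPairsP.tabulate⁺-< {f = λ (i : Fin n) → Fin.suc (Fin.suc i)} (λ l → s≤s (s≤s l))

  opaque
    -- An alternating function vanishes on every diagonal, and the differences of coordinates are
    -- pairwise distinct forms, so their whole product divides it.
    ε-divides : Divides (pairForms xIndices xIndices-<) εValue
    ε-divides = divides-distinct poly-ε (pairForms xIndices xIndices-<)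
      (pairForms-all (λ k → Σ (Fin n) λ i → k ≡ Fin.suc (Fin.suc i)) (λ (f : Form (2 ℕ.+ n)) → ∀ v → value f v ≡ 0ℚ → εValue v ≡ 0ℚ) xIndices xIndices-< (tabulate⁺ (λ i → i , refl))
        λ { (i , refl) (j , refl) i<j (a ∷ b ∷ x) z → ε-diagonal a b x (≤-pred (≤-pred i<j)) (x-y≡0⇒x≡y (trans (sym (value-difference (lookup x i) (lookup x j))) z)) })
      (pairForms-distinct xIndices xIndices-<)

  ε-numerator : Poly (2 ℕ.+ n)
  ε-numerator = proj₁ (proj₁ (proj₂ ε-divides))

  ε-vand : ∀ a b (x : Vec ℚ n) → εNum n ν a b (toList x) ≡ vand (toList x) * ev ε-numerator (a ∷ b ∷ x)
  ε-vand a b x = trans (proj₂ (proj₂ ε-divides) (a ∷ b ∷ x)) (cong₂ _*_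
    (trans (product-pairForms xIndices xIndices-< (a ∷ b ∷ x)) (cong vand (trans (map-tabulate (λ (i : Fin n) → Fin.suc (Fin.suc i)) (lookup (a ∷ b ∷ x))) (sym (toList-tabulate x)))))
    (proj₂ (proj₁ (proj₂ ε-divides)) (a ∷ b ∷ x)))

  ε-numer : ∀ a b xs → length xs ≡ n → εNum n ν a b xs ≡ vand xs * numer ε-numerator a b xs
  ε-numer a b xs l = transport (λ zs → εNum n ν a b zs ≡ vand zs * numer ε-numerator a b xs) (toList-toVec n xs l) (ε-vand a b (toVec n xs))

  -- The quotient of two alternating functions; the Vandermonde product is cancelled as a
  -- polynomial.
  ε-symmetric : ∀ a b → SymmetricOn n (numer ε-numerator a b)
  ε-symmetric a b = swaps⇒symmetric (numer ε-numerator a b) λ k zs l → case suc k <? length zs of λ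
    { (no k≮) → cong (numer ε-numerator a b) (sym (swapAt-beyond k zs k≮))
    ; (yes k<) → transport (λ ys → numer ε-numerator a b ys ≡ numer ε-numerator a b (swapAt k ys)) (toList-toVec n zs l) (swapped k (<-≤-trans k< (≤-reflexive l)) (toVec n zs)) }
    where
    swapped : ∀ k → suc k < n → ∀ x → numer ε-numerator a b (toList x) ≡ numer ε-numerator a b (swapAt k (toList x))
    swapped k k<n = poly-cancel {h = vand ∘ toList} {numer ε-numerator a b ∘ toList} {λ x → numer ε-numerator a b (swapAt k (toList x))}
      (poly-vand (polyList-toList n)) numerP (polyOn-∘ {F = numer ε-numerator a b} numerP (polyList-swapAt k (polyList-toList n)))
      (λ x → let xs = toList x ; k< = <-≤-trans k<n (≤-reflexive (sym (length-toList x))) ; len = length-toList x in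
        trans (sym (ε-numer a b xs len)) (trans (sym (neg-neg (εNum n ν a b xs))) (trans (cong -_ (trans (sym (εNum-swap n ν a b k xs k<))
          (trans (ε-numer a b (swapAt k xs) (trans (↭-length (swapAt-↭ k xs)) len)) (cong (_* numer ε-numerator a b (swapAt k xs)) (vand-alternating k xs k<)))))
          (cancel-signs (vand xs) (numer ε-numerator a b (swapAt k xs))))))
      (samples n 1) (vand-≢0 (samples-distinct n 1))
      where
      numerP : PolyOn n (numer ε-numerator a b)
      numerP = polyOn-toVec {h = λ x → ev ε-numerator (a ∷ b ∷ x)} (poly-fix b (poly-fix a (poly-ev ε-numerator)))

wheelPoint : ∀ {r} → (Vec ℚ (3 ℕ.+ r) → ℚ) → Vec ℚ (3 ℕ.+ r) → Vec ℚ (5 ℕ.+ r)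
wheelPoint c w = head w ∷ head (tail w) ∷ x ∷ c w * x ∷ head w * (head (tail w) * x) ∷ tail (tail (tail w))
  where x = head (tail (tail w))

poly-wheelPoint : ∀ {r} {c : Vec ℚ (3 ℕ.+ r) → ℚ} → IsPoly (3 ℕ.+ r) c → ∀ {h} → IsPoly (5 ℕ.+ r) h → IsPoly (3 ℕ.+ r) (h ∘ wheelPoint c)
poly-wheelPoint {r} {c} cp {h} hp = poly-∘ {h = h} (wheelPoint c) hp λ
  { 0F → poly-head ; 1F → poly-second ; 2F → poly-third
  ; (Fin.suc 2F) → poly-* cp poly-third
  ; (Fin.suc (Fin.suc 2F)) → poly-* poly-head (poly-* poly-second poly-third)
  ; (Fin.suc (Fin.suc (Fin.suc (Fin.suc (Fin.suc i))))) → poly-resp (λ { (a ∷ b ∷ x ∷ w) → refl }) (poly-var (Fin.suc (Fin.suc (Fin.suc i)))) }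

module _ (r : ℕ) (ν : List ℕ) (c : Vec ℚ (3 ℕ.+ r) → ℚ) (cp : IsPoly (3 ℕ.+ r) c) where

  -- The wheel relation is known for the product of the numerator with the Vandermonde product. The
  -- latter is not identically zero along the wheel family, as the sample point shows, and cancels.
  ε-wheel : (∀ a b x zs → εNum (3 ℕ.+ r) ν a b (x ∷ c (a ∷ b ∷ x ∷ zs) * x ∷ a * (b * x) ∷ toList zs) ≡ 0ℚ) →
    vand (xsOf (3 ℕ.+ r) ν (wheelPoint c (fromℕ 2 ∷ fromℕ 3 ∷ fromℕ 1 ∷ samples r 7))) ≢ 0ℚ → ∀ w → ev (ε-numerator (3 ℕ.+ r) ν) (wheelPoint c w) ≡ 0ℚ
  ε-wheel z ne = poly-domain {h = λ w → vand (xsOf (3 ℕ.+ r) ν (wheelPoint c w))} {λ w → ev (ε-numerator (3 ℕ.+ r) ν) (wheelPoint c w)}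
    (poly-wheelPoint cp (poly-vand (polyList-xs (3 ℕ.+ r)))) (poly-wheelPoint cp (poly-ev (ε-numerator (3 ℕ.+ r) ν)))
    (λ { w@(a ∷ b ∷ x ∷ zs) → trans (sym (ε-vand (3 ℕ.+ r) ν a b (x ∷ c w * x ∷ a * (b * x) ∷ zs))) (z a b x zs) }) (fromℕ 2 ∷ fromℕ 3 ∷ fromℕ 1 ∷ samples r 7) ne

ε-wheel₁ : ∀ n ν a b x zs → 3 ℕ.+ length zs ≡ n → numer (ε-numerator n ν) a b (x ∷ a * x ∷ a * (b * x) ∷ zs) ≡ 0ℚ
ε-wheel₁ _ ν a b x zs refl = ε-wheel (length zs) ν head poly-head
  (λ a b x ys → εNum-wheel₁ a b (3 ℕ.+ length zs) ν x (toList ys)) (vand-≢0 (wheel-point-distinct (length zs) 2 (sym (fromℕ-* 2 1)) (s≤s (s≤s z≤n)) (s≤s (s≤s (s≤s z≤n))))) (a ∷ b ∷ x ∷ toVec (length zs) zs)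

ε-wheel₂ : ∀ n ν a b x zs → 3 ℕ.+ length zs ≡ n → numer (ε-numerator n ν) a b (x ∷ b * x ∷ a * (b * x) ∷ zs) ≡ 0ℚ
ε-wheel₂ _ ν a b x zs refl = ε-wheel (length zs) ν (head ∘ tail) poly-second
  (λ a b x ys → εNum-wheel₂ a b (3 ℕ.+ length zs) ν x (toList ys)) (vand-≢0 (wheel-point-distinct (length zs) 3 (sym (fromℕ-* 3 1)) (s≤s (s≤s z≤n)) (s≤s (s≤s (s≤s (s≤s z≤n)))))) (a ∷ b ∷ x ∷ toVec (length zs) zs)

scaleEval : ∀ {m} t (tp : IsPoly m t) (cf : PolyColored m) → Σ (PolyColored m) λ dg → ∀ v → scaleColored (t v) (evalColored v cf) ≡ evalColored v dg
scaleEval t tp cf = map (λ { (c , f , fp) → c , (λ v → t v * f v) , poly-* tp fp }) cf , λ v → trans (sym (map-∘ cf)) (map-∘ cf)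

module _ (n : ℕ) (ν : List ℕ) (k : ℕ) (k≤n : k ≤ n) where

  private m = n ∸ k

  -- What a coloring contributes once the power of `t` coming from the scaled block has been taken
  -- out: only the mixed pairs still depend on `t`.
  ε-term : ℚ → ℚ → ℚ → Colored → ℚ
  ε-term t a b us = indicator n ν us * ((coloredProduct a b (take m us) * crossFactors a b (take m us) (scaleColored t (drop m us))) * coloredProduct a b (drop m us))

  ε-reduced : Vec ℚ (3 ℕ.+ n) → ℚ
  ε-reduced (t ∷ a ∷ b ∷ x) = colorSum n (toList x) (ε-term t a b)

  poly-ε-reduced : IsPoly (3 ℕ.+ n) ε-reduced
  poly-ε-reduced = poly-resp (λ { (t ∷ a ∷ b ∷ x) → refl })
    (colorSum-poly n {λ v us → ε-term (head v) (A v) (B v) us} (polyList-∘ tail poly-tail (polyList-xs n)) λ cf →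
      let (dg , e) = scaleEval head poly-head (drop m cf) in
      poly-resp (λ v → cong (λ z → indicator n ν (evalColored v cf) * z) (cong₂ _*_ (cong₂ (λ us ws → coloredProduct (A v) (B v) us * crossFactors (A v) (B v) us ws)
          (sym (take-map m cf)) (trans (sym (e v)) (cong (scaleColored (head v)) (sym (drop-map m cf))))) (cong (coloredProduct (A v) (B v)) (sym (drop-map m cf)))))
        (poly-* (poly-indicator n ν cf) (poly-* (poly-* (poly-coloredProduct {b = B} poly-second poly-third (take m cf)) (poly-crossFactors {b = B} poly-second poly-third (take m cf) dg))
          (poly-coloredProduct {b = B} poly-second poly-third (drop m cf)))))
    where
    A B : Vec ℚ (3 ℕ.+ n) → ℚ
    A v = head (tail v)
    B v = head (tail (tail v))

  split-term : ∀ t a b xs us → length xs ≡ n → Coloring n xs us → indicator n ν (splitScale m t us) * coloredProduct a b (splitScale m t us) ≡ (t ^ 3) ^ tri k * ε-term t a b us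
  split-term t a b xs us l (e , _) = trans (cong₂ _*_
      (indicator-cong n ν {splitScale m t us} {us} (cong (content n) same-colors))
      (trans (coloredProduct-++ a b (take m us) (scaleColored t (drop m us))) (cong (coloredProduct a b (take m us) * crossFactors a b (take m us) (scaleColored t (drop m us)) *_)
        (trans (coloredProduct-scale a b t (drop m us)) (cong (λ j → (t ^ 3) ^ tri j * coloredProduct a b (drop m us)) length-drop)))))
    (collect-power (indicator n ν us) (coloredProduct a b (take m us)) (crossFactors a b (take m us) (scaleColored t (drop m us))) ((t ^ 3) ^ tri k) (coloredProduct a b (drop m us)))
    where
    length-drop : length (drop m us) ≡ k
    length-drop = trans (ListP.length-drop m us) (trans (cong (_∸ m) (trans (sym (length-map proj₂ us)) (trans (cong length e) l))) (m∸[m∸n]≡n k≤n))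
    same-colors : colors (splitScale m t us) ≡ colors us
    same-colors = trans (map-++ proj₁ (take m us) (scaleColored t (drop m us))) (trans (cong (colors (take m us) ++_) (sym (map-∘ (drop m us))))
      (trans (sym (map-++ proj₁ (take m us) (drop m us))) (cong colors (take++drop≡id m us))))

  ε-scaling : Scaling {n} (ε-numerator n ν) k
  ε-scaling = record
    { reduced = ε-reduced
    ; poly-reduced = poly-ε-reduced
    ; scaling = λ t a b x → trans (sym (ε-numer n ν a b (scaled k t x) (length-scaled k t x)))
        (trans (colorSum-split n m t (toList x) (λ us → indicator n ν us * coloredProduct a b us))
        (trans (colorSum-cong n (toList x) (λ us col → split-term t a b (toList x) us (length-toList x) col))
          (colorSum-scale n (toList x) ((t ^ 3) ^ tri k) (ε-term t a b))))
    ; balance = λ a b x → colorSum-balanced n (toList x) {λ t → ε-term t a b} λ us col →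
        transport (λ d → Balanced d (trailing (front k x) (back k x)) (leading (front k x) (back k x)) (λ t → ε-term t a b us))
          (cong₂ (λ i j → i ℕ.* (j ℕ.* 3)) (trans (sym (length-map proj₂ (take m us))) (trans (cong length (front≡ x us col)) (length-front k x)))
            (trans (sym (length-map proj₂ (drop m us))) (trans (cong length (back≡ x us col)) (length-back k x k≤n))))
          (transport (λ zs → Balanced _ (trailing zs (back k x)) (leading zs (back k x)) (λ t → ε-term t a b us)) (front≡ x us col)
            (transport (λ ws → Balanced _ (trailing (map proj₂ (take m us)) ws) (leading (map proj₂ (take m us)) ws) (λ t → ε-term t a b us)) (back≡ x us col)
              (balanced-resp (λ t → sym (crossing-middle (indicator n ν us) (coloredProduct a b (take m us)) (crossFactors a b (take m us) (scaleColored t (drop m us))) (coloredProduct a b (drop m us))))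
                (balanced-scalar (indicator n ν us * (coloredProduct a b (take m us) * coloredProduct a b (drop m us))) (crossFactors-balanced a b (take m us) (drop m us)))))) }
    where
    front≡ : ∀ x us → Coloring n (toList x) us → map proj₂ (take m us) ≡ front k x
    front≡ x us (e , _) = trans (sym (take-map m us)) (cong (take m) e)
    back≡ : ∀ x us → Coloring n (toList x) us → map proj₂ (drop m us) ≡ back k x
    back≡ x us (e , _) = trans (sym (drop-map m us)) (cong (drop m) e)

ε : ∀ n → List ℕ → Element n
ε n ν = record { numerator = ε-numerator n ν ; symmetric = ε-symmetric n ν ; wheel₁ = ε-wheel₁ n ν ; wheel₂ = ε-wheel₂ n ν ; scalings = ε-scaling n ν }

-- Linear systems

opaque
  unfolding _+_

  eliminate-term : ∀ e r₀ s r s₀ → e * (r₀ * s - r * s₀) ≡ r₀ * (e * s) + (- s₀) * (e * r)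
  eliminate-term = solve-∀ ringℚ

  lift-sum : ∀ r₀ s₀ S R → ((- 1ℚ) * R) * s₀ + r₀ * S ≡ r₀ * S + (- s₀) * R
  lift-sum = solve-∀ ringℚ

  eliminate-self : ∀ r₀ r → r₀ * r - r * r₀ ≡ 0ℚ
  eliminate-self = solve-∀ ringℚ

  unit-sum : ∀ x → 1ℚ * x + 0ℚ ≡ x
  unit-sum = solve-∀ ringℚ

  solved-sum : ∀ r₀ s₀ e S R → e * s₀ + S ≡ 0ℚ → e * r₀ + R ≡ 0ℚ → r₀ * S + (- s₀) * R ≡ 0ℚ
  solved-sum r₀ s₀ e S R x y = trans (split r₀ s₀ e S R) (trans (cong₂ (λ u v → r₀ * u + (- s₀) * v) x y) (combination-of-zeros r₀ (- s₀)))
    where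
    split : ∀ r₀ s₀ e S R → r₀ * S + (- s₀) * R ≡ r₀ * (e * s₀ + S) + (- s₀) * (e * r₀ + R)
    split = solve-∀ ringℚ

-- Two-by-two minors with the first column: the first unknown is eliminated without division, so the
-- same formulas serve for coefficients that are polynomials in q₁ and q₂.
eliminate : ∀ {k} → (r s : Fin (suc k) → ℚ) → Fin k → ℚ
eliminate r s i = r 0F * s (Fin.suc i) - r (Fin.suc i) * s 0F

-- Lifts a solution of the eliminated system. The first entry is chosen so that `r` itself is
-- annihilated; the others are scaled by the pivot to avoid a denominator.
substituted : ∀ {k} → (Fin (suc k) → ℚ) → (Fin k → ℚ) → Fin (suc k) → ℚ
substituted {k} r e 0F = (- 1ℚ) * ∑ k (λ i → e i * r (Fin.suc i))
substituted r e (Fin.suc i) = r 0F * e i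

eliminate-sum : ∀ k (r s : Fin (suc k) → ℚ) (e : Fin k → ℚ) → ∑ k (λ i → e i * eliminate r s i) ≡
  r 0F * ∑ k (λ i → e i * s (Fin.suc i)) + (- s 0F) * ∑ k (λ i → e i * r (Fin.suc i))
eliminate-sum k r s e = trans (∑-cong k (λ i → eliminate-term (e i) (r 0F) (s (Fin.suc i)) (r (Fin.suc i)) (s 0F)))
  (trans (∑-+ k (λ i → r 0F * (e i * s (Fin.suc i))) (λ i → (- s 0F) * (e i * r (Fin.suc i))))
    (cong₂ _+_ (∑-scale k (r 0F) (λ i → e i * s (Fin.suc i))) (∑-scale k (- s 0F) (λ i → e i * r (Fin.suc i)))))

substituted-sum : ∀ k (r s : Fin (suc k) → ℚ) (e : Fin k → ℚ) → ∑ (suc k) (λ i → substituted r e i * s i) ≡ ∑ k (λ i → e i * eliminate r s i)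
substituted-sum k r s e = trans (cong (λ z → ((- 1ℚ) * ∑ k (λ i → e i * r (Fin.suc i))) * s 0F + z)
    (trans (∑-cong k (λ i → F.*-assoc (r 0F) (e i) (s (Fin.suc i)))) (∑-scale k (r 0F) (λ i → e i * s (Fin.suc i)))))
  (trans (lift-sum (r 0F) (s 0F) (∑ k (λ i → e i * s (Fin.suc i))) (∑ k (λ i → e i * r (Fin.suc i)))) (sym (eliminate-sum k r s e)))

unit : ∀ {k} → Fin (suc k) → ℚ
unit 0F = 1ℚ
unit (Fin.suc i) = 0ℚ

unit-product : ∀ k (s : Fin (suc k) → ℚ) → ∑ (suc k) (λ i → unit i * s i) ≡ s 0F
unit-product k s = trans (cong (1ℚ * s 0F +_) (∑-0 k (λ i → F.zeroˡ (s (Fin.suc i))))) (unit-sum (s 0F))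

-- Elimination with a pivot row: one row and one unknown disappear together. If all rows have first
-- entry zero, the first unit vector is a solution.
kernel : ∀ k (rows : List (Fin k → ℚ)) → length rows < k → Σ (Fin k → ℚ) λ e → (Σ (Fin k) λ i → e i ≢ 0ℚ) × All (λ r → ∑ k (λ i → e i * r i) ≡ 0ℚ) rows
kernel (suc k) rows l = go (pivot rows)
  where
  pivot : ∀ rows → All (λ (r : Fin (suc k) → ℚ) → r 0F ≡ 0ℚ) rows ⊎ Σ (Fin (suc k) → ℚ) λ r → Σ (List (Fin (suc k) → ℚ)) λ rest → r 0F ≢ 0ℚ × rows ↭ r ∷ rest
  pivot [] = inj₁ []
  pivot (r ∷ rows) with r 0F ℚP.≟ 0ℚ | pivot rows
  ... | no ne | _ = inj₂ (r , rows , ne , ↭-refl)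
  ... | yes e | inj₁ es = inj₁ (e ∷ es)
  ... | yes e | inj₂ (r′ , rest , ne , p) = inj₂ (r′ , r ∷ rest , ne , ↭-trans (Permutation.prep r p) (Permutation.swap r r′ ↭-refl))
  go : _ → _
  go (inj₁ zeros) = unit , (0F , λ ()) , All.map (λ {r} z → trans (unit-product k r) z) zeros
  go (inj₂ (r , rest , ne , p)) =
    let (e , (i , e≢0) , es) = kernel k (map (eliminate r) rest) (<-≤-trans (s≤s (≤-reflexive (length-map (eliminate r) rest)))
          (≤-trans (≤-reflexive (sym (↭-length p))) (≤-pred l))) in
    substituted r e , (Fin.suc i , *-≢0 ne e≢0) , All-resp-↭ (↭-sym p)
      (trans (substituted-sum k r r e) (∑-0 k (λ i → *0≡0 (eliminate-self (r 0F) (r (Fin.suc i))))) ∷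
       All.map (λ {s} z → trans (substituted-sum k r s e) z) (map⁻ es))

-- A family over ℚ(q₁, q₂) is either linearly dependent, or remains independent at all q outside a hypersurface.
module Dichotomy {Z : Set} (𝒞 : (Vec ℚ 2 → Z → ℚ) → Set) (slice : ∀ H → 𝒞 H → ∀ z → IsPoly 2 (λ q → H q z))
  (closed : ∀ H K {a b} → IsPoly 2 a → IsPoly 2 b → 𝒞 H → 𝒞 K → 𝒞 (λ q z → a q * H q z - b q * K q z))
  (zero? : ∀ H → 𝒞 H → (∀ q z → H q z ≡ 0ℚ) ⊎ Σ (Vec ℚ 2) λ q → Σ Z λ z → H q z ≢ 0ℚ) where

  record Dependent {k} (H : Fin k → Vec ℚ 2 → Z → ℚ) : Set where
    field
      coefficient : Fin k → Vec ℚ 2 → ℚ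
      poly-coefficient : ∀ i → IsPoly 2 (coefficient i)
      nontrivial : Σ (Fin k) λ i → Σ (Vec ℚ 2) λ q → coefficient i q ≢ 0ℚ
      relation : ∀ q z → ∑ k (λ i → coefficient i q * H i q z) ≡ 0ℚ

  record Independent {k} (H : Fin k → Vec ℚ 2 → Z → ℚ) : Set where
    field
      exception : Vec ℚ 2 → ℚ
      poly-exception : IsPoly 2 exception
      exception-nonzero : Σ (Vec ℚ 2) λ q → exception q ≢ 0ℚ
      independent : ∀ q → exception q ≢ 0ℚ → ∀ (e : Fin k → ℚ) → (∀ z → ∑ k (λ i → e i * H i q z) ≡ 0ℚ) → ∀ i → e i ≡ 0ℚ

  -- Unless the first member is zero, choose `z₀` where it is not, and use its value there as pivot.
  -- A dependence of the eliminated family lifts with polynomial coefficients; independence lifts to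
  -- all `q` at which neither the pivot nor the earlier exception vanishes.
  dichotomy : ∀ k (H : Fin k → Vec ℚ 2 → Z → ℚ) → (∀ i → 𝒞 (H i)) → Dependent H ⊎ Independent H
  dichotomy zero H c = inj₂ (record { exception = λ _ → 1ℚ ; poly-exception = poly-const 1ℚ ; exception-nonzero = 0ℚ ∷ 0ℚ ∷ [] , (λ ()) ; independent = λ _ _ _ _ () })
  dichotomy (suc k) H c = go (zero? _ (c 0F))
    where
    go : _ → _
    go (inj₁ z) = inj₁ (record { coefficient = λ i _ → unit i ; poly-coefficient = λ i → poly-const (unit i) ; nontrivial = 0F , 0ℚ ∷ 0ℚ ∷ [] , (λ ())
      ; relation = λ q x → trans (unit-product k (λ i → H i q x)) (z q x) })
    go (inj₂ (q₀ , z₀ , ne)) = reduce (dichotomy k W (λ i → closed _ _ (slice _ (c 0F) z₀) (slice _ (c (Fin.suc i)) z₀) (c (Fin.suc i)) (c 0F)))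
      where
      pivot : Vec ℚ 2 → Fin (suc k) → ℚ
      pivot q i = H i q z₀
      W : Fin k → Vec ℚ 2 → Z → ℚ
      W i q z = eliminate (pivot q) (λ i → H i q z) i
      reduce : Dependent W ⊎ Independent W → Dependent H ⊎ Independent H
      reduce (inj₁ d) = let (i , q₁ , c≢0) = D.nontrivial ; (q , product≢0) = poly-*-nonzero (slice _ (c 0F) z₀) (D.poly-coefficient i) (q₀ , ne) (q₁ , c≢0) in
        inj₁ (record
        { coefficient = λ i q → substituted (pivot q) (λ i → D.coefficient i q) i
        ; poly-coefficient = λ { 0F → poly-* (poly-const (- 1ℚ)) (∑-poly k (λ i → poly-* (D.poly-coefficient i) (slice _ (c (Fin.suc i)) z₀)))
                               ; (Fin.suc i) → poly-* (slice _ (c 0F) z₀) (D.poly-coefficient i) }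
        ; nontrivial = Fin.suc i , q , product≢0
        ; relation = λ q z → trans (substituted-sum k (pivot q) (λ i → H i q z) (λ i → D.coefficient i q)) (D.relation q z) })
        where module D = Dependent d
      reduce (inj₂ d) = inj₂ (record
        { exception = λ q → H 0F q z₀ * D.exception q
        ; poly-exception = poly-* (slice _ (c 0F) z₀) D.poly-exception
        ; exception-nonzero = poly-*-nonzero (slice _ (c 0F) z₀) D.poly-exception (q₀ , ne) D.exception-nonzero
        ; independent = λ q ≢0 e rel → trivial q ≢0 e rel })
        where
        module D = Independent d
        trivial : ∀ q → H 0F q z₀ * D.exception q ≢ 0ℚ → ∀ (e : Fin (suc k) → ℚ) → (∀ z → ∑ (suc k) (λ i → e i * H i q z) ≡ 0ℚ) → ∀ i → e i ≡ 0ℚ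
        trivial q ≢0 e rel = λ { 0F → *-cancelʳ-0 (λ z → ≢0 (0*≡0 z)) (trans (sym (trans (cong (e 0F * H 0F q z₀ +_) (∑-0 k (λ i → 0*≡0 (rest i)))) (F.+-identityʳ _))) (rel z₀))
                               ; (Fin.suc i) → rest i }
          where
          rest : ∀ i → e (Fin.suc i) ≡ 0ℚ
          rest = D.independent q (λ z → ≢0 (*0≡0 z)) (e ∘ Fin.suc) λ z → trans (eliminate-sum k (pivot q) (λ i → H i q z) (e ∘ Fin.suc))
            (solved-sum (H 0F q z₀) (H 0F q z) (e 0F) _ _ (rel z) (rel z₀))

-- Existence

poly-base : ∀ {k} {h : Vec ℚ (2 ℕ.+ k) → ℚ} → IsPoly (2 ℕ.+ k) h → ∀ y → IsPoly 2 (λ q → h (head q ∷ head (tail q) ∷ y))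
poly-base {h = h} hp y = poly-∘ {h = h} (λ q → head q ∷ head (tail q) ∷ y) hp
  λ { 0F → poly-head ; 1F → poly-second ; (Fin.suc (Fin.suc i)) → poly-const (lookup y i) }

poly-lift : ∀ {k} {h : Vec ℚ 2 → ℚ} → IsPoly 2 h → IsPoly (2 ℕ.+ k) (λ w → h (head w ∷ head (tail w) ∷ []))
poly-lift {h = h} hp = poly-∘ {h = h} (λ w → head w ∷ head (tail w) ∷ []) hp
  λ { 0F → poly-head ; 1F → poly-second }

length-zipBlocks : ∀ p μ y → length (strings p (zipBlocks μ y)) ≡ sum μ
length-zipBlocks p [] [] = refl
length-zipBlocks p (a ∷ μ) (y ∷ ys) = trans (length-++ (str p a y)) (cong₂ ℕ._+_ (length-str p a y) (length-zipBlocks p μ ys))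

∑-single : ∀ m {f : Fin m → ℚ} i → (∀ j → j ≢ i → f j ≡ 0ℚ) → ∑ m f ≡ f i
∑-single (suc m) {f} 0F z = trans (cong (f 0F +_) (∑-0 m (λ j → z (Fin.suc j) λ ()))) (x+0≡x (f 0F))
∑-single (suc m) {f} (Fin.suc i) z = trans (cong₂ _+_ (z 0F λ ()) (∑-single m i (λ j j≢i → z (Fin.suc j) (j≢i ∘ FinP.suc-injective)))) (F.+-identityˡ (f (Fin.suc i)))

lookup-injective : ∀ {A : Set} {xs : List A} → AllPairs _≢_ xs → ∀ i j → List.lookup xs i ≡ List.lookup xs j → i ≡ j
lookup-injective (_ ∷ _) 0F 0F e = refl
lookup-injective {xs = _ ∷ xs} (d ∷ _) 0F (Fin.suc j) e = ⊥-elim (All.lookup d (∈-lookup {xs = xs} j) e)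
lookup-injective {xs = _ ∷ xs} (d ∷ _) (Fin.suc i) 0F e = ⊥-elim (All.lookup d (∈-lookup {xs = xs} i) (sym e))
lookup-injective (_ ∷ ds) (Fin.suc i) (Fin.suc j) e = cong Fin.suc (lookup-injective ds i j e)

sum-map-compare : ∀ {f g : ℕ → ℕ} → (∀ k → f k ≤ g k) → ∀ ks → sum (map f ks) ≤ sum (map g ks) × (sum (map f ks) < sum (map g ks) ⊎ All (λ k → g k ≤ f k) ks)
sum-map-compare le [] = z≤n , inj₂ []
sum-map-compare le (k ∷ ks) with m≤n⇒m<n∨m≡n (le k) | sum-map-compare le ks
... | inj₁ lt | (le′ , _) = +-mono-≤ (le k) le′ , inj₁ (ℕP.+-mono-<-≤ lt le′)
... | inj₂ eq | (le′ , inj₁ lt) = +-mono-≤ (le k) le′ , inj₁ (ℕP.+-mono-≤-< (le k) lt)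
... | inj₂ eq | (le′ , inj₂ ge) = +-mono-≤ (le k) le′ , inj₂ (≤-reflexive (sym eq) ∷ ge)

excess≤sum : ∀ k μ → excess k μ ≤ sum μ
excess≤sum k [] = z≤n
excess≤sum k (a ∷ μ) = +-mono-≤ (m∸n≤m a k) (excess≤sum k μ)

-- Strictly monotone for `⊑` on partitions of `n` and at most `n * n`; it bounds the descent in
-- `ε-independent`.
rank : ℕ → List ℕ → ℕ
rank n μ = sum (target n μ)

rank≤ : ∀ {n μ} → sum μ ≡ n → rank n μ ≤ n ℕ.* n
rank≤ {n} {μ} refl = ≤-trans (go (upTo n)) (≤-reflexive (cong (ℕ._* n) (ListP.length-upTo n)))
  where
  go : ∀ ks → sum (map (λ k → excess k μ) ks) ≤ length ks ℕ.* n
  go [] = z≤n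
  go (k ∷ ks) = +-mono-≤ (excess≤sum k μ) (go ks)

⊑-from-below : ∀ {n μ ν} → sum μ ≡ n → All (λ k → excess k μ ≤ excess k ν) (upTo n) → μ ⊑ ν
⊑-from-below {n} {μ} s le k = case k <? n of λ
  { (yes k<n) → All.lookup le (MemP.∈-upTo⁺ k<n)
  ; (no k≮n) → ≤-trans (≤-reflexive (excess-beyond {μ = μ} s k (≮⇒≥ k≮n))) z≤n }

rank-< : ∀ {n μ ν} → IsPartition n μ → IsPartition n ν → μ ⊑ ν → μ ≢ ν → rank n μ < rank n ν
rank-< {n} {μ} {ν} μ-part ν-part le ne with proj₂ (sum-map-compare {λ k → excess k μ} {λ k → excess k ν} le (upTo n))
... | inj₁ lt = lt
... | inj₂ ge = ⊥-elim (ne (⊑-antisym μ-part ν-part le (⊑-from-below {n} {ν} {μ} (sum≡ ν-part) ge)))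

opaque
  unfolding _+_

  swap-scalar : ∀ c V N → c * (V * N) ≡ V * (c * N)
  swap-scalar = solve-∀ ringℚ

  isolate : ∀ x c v S → 1ℚ * x + (- c) * v ≡ S → x ≡ c * v + S
  isolate x c v S refl = regroup x c v
    where
    regroup : ∀ x c v → x ≡ c * v + (1ℚ * x + (- c) * v)
    regroup = solve-∀ ringℚ

  remove-first : ∀ c F S → 1ℚ * (c * F + S) + (- c) * F ≡ S
  remove-first = solve-∀ ringℚ

  0-combination : ∀ x → 0ℚ * x + 0ℚ * x ≡ 0ℚ
  0-combination = solve-∀ ringℚ

module Family (n : ℕ) where

  m : ℕ
  m = length (partitions n)

  νAt : Fin m → List ℕ
  νAt = List.lookup (partitions n)

  νAt-part : ∀ i → IsPartition n (νAt i)
  νAt-part i = All.lookup (partitions-sound n) (∈-lookup {xs = partitions n} i)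

  E : Fin m → Element n
  E i = ε n (νAt i)

  -- Evaluated at strings of type μ, only the ε_ν with μ ⊑ ν survive, and ε_μ does.
  module _ {a b} (gen : Generic a b) (c : Fin m → ℚ) (rel : ∀ zs → length zs ≡ n → ∑ m (λ j → c j * numer (numerator (E j)) a b zs) ≡ 0ℚ) where

    εNum-relation : ∀ zs → length zs ≡ n → ∑ m (λ j → c j * εNum n (νAt j) a b zs) ≡ 0ℚ
    εNum-relation zs l = trans (∑-cong m (λ j → trans (cong (c j *_) (ε-numer n (νAt j) a b zs l)) (swap-scalar (c j) (vand zs) (numer (ε-numerator n (νAt j)) a b zs))))
      (trans (∑-scale m (vand zs) (λ j → c j * numer (numerator (E j)) a b zs)) (*0≡0 (rel zs l)))

    coefficient-zero : ∀ i → (∀ j → j ≢ i → νAt i ⊑ νAt j → c j ≡ 0ℚ) → c i ≡ 0ℚ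
    coefficient-zero i above = *-cancelʳ-0 (canonical-≢0 gen μ) (trans (cong (c i *_) (sym (εNum-canonical a b μ y (sum≡ (νAt-part i)))))
      (trans (sym (∑-single m i (λ j j≢i → decidable-stable (_ ℚP.≟ 0ℚ) λ ne →
        ne (*0≡0 (εNum-vanishes a b μ (νAt j) y (sum≡ (νAt-part i)) λ μ⊑ν → ne (0*≡0 (above j j≢i μ⊑ν)))))))
        (εNum-relation (strings a (zipBlocks μ y)) (trans (length-zipBlocks a μ y) (sum≡ (νAt-part i))))))
      where
      μ = νAt i
      y = evenPowers gen (length μ) 0

    -- A triangular system solved from the largest partitions downwards: every coefficient at a
    -- strictly larger partition has larger rank and is already zero.
    ε-independent : ∀ i → c i ≡ 0ℚ
    ε-independent i = descend (suc (n ℕ.* n)) i (m≤n+m (suc (n ℕ.* n)) (rank n (νAt i)))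
      where
      descend : ∀ fuel i → n ℕ.* n < rank n (νAt i) ℕ.+ fuel → c i ≡ 0ℚ
      descend zero i l = ⊥-elim (<⇒≱ (<-≤-trans l (≤-reflexive (+-identityʳ (rank n (νAt i))))) (rank≤ {n} {νAt i} (sum≡ (νAt-part i))))
      descend (suc fuel) i l = coefficient-zero i λ j j≢i le → descend fuel j (<-≤-trans l (≤-trans (≤-reflexive (+-suc (rank n (νAt i)) fuel))
        (+-monoˡ-≤ fuel (rank-< (νAt-part i) (νAt-part j) le (λ e → j≢i (sym (lookup-injective (partitions-unique n) i j e)))))))

  combination-value : ∀ (e : Fin m → ℚ) a b zs → numer (numerator (combination m (λ i → constₚ (e i)) E)) a b zs ≡ ∑ m (λ i → e i * numer (numerator (E i)) a b zs)
  combination-value e a b zs = trans (numer-combination m (λ i → constₚ (e i)) E a b zs) (∑-cong m (λ i → cong (_* numer (numerator (E i)) a b zs) (ev-const (e i) (a ∷ b ∷ []))))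

side : Bool → ℚ → ℚ → ℚ
side true a b = a
side false a b = b

sideₚ : Bool → Poly 2
sideₚ true = q₁
sideₚ false = q₂

ev-side : ∀ s a b → ev (sideₚ s) (a ∷ b ∷ []) ≡ side s a b
ev-side true = ev-q₁
ev-side false = ev-q₂

spec-numer : ∀ {n} (P : Poly (2 ℕ.+ n)) s μ a b y → sum μ ≡ n →
  ev P (image (specσ {n} (sideₚ s) μ) (a ∷ b ∷ y)) ≡ numer P a b (strings (side s a b) (zipBlocks μ y))
spec-numer {n} P s μ a b y e = trans (cong (ev P) (image-specσ {n} (sideₚ s) μ a b y e)) (cong (λ p → numer P a b (strings p (zipBlocks μ y))) (ev-side s a b))

-- A nonzero element of both filters, and its uniqueness

module _ {n : ℕ} {la : List ℕ} (la-part : IsPartition n la) where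

  open Family n

  bound : Bool → List ℕ
  bound true = la
  bound false = conj la

  module Kernel (p q : ℚ) (gen : Generic p q) where
    open Pointwise p q gen

    FF : Fin m → List ℚ → ℚ
    FF i = numer (numerator (E i)) p q

    rowValue-sum : ∀ μ k (c v : Fin k → ℚ) (G : Fin k → List ℚ → ℚ) → (∀ i → R.RowValue μ 1ℚ (G i) (v i)) →
      ∀ {H x} → (∀ zs → H zs ≡ ∑ k (λ i → c i * G i zs)) → R.RowValue μ 1ℚ H x → x ≡ ∑ k (λ i → c i * v i)
    -- For the empty sum `H` is the zero function. Its row value is read off by linearity from the
    -- combination `0ℚ * H + 0ℚ * H`.
    rowValue-sum μ zero c v G vs {H} {x} eq w = trans (compare-values H (λ zs → 0ℚ * H zs + 0ℚ * H zs) w (R.rowValue-linear μ {F = H} {H} 0ℚ 0ℚ w w)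
      (λ zs → trans (eq zs) (sym (0-combination (H zs))))) (0-combination x)
      where
      compare-values : ∀ F F′ {e e′} → R.RowValue μ 1ℚ F e → R.RowValue μ 1ℚ F′ e′ → (∀ zs → F zs ≡ F′ zs) → e ≡ e′
      compare-values F F′ {e} {e′} v v′ h = trans (sym (simplify e)) (trans
        (R.rowValue-compare μ {F = F} {F′} 1≢0 v v′ 1ℚ 1ℚ (λ _ → 1ℚ) (λ _ → 1ℚ) (λ _ → poly-const 1ℚ) (λ _ → poly-const 1ℚ) (λ zs l → cong (λ z → 1ℚ * (z * prodℚ (map (λ _ → 1ℚ) zs))) (h zs))) (simplify e′))
        where
        simplify : ∀ e → 1ℚ * (e * prodℚ (map (λ _ → 1ℚ) (R.boxes μ 1ℚ))) ≡ e
        simplify e = trans (F.*-identityˡ _) (trans (cong (e *_) (prodℚ-1 (R.boxes μ 1ℚ))) (F.*-identityʳ e))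
    rowValue-sum μ (suc k) c v G vs {H} {x} eq w = isolate x (c 0F) (v 0F) _
      (rowValue-sum μ k (c ∘ Fin.suc) (v ∘ Fin.suc) (G ∘ Fin.suc) (vs ∘ Fin.suc) {λ zs → 1ℚ * H zs + (- c 0F) * G 0F zs}
        (λ zs → trans (cong (λ z → 1ℚ * z + (- c 0F) * G 0F zs) (eq zs)) (remove-first (c 0F) (G 0F zs) _))
        (R.rowValue-linear μ {F = H} {G 0F} 1ℚ (- c 0F) w (vs 0F)))

    rowOf : ∀ μ → Dec (IsPartition n μ) → Fin m → ℚ
    rowOf μ (yes part) i = proj₁ (R.rowValue-exists μ {1ℚ} {FF i} 1≢0 (wheeled-size (sym (sum≡ part)) (inA-wheeled (element-frac (E i)) (element-inA (E i)) p q)))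
    -- A default value; the system takes its rows from `partitions n`, whose members are all
    -- partitions.
    rowOf μ (no _) i = 0ℚ

    rowOf-correct : ∀ μ d → IsPartition n μ → ∀ i → R.RowValue μ 1ℚ (FF i) (rowOf μ d i)
    rowOf-correct μ (yes part) _ i = proj₂ (R.rowValue-exists μ {1ℚ} {FF i} 1≢0 (wheeled-size (sym (sum≡ part)) (inA-wheeled (element-frac (E i)) (element-inA (E i)) p q)))
    rowOf-correct μ (no ¬part) part i = ⊥-elim (¬part part)

    other? : ∀ μ → Dec (μ ≢ la)
    other? μ = ¬? (μ ≟ₗ la)

    row : List ℕ → Fin m → ℚ
    row μ = rowOf μ (isPartition? n μ)

    solution : Σ (Fin m → ℚ) λ e → (Σ (Fin m) λ i → e i ≢ 0ℚ) × All (λ r → ∑ m (λ i → e i * r i) ≡ 0ℚ) (map row (filter other? (partitions n)))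
    -- Since `la` occurs in the enumeration and is filtered out, there are strictly fewer equations
    -- than the `m` unknowns.
    solution = kernel m (map row (filter other? (partitions n))) (ℕP.≤-<-trans (≤-reflexive (length-map row (filter other? (partitions n))))
      (ListP.filter-notAll other? (partitions n) (Any.map (λ e ne → ne (sym e)) (partitions-complete la-part))))

    e : Fin m → ℚ
    e = proj₁ solution

    C : Element n
    C = combination m (λ i → constₚ (e i)) E

    G : List ℚ → ℚ
    G = numer (numerator C) p q

    G-wheeled : Wheeled p q n G
    G-wheeled = inA-wheeled (element-frac C) (element-inA C) p q

    G-bounded : Bounded n G
    G-bounded = inA-bounded (element-frac C) (element-inA C) p q

    G-rows : ∀ μ → IsPartition n μ → μ ≢ la → ∀ v → R.RowValue μ 1ℚ G v → v ≡ 0ℚ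
    G-rows μ part μ≢la v w = trans (rowValue-sum μ m e (row μ) FF (rowOf-correct μ (isPartition? n μ) part) {G} (combination-value e p q) w)
      (All.lookup (map⁻ (proj₂ (proj₂ solution))) (∈-filter⁺ other? (partitions-complete part) μ≢la))

    -- A column value at `ν` vanishes with the row value at `conj ν`, and this one vanishes because
    -- `conj ν ≡ la` would make `ν` and `conj la` transposes of the same diagram.
    G-columns : ∀ ν → IsPartition n ν → ¬ (ν ⊑ conj la) → ∀ v → C.RowValue ν 1ℚ G v → v ≡ 0ℚ
    G-columns ν part ¬⊑ v w = let μ = conj ν ; μ-part = conj-isPartition part
                                  (x , vx) = R.rowValue-exists μ {1ℚ} {G} 1≢0 (wheeled-size (sym (sum≡ μ-part)) G-wheeled) in
      rowValue-transpose _ p q gen μ ν {1ℚ} {G} ≤-refl (transposed-sym (conj-transposed (decreasing part))) 1≢0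
        (wheeled-size (sym (sum≡ μ-part)) G-wheeled) vx w (G-rows μ μ-part
          (λ μ≡la → ¬⊑ (transposed-unique {la} {ν} {conj la} (transport (λ ξ → Transposed ξ ν) μ≡la (transposed-sym (conj-transposed (decreasing part)))) (conj-transposed (decreasing la-part)))) x vx)

    G-vanishes : ∀ s μ → IsPartition n μ → ¬ (μ ⊑ bound s) → ∀ y → G (strings (side s p q) (zipBlocks μ y)) ≡ 0ℚ
    G-vanishes true μ part ¬⊑ = FR.filtration-vanishing {n} {G} 1≢0 G-wheeled G-bounded (λ μ → ¬ (μ ⊑ la)) (λ {μ} {ν} ¬μ⊑ μ⊑ν ν⊑ → ¬μ⊑ (⊑-trans {μ} {ν} {la} μ⊑ν ν⊑))
      (λ μ part ¬⊑ → G-rows μ part (λ { refl → ¬⊑ (λ _ → ≤-refl) })) μ part ¬⊑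
    G-vanishes false μ part ¬⊑ = FC.filtration-vanishing {n} {G} 1≢0 (wheeled-swap G-wheeled) G-bounded (λ ν → ¬ (ν ⊑ conj la)) (λ {μ} {ν} ¬μ⊑ μ⊑ν ν⊑ → ¬μ⊑ (⊑-trans {μ} {ν} {conj la} μ⊑ν ν⊑))
      G-columns μ part ¬⊑

  -- Only `k < n` is tested: beyond that the excess of a partition of `n` is zero.
  notBelow? : ∀ ξ μ → Dec (¬ All (λ k → excess k μ ≤ excess k ξ) (upTo n))
  notBelow? ξ μ = ¬? (All.all? (λ k → excess k μ ≤? excess k ξ) (upTo n))

  conditions : List (Bool × List ℕ)
  conditions = map (true ,_) (filter (notBelow? la) (partitions n)) ++ map (false ,_) (filter (notBelow? (conj la)) (partitions n))

  conditions-valid : All (λ (s , μ) → IsPartition n μ × ¬ (μ ⊑ bound s)) conditions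
  conditions-valid = ++⁺ (map⁺ (valid true)) (map⁺ (valid false))
    where
    valid : ∀ s → All (λ μ → IsPartition n μ × ¬ (μ ⊑ bound s)) (filter (notBelow? (bound s)) (partitions n))
    valid s = All.zipWith (λ (part , nb) → part , λ le → nb (All.universal le (upTo n))) (AllP.filter⁺ (notBelow? (bound s)) (partitions-sound n) , all-filter (notBelow? (bound s)) (partitions n))

  conditions-complete : ∀ s {μ} → IsPartition n μ → ¬ (μ ⊑ bound s) → (s , μ) ∈ conditions
  conditions-complete s {μ} part ¬⊑ = place s (∈-filter⁺ (notBelow? (bound s)) (partitions-complete part) λ all → ¬⊑ (⊑-from-below {n} {μ} {bound s} (sum≡ part) all))
    where
    place : ∀ s → μ ∈ filter (notBelow? (bound s)) (partitions n) → (s , μ) ∈ conditions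
    place true μ∈ = MemP.∈-++⁺ˡ (∈-map⁺ (true ,_) μ∈)
    place false μ∈ = MemP.∈-++⁺ʳ (map (true ,_) (filter (notBelow? la) (partitions n))) (∈-map⁺ (false ,_) μ∈)

  condition : Fin (length conditions) → Bool × List ℕ
  condition = List.lookup conditions

  condition-valid : ∀ c → IsPartition n (proj₂ (condition c)) × ¬ (proj₂ (condition c) ⊑ bound (proj₁ (condition c)))
  condition-valid c = All.lookup conditions-valid (∈-lookup {xs = conditions} c)

  -- The vanishing of one specialization is a linear equation for every point `y`. Unlike the row
  -- values, these equations depend polynomially on q₁ and q₂, so they make sense over the field.
  Z : Set
  Z = Σ (Fin (length conditions)) λ c → Vec ℚ (length (proj₂ (condition c)))

  Regular : (Vec ℚ 2 → Z → ℚ) → Set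
  Regular H = ∀ c → IsPoly (2 ℕ.+ length (proj₂ (condition c))) (λ w → H (head w ∷ head (tail w) ∷ []) (c , tail (tail w)))

  regular-zero? : ∀ H → Regular H → (∀ q z → H q z ≡ 0ℚ) ⊎ Σ (Vec ℚ 2) λ q → Σ Z λ z → H q z ≢ 0ℚ
  regular-zero? H r = decide (search (length conditions) id)
    where
    Zero : Fin (length conditions) → Set
    Zero c = ∀ q y → H q (c , y) ≡ 0ℚ
    one : ∀ c → Zero c ⊎ Σ (Vec ℚ 2) λ q → Σ Z λ z → H q z ≢ 0ℚ
    one c with poly-zero? (r c)
    ... | inj₁ z = inj₁ λ { (a ∷ b ∷ []) y → z (a ∷ b ∷ y) }
    ... | inj₂ (a ∷ b ∷ y , ne) = inj₂ (a ∷ b ∷ [] , (c , y) , ne)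
    search : ∀ N (g : Fin N → Fin (length conditions)) → (∀ i → Zero (g i)) ⊎ Σ (Vec ℚ 2) λ q → Σ Z λ z → H q z ≢ 0ℚ
    search zero g = inj₁ λ ()
    search (suc N) g with one (g 0F) | search N (g ∘ Fin.suc)
    ... | inj₂ w | _ = inj₂ w
    ... | inj₁ _ | inj₂ w = inj₂ w
    ... | inj₁ z | inj₁ zs = inj₁ λ { 0F → z ; (Fin.suc i) → zs i }
    decide : (∀ c → Zero c) ⊎ Σ (Vec ℚ 2) (λ q → Σ Z λ z → H q z ≢ 0ℚ) → (∀ q z → H q z ≡ 0ℚ) ⊎ Σ (Vec ℚ 2) λ q → Σ Z λ z → H q z ≢ 0ℚ
    decide (inj₁ zs) = inj₁ λ q (c , y) → zs c q y
    decide (inj₂ w) = inj₂ w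

  regular-slice : ∀ H → Regular H → ∀ z → IsPoly 2 (λ q → H q z)
  regular-slice _ r (c , y) = poly-resp (λ { (a ∷ b ∷ []) → refl }) (poly-base (r c) y)

  regular-closed : ∀ H K {f g} → IsPoly 2 f → IsPoly 2 g → Regular H → Regular K → Regular (λ q z → f q * H q z - g q * K q z)
  regular-closed _ _ fp gp r s c = poly-- (poly-* (poly-lift fp) (r c)) (poly-* (poly-lift gp) (s c))

  open Dichotomy Regular regular-slice regular-closed regular-zero?

  restriction : Fin m → Vec ℚ 2 → Z → ℚ
  restriction i q (c , y) = numer (numerator (E i)) (head q) (head (tail q)) (strings (side (proj₁ (condition c)) (head q) (head (tail q))) (zipBlocks (proj₂ (condition c)) y))

  restriction-regular : ∀ i → Regular (restriction i)
  restriction-regular i c = poly-resp (λ { (a ∷ b ∷ y) → spec-numer (numerator (E i)) (proj₁ (condition c)) (proj₂ (condition c)) a b y (sum≡ (proj₁ (condition-valid c))) })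
    (poly-image (specσ {n} (sideₚ (proj₁ (condition c))) (proj₂ (condition c))) (poly-ev (numerator (E i))))

  -- At every grid point the numerical solution of `Kernel` is a nontrivial relation among the
  -- restrictions. If they were independent off a hypersurface, its equation would vanish on the
  -- dense grid, hence identically.
  dependent : Dependent restriction
  dependent = go (dichotomy m restriction restriction-regular)
    where
    go : Dependent restriction ⊎ Independent restriction → Dependent restriction
    go (inj₁ d) = d
    go (inj₂ d) = ⊥-elim (proj₂ (Independent.exception-nonzero d)
      (grid-dense {0} {Independent.exception d} (Independent.poly-exception d) vanishes (proj₁ (Independent.exception-nonzero d))))
      where
      vanishes : ∀ i j v → Independent.exception d (grid₁ i ∷ grid₂ j ∷ v) ≡ 0ℚ
      vanishes i j [] = decidable-stable (_ ℚP.≟ 0ℚ) λ ne → proj₂ K.nonzero (Independent.independent d (grid₁ i ∷ grid₂ j ∷ []) ne K.e K.annihilates (proj₁ K.nonzero))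
        where
        module K where
          open Kernel (grid₁ i) (grid₂ j) (grid-generic i j) public
          nonzero = proj₁ (proj₂ solution)
          annihilates : ∀ z → ∑ m (λ i′ → e i′ * restriction i′ (grid₁ i ∷ grid₂ j ∷ []) z) ≡ 0ℚ
          annihilates (c , y) = trans (sym (combination-value e (grid₁ i) (grid₂ j) _))
            (G-vanishes (proj₁ (condition c)) (proj₂ (condition c)) (proj₁ (condition-valid c)) (proj₂ (condition-valid c)) y)

  open Dependent dependent

  solutionCoefficient : Fin m → Poly 2
  solutionCoefficient i = proj₁ (poly-coefficient i)

  solution : Element n
  solution = combination m solutionCoefficient E

  solution-vanishes : ∀ s μ → IsPartition n μ → ¬ (μ ≤ᵈ bound s) → ∀ a b y → numer (numerator solution) a b (strings (side s a b) (zipBlocks μ y)) ≡ 0ℚ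
  solution-vanishes s μ part ¬≤ a b y = at (s , μ) (Any.index μ∈) (AnyP.lookup-index μ∈) y
    where
    bound-decreasing : ∀ s → Decreasing (bound s)
    bound-decreasing true = decreasing la-part
    bound-decreasing false = decreasing (conj-isPartition la-part)
    μ∈ : (s , μ) ∈ conditions
    μ∈ = conditions-complete s part (λ le → ¬≤ (⊑⇒≤ᵈ {μ} {bound s} (bound-decreasing s) le))
    at : ∀ c i → c ≡ condition i → ∀ y → numer (numerator solution) a b (strings (side (proj₁ c) a b) (zipBlocks (proj₂ c) y)) ≡ 0ℚ
    at _ i refl y = trans (numer-combination m solutionCoefficient E a b _)
      (trans (∑-cong m (λ j → cong (_* restriction j (a ∷ b ∷ []) (i , y)) (sym (proj₂ (poly-coefficient j) (a ∷ b ∷ []))))) (relation (a ∷ b ∷ []) (i , y)))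

  -- At each grid point the ε_ν are independent, so a zero combination has coefficients that vanish
  -- on the grid and hence identically, contradicting the nontriviality of the dependence.
  solution≉0 : ¬ (numerator solution ≈ 0ₚ)
  solution≉0 z = let (i , q , ne) = nontrivial in ne (trans (proj₂ (poly-coefficient i) q)
    (grid-dense {0} {ev (solutionCoefficient i)} (poly-ev (solutionCoefficient i)) (λ { j k [] → zero-at-grid j k i }) q))
    where
    zero-at-grid : ∀ j k i → ev (solutionCoefficient i) (grid₁ j ∷ grid₂ k ∷ []) ≡ 0ℚ
    zero-at-grid j k = ε-independent (grid-generic j k) (λ i → ev (solutionCoefficient i) (grid₁ j ∷ grid₂ k ∷ [])) λ zs l →
      trans (sym (numer-combination m solutionCoefficient E (grid₁ j) (grid₂ k) zs)) (ev-resp-≈ {P = numerator solution} {0ₚ} z (grid₁ j ∷ grid₂ k ∷ toVec n zs))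

  distinct-strings : ∀ s μ → Σ (Vec ℚ (length μ)) λ y → AllPairs _≢_ (strings (side s (grid₁ 0) (grid₂ 0)) (zipBlocks μ y))
  distinct-strings true μ = _ , strings-distinct (grid-generic 0 0) μ
  distinct-strings false μ = _ , strings-distinct (generic-swap (grid-generic 0 0)) μ

  solution-gordon : ∀ s (ξ : Partition n) → parts ξ ≡ bound s → Gordon (sideₚ s) ξ (element-frac solution)
  solution-gordon s ξ e = element-inA solution , λ μ ¬≤ →
    let (y , distinct) = distinct-strings s (parts μ)
        p = ev (sideₚ s) (grid₁ 0 ∷ grid₂ 0 ∷ [])
        zs≡ : toList (toVec n (strings p (zipBlocks (parts μ) y))) ≡ strings (side s (grid₁ 0) (grid₂ 0)) (zipBlocks (parts μ) y)
        zs≡ = trans (toList-toVec n _ (trans (length-zipBlocks p (parts μ) y) (Partition.size μ))) (cong (λ p → strings p (zipBlocks (parts μ) y)) (ev-side s (grid₁ 0) (grid₂ 0)))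
    in element-vanishes solution (specσ {n} (sideₚ s) (parts μ)) (grid₁ 0 ∷ grid₂ 0 ∷ y) (image-specσ {n} (sideₚ s) (parts μ) (grid₁ 0) (grid₂ 0) y (Partition.size μ))
      (transport (AllPairs _≢_) (sym zs≡) distinct)
      λ { (a ∷ b ∷ y) → trans (spec-numer (numerator solution) s (parts μ) a b y (Partition.size μ))
        (solution-vanishes s (parts μ) (partition⇒isPartition μ) (λ le → ¬≤ (transport (parts μ ≤ᵈ_) (sym e) le)) a b y) }

  module Unique (g : Frac (2 ℕ.+ n)) (A : InA n g) (V : ∀ s (μ : Partition n) → ¬ (parts μ ≤ᵈ bound s) → Vanishes (specσ {n} (sideₚ s) (parts μ)) g) where

    open Numerator g A

    Pf : Poly (2 ℕ.+ n)
    Pf = numerator solution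

    g-vanishes : ∀ s μ → IsPartition n μ → ¬ (μ ≤ᵈ bound s) → ∀ a b y → numer P a b (strings (side s a b) (zipBlocks μ y)) ≡ 0ℚ
    g-vanishes s μ part ¬≤ a b y = trans (cong (λ p → numer P a b (strings p (zipBlocks μ y))) (sym (ev-side s a b)))
      (inA-spec g A (sideₚ s) μ (sum≡ part) (V s (proj₁ (isPartition⇒partition part)) ¬≤) a b y)

    proportional-at-grid : ∀ i j (x x₀ : Vec ℚ n) → let a = grid₁ i ; b = grid₂ j in
      ev Pf (a ∷ b ∷ x) * ev P (a ∷ b ∷ x₀) ≡ ev Pf (a ∷ b ∷ x₀) * ev P (a ∷ b ∷ x)
    proportional-at-grid i j x x₀ = trans (sym (cong₂ _*_ (at Pf x) (at P x₀))) (trans (W.proportional la-part {numer Pf a b} {numer P a b}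
        wf wg (inA-bounded (element-frac solution) (element-inA solution) a b) (inA-bounded g A a b)
        (W.only-at la-part {numer Pf a b} wf (λ μ part ¬≤ → solution-vanishes true μ part ¬≤ a b) (λ μ part ¬≤ → solution-vanishes false μ part ¬≤ a b))
        (W.only-at la-part {numer P a b} wg (λ μ part ¬≤ → g-vanishes true μ part ¬≤ a b) (λ μ part ¬≤ → g-vanishes false μ part ¬≤ a b))
        (toList x) (toList x₀) (length-toList x) (length-toList x₀)) (cong₂ _*_ (at Pf x₀) (at P x)))
      where
      a = grid₁ i
      b = grid₂ j
      module W = Pointwise a b (grid-generic i j)
      wf = inA-wheeled (element-frac solution) (element-inA solution) a b
      wg = inA-wheeled g A a b
      at : ∀ Q x → numer Q a b (toList x) ≡ ev Q (a ∷ b ∷ x)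
      at Q x = cong (λ y → ev Q (a ∷ b ∷ y)) (toVec-toList x)

    poly-at : ∀ (Q : Poly (2 ℕ.+ n)) x₀ → IsPoly 2 (λ q → ev Q (head q ∷ head (tail q) ∷ x₀))
    poly-at Q x₀ = poly-base {h = ev Q} (poly-ev Q) x₀

    -- With `x₀` fixed this is a polynomial identity in the parameters and `x`; it holds over the
    -- grid, which is dense.
    cross-proportional : ∀ x₀ a b x → ev Pf (a ∷ b ∷ x) * ev P (a ∷ b ∷ x₀) ≡ ev Pf (a ∷ b ∷ x₀) * ev P (a ∷ b ∷ x)
    cross-proportional x₀ a b x = x-y≡0⇒x≡y (grid-dense {n} {λ w → ev Pf w * fixed P w - fixed Pf w * ev P w}
      (poly-- (poly-* (poly-ev Pf) (fixed-poly P)) (poly-* (fixed-poly Pf) (poly-ev P))) (λ i j x → x≡y⇒x-y≡0 (proportional-at-grid i j x x₀)) (a ∷ b ∷ x))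
      where
      fixed : Poly (2 ℕ.+ n) → Vec ℚ (2 ℕ.+ n) → ℚ
      fixed Q w = ev Q (head w ∷ head (tail w) ∷ x₀)
      fixed-poly : ∀ Q → IsPoly (2 ℕ.+ n) (fixed Q)
      fixed-poly Q = poly-lift {h = λ q → ev Q (head q ∷ head (tail q) ∷ x₀)} (poly-at Q x₀)

    opaque
      unfolding _+_

      assemble : ∀ N d f V P e f₀ p₀ → N * (d * V) ≡ P * e → f * p₀ ≡ f₀ * P → N * ((d * f₀) * V) ≡ (p₀ * f) * e
      assemble N d f V P e f₀ p₀ h₁ h₂ = trans (out N d f₀ V) (trans (cong (f₀ *_) h₁) (trans (sym (F.*-assoc f₀ P e)) (cong (_* e) (trans (sym h₂) (F.*-comm f p₀)))))
        where
        out : ∀ N d f₀ V → N * ((d * f₀) * V) ≡ f₀ * (N * (d * V))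
        out = solve-∀ ringℚ

    -- Fixing `x₀` where the numerator `Pf` of the solution is nonzero for some parameters, the
    -- scalar is `P` over `D` times `Pf`, both numerators taken at `x₀`. The factor `D` is the part
    -- of the denominator of `g` that depends on the parameters alone.
    ratio : Σ (Frac 2) λ c → num g *ₚ (ι (den c) *ₚ den (element-frac solution)) ≈ (ι (num c) *ₚ num (element-frac solution)) *ₚ den g
    ratio = at (≉0⇒nonzero Pf solution≉0)
      where
      at : Σ (Vec ℚ (2 ℕ.+ n)) (λ v → ev Pf v ≢ 0ℚ) → _
      at (a₀ ∷ b₀ ∷ x₀ , ne) = c , ev≡⇒≈ (num g *ₚ (ι (den c) *ₚ Δ²)) ((ι (num c) *ₚ Pf) *ₚ den g) λ { (a ∷ b ∷ x) → let w = a ∷ b ∷ x in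
        trans (trans (ev-* (num g) (ι (den c) *ₚ Δ²) w) (cong (ev (num g) w *_) (trans (ev-* (ι (den c)) Δ² w) (cong (_* ev (Δ² {n}) w) (trans (ev-ι (den c) a b x) (sym (proj₂ den-poly (a ∷ b ∷ []))))))))
        (trans (assemble (ev (num g) w) (ev D (a ∷ b ∷ [])) (ev Pf w) (ev (Δ² {n}) w) (ev P w) (ev (den g) w) (ev Pf (a ∷ b ∷ x₀)) (ev P (a ∷ b ∷ x₀))
            (trans (cong (ev (num g) w *_) (sym (trans (ev-* (ι D) Δ² w) (cong (_* ev (Δ² {n}) w) (ev-ι D a b x))))) (≃-ev g P (ι D *ₚ Δ²) f≃ w)) (cross-proportional x₀ a b x))
          (sym (trans (ev-* (ι (num c) *ₚ Pf) (den g) w) (cong (_* ev (den g) w) (trans (ev-* (ι (num c)) Pf w) (cong (_* ev Pf w) (trans (ev-ι (num c) a b x) (sym (proj₂ (poly-at P x₀) (a ∷ b ∷ [])))))))))) }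
        where
        den-poly : IsPoly 2 (λ q → ev D q * ev Pf (head q ∷ head (tail q) ∷ x₀))
        den-poly = poly-* (poly-ev D) (poly-at Pf x₀)
        den-nonzero = poly-*-nonzero (poly-ev D) (poly-at Pf x₀) (≉0⇒nonzero D D≉0) (a₀ ∷ b₀ ∷ [] , ne)
        c : Frac 2
        c = record { num = proj₁ (poly-at P x₀) ; den = proj₁ den-poly
                   ; den≉0 = nonzero⇒≉0 (proj₁ den-poly) (proj₁ den-nonzero) (λ z → proj₂ den-nonzero (trans (proj₂ den-poly (proj₁ den-nonzero)) z)) }

theorem1p10 : (n : ℕ) (la la′ : Partition n) → parts la′ ≡ conj (parts la) →
                DimOne {n} (λ f → Gordon q₁ la f × Gordon q₂ la′ f)
theorem1p10 n la la′ e = element-frac (solution la-part) ,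
  (solution-gordon la-part true la refl , solution-gordon la-part false la′ e) , solution≉0 la-part ,
  λ { g ((A , V₁) , (_ , V₂)) → Unique.ratio la-part g A λ
    { true → V₁ ; false μ ¬≤ → V₂ μ (λ le → ¬≤ (transport (parts μ ≤ᵈ_) e le)) } }
  where la-part = partition⇒isPartition la
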